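{- Let $d\neq 0,1$ be a square-free integer with $d\not\equiv 1 \pmod 8$, and let $p,q$ be two prime integers with $q\geq 3$ and $p\neq q$. Let $K=\mathbb{Q}(\sqrt{d})$, let $\mathcal{O}_K$ be its ring of integers and let $\Delta_K$ be the discriminant of $K$ (so $\Delta_K=d$ if $d\equiv 1\pmod 4$ and $\Delta_K=4d$ if $d\equiv 2,3 \pmod 4$). Then: (i) if $p\geq 3$ and the Legendre symbols satisfy $\left(\frac{\Delta_K}{p}\right)\neq 1$ and $\left(\frac{\Delta_K}{q}\right)\neq 1$, then the quaternion algebra $H_{\mathbb{Q}(\sqrt{d})}(p,q)$ splits; (ii) if $p=2$ and the Legendre symbol satisfies $\left(\frac{\Delta_K}{q}\right)\neq 1$, then the quaternion algebra $H_{\mathbb{Q}(\sqrt{d})}(2,q)$ splits.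
   Context: For a field $F$ of characteristic $\neq 2$ and $a,b\in F^{*}$, the quaternion algebra $H_F(a,b)$ is the $F$-algebra with basis $1,e_1,e_2,e_3$ subject to $e_1^2=a$, $e_2^2=b$, $e_3=e_1e_2=-e_2e_1$. It is said to split (over $F$) if it is isomorphic to the matrix algebra $M_2(F)$. -}

module Defs where

open import Data.Nat as ℕ using (ℕ)
open import Data.Integer as ℤ using (ℤ; +_)
open import Data.Integer.DivMod using (_%ℕ_)
open import Data.Integer.Divisibility using () renaming (_∣_ to _∣ℤ_)
open import Data.Rational as ℚ using (ℚ; 0ℚ; 1ℚ)
open import Data.Product using (_×_; Σ; ∃; ∃-syntax; _,_)
open import Relation.Binary.PropositionalEquality using (_≡_)
open import Relation.Nullary using (¬_)
open import Function.Definitions using (Injective; Surjective)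

SquareFree : ℤ → Set
SquareFree d = ∀ (n : ℕ) → (+ (n ℕ.* n)) ∣ℤ d → n ≡ 1

-- discriminant of Q(√d): d if d ≡ 1 mod 4, 4d otherwise (d ≡ 2,3 mod 4 for square-free d)
disc : ℤ → ℤ
disc d with d %ℕ 4
... | 1 = d
... | _ = + 4 ℤ.* d

LegendreIsOne : ℤ → ℕ → Set
LegendreIsOne a p = ¬ ((+ p) ∣ℤ a) × ∃[ x ] ((+ p) ∣ℤ (x ℤ.* x ℤ.- a))

module QuadField (d : ℤ) where

  record K : Set where
    constructor _+√_
    field
      re : ℚ
      im : ℚ

  open K public

  dℚ : ℚ
  dℚ = d ℚ./ 1

  infixl 6 _⊕_
  infixl 7 _⊗_

  _⊕_ : K → K → K
  (a +√ b) ⊕ (c +√ e) = (a ℚ.+ c) +√ (b ℚ.+ e)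

  _⊗_ : K → K → K
  (a +√ b) ⊗ (c +√ e) = (a ℚ.* c ℚ.+ dℚ ℚ.* (b ℚ.* e)) +√ (a ℚ.* e ℚ.+ b ℚ.* c)

  ⊖_ : K → K
  ⊖ (a +√ b) = (ℚ.- a) +√ (ℚ.- b)

  0K 1K : K
  0K = 0ℚ +√ 0ℚ
  1K = 1ℚ +√ 0ℚ

  ι : ℚ → K
  ι a = a +√ 0ℚ

  record H : Set where
    constructor quat
    field
      c0 c1 c2 c3 : K

  module QuatOps (a b : K) where
    _·H_ : H → H → H
    quat x0 x1 x2 x3 ·H quat y0 y1 y2 y3 = quat
      (x0 ⊗ y0 ⊕ a ⊗ (x1 ⊗ y1) ⊕ b ⊗ (x2 ⊗ y2) ⊕ ⊖ (a ⊗ b ⊗ (x3 ⊗ y3)))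
      (x0 ⊗ y1 ⊕ x1 ⊗ y0 ⊕ ⊖ (b ⊗ (x2 ⊗ y3)) ⊕ b ⊗ (x3 ⊗ y2))
      (x0 ⊗ y2 ⊕ x2 ⊗ y0 ⊕ a ⊗ (x1 ⊗ y3) ⊕ ⊖ (a ⊗ (x3 ⊗ y1)))
      (x0 ⊗ y3 ⊕ x3 ⊗ y0 ⊕ x1 ⊗ y2 ⊕ ⊖ (x2 ⊗ y1))

    _+H_ : H → H → H
    quat x0 x1 x2 x3 +H quat y0 y1 y2 y3 = quat (x0 ⊕ y0) (x1 ⊕ y1) (x2 ⊕ y2) (x3 ⊕ y3)

    _•H_ : K → H → H
    c •H quat x0 x1 x2 x3 = quat (c ⊗ x0) (c ⊗ x1) (c ⊗ x2) (c ⊗ x3)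

    1H : H
    1H = quat 1K 0K 0K 0K

  record M2 : Set where
    constructor mat
    field
      m11 m12 m21 m22 : K

  _·M_ : M2 → M2 → M2
  mat a b c e ·M mat a' b' c' e' =
    mat (a ⊗ a' ⊕ b ⊗ c') (a ⊗ b' ⊕ b ⊗ e') (c ⊗ a' ⊕ e ⊗ c') (c ⊗ b' ⊕ e ⊗ e')

  _+M_ : M2 → M2 → M2
  mat a b c e +M mat a' b' c' e' = mat (a ⊕ a') (b ⊕ b') (c ⊕ c') (e ⊕ e')

  _•M_ : K → M2 → M2
  k •M mat a b c e = mat (k ⊗ a) (k ⊗ b) (k ⊗ c) (k ⊗ e)

  1M : M2
  1M = mat 1K 0K 0K 1K

  record AlgIso (a b : K) : Set where
    open QuatOps a b
    field
      φ     : H → M2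
      φ-+   : ∀ x y → φ (x +H y) ≡ φ x +M φ y
      φ-•   : ∀ c x → φ (c •H x) ≡ c •M φ x
      φ-·   : ∀ x y → φ (x ·H y) ≡ φ x ·M φ y
      φ-1   : φ 1H ≡ 1M
      φ-inj : Injective _≡_ _≡_ φ
      φ-surj : Surjective _≡_ _≡_ φ

  Splits : K → K → Set
  Splits a b = AlgIso a b

QuatSplits : ℤ → ℕ → ℕ → Set
QuatSplits d p q = QuadField.Splits d (QuadField.ι d (+ p ℚ./ 1)) (QuadField.ι d (+ q ℚ./ 1))

{-# OPTIONS --safe #-}
-- K = ℚ(√d) splits H(p, q) as soon as q is a norm from K(√p). This holds if, for some n ≠ 0, both (p, qn) and
-- (pd, n) split over ℚ: then qn and n are norms from ℚ(√p) and ℚ(√(pd)), which have the same compositum with K. By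
-- Legendre's theorem (Lagrange's descent) the two splittings are local conditions at the odd primes. The local
-- class of n at 2 and at the odd primes dividing pqd is chosen from a finite table, and quadratic reciprocity
-- makes the choices compatible. What remains is to find n in a residue class such that the primes dividing n to an
-- odd power split in ℚ(√p) and ℚ(√(pd)), whose characters χ₁ and χ₂ are trivial on the class. Let r be the
-- Dirichlet convolution 1 * χ₁ * χ₂ * χ₁χ₂ ≥ 0. Then r n ≠ 0 forces this splitting, and r ≥ 1 at squares prime to
-- the modulus. If r vanished on the class, then, weighted by (X/(X + n))⁵, the sum of r over the class of 1 minus
-- the sum over the given class would grow like √X because of the squares. But that difference is a sum over
-- factorisations n = abce of a function which is periodic with mean zero in each variable, so that by summation by
-- parts it is O((log X)⁴).
module Submission where

-- The integer `n` is a common slot: that `(p, q n)` and `(p d, n)` split says that `(p, q)`,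
-- `(p, n)` and `(d, n)` are one and the same class over `ℚ`, and `K` visibly splits the last. All
-- local arguments thus stay over `ℚ`, at the price of constructing `n` globally. The hypotheses on
-- `d` and on the Legendre symbols together say that neither 2 nor an odd prime dividing `p q d`
-- splits in `K`; this is exactly what the finite tables require. The condition on the primes of odd
-- exponent in `n` is weaker than primality and involves only quadratic characters, so the sign and
-- support of `r` can decide it. The analysis stays inside `ℚ` and finite sums. The weight
-- `X/(X + n)` is rational, and its multiplicative differences are products of functions of the same
-- kind, bounded uniformly in `X`. The fifth power makes the terms beyond a cut-off `N`, up to `N⁴`
-- quadruples, contribute a bounded amount. With `h` such that `N < 2^h` in the role of the
-- logarithm, the contradiction concerns an explicit range, so `n` is found by search.

-- Congruences, and roots of polynomials modulo a prime.

module Congruences where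
  open import Data.Nat as ℕ using (ℕ; zero; suc)
  import Data.Nat.Properties as ℕ
  import Data.Nat.Divisibility as ℕ
  open import Data.Nat.Primality using (Prime; euclidsLemma)
  open import Data.Integer using (ℤ; +_; -_; _+_; _-_; _*_; _^_; 0ℤ; 1ℤ) renaming (∣_∣ to abs)
  open import Data.Integer.Properties using (abs-*; *-zeroˡ; +-inverseʳ)
  open import Data.Integer.DivMod using (_%ℕ_; _/ℕ_; a≡a%ℕn+[a/ℕn]*n; n%ℕd<d)
  open import Data.Integer.Divisibility.Signed using (_∣_; divides; ∣⇒∣ᵤ; ∣ᵤ⇒∣; ∣m∣n⇒∣m+n; ∣m∣n⇒∣m-n; ∣m⇒∣-m; ∣m⇒∣m*n; ∣n⇒∣m*n)
  open import Data.Integer.Tactic.RingSolver using (solve-∀)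
  open import Data.List using (List; []; _∷_; length)
  open import Data.List.Relation.Unary.All using (All; []; _∷_)
  open import Data.List.Relation.Unary.AllPairs using (AllPairs; []; _∷_)
  open import Data.Product using (∃; _×_; _,_)
  open import Data.Sum using (_⊎_; inj₁; inj₂)
  open import Data.Empty using (⊥; ⊥-elim)
  open import Relation.Nullary using (¬_)
  open import Relation.Binary.PropositionalEquality

  infix 4 _≅_⟦_⟧
  -- A record, because unification cannot recover `a` and `b` from the difference in `+ m ∣ a - b`.
  record _≅_⟦_⟧ (a b : ℤ) (m : ℕ) : Set where
    constructor mk≅
    field m∣a-b : + m ∣ a - b
  open _≅_⟦_⟧ public

  ≅-reflexive : ∀ {m a b} → a ≡ b → a ≅ b ⟦ m ⟧
  ≅-reflexive {m} {a} refl = mk≅ (divides 0ℤ (trans (+-inverseʳ a) (sym (*-zeroˡ (+ m)))))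

  ≅-refl : ∀ {m a} → a ≅ a ⟦ m ⟧
  ≅-refl = ≅-reflexive refl

  ≅-sym : ∀ {m a b} → a ≅ b ⟦ m ⟧ → b ≅ a ⟦ m ⟧
  ≅-sym {m} {a} {b} (mk≅ h) = mk≅ (subst (+ m ∣_) (lem a b) (∣m⇒∣-m h))
    where
    lem : ∀ a b → - (a - b) ≡ b - a
    lem = solve-∀

  ≅-trans : ∀ {m a b c} → a ≅ b ⟦ m ⟧ → b ≅ c ⟦ m ⟧ → a ≅ c ⟦ m ⟧
  ≅-trans {m} {a} {b} {c} (mk≅ h) (mk≅ k) = mk≅ (subst (+ m ∣_) (lem a b c) (∣m∣n⇒∣m+n h k))
    where
    lem : ∀ a b c → (a - b) + (b - c) ≡ a - c
    lem = solve-∀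

  ≅-* : ∀ {m a b c d} → a ≅ b ⟦ m ⟧ → c ≅ d ⟦ m ⟧ → a * c ≅ b * d ⟦ m ⟧
  ≅-* {m} {a} {b} {c} {d} (mk≅ h) (mk≅ k) = mk≅ (subst (+ m ∣_) (lem a b c d) (∣m∣n⇒∣m+n (∣m⇒∣m*n c h) (∣n⇒∣m*n b k)))
    where
    lem : ∀ a b c d → (a - b) * c + b * (c - d) ≡ a * c - b * d
    lem = solve-∀

  ≅-^ : ∀ {m a b} n → a ≅ b ⟦ m ⟧ → a ^ n ≅ b ^ n ⟦ m ⟧
  ≅-^ zero h = ≅-refl
  ≅-^ (suc n) h = ≅-* h (≅-^ n h)

  ≅-∣ : ∀ {m a b} → a ≅ b ⟦ m ⟧ → + m ∣ b → + m ∣ a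
  ≅-∣ {m} {a} {b} (mk≅ h) k = subst (+ m ∣_) (lem a b) (∣m∣n⇒∣m+n h k)
    where
    lem : ∀ a b → (a - b) + b ≡ a
    lem = solve-∀

  %ℕ-≅ : ∀ a m .{{_ : ℕ.NonZero m}} → a ≅ + (a %ℕ m) ⟦ m ⟧
  %ℕ-≅ a m = mk≅ (divides (a /ℕ m) (trans (cong (_- + (a %ℕ m)) (a≡a%ℕn+[a/ℕn]*n a m)) (lem (+ (a %ℕ m)) (a /ℕ m * + m))))
    where
    lem : ∀ a b → (a + b) - a ≡ b
    lem = solve-∀

  private
    small : ∀ {m r s} → s ℕ.≤ r → r ℕ.< m → + r ≅ + s ⟦ m ⟧ → r ≡ s
    small {m} {r} {s} s≤r r<m (mk≅ h) = ℕ.≤-antisym (ℕ.m∸n≡0⇒m≤n (zero-of (r ℕ.∸ s) div (ℕ.≤-<-trans (ℕ.m∸n≤m r s) r<m))) s≤r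
      where
      open import Data.Integer.Properties using ([+m]-[+n]≡m⊖n; ⊖-≥)
      div : m ℕ.∣ r ℕ.∸ s
      div = ∣⇒∣ᵤ (subst (+ m ∣_) (trans ([+m]-[+n]≡m⊖n r s) (⊖-≥ s≤r)) h)
      zero-of : ∀ n → m ℕ.∣ n → n ℕ.< m → n ≡ 0
      zero-of zero _ _ = refl
      zero-of (suc n) d l = ⊥-elim (ℕ.<⇒≱ l (ℕ.∣⇒≤ d))

  residue-unique : ∀ {m r s} → r ℕ.< m → s ℕ.< m → + r ≅ + s ⟦ m ⟧ → r ≡ s
  residue-unique {m} {r} {s} r<m s<m h with ℕ.≤-total s r
  ... | inj₁ s≤r = small s≤r r<m h
  ... | inj₂ r≤s = sym (small r≤s s<m (≅-sym h))

  ≅⇒%ℕ : ∀ {m a b} .{{_ : ℕ.NonZero m}} → a ≅ b ⟦ m ⟧ → a %ℕ m ≡ b %ℕ m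
  ≅⇒%ℕ {m} {a} {b} h = residue-unique (n%ℕd<d a m) (n%ℕd<d b m)
    (≅-trans (≅-sym (%ℕ-≅ a m)) (≅-trans h (%ℕ-≅ b m)))

  %ℕ⇒≅ : ∀ {m a b} .{{_ : ℕ.NonZero m}} → a %ℕ m ≡ b %ℕ m → a ≅ b ⟦ m ⟧
  %ℕ⇒≅ {m} {a} {b} h = ≅-trans (%ℕ-≅ a m) (subst (λ r → + r ≅ b ⟦ m ⟧) (sym h) (≅-sym (%ℕ-≅ b m)))

  euclid : ∀ {p} → Prime p → ∀ a b → + p ∣ a * b → + p ∣ a ⊎ + p ∣ b
  euclid pr a b h with euclidsLemma (abs a) (abs b) pr (subst (_ ℕ.∣_) (abs-* a b) (∣⇒∣ᵤ h))
  ... | inj₁ x = inj₁ (∣ᵤ⇒∣ x)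
  ... | inj₂ y = inj₂ (∣ᵤ⇒∣ y)

  -- A list of coefficients, lowest degree first, with an implicit leading coefficient 1.
  evalMonic : List ℤ → ℤ → ℤ
  evalMonic [] x = 1ℤ
  evalMonic (c ∷ cs) x = c + x * evalMonic cs x

  -- Horner's scheme: the coefficients of the quotient are the values at `r` of the tails of the
  -- polynomial. The quotient is again monic, so it fits the same encoding with one coefficient
  -- fewer.
  synthetic-division : ∀ c cs r → ∃ λ qs → length qs ≡ length cs ×
    (∀ x → evalMonic (c ∷ cs) x - evalMonic (c ∷ cs) r ≡ (x - r) * evalMonic qs x)
  synthetic-division c [] r = [] , refl , λ x → lem c x r
    where
    lem : ∀ c x r → (c + x * 1ℤ) - (c + r * 1ℤ) ≡ (x - r) * 1ℤ
    lem = solve-∀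
  synthetic-division c (c' ∷ cs) r with synthetic-division c' cs r
  ... | qs , len , eq = evalMonic (c' ∷ cs) r ∷ qs , cong suc len , λ x →
    let E = evalMonic (c' ∷ cs) x ; F = evalMonic (c' ∷ cs) r ; G = evalMonic qs x in
    trans (lem₁ c x r E F) (trans (cong (λ z → x * z + (x - r) * F) (eq x)) (lem₂ x r F G))
    where
    lem₁ : ∀ c x r E F → (c + x * E) - (c + r * F) ≡ x * (E - F) + (x - r) * F
    lem₁ = solve-∀
    lem₂ : ∀ x r F G → x * ((x - r) * G) + (x - r) * F ≡ (x - r) * (F + x * G)
    lem₂ = solve-∀

  -- Lagrange's bound. After one root is split off, Euclid's lemma hands the other roots to the
  -- quotient, which is still monic; the induction ends at the constant 1, which no prime divides.
  too-many-roots : ∀ {p} → Prime p → ∀ cs rs → length cs ℕ.< length rs →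
    AllPairs (λ r s → ¬ s ≅ r ⟦ p ⟧) rs → All (λ r → + p ∣ evalMonic cs r) rs → ⊥
  too-many-roots {p} pr [] (r ∷ rs) l d (h ∷ _) = ¬p∣1 (∣⇒∣ᵤ h)
    where
    open import Data.Nat.Primality using (¬prime[1])
    ¬p∣1 : ¬ p ℕ.∣ 1
    ¬p∣1 k = ¬prime[1] (subst Prime (ℕ.∣1⇒≡1 k) pr)
  too-many-roots {p} pr (c ∷ cs) (r ∷ rs) (ℕ.s≤s l) (dr ∷ drs) (hr ∷ hrs) with synthetic-division c cs r
  ... | qs , len , eq = too-many-roots pr qs rs (subst (ℕ._< length rs) (sym len) l) drs (step rs dr hrs)
    where
    step : ∀ ss → All (λ s → ¬ s ≅ r ⟦ p ⟧) ss → All (λ s → + p ∣ evalMonic (c ∷ cs) s) ss →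
           All (λ s → + p ∣ evalMonic qs s) ss
    step [] _ _ = []
    step (s ∷ ss) (n ∷ ns) (h ∷ hs) with euclid pr (s - r) (evalMonic qs s) (subst (+ p ∣_) (eq s) (∣m∣n⇒∣m-n h hr))
    ... | inj₁ x = ⊥-elim (n (mk≅ x))
    ... | inj₂ y = y ∷ step ss ns hs

-- Gauss's lemma, Euler's criterion and square roots modulo an odd prime.

module Gauss where
  open Congruences
  open import Data.Nat as ℕ using (ℕ; zero; suc; ⌊_/2⌋; parity)
  import Data.Nat.Properties as ℕ
  import Data.Nat.Divisibility as ℕ
  import Data.Nat.DivMod as ℕ
  open import Data.Nat.Primality using (Prime; ¬prime[1])
  open import Data.Integer using (ℤ; +_; -_; _+_; _-_; _*_; _^_; 0ℤ; 1ℤ; -1ℤ)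
  open import Data.Integer.Properties using (*-1-commutativeMonoid; pos-*; *-identityˡ)
  open import Data.Integer.DivMod using (_%ℕ_)
  open import Data.Integer.Divisibility.Signed using (_∣_; _∣?_; ∣⇒∣ᵤ; ∣ᵤ⇒∣; ∣m⇒∣m*n)
  open import Data.Integer.Tactic.RingSolver using (solve-∀)
  open import Data.Parity using (Parity; 0ℙ; 1ℙ) renaming (_+_ to infixl 6 _⊕_)
  import Data.Parity.Properties as ℙ
  open import Data.Bool using (Bool; true; false; if_then_else_)
  open import Data.Fin using (Fin; zero; suc; toℕ; fromℕ<; punchOut)
  open import Data.Fin.Properties using (toℕ<n; toℕ-fromℕ<; toℕ-injective; any?; injective⇒≤; punchOut-injective) renaming (_≟_ to _≟ᶠ_)
  open import Data.Fin.Permutation using (Permutation′; permutation)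
  open import Data.List using (List; _∷_; length; replicate; tabulate)
  open import Data.List.Properties using (length-tabulate; length-replicate)
  open import Data.List.Relation.Unary.All as All using (All; _∷_)
  import Data.List.Relation.Unary.All.Properties as All
  open import Data.List.Relation.Unary.AllPairs using (AllPairs; _∷_)
  import Data.List.Relation.Unary.AllPairs.Properties as AllPairs
  open import Data.Product using (∃; _×_; _,_; proj₁; proj₂)
  open import Data.Sum using (inj₁; inj₂; [_,_]′)
  open import Data.Empty using (⊥; ⊥-elim)
  open import Function using (_∘_)
  open import Function.Definitions using (Injective)
  open import Relation.Nullary using (¬_; yes; no)
  open import Relation.Binary.PropositionalEquality
  open import Algebra.Properties.CommutativeMonoid.Sum ℙ.+-0-commutativeMonoid using (sum)
  open import Algebra.Properties.CommutativeMonoid.Sum *-1-commutativeMonoid using () renaming (sum to prod; sum-permute to prod-permute; sum-cong-≗ to prod-cong)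

  -- If a value were missed, punching it out would give an injection into a smaller set.
  injective⇒surjective : ∀ {n} (f : Fin n → Fin n) → Injective _≡_ _≡_ f → ∀ j → ∃ λ i → f i ≡ j
  injective⇒surjective {suc n} f inj j with any? (λ i → f i ≟ᶠ j)
  ... | yes h = h
  ... | no ¬h = ⊥-elim (ℕ.1+n≰n (injective⇒≤ {f = λ i → punchOut (¬h ∘ (λ e → i , sym e))}
    (λ {i} {k} e → inj (punchOut-injective (λ e' → ¬h (i , sym e')) (λ e' → ¬h (k , sym e')) e))))

  injective⇒permutation : ∀ {n} (f : Fin n → Fin n) → Injective _≡_ _≡_ f → Permutation′ n
  injective⇒permutation f inj = permutation f (proj₁ ∘ sur) (proj₂ ∘ sur) (λ i → inj (proj₂ (sur (f i))))
    where sur = injective⇒surjective f inj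

  sgnℤ : Parity → ℤ
  sgnℤ 0ℙ = 1ℤ
  sgnℤ 1ℙ = -1ℤ

  sgnℤ-⊕ : ∀ s t → sgnℤ (s ⊕ t) ≡ sgnℤ s * sgnℤ t
  sgnℤ-⊕ 0ℙ 0ℙ = refl
  sgnℤ-⊕ 0ℙ 1ℙ = refl
  sgnℤ-⊕ 1ℙ 0ℙ = refl
  sgnℤ-⊕ 1ℙ 1ℙ = refl

  prod-sgnℤ : ∀ {n} (s : Fin n → Parity) → prod (sgnℤ ∘ s) ≡ sgnℤ (sum s)
  prod-sgnℤ {zero} s = refl
  prod-sgnℤ {suc n} s = trans (cong (sgnℤ (s zero) *_) (prod-sgnℤ (s ∘ suc))) (sym (sgnℤ-⊕ (s zero) _))

  prod-* : ∀ {n} (f g : Fin n → ℤ) → prod (λ i → f i * g i) ≡ prod f * prod g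
  prod-* {zero} f g = refl
  prod-* {suc n} f g = trans (cong (f zero * g zero *_) (prod-* (f ∘ suc) (g ∘ suc))) (lem (f zero) (g zero) _ _)
    where
    lem : ∀ a b c d → a * b * (c * d) ≡ a * c * (b * d)
    lem = solve-∀

  prod-const : ∀ n c → prod {n} (λ _ → c) ≡ c ^ n
  prod-const zero c = refl
  prod-const (suc n) c = cong (c *_) (prod-const n c)

  prod-≅ : ∀ {m n} {f g : Fin n → ℤ} → (∀ i → f i ≅ g i ⟦ m ⟧) → prod f ≅ prod g ⟦ m ⟧
  prod-≅ {n = zero} h = ≅-refl
  prod-≅ {n = suc n} h = ≅-* (h zero) (prod-≅ (h ∘ suc))

  prime∤prod : ∀ {p n} → Prime p → (f : Fin n → ℤ) → (∀ i → ¬ + p ∣ f i) → ¬ + p ∣ prod f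
  prime∤prod {p} {zero} pr f h d = ¬prime[1] (subst Prime (ℕ.∣1⇒≡1 (∣⇒∣ᵤ d)) pr)
  prime∤prod {n = suc n} pr f h d with euclid pr (f zero) _ d
  ... | inj₁ x = h zero x
  ... | inj₂ y = prime∤prod pr (f ∘ suc) (h ∘ suc) y

  -- Marks the residues whose representative of least absolute value is negative.
  isHigh : ℕ → ℕ → Parity
  isHigh p r = if ⌊ p /2⌋ ℕ.<ᵇ r then 1ℙ else 0ℙ

  -- Gauss's lemma as a definition: the Legendre symbol (a/p) is (-1)^res p a for odd primes p ∤ a.
  res : ℕ → ℤ → Parity
  res zero a = 0ℙ
  res p@(suc _) a = sum {⌊ p /2⌋} (λ k → isHigh p ((suc (toℕ k) ℕ.* (a %ℕ p)) ℕ.% p))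

  res-cong : ∀ {p a b} → a ≅ b ⟦ p ⟧ → res p a ≡ res p b
  res-cong {zero} h = refl
  res-cong {p@(suc _)} h = cong (λ r → sum {⌊ p /2⌋} (λ k → isHigh p ((suc (toℕ k) ℕ.* r) ℕ.% p))) (≅⇒%ℕ h)

  foldResidue : ℕ → ℕ → ℕ
  foldResidue p r = if ⌊ p /2⌋ ℕ.<ᵇ r then p ℕ.∸ r else r

  -- Sign and absolute value of the least absolute residue in one index pair, so that a single match
  -- settles both.
  data Folded (p r : ℕ) : Parity → ℕ → Set where
    low  : r ℕ.≤ ⌊ p /2⌋ → Folded p r 0ℙ r
    high : ⌊ p /2⌋ ℕ.< r → Folded p r 1ℙ (p ℕ.∸ r)

  folded : ∀ p r → Folded p r (isHigh p r) (foldResidue p r)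
  folded p r with ⌊ p /2⌋ ℕ.<ᵇ r in eq
  ... | true  = high (ℕ.<ᵇ⇒< ⌊ p /2⌋ r (subst Data.Bool.T (sym eq) _))
  ... | false = low (ℕ.≮⇒≥ (λ l → subst Data.Bool.T eq (ℕ.<⇒<ᵇ l)))

  module OddPrime {m : ℕ} (pr : Prime (suc m)) (odd : parity (suc m) ≡ 1ℙ) where
    p = suc m
    P = ⌊ p /2⌋

    p≡1+2P : p ≡ suc (P ℕ.+ P)
    p≡1+2P = go p odd
      where
      go : ∀ n → parity n ≡ 1ℙ → n ≡ suc (⌊ n /2⌋ ℕ.+ ⌊ n /2⌋)
      go (suc zero) h = refl
      go (suc (suc n)) h = cong (λ x → suc (suc x)) (trans (go n h) (sym (ℕ.+-suc ⌊ n /2⌋ ⌊ n /2⌋)))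

    0<P : 0 ℕ.< P
    0<P = ℕ.n≢0⇒n>0 (λ e → ¬prime[1] (subst Prime (trans p≡1+2P (cong (λ x → suc (x ℕ.+ x)) e)) pr))

    P<p : P ℕ.< p
    P<p = subst (P ℕ.<_) (sym p≡1+2P) (ℕ.s≤s (ℕ.m≤m+n P P))

    small∤ : ∀ {k} → 0 ℕ.< k → k ℕ.< p → ¬ + p ∣ + k
    small∤ {suc k} _ l d = ℕ.<⇒≱ l (ℕ.∣⇒≤ (∣⇒∣ᵤ d))

    1≢-1 : ¬ 1ℤ ≅ -1ℤ ⟦ p ⟧
    1≢-1 (mk≅ d) = small∤ {2} (ℕ.s≤s ℕ.z≤n) 2<p d
      where
      2<p : 2 ℕ.< p
      2<p = subst (2 ℕ.<_) (sym p≡1+2P) (ℕ.s≤s (ℕ.+-mono-≤ 0<P 0<P))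

    sgnℤ-injective : ∀ s t → sgnℤ s ≅ sgnℤ t ⟦ p ⟧ → s ≡ t
    sgnℤ-injective 0ℙ 0ℙ h = refl
    sgnℤ-injective 0ℙ 1ℙ h = ⊥-elim (1≢-1 h)
    sgnℤ-injective 1ℙ 0ℙ h = ⊥-elim (1≢-1 (≅-sym h))
    sgnℤ-injective 1ℙ 1ℙ h = refl

    module _ (a : ℕ) (p∤a : ¬ + p ∣ + a) where
      private
        idx : Fin P → ℕ
        idx k = suc (toℕ k)

        idx≤P : ∀ k → idx k ℕ.≤ P
        idx≤P k = toℕ<n k

        r : Fin P → ℕ
        r k = (idx k ℕ.* a) ℕ.% p

        p∤idx : ∀ k → ¬ + p ∣ + idx k
        p∤idx k = small∤ (ℕ.s≤s ℕ.z≤n) (ℕ.≤-<-trans (idx≤P k) P<p)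

        ka≅r : ∀ k → + (idx k) * + a ≅ + r k ⟦ p ⟧
        ka≅r k = ≅-trans (≅-reflexive (sym (pos-* (idx k) a))) (%ℕ-≅ (+ (idx k ℕ.* a)) p)

        r>0 : ∀ k → 0 ℕ.< r k
        r>0 k = ℕ.n≢0⇒n>0 (λ eq → [ p∤idx k , p∤a ]′
          (euclid pr (+ idx k) (+ a) (≅-∣ (ka≅r k) (subst (λ z → + p ∣ + z) (sym eq) (∣ᵤ⇒∣ (p ℕ.∣0))))))

      foldedMultiple : Fin P → ℕ
      foldedMultiple k = foldResidue p (r k)

      private
        A = foldedMultiple
        s : Fin P → Parity
        s k = isHigh p (r k)

        ka≅sA : ∀ k → + (idx k) * + a ≅ sgnℤ (s k) * + A k ⟦ p ⟧
        ka≅sA k = ≅-trans (ka≅r k) (go (r k) (ℕ.m%n<n (idx k ℕ.* a) p) (folded p (r k)))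
          where
          go : ∀ x {σ α} → x ℕ.< p → Folded p x σ α → + x ≅ sgnℤ σ * + α ⟦ p ⟧
          go x l (low _) = ≅-reflexive (sym (*-identityˡ (+ x)))
          go x l (high _) = mk≅ (subst (+ p ∣_) (trans (sym (trans (cong (λ z → + x + z) ℤ⊖) (lem₁ (+ p) (+ x)))) (lem₂ (+ x) (+ (p ℕ.∸ x)))) (∣ᵤ⇒∣ ℕ.∣-refl))
            where
            open import Data.Integer.Properties using ([+m]-[+n]≡m⊖n; ⊖-≥)
            ℤ⊖ : + (p ℕ.∸ x) ≡ + p - + x
            ℤ⊖ = sym (trans ([+m]-[+n]≡m⊖n p x) (⊖-≥ (ℕ.<⇒≤ l)))
            lem₁ : ∀ u v → v + (u - v) ≡ u
            lem₁ = solve-∀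
            lem₂ : ∀ u v → u + v ≡ u - -1ℤ * v
            lem₂ = solve-∀

        A-range : ∀ k → 0 ℕ.< A k × A k ℕ.≤ P
        A-range k = go (r k) (r>0 k) (ℕ.m%n<n (idx k ℕ.* a) p) (folded p (r k))
          where
          go : ∀ x {σ α} → 0 ℕ.< x → x ℕ.< p → Folded p x σ α → 0 ℕ.< α × α ℕ.≤ P
          go x 0<x l (low h) = 0<x , h
          go x 0<x l (high h) = ℕ.m<n⇒0<n∸m l ,
            ℕ.≤-trans (ℕ.∸-monoʳ-≤ p h) (ℕ.≤-reflexive (trans (cong (ℕ._∸ suc P) p≡1+2P) (ℕ.m+n∸n≡m P P)))

        -- Equal absolute values mean `k a ≡ ± l a`, so `p` divides `k - l` or `k + l`. Both indices
        -- lie between 1 and `P`, which rules out the sum and leaves `k = l`.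
        A-injective : ∀ {k l} → A k ≡ A l → k ≡ l
        A-injective {k} {l} e = toℕ-injective (ℕ.suc-injective (go (s k) (s l) (ka≅sA k) (ka≅sA l)))
          where
          same : (+ idx k) * + a ≅ (+ idx l) * + a ⟦ p ⟧ → idx k ≡ idx l
          same (mk≅ h) = [ (λ x → residue-unique (ℕ.≤-<-trans (idx≤P k) P<p) (ℕ.≤-<-trans (idx≤P l) P<p) (mk≅ x))
                         , (λ y → ⊥-elim (p∤a y)) ]′
            (euclid pr (+ idx k - + idx l) (+ a) (subst (+ p ∣_) (lem (+ idx k) (+ idx l) (+ a)) h))
            where
            lem : ∀ x y z → x * z - y * z ≡ (x - y) * z
            lem = solve-∀
          opp : (+ idx k) * + a ≅ -1ℤ * ((+ idx l) * + a) ⟦ p ⟧ → ⊥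
          opp (mk≅ h) = [ small∤ {idx k ℕ.+ idx l} (ℕ.s≤s ℕ.z≤n)
                            (subst (idx k ℕ.+ idx l ℕ.<_) (sym p≡1+2P) (ℕ.s≤s (ℕ.+-mono-≤ (idx≤P k) (idx≤P l))))
                        , p∤a ]′
            (euclid pr (+ idx k + + idx l) (+ a) (subst (+ p ∣_) (lem (+ idx k) (+ idx l) (+ a)) h))
            where
            lem : ∀ x y z → x * z - -1ℤ * (y * z) ≡ (x + y) * z
            lem = solve-∀
          neg : ∀ {x y} → x ≅ -1ℤ * y ⟦ p ⟧ → -1ℤ * x ≅ y ⟦ p ⟧
          neg {x} {y} h = ≅-trans (≅-* {a = -1ℤ} ≅-refl h) (≅-reflexive (lem y))
            where
            lem : ∀ z → -1ℤ * (-1ℤ * z) ≡ z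
            lem = solve-∀
          one : ∀ {x} → 1ℤ * x ≅ x ⟦ p ⟧
          one {x} = ≅-reflexive (*-identityˡ x)
          Ae : + A k ≅ + A l ⟦ p ⟧
          Ae = ≅-reflexive (cong +_ e)
          go : ∀ σ τ → (+ idx k) * + a ≅ sgnℤ σ * + A k ⟦ p ⟧ → (+ idx l) * + a ≅ sgnℤ τ * + A l ⟦ p ⟧ → idx k ≡ idx l
          go 0ℙ 0ℙ h h' = same (≅-trans h (≅-trans one (≅-trans Ae (≅-sym (≅-trans h' one)))))
          go 1ℙ 1ℙ h h' = same (≅-trans h (≅-trans (≅-* {a = -1ℤ} ≅-refl Ae) (≅-sym h')))
          go 0ℙ 1ℙ h h' = ⊥-elim (opp (≅-trans h (≅-trans one (≅-trans Ae (≅-sym (neg h'))))))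
          go 1ℙ 0ℙ h h' = ⊥-elim (opp (≅-trans h (≅-* {a = -1ℤ} ≅-refl (≅-trans Ae (≅-sym (≅-trans h' one))))))

        A' : Fin P → Fin P
        A' k = fromℕ< {A k ℕ.∸ 1} (lt (A-range k))
          where
          lt : ∀ {x} → 0 ℕ.< x × x ℕ.≤ P → x ℕ.∸ 1 ℕ.< P
          lt {suc x} (_ , h) = h

        A≡A' : ∀ k → A k ≡ suc (toℕ (A' k))
        A≡A' k = trans (lem (proj₁ (A-range k))) (cong suc (sym (toℕ-fromℕ< _)))
          where
          lem : ∀ {x} → 0 ℕ.< x → x ≡ suc (x ℕ.∸ 1)
          lem {suc x} _ = refl

        A'-injective : Injective _≡_ _≡_ A'
        A'-injective {k} {l} e = A-injective (trans (A≡A' k) (trans (cong (suc ∘ toℕ) e) (sym (A≡A' l))))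

      π : Permutation′ P
      π = injective⇒permutation A' A'-injective

      foldedMultiple≡π : ∀ k → foldedMultiple k ≡ suc (toℕ (A' k))
      foldedMultiple≡π = A≡A'

      -- Multiply the congruences `k a ≡ ± A k` over all `k`. The `A k` are a permutation of
      -- `1, ..., P`, so the product `F` of these numbers occurs on both sides and, being prime to
      -- `p`, cancels.
      gauss-lemma : (+ a) ^ P ≅ sgnℤ (sum s) ⟦ p ⟧
      gauss-lemma = [ mk≅ , (λ y → ⊥-elim (prime∤prod pr (λ k → + idx k) p∤idx y)) ]′
        (euclid pr ((+ a) ^ P - sgnℤ (sum s)) F (subst (+ p ∣_) (lem ((+ a) ^ P) (sgnℤ (sum s)) F) (m∣a-b main)))
        where
        F : ℤ
        F = prod {P} (λ k → + idx k)
        lem : ∀ x y z → z * x - y * z ≡ (x - y) * z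
        lem = solve-∀
        main : F * (+ a) ^ P ≅ sgnℤ (sum s) * F ⟦ p ⟧
        main = ≅-trans (≅-reflexive (trans (cong (F *_) (sym (prod-const P (+ a)))) (sym (prod-* {P} (λ k → + idx k) (λ _ → + a)))))
          (≅-trans (prod-≅ ka≅sA) (≅-reflexive (trans (prod-* (sgnℤ ∘ s) (+_ ∘ A))
            (cong₂ _*_ (prod-sgnℤ s) (trans (prod-cong (λ k → cong +_ (A≡A' k))) (sym (prod-permute (λ k → + idx k) π)))))))

    euler-criterion : ∀ a → ¬ + p ∣ a → a ^ P ≅ sgnℤ (res p a) ⟦ p ⟧
    euler-criterion a p∤a = ≅-trans (≅-^ P (%ℕ-≅ a p)) (gauss-lemma (a %ℕ p) (λ d → p∤a (≅-∣ (%ℕ-≅ a p) d)))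

    -- Multiplicativity is invisible in the count that defines `res`; it comes from Euler's
    -- criterion, since a sign is determined by its class modulo an odd prime.
    res-* : ∀ a b → ¬ + p ∣ a → ¬ + p ∣ b → res p (a * b) ≡ res p a ⊕ res p b
    res-* a b p∤a p∤b = sgnℤ-injective _ _ (≅-trans (≅-sym (euler-criterion (a * b) p∤ab))
      (≅-trans (≅-reflexive (pow-* P)) (≅-trans (≅-* (euler-criterion a p∤a) (euler-criterion b p∤b))
        (≅-reflexive (sym (sgnℤ-⊕ (res p a) (res p b)))))))
      where
      p∤ab : ¬ + p ∣ a * b
      p∤ab d = [ p∤a , p∤b ]′ (euclid pr a b d)
      lem : ∀ x y z w → x * y * (z * w) ≡ x * z * (y * w)
      lem = solve-∀
      pow-* : ∀ n → (a * b) ^ n ≡ a ^ n * b ^ n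
      pow-* zero = refl
      pow-* (suc n) = trans (cong (a * b *_) (pow-* n)) (lem a b (a ^ n) (b ^ n))

    res-square : ∀ a x → ¬ + p ∣ a → + p ∣ x * x - a → res p a ≡ 0ℙ
    res-square a x p∤a h = trans (sym (res-cong {p} {x * x} {a} (mk≅ h))) (trans (res-* x x p∤x p∤x) (ℙ.p+p≡0ℙ (res p x)))
      where
      p∤x : ¬ + p ∣ x
      p∤x d = p∤a (≅-∣ (≅-sym (mk≅ {x * x} {a} h)) (∣m⇒∣m*n x d))

    private
      fermatPoly : ℕ → List ℤ
      fermatPoly n = -1ℤ ∷ replicate n 0ℤ

      eval-zeros : ∀ n x → evalMonic (replicate n 0ℤ) x ≡ x ^ n
      eval-zeros zero x = refl
      eval-zeros (suc n) x = trans (lem (x * evalMonic (replicate n 0ℤ) x)) (cong (x *_) (eval-zeros n x))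
        where
        lem : ∀ z → 0ℤ + z ≡ z
        lem = solve-∀

      eval-fermat : ∀ n x → evalMonic (fermatPoly n) x ≡ x ^ suc n - 1ℤ
      eval-fermat n x = trans (cong (λ z → -1ℤ + x * z) (eval-zeros n x)) (lem (x * x ^ n))
        where
        lem : ∀ z → -1ℤ + z ≡ z - 1ℤ
        lem = solve-∀

      -- By Euler's criterion the residues are roots of `x^P - 1`, of degree `P`. Both the existence
      -- of nonresidues and that of square roots follow by exhibiting `P + 1` candidates.
      few-residues : ∀ rs → P ℕ.< length rs → AllPairs (λ r s → ¬ s ≅ r ⟦ p ⟧) rs →
                     All (λ r → (¬ + p ∣ r) × res p r ≡ 0ℙ) rs → ⊥
      few-residues rs l d h = go P refl 0<P
        where
        go : ∀ n → P ≡ n → 0 ℕ.< n → ⊥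
        go (suc Q) eqP _ = too-many-roots pr (fermatPoly Q) rs
          (subst (ℕ._< length rs) (trans eqP (cong suc (sym (length-replicate Q)))) l) d
          (All.map (λ {r} (p∤r , e) → subst (+ p ∣_) (sym (eval-fermat Q r))
            (m∣a-b (subst₂ (λ n z → r ^ n ≅ z ⟦ p ⟧) eqP (cong sgnℤ e) (euler-criterion r p∤r)))) h)

    -- The candidates `1, ..., P + 1` are distinct modulo `p = 2P + 1` and too many to be residues
    -- all at once.
    nonresidue : ∃ λ a → (0 ℕ.< a × a ℕ.< p) × res p (+ a) ≡ 1ℙ
    nonresidue with any? {suc P} (λ i → res p (+ suc (toℕ i)) ℙ.≟ 1ℙ)
    ... | yes (i , h) = suc (toℕ i) , (ℕ.s≤s ℕ.z≤n , bound i) , h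
      where
      bound : ∀ i → suc (toℕ {suc P} i) ℕ.< p
      bound i = ℕ.<-≤-trans (ℕ.s≤s (toℕ<n i)) (subst (suc (suc P) ℕ.≤_) (sym p≡1+2P) (ℕ.s≤s (ℕ.+-monoˡ-≤ P 0<P)))
    ... | no ¬h = ⊥-elim (few-residues (tabulate {n = suc P} (λ i → + suc (toℕ i)))
        (subst (P ℕ.<_) (sym (length-tabulate {n = suc P} (λ i → + suc (toℕ i)))) ℕ.≤-refl)
        (AllPairs.tabulate⁺ (λ {i} {j} i≢j e → i≢j (sym (toℕ-injective (ℕ.suc-injective (residue-unique (bound j) (bound i) e))))))
        (All.tabulate⁺ (λ i → small∤ (ℕ.s≤s ℕ.z≤n) (bound i) , only0 _ (λ e → ¬h (i , e)))))
      where
      bound : ∀ i → suc (toℕ {suc P} i) ℕ.< p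
      bound i = ℕ.<-≤-trans (ℕ.s≤s (toℕ<n i)) (subst (suc (suc P) ℕ.≤_) (sym p≡1+2P) (ℕ.s≤s (ℕ.+-monoˡ-≤ P 0<P)))
      only0 : ∀ s → s ≢ 1ℙ → s ≡ 0ℙ
      only0 0ℙ _ = refl
      only0 1ℙ h = ⊥-elim (h refl)

    -- The squares of `1, ..., P` are `P` distinct residues. If `a` were none of them, it would be
    -- one residue too many.
    sqrt-of-residue : ∀ a → ¬ + p ∣ a → res p a ≡ 0ℙ → ∃ λ x → + p ∣ x * x - a
    sqrt-of-residue a p∤a h with any? {P} (λ i → + p ∣? + suc (toℕ i) * + suc (toℕ i) - a)
    ... | yes (i , d) = + suc (toℕ i) , d
    ... | no ¬d = ⊥-elim (few-residues (a ∷ tabulate sq)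
        (subst (P ℕ.<_) (cong suc (sym (length-tabulate sq))) ℕ.≤-refl)
        (All.tabulate⁺ (λ i (mk≅ e) → ¬d (i , e)) ∷ AllPairs.tabulate⁺ distinct)
        ((p∤a , h) ∷ All.tabulate⁺ (λ i → p∤sq i , res-square (sq i) (rt i) (p∤sq i) (m∣a-b (≅-refl {a = sq i})))))
      where
      rt sq : Fin P → ℤ
      rt i = + suc (toℕ i)
      sq i = rt i * rt i
      p∤rt : ∀ i → ¬ + p ∣ rt i
      p∤rt i = small∤ (ℕ.s≤s ℕ.z≤n) (ℕ.≤-<-trans (toℕ<n i) P<p)
      p∤sq : ∀ i → ¬ + p ∣ sq i
      p∤sq i d = [ p∤rt i , p∤rt i ]′ (euclid pr (rt i) (rt i) d)
      distinct : ∀ {i j} → i ≢ j → ¬ sq j ≅ sq i ⟦ p ⟧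
      distinct {i} {j} i≢j (mk≅ d) =
        [ (λ x → i≢j (sym (toℕ-injective (ℕ.suc-injective
            (residue-unique (ℕ.≤-<-trans (toℕ<n j) P<p) (ℕ.≤-<-trans (toℕ<n i) P<p) (mk≅ x))))))
        , small∤ {suc (toℕ j) ℕ.+ suc (toℕ i)} (ℕ.s≤s ℕ.z≤n)
            (subst (suc (toℕ j) ℕ.+ suc (toℕ i) ℕ.<_) (sym p≡1+2P) (ℕ.s≤s (ℕ.+-mono-≤ (toℕ<n j) (toℕ<n i)))) ]′
        (euclid pr (rt j - rt i) (rt j + rt i) (subst (+ p ∣_) (lem (rt j) (rt i)) d))
        where
        lem : ∀ x y → x * x - y * y ≡ (x - y) * (x + y)
        lem = solve-∀

-- Quadratic reciprocity and its supplements, after Eisenstein.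

module Reciprocity where
  open Congruences
  open Gauss
  open import Data.Nat as ℕ using (ℕ; zero; suc; ⌊_/2⌋; parity)
  import Data.Nat.Properties as ℕ
  import Data.Nat.Divisibility as ℕ
  import Data.Nat.DivMod as ℕ
  open import Data.Nat.Primality using (Prime; prime⇒irreducible; ¬prime[1])
  open import Data.Nat.Tactic.RingSolver using () renaming (solve-∀ to solve-∀ⁿ)
  open import Data.Integer using (+_; -_; _+_; _-_; _*_; _^_; -1ℤ)
  open import Data.Integer.Divisibility.Signed using (_∣_; ∣⇒∣ᵤ)
  open import Data.Parity using (Parity; 0ℙ; 1ℙ) renaming (_+_ to infixl 6 _⊕_; _*_ to _⊗_)
  import Data.Parity.Properties as ℙ
  open import Data.Bool using (true; false; if_then_else_; T)
  open import Data.Fin using (Fin; zero; suc; toℕ)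
  open import Data.Fin.Properties using (toℕ<n)
  open import Data.Sum using (inj₁; inj₂)
  open import Data.Empty using (⊥-elim)
  open import Function using (_∘_)
  open import Relation.Nullary using (¬_; yes; no)
  open import Relation.Binary.PropositionalEquality
  open import Algebra.Properties.CommutativeMonoid.Sum ℙ.+-0-commutativeMonoid
    using (sum; sum-cong-≗; sum-permute; ∑-distrib-+; ∑-comm; sum-replicate-zero)

  open ≡-Reasoning

  leq : ℕ → ℕ → Parity
  leq m n = if m ℕ.≤ᵇ n then 1ℙ else 0ℙ

  leq-yes : ∀ {m n} → m ℕ.≤ n → leq m n ≡ 1ℙ
  leq-yes {m} {n} h with m ℕ.≤ᵇ n in e
  ... | true = refl
  ... | false = ⊥-elim (subst T e (ℕ.≤⇒≤ᵇ h))

  leq-no : ∀ {m n} → ¬ m ℕ.≤ n → leq m n ≡ 0ℙ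
  leq-no {m} {n} h with m ℕ.≤ᵇ n in e
  ... | false = refl
  ... | true = ⊥-elim (h (ℕ.≤ᵇ⇒≤ m n (subst T (sym e) _)))

  -- Replaces the parity of a quotient by a count of indices modulo 2, which turns the sums of
  -- quotients into counts of lattice points.
  parity-as-count : ∀ {Q} n → n ℕ.≤ Q → sum {Q} (λ j → leq (suc (toℕ j)) n) ≡ parity n
  parity-as-count {Q} zero _ = trans (sum-cong-≗ {Q} (λ j → leq-no {suc (toℕ j)} {0} (λ ()))) (sum-replicate-zero Q)
  parity-as-count {suc Q} (suc n) (ℕ.s≤s h) = begin
    leq 1 (suc n) ⊕ sum (λ (j : Fin Q) → leq (suc (suc (toℕ j))) (suc n)) ≡⟨ cong₂ _⊕_ (leq-yes {1} {suc n} (ℕ.s≤s ℕ.z≤n)) (sum-cong-≗ {Q} (λ j → leq-suc (suc (toℕ j)) n)) ⟩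
    1ℙ ⊕ sum (λ (j : Fin Q) → leq (suc (toℕ j)) n)                       ≡⟨ cong (1ℙ ⊕_) (parity-as-count n h) ⟩
    1ℙ ⊕ parity n                                                       ≡⟨ ℙ.+-homo-+ 1 n ⟨
    parity (suc n)                                                      ∎
    where
    leq-suc : ∀ m n → leq (suc m) (suc n) ≡ leq m n
    leq-suc m n with m ℕ.≤? n
    ... | yes h = trans (leq-yes (ℕ.s≤s h)) (sym (leq-yes h))
    ... | no ¬h = trans (leq-no (¬h ∘ ℕ.≤-pred)) (sym (leq-no ¬h))

  sum-const-1ℙ : ∀ n → sum {n} (λ _ → 1ℙ) ≡ parity n
  sum-const-1ℙ zero = refl
  sum-const-1ℙ (suc n) = trans (cong (1ℙ ⊕_) (sum-const-1ℙ n)) (sym (ℙ.+-homo-+ 1 n))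

  sum-const-parity : ∀ m n → sum {m} (λ _ → parity n) ≡ parity (m ℕ.* n)
  sum-const-parity zero n = refl
  sum-const-parity (suc m) n = trans (cong (parity n ⊕_) (sum-const-parity m n)) (sym (ℙ.+-homo-+ n (m ℕ.* n)))

  module Eisenstein {m} (pr : Prime (suc m)) (odd : parity (suc m) ≡ 1ℙ) where
    open OddPrime pr odd

    private
      idx : Fin P → ℕ
      idx k = suc (toℕ k)

    -- Compare parities in `k a = ⌊k a / p⌋ p + r`. As `p` is odd, folding `r` to `p - r` flips the
    -- parity, so the parity of `r` is that of the folded residue plus the sign. The folded residues
    -- run through `1, ..., P`, and summing over `k` isolates the number of signs.
    eisenstein-lemma : ∀ a → ¬ + p ∣ + a →
      res p (+ a) ≡ sum (λ k → parity ((idx k ℕ.* a) ℕ./ p)) ⊕ (sum (λ k → parity (idx k ℕ.* a)) ⊕ sum (λ k → parity (idx k)))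
    eisenstein-lemma a p∤a = begin
      res p (+ a)                    ≡⟨ sum-cong-≗ {P} (λ k → cong (isHigh p) (mod-lemma (idx k))) ⟩
      sum s                          ≡⟨ cancel (sum fl) (sum s) (sum (λ k → parity (idx k))) ⟩
      sum fl ⊕ ((sum fl ⊕ (sum (λ k → parity (idx k)) ⊕ sum s)) ⊕ sum (λ k → parity (idx k)))
        ≡⟨ cong (λ z → sum fl ⊕ (z ⊕ sum (λ k → parity (idx k)))) (sym total) ⟩
      sum fl ⊕ (sum (λ k → parity (idx k ℕ.* a)) ⊕ sum (λ k → parity (idx k))) ∎
      where
      r : Fin P → ℕ
      r k = (idx k ℕ.* a) ℕ.% p
      s fl : Fin P → Parity
      s k = isHigh p (r k)
      fl k = parity ((idx k ℕ.* a) ℕ./ p)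
      A = foldedMultiple a p∤a

      mod-lemma : ∀ x → (x ℕ.* (a ℕ.% p)) ℕ.% p ≡ (x ℕ.* a) ℕ.% p
      mod-lemma x = begin
        (x ℕ.* (a ℕ.% p)) ℕ.% p ≡⟨ ℕ.%-distribˡ-* x (a ℕ.% p) p ⟩
        (x ℕ.% p ℕ.* (a ℕ.% p ℕ.% p)) ℕ.% p ≡⟨ cong (λ z → (x ℕ.% p ℕ.* z) ℕ.% p) (ℕ.m%n%n≡m%n a p) ⟩
        (x ℕ.% p ℕ.* (a ℕ.% p)) ℕ.% p ≡⟨ ℕ.%-distribˡ-* x a p ⟨
        (x ℕ.* a) ℕ.% p ∎

      cancel : ∀ x y z → y ≡ x ⊕ ((x ⊕ (z ⊕ y)) ⊕ z)
      cancel 0ℙ 0ℙ 0ℙ = refl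
      cancel 0ℙ 0ℙ 1ℙ = refl
      cancel 0ℙ 1ℙ 0ℙ = refl
      cancel 0ℙ 1ℙ 1ℙ = refl
      cancel 1ℙ 0ℙ 0ℙ = refl
      cancel 1ℙ 0ℙ 1ℙ = refl
      cancel 1ℙ 1ℙ 0ℙ = refl
      cancel 1ℙ 1ℙ 1ℙ = refl

      parity-folded : ∀ x {σ α} → x ℕ.< p → Folded p x σ α → parity x ≡ parity α ⊕ σ
      parity-folded x l (low _) = sym (ℙ.+-identityʳ _)
      parity-folded x l (high _) = begin
        parity x ≡⟨ lem (parity x) (parity (p ℕ.∸ x)) (trans (sym (ℙ.+-homo-+ x (p ℕ.∸ x))) (trans (cong parity (ℕ.m+[n∸m]≡n (ℕ.<⇒≤ l))) odd)) ⟩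
        parity (p ℕ.∸ x) ⊕ 1ℙ ∎
        where
        lem : ∀ u v → u ⊕ v ≡ 1ℙ → u ≡ v ⊕ 1ℙ
        lem 0ℙ 1ℙ e = refl
        lem 1ℙ 0ℙ e = refl

      each : ∀ k → parity (idx k ℕ.* a) ≡ fl k ⊕ (parity (A k) ⊕ s k)
      each k = begin
        parity (idx k ℕ.* a) ≡⟨ cong parity (ℕ.m≡m%n+[m/n]*n (idx k ℕ.* a) p) ⟩
        parity (r k ℕ.+ (idx k ℕ.* a) ℕ./ p ℕ.* p) ≡⟨ ℙ.+-homo-+ (r k) _ ⟩
        parity (r k) ⊕ parity ((idx k ℕ.* a) ℕ./ p ℕ.* p) ≡⟨ cong₂ _⊕_ (parity-folded (r k) (ℕ.m%n<n (idx k ℕ.* a) p) (folded p (r k)))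
            (trans (ℙ.*-homo-* ((idx k ℕ.* a) ℕ./ p) p) (trans (cong (fl k ⊗_) odd) (ℙ.*-identityʳ (fl k)))) ⟩
        (parity (A k) ⊕ s k) ⊕ fl k ≡⟨ ℙ.+-comm (parity (A k) ⊕ s k) (fl k) ⟩
        fl k ⊕ (parity (A k) ⊕ s k) ∎

      total : sum (λ k → parity (idx k ℕ.* a)) ≡ sum fl ⊕ (sum (λ k → parity (idx k)) ⊕ sum s)
      total = begin
        sum (λ k → parity (idx k ℕ.* a)) ≡⟨ sum-cong-≗ {P} each ⟩
        sum (λ k → fl k ⊕ (parity (A k) ⊕ s k)) ≡⟨ ∑-distrib-+ fl (λ k → parity (A k) ⊕ s k) ⟩
        sum fl ⊕ sum (λ k → parity (A k) ⊕ s k) ≡⟨ cong (sum fl ⊕_) (∑-distrib-+ (parity ∘ A) s) ⟩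
        sum fl ⊕ (sum (parity ∘ A) ⊕ sum s) ≡⟨ cong (λ z → sum fl ⊕ (z ⊕ sum s)) (trans (sum-cong-≗ {P} (λ k → cong parity (foldedMultiple≡π a p∤a k)))
             (sym (sum-permute (λ k → parity (idx k)) (π a p∤a)))) ⟩
        sum fl ⊕ (sum (λ k → parity (idx k)) ⊕ sum s) ∎

    res-neg1 : res p -1ℤ ≡ parity P
    res-neg1 = sgnℤ-injective _ _ (≅-trans (≅-sym (euler-criterion -1ℤ (λ d → 1≢-1 (mk≅ (∣m⇒∣m*n (- (+ 2)) d)))))
      (≅-reflexive (pow P)))
      where
      open import Data.Integer.Divisibility.Signed using (∣m⇒∣m*n)
      pow : ∀ n → -1ℤ ^ n ≡ sgnℤ (parity n)
      pow zero = refl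
      pow (suc zero) = refl
      pow (suc (suc n)) = trans (cong (λ z → -1ℤ * (-1ℤ * z)) (pow n)) (lem (sgnℤ (parity n)))
        where
        open import Data.Integer.Tactic.RingSolver using (solve-∀)
        lem : ∀ z → -1ℤ * (-1ℤ * z) ≡ z
        lem = solve-∀

    -- For `a = 2` all quotients vanish and all multiples are even, so only the sum of the indices
    -- survives.
    res-2 : res p (+ 2) ≡ sum (λ k → parity (idx k))
    res-2 = begin
      res p (+ 2) ≡⟨ eisenstein-lemma 2 (λ d → 1≢-1 (mk≅ d)) ⟩
      sum (λ k → parity ((idx k ℕ.* 2) ℕ./ p)) ⊕ (sum (λ k → parity (idx k ℕ.* 2)) ⊕ sum (λ k → parity (idx k)))
        ≡⟨ cong₂ (λ x y → x ⊕ (y ⊕ sum (λ k → parity (idx k))))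
             (trans (sum-cong-≗ {P} (λ k → cong parity (ℕ.m<n⇒m/n≡0 {idx k ℕ.* 2} {p} (lt k)))) (sum-replicate-zero P))
             (trans (sum-cong-≗ {P} (λ k → trans (ℙ.*-homo-* (idx k) 2) (ℙ.*-zeroʳ _))) (sum-replicate-zero P)) ⟩
      sum (λ k → parity (idx k)) ∎
      where
      lt : ∀ k → idx k ℕ.* 2 ℕ.< p
      lt k = subst (idx k ℕ.* 2 ℕ.<_) (sym p≡1+2P) (ℕ.s≤s (ℕ.≤-trans (ℕ.*-monoˡ-≤ 2 (toℕ<n k)) (ℕ.≤-reflexive (lem P))))
        where
        lem : ∀ x → x ℕ.* 2 ≡ x ℕ.+ x
        lem = solve-∀ⁿ

    res-odd : ∀ a → ¬ + p ∣ + a → parity a ≡ 1ℙ → res p (+ a) ≡ sum (λ k → parity ((idx k ℕ.* a) ℕ./ p))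
    res-odd a p∤a odd-a = begin
      res p (+ a) ≡⟨ eisenstein-lemma a p∤a ⟩
      F ⊕ (sum (λ k → parity (idx k ℕ.* a)) ⊕ E) ≡⟨ cong (λ z → F ⊕ (z ⊕ E)) (sum-cong-≗ {P} (λ k → trans (ℙ.*-homo-* (idx k) a) (trans (cong (parity (idx k) ⊗_) odd-a) (ℙ.*-identityʳ _)))) ⟩
      F ⊕ (E ⊕ E) ≡⟨ cong (F ⊕_) (ℙ.p+p≡0ℙ E) ⟩
      F ⊕ 0ℙ ≡⟨ ℙ.+-identityʳ F ⟩
      F ∎
      where
      F = sum (λ k → parity ((idx k ℕ.* a) ℕ./ p))
      E = sum (λ k → parity (idx k))

    -- The quotient counts the points of column `k` on or below the line of slope `a / p`. Since
    -- `k ≤ P` and `a = 2Q + 1`, the column stays within height `Q`.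
    lattice-count : ∀ Q → ∀ a → a ≡ suc (Q ℕ.+ Q) → ∀ k →
      parity ((idx k ℕ.* a) ℕ./ p) ≡ sum {Q} (λ j → leq (suc (toℕ j) ℕ.* p) (idx k ℕ.* a))
    lattice-count Q a a≡ k = begin
      parity n                                ≡⟨ parity-as-count n n≤Q ⟨
      sum {Q} (λ j → leq (suc (toℕ j)) n)      ≡⟨ sum-cong-≗ {Q} (λ j → same (suc (toℕ j))) ⟩
      sum {Q} (λ j → leq (suc (toℕ j) ℕ.* p) x) ∎
      where
      x = idx k ℕ.* a
      n = x ℕ./ p
      same : ∀ j → leq j n ≡ leq (j ℕ.* p) x
      same j with j ℕ.≤? n
      ... | yes h = trans (leq-yes h) (sym (leq-yes (ℕ.≤-trans (ℕ.*-monoˡ-≤ p h) (ℕ.m/n*n≤m x p))))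
      ... | no ¬h = trans (leq-no ¬h) (sym (leq-no {j ℕ.* p} {x} (λ h → ¬h (subst (ℕ._≤ n) (ℕ.m*n/n≡m j p) (ℕ./-monoˡ-≤ {j ℕ.* p} {x} p h)))))
      n≤Q : n ℕ.≤ Q
      n≤Q = ℕ.≤-pred (ℕ.m<n*o⇒m/o<n {x} {suc Q} {p} (ℕ.<-≤-trans (ℕ.s≤s (ℕ.*-monoˡ-≤ a (toℕ<n k)))
        (subst₂ (λ u v → suc (P ℕ.* u) ℕ.≤ suc Q ℕ.* v) (sym a≡) (sym p≡1+2P)
          (ℕ.≤-trans (ℕ.m≤m+n _ (Q ℕ.+ P)) (ℕ.≤-reflexive (lem P Q))))))
        where
        lem : ∀ P Q → suc (P ℕ.* suc (Q ℕ.+ Q)) ℕ.+ (Q ℕ.+ P) ≡ suc Q ℕ.* suc (P ℕ.+ P)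
        lem = solve-∀ⁿ

  -- The two sums count the points of the `P` by `Q` rectangle below and above the diagonal. No
  -- point lies on it, because `j p = k q` would make `p` divide `k` or `q`, so together they count
  -- the whole rectangle.
  quadratic-reciprocity : ∀ {p q} → Prime p → Prime q → parity p ≡ 1ℙ → parity q ≡ 1ℙ → p ≢ q →
    res p (+ q) ⊕ res q (+ p) ≡ parity (⌊ p /2⌋ ℕ.* ⌊ q /2⌋)
  quadratic-reciprocity {suc m} {suc n} pp pq op oq p≢q = begin
    res p (+ q) ⊕ res q (+ p)
      ≡⟨ cong₂ _⊕_ (EP.res-odd q (p∤q pp pq p≢q) oq) (EQ.res-odd p (p∤q pq pp (p≢q ∘ sym)) op) ⟩
    sum {P} (λ k → parity ((suc (toℕ k) ℕ.* q) ℕ./ p)) ⊕ sum {Q} (λ j → parity ((suc (toℕ j) ℕ.* p) ℕ./ q))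
      ≡⟨ cong₂ _⊕_ (sum-cong-≗ {P} (EP.lattice-count Q q OQ.p≡1+2P)) (sum-cong-≗ {Q} (EQ.lattice-count P p OP.p≡1+2P)) ⟩
    sum {P} (λ k → sum {Q} (λ j → leq (jp j) (kq k))) ⊕ sum {Q} (λ j → sum {P} (λ k → leq (kq k) (jp j)))
      ≡⟨ cong (sum {P} (λ k → sum {Q} (λ j → leq (jp j) (kq k))) ⊕_) (∑-comm {Q} {P} (λ j k → leq (kq k) (jp j))) ⟩
    sum {P} (λ k → sum {Q} (λ j → leq (jp j) (kq k))) ⊕ sum {P} (λ k → sum {Q} (λ j → leq (kq k) (jp j)))
      ≡⟨ ∑-distrib-+ {P} (λ k → sum {Q} (λ j → leq (jp j) (kq k))) _ ⟨
    sum {P} (λ k → sum {Q} (λ j → leq (jp j) (kq k)) ⊕ sum {Q} (λ j → leq (kq k) (jp j)))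
      ≡⟨ sum-cong-≗ {P} (λ k → trans (sym (∑-distrib-+ {Q} (λ j → leq (jp j) (kq k)) (λ j → leq (kq k) (jp j)))) (trans (sum-cong-≗ {Q} (λ j → exactly-one k j)) (sum-const-1ℙ Q))) ⟩
    sum {P} (λ _ → parity Q)
      ≡⟨ sum-const-parity P Q ⟩
    parity (P ℕ.* Q) ∎
    where
    p = suc m
    q = suc n
    module EP = Eisenstein pp op
    module EQ = Eisenstein pq oq
    module OP = OddPrime pp op
    module OQ = OddPrime pq oq
    P = ⌊ p /2⌋
    Q = ⌊ q /2⌋
    jp : Fin Q → ℕ
    jp j = suc (toℕ j) ℕ.* p
    kq : Fin P → ℕ
    kq k = suc (toℕ k) ℕ.* q
    p∤q : ∀ {p q} → Prime p → Prime q → p ≢ q → ¬ + p ∣ + q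
    p∤q pp pq ne d with prime⇒irreducible pq (∣⇒∣ᵤ d)
    ... | inj₁ refl = ¬prime[1] pp
    ... | inj₂ e = ne e
    never-equal : ∀ k j → jp j ≢ kq k
    never-equal k j e with euclidsLemma (suc (toℕ k)) q pp (subst (p ℕ.∣_) e (ℕ.∣n⇒∣m*n (suc (toℕ j)) ℕ.∣-refl))
      where open import Data.Nat.Primality using (euclidsLemma)
    ... | inj₁ d = ℕ.<⇒≱ (ℕ.≤-<-trans (toℕ<n k) OP.P<p) (ℕ.∣⇒≤ d)
    ... | inj₂ d with prime⇒irreducible pq d
    ...   | inj₁ e' = ¬prime[1] (subst Prime e' pp)
    ...   | inj₂ e' = p≢q e'
    exactly-one : ∀ k j → leq (jp j) (kq k) ⊕ leq (kq k) (jp j) ≡ 1ℙ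
    exactly-one k j with ℕ.≤-total (jp j) (kq k)
    ... | inj₁ h = cong₂ _⊕_ (leq-yes h) (leq-no (λ h' → never-equal k j (ℕ.≤-antisym h h')))
    ... | inj₂ h = cong₂ _⊕_ (leq-no (λ h' → never-equal k j (ℕ.≤-antisym h' h))) (leq-yes h)

-- Square classes, Hilbert symbols and the product formula.

module Hilbert where
  open Congruences
  open Gauss
  open Reciprocity
  open import Data.Nat as ℕ using (ℕ; zero; suc; ⌊_/2⌋; parity)
  import Data.Nat.Properties as ℕ
  import Data.Nat.Divisibility as ℕ
  import Data.Nat.DivMod as ℕ
  open import Data.Nat.Primality using (Prime; prime⇒nonTrivial; prime⇒nonZero; prime⇒irreducible; ¬prime[1]; prime[2])
  open import Data.Integer using (ℤ; +_; -_; _+_; _-_; _*_; _^_; 0ℤ; 1ℤ; -1ℤ; ≢-nonZero) renaming (∣_∣ to abs)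
  open import Data.Integer.Properties using (abs-*; *-comm; *-assoc; *-zeroˡ; *-identityˡ; *-identityʳ; *-cancelˡ-≡; ∣i∣≡0⇒i≡0; i*j≡0⇒i≡0∨j≡0)
  open import Data.Integer.DivMod using (_%ℕ_)
  open import Data.Integer.Divisibility.Signed using (_∣_; _∣?_; divides; ∣-refl; ∣⇒∣ᵤ; ∣ᵤ⇒∣; ∣m⇒∣m*n; ∣m∣n⇒∣m+n)
  open import Data.Integer.Tactic.RingSolver using (solve-∀)
  open import Data.Parity using (Parity; 0ℙ; 1ℙ) renaming (_+_ to infixl 6 _⊕_; _*_ to _⊗_)
  import Data.Parity.Properties as ℙ
  open import Data.Fin using (toℕ)
  open import Data.List using (List; []; _∷_; foldr)
  open import Data.List.Relation.Unary.All as All using (All; []; _∷_)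
  open import Data.List.Relation.Unary.AllPairs using ([]; _∷_)
  open import Data.List.Relation.Unary.Any using (here; there)
  open import Data.List.Relation.Unary.Unique.Propositional using (Unique)
  open import Data.List.Membership.Propositional using (_∈_)
  open import Data.Product using (_×_; _,_; proj₁; proj₂)
  open import Data.Sum using (inj₁; inj₂; [_,_]′)
  open import Data.Empty using (⊥; ⊥-elim)
  open import Function using (_∘_)
  open import Relation.Nullary using (¬_; Dec; yes; no)
  open import Relation.Binary.PropositionalEquality
  open import Algebra.Properties.CommutativeMonoid.Sum ℙ.+-0-commutativeMonoid using (sum)
  import Algebra.Solver.Ring.Simple
  import Algebra.Solver.Ring.AlmostCommutativeRing as ACR
  module ℙ-Solver = Algebra.Solver.Ring.Simple (ACR.fromCommutativeRing ℙ.+-*-commutativeRing) ℙ._≟_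

  *-≢0 : ∀ {a b} → a ≢ 0ℤ → b ≢ 0ℤ → a * b ≢ 0ℤ
  *-≢0 {a} {b} ha hb e = [ ha , hb ]′ (i*j≡0⇒i≡0∨j≡0 a e)

  -- A relation rather than a function: uniqueness lets a square class be read off from any
  -- factorisation at hand, without unfolding `ord`.
  record Split (ℓ : ℕ) (a : ℤ) (i : ℕ) (u : ℤ) : Set where
    constructor split
    field
      factors : a ≡ (+ ℓ) ^ i * u
      isUnit  : ¬ + ℓ ∣ u
  open Split

  split-unit : ∀ {ℓ a} → ¬ + ℓ ∣ a → Split ℓ a 0 a
  split-unit {a = a} h = split (sym (*-identityˡ a)) h

  split-times : ∀ {ℓ u} → ¬ + ℓ ∣ u → Split ℓ (+ ℓ * u) 1 u
  split-times {ℓ} {u} h = split (cong (_* u) (sym (*-identityʳ (+ ℓ)))) h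

  module _ {ℓ : ℕ} (pr : Prime ℓ) where
    private instance
      nz : ℕ.NonZero ℓ
      nz = prime⇒nonZero pr

    prime∤1 : ¬ + ℓ ∣ 1ℤ
    prime∤1 d = ¬prime[1] (subst Prime (ℕ.∣1⇒≡1 (∣⇒∣ᵤ d)) pr)

    split-prime : Split ℓ (+ ℓ) 1 1ℤ
    split-prime = subst (λ z → Split ℓ z 1 1ℤ) (*-identityʳ (+ ℓ)) (split-times prime∤1)

    split-* : ∀ {a b i j u v} → Split ℓ a i u → Split ℓ b j v → Split ℓ (a * b) (i ℕ.+ j) (u * v)
    split-* {i = i} {j} {u} {v} (split refl hu) (split refl hv) =
      split (trans (lem ((+ ℓ) ^ i) u ((+ ℓ) ^ j) v) (cong (_* (u * v)) (sym (^-distribˡ-+-* (+ ℓ) i j))))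
        (λ d → [ hu , hv ]′ (euclid pr u v d))
      where
      open import Data.Integer.Properties using (^-distribˡ-+-*)
      lem : ∀ x u y v → x * u * (y * v) ≡ x * y * (u * v)
      lem = solve-∀

    split-unique : ∀ {a i j u v} → Split ℓ a i u → Split ℓ a j v → i ≡ j × u ≡ v
    split-unique {i = i} {j} {u} {v} (split refl hu) (split e hv) = go i j e
      where
      go : ∀ i j → (+ ℓ) ^ i * u ≡ (+ ℓ) ^ j * v → i ≡ j × u ≡ v
      go zero zero e = refl , trans (sym (*-identityˡ u)) (trans e (*-identityˡ v))
      go zero (suc j) e = ⊥-elim (hu (subst (+ ℓ ∣_) (trans (sym e) (*-identityˡ u)) (∣m⇒∣m*n v (∣m⇒∣m*n {m = + ℓ} ((+ ℓ) ^ j) ∣-refl))))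
      go (suc i) zero e = ⊥-elim (hv (subst (+ ℓ ∣_) (trans e (*-identityˡ v)) (∣m⇒∣m*n u (∣m⇒∣m*n {m = + ℓ} ((+ ℓ) ^ i) ∣-refl))))
      go (suc i) (suc j) e with go i j (*-cancelˡ-≡ (+ ℓ) _ _ (trans (sym (*-assoc (+ ℓ) ((+ ℓ) ^ i) u)) (trans e (*-assoc (+ ℓ) ((+ ℓ) ^ j) v))))
      ... | refl , e' = refl , e'

  -- Fuel `abs a` suffices for nonzero `a`, since every division by `ℓ ≥ 2` lowers the absolute
  -- value. For `a = 0` the result is a default.
  strip : ℕ → ℕ → ℤ → ℕ × ℤ
  strip ℓ zero a = 0 , a
  strip ℓ (suc fuel) a with + ℓ ∣? a
  ... | yes (divides q _) = suc (proj₁ (strip ℓ fuel q)) , proj₂ (strip ℓ fuel q)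
  ... | no _ = 0 , a

  ord : ℕ → ℤ → ℕ
  ord ℓ a = proj₁ (strip ℓ (abs a) a)

  unitPart : ℕ → ℤ → ℤ
  unitPart ℓ a = proj₂ (strip ℓ (abs a) a)

  split-strip : ∀ {ℓ} → Prime ℓ → ∀ fuel a → a ≢ 0ℤ → abs a ℕ.≤ fuel → Split ℓ a (proj₁ (strip ℓ fuel a)) (proj₂ (strip ℓ fuel a))
  split-strip pr zero a h l = ⊥-elim (h (∣i∣≡0⇒i≡0 (ℕ.n≤0⇒n≡0 l)))
  split-strip {ℓ} pr (suc fuel) a h l with + ℓ ∣? a
  ... | no ¬d = split-unit ¬d
  ... | yes (divides q e) = split
          (trans e (trans (cong (_* + ℓ) (factors rec)) (lem ((+ ℓ) ^ proj₁ (strip ℓ fuel q)) (proj₂ (strip ℓ fuel q)) (+ ℓ))))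
          (isUnit rec)
    where
    q≢0 : q ≢ 0ℤ
    q≢0 z = h (trans e (trans (cong (_* + ℓ) z) (*-zeroˡ (+ ℓ))))
    open ℕ.≤-Reasoning
    shrink : abs q ℕ.< abs a
    shrink = begin-strict
      abs q            <⟨ ℕ.m<m*n (abs q) ℓ {{ℕ.≢-nonZero (q≢0 ∘ ∣i∣≡0⇒i≡0)}} (ℕ.nonTrivial⇒n>1 ℓ {{prime⇒nonTrivial pr}}) ⟩
      abs q ℕ.* ℓ      ≡⟨ abs-* q (+ ℓ) ⟨
      abs (q * + ℓ)    ≡⟨ cong abs e ⟨
      abs a            ∎
    rec = split-strip pr fuel q q≢0 (ℕ.≤-pred (ℕ.<-≤-trans shrink l))
    lem : ∀ x y z → x * y * z ≡ z * x * y
    lem = solve-∀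

  split-ord : ∀ {ℓ} → Prime ℓ → ∀ {a} → a ≢ 0ℤ → Split ℓ a (ord ℓ a) (unitPart ℓ a)
  split-ord pr {a} h = split-strip pr (abs a) a h ℕ.≤-refl

  Split⇒≢0 : ∀ {ℓ a i u} → Prime ℓ → Split ℓ a i u → a ≢ 0ℤ
  Split⇒≢0 {ℓ} {i = i} {u} pr (split refl h) e =
    [ pow i , (λ z → h (subst (+ ℓ ∣_) (sym z) (divides 0ℤ refl))) ]′ (i*j≡0⇒i≡0∨j≡0 ((+ ℓ) ^ i) e)
    where
    pow : ∀ i → (+ ℓ) ^ i ≢ 0ℤ
    pow zero ()
    pow (suc i) e = [ (λ z → ¬prime[0] (subst Prime (cong abs z) pr)) , pow i ]′ (i*j≡0⇒i≡0∨j≡0 (+ ℓ) e)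
      where open import Data.Nat.Primality using () renaming (¬prime[0] to ¬prime[0])

  -- Square classes of ℚ_ℓ (ℓ odd): parity of the valuation, and the Legendre symbol of the unit part.
  cls : ℕ → ℤ → Parity × Parity
  cls ℓ a = parity (ord ℓ a) , res ℓ (unitPart ℓ a)

  OddPrime′ : ℕ → Set
  OddPrime′ ℓ = Prime ℓ × parity ℓ ≡ 1ℙ

  cls-split : ∀ {ℓ} → Prime ℓ → ∀ {a i u} → Split ℓ a i u → cls ℓ a ≡ (parity i , res ℓ u)
  cls-split {ℓ} pr s with split-unique pr (split-ord pr (Split⇒≢0 pr s)) s
  ... | e , e' = cong₂ (λ i u → parity i , res ℓ u) e e'

  res-*′ : ∀ {ℓ} → OddPrime′ ℓ → ∀ a b → ¬ + ℓ ∣ a → ¬ + ℓ ∣ b → res ℓ (a * b) ≡ res ℓ a ⊕ res ℓ b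
  res-*′ {suc m} (pr , odd) = OddPrime.res-* pr odd

  res-square′ : ∀ {ℓ} → OddPrime′ ℓ → ∀ a x → ¬ + ℓ ∣ a → + ℓ ∣ x * x - a → res ℓ a ≡ 0ℙ
  res-square′ {suc m} (pr , odd) = OddPrime.res-square pr odd

  res-1 : ∀ {ℓ} → OddPrime′ ℓ → res ℓ 1ℤ ≡ 0ℙ
  res-1 (pr , odd) = res-square′ (pr , odd) 1ℤ 1ℤ (prime∤1 pr) (divides 0ℤ refl)

  infixl 6 _⊞_ _⊞₂_
  _⊞_ : Parity × Parity → Parity × Parity → Parity × Parity
  (i , s) ⊞ (j , t) = i ⊕ j , s ⊕ t

  cls-* : ∀ {ℓ} → OddPrime′ ℓ → ∀ {a b} → a ≢ 0ℤ → b ≢ 0ℤ → cls ℓ (a * b) ≡ cls ℓ a ⊞ cls ℓ b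
  cls-* {ℓ} (pr , odd) {a} {b} ha hb = trans (cls-split pr (split-* pr sa sb))
    (cong₂ _,_ (ℙ.+-homo-+ (ord ℓ a) (ord ℓ b)) (res-*′ (pr , odd) (unitPart ℓ a) (unitPart ℓ b) (isUnit sa) (isUnit sb)))
    where
    sa = split-ord pr ha
    sb = split-ord pr hb

  -- The tame Hilbert symbol; ε is the class of -1.
  hilb : Parity → Parity × Parity → Parity × Parity → Parity
  hilb ε (i , s) (j , t) = i ⊗ j ⊗ ε ⊕ (i ⊗ t ⊕ j ⊗ s)

  h : ℕ → ℤ → ℤ → Parity
  h ℓ a b = hilb (res ℓ -1ℤ) (cls ℓ a) (cls ℓ b)

  hilb-⊞ˡ : ∀ ε x y z → hilb ε (x ⊞ y) z ≡ hilb ε x z ⊕ hilb ε y z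
  hilb-⊞ˡ ε (i , s) (j , t) (k , u) = solve 7 (λ ε i s j t k u → (i :+ j) :* k :* ε :+ ((i :+ j) :* u :+ k :* (s :+ t)) :=
    (i :* k :* ε :+ (i :* u :+ k :* s)) :+ (j :* k :* ε :+ (j :* u :+ k :* t))) refl ε i s j t k u
    where open ℙ-Solver using (solve; _:=_; _:+_; _:*_)

  hilb-sym : ∀ ε x y → hilb ε x y ≡ hilb ε y x
  hilb-sym ε (i , s) (j , t) = solve 5 (λ ε i s j t → i :* j :* ε :+ (i :* t :+ j :* s) := j :* i :* ε :+ (j :* s :+ i :* t)) refl ε i s j t
    where open ℙ-Solver using (solve; _:=_; _:+_; _:*_)

  h-sym : ∀ ℓ a b → h ℓ a b ≡ h ℓ b a
  h-sym ℓ a b = hilb-sym (res ℓ -1ℤ) (cls ℓ a) (cls ℓ b)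

  h-*ˡ : ∀ {ℓ} → OddPrime′ ℓ → ∀ {a b} c → a ≢ 0ℤ → b ≢ 0ℤ → h ℓ (a * b) c ≡ h ℓ a c ⊕ h ℓ b c
  h-*ˡ {ℓ} op {a} {b} c ha hb = trans (cong (λ z → hilb (res ℓ -1ℤ) z (cls ℓ c)) (cls-* op ha hb)) (hilb-⊞ˡ (res ℓ -1ℤ) (cls ℓ a) (cls ℓ b) (cls ℓ c))

  h-*ʳ : ∀ {ℓ} → OddPrime′ ℓ → ∀ c {a b} → a ≢ 0ℤ → b ≢ 0ℤ → h ℓ c (a * b) ≡ h ℓ c a ⊕ h ℓ c b
  h-*ʳ {ℓ} op c {a} {b} ha hb = trans (h-sym ℓ c (a * b)) (trans (h-*ˡ op c ha hb) (cong₂ _⊕_ (h-sym ℓ a c) (h-sym ℓ b c)))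

  h-units : ∀ {ℓ} → Prime ℓ → ∀ {a b} → ¬ + ℓ ∣ a → ¬ + ℓ ∣ b → h ℓ a b ≡ 0ℙ
  h-units {ℓ} pr ha hb = cong₂ (hilb (res ℓ -1ℤ)) (cls-split pr (split-unit ha)) (cls-split pr (split-unit hb))

  -- c = t² - a is a norm from ℚ(√a).
  h-norm : ∀ {ℓ} → OddPrime′ ℓ → ∀ {a} t → ¬ + ℓ * + ℓ ∣ a → t * t - a ≢ 0ℤ → h ℓ a (t * t - a) ≡ 0ℙ
  h-norm {ℓ} (pr , odd) {a} t sqf c≢0 with + ℓ ∣? a
  ... | no ℓ∤a = go (+ ℓ ∣? (t * t - a))
    where
    go : Dec (+ ℓ ∣ t * t - a) → h ℓ a (t * t - a) ≡ 0ℙ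
    go (no ℓ∤c) = h-units pr ℓ∤a ℓ∤c
    go (yes ℓ∣c) = trans (cong (λ z → hilb (res ℓ -1ℤ) z (cls ℓ (t * t - a)))
        (trans (cls-split pr (split-unit ℓ∤a)) (cong (0ℙ ,_) (res-square′ (pr , odd) a t ℓ∤a ℓ∣c))))
      (lem (cls ℓ (t * t - a)))
      where
      lem : ∀ x → hilb (res ℓ -1ℤ) (0ℙ , 0ℙ) x ≡ 0ℙ
      lem (j , u) = ℙ.*-zeroʳ j
  ... | yes (divides a' refl) = go (+ ℓ ∣? t)
    where
    ℓ∤a' : ¬ + ℓ ∣ a'
    ℓ∤a' (divides b refl) = sqf (divides b (*-assoc b (+ ℓ) (+ ℓ)))
    cls-a : cls ℓ (a' * + ℓ) ≡ (1ℙ , res ℓ a')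
    cls-a = cls-split pr (subst (λ z → Split ℓ z 1 a') (*-comm (+ ℓ) a') (split-times ℓ∤a'))
    ε = res ℓ -1ℤ
    go : Dec (+ ℓ ∣ t) → h ℓ (a' * + ℓ) (t * t - a' * + ℓ) ≡ 0ℙ
    go (no ℓ∤t) = trans (cong₂ (hilb ε) cls-a cls-c) (lem (res ℓ a'))
      where
      lem : ∀ s → hilb ε (1ℙ , s) (0ℙ , 0ℙ) ≡ 0ℙ
      lem s = refl
      c = t * t - a' * + ℓ
      lem₂ : ∀ t a → t * t - (t * t - a) ≡ a
      lem₂ = solve-∀
      lem₃ : ∀ t a → (t * t - a) + a ≡ t * t
      lem₃ = solve-∀
      ℓ∣a : + ℓ ∣ a' * + ℓ
      ℓ∣a = divides a' refl
      ℓ∤c : ¬ + ℓ ∣ c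
      ℓ∤c d = [ ℓ∤t , ℓ∤t ]′ (euclid pr t t (subst (+ ℓ ∣_) (lem₃ t (a' * + ℓ)) (∣m∣n⇒∣m+n d ℓ∣a)))
      cls-c : cls ℓ c ≡ (0ℙ , 0ℙ)
      cls-c = trans (cls-split pr (split-unit ℓ∤c)) (cong (0ℙ ,_) (res-square′ (pr , odd) c t ℓ∤c (subst (+ ℓ ∣_) (sym (lem₂ t (a' * + ℓ))) ℓ∣a)))
    -- Here `t² - a` is `ℓ` times a unit congruent to `-a'`, so it has the class of `-a`. That
    -- `(a, -a)` is trivial is checked on the four combinations of signs.
    go (yes (divides t' refl)) = trans (cong₂ (hilb ε) cls-a cls-c) (lem ε (res ℓ a'))
      where
      lem : ∀ ε s → hilb ε (1ℙ , s) (1ℙ , ε ⊕ s) ≡ 0ℙ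
      lem 0ℙ 0ℙ = refl
      lem 0ℙ 1ℙ = refl
      lem 1ℙ 0ℙ = refl
      lem 1ℙ 1ℙ = refl
      c' = t' * t' * + ℓ - a'
      lem₂ : ∀ t a l → t * l * (t * l) - a * l ≡ l * (t * t * l - a)
      lem₂ = solve-∀
      lem₃ : ∀ t a l → (t * t * l - a) - -1ℤ * a ≡ t * t * l
      lem₃ = solve-∀
      ℓ∤-1 : ¬ + ℓ ∣ -1ℤ
      ℓ∤-1 d = prime∤1 pr (∣ᵤ⇒∣ (∣⇒∣ᵤ d))
      c'≅ : c' ≅ -1ℤ * a' ⟦ ℓ ⟧
      c'≅ = mk≅ (divides (t' * t') (lem₃ t' a' (+ ℓ)))
      ℓ∤c' : ¬ + ℓ ∣ c'
      ℓ∤c' d = [ ℓ∤-1 , ℓ∤a' ]′ (euclid pr -1ℤ a' (≅-∣ (≅-sym c'≅) d))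
      cls-c : cls ℓ (t' * + ℓ * (t' * + ℓ) - a' * + ℓ) ≡ (1ℙ , ε ⊕ res ℓ a')
      cls-c = trans (cls-split pr (subst (λ z → Split ℓ z 1 c') (sym (lem₂ t' a' (+ ℓ))) (split-times ℓ∤c')))
        (cong (1ℙ ,_) (trans (res-cong c'≅) (res-*′ (pr , odd) -1ℤ a' ℓ∤-1 ℓ∤a')))

  -- For odd u with residue r mod 8: ((-1)^((u-1)/2), (-1)^((u²-1)/8)) in exponent form.
  ρ₈ : ℕ → Parity × Parity
  ρ₈ 3 = 1ℙ , 1ℙ
  ρ₈ 5 = 0ℙ , 1ℙ
  ρ₈ 7 = 1ℙ , 0ℙ
  ρ₈ _ = 0ℙ , 0ℙ

  cls₂ : ℤ → Parity × Parity × Parity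
  cls₂ a = parity (ord 2 a) , ρ₈ (unitPart 2 a %ℕ 8)

  _⊞₂_ : Parity × Parity × Parity → Parity × Parity × Parity → Parity × Parity × Parity
  (i , x) ⊞₂ (j , y) = i ⊕ j , x ⊞ y

  hilb₂ : Parity × Parity × Parity → Parity × Parity × Parity → Parity
  hilb₂ (i , e , w) (j , f , x) = e ⊗ f ⊕ (i ⊗ x ⊕ j ⊗ w)

  h₂ : ℤ → ℤ → Parity
  h₂ a b = hilb₂ (cls₂ a) (cls₂ b)

  cls₂-split : ∀ {a i u} → Split 2 a i u → cls₂ a ≡ (parity i , ρ₈ (u %ℕ 8))
  cls₂-split s with split-unique prime[2] (split-ord prime[2] (Split⇒≢0 prime[2] s)) s
  ... | e , e' = cong₂ (λ i u → parity i , ρ₈ (u %ℕ 8)) e e'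

  data Odd₈ : ℕ → Set where
    r1 : Odd₈ 1
    r3 : Odd₈ 3
    r5 : Odd₈ 5
    r7 : Odd₈ 7

  odd₈ : ∀ u → ¬ + 2 ∣ u → Odd₈ (u %ℕ 8)
  odd₈ u h = go (u %ℕ 8) (n%ℕd<d u 8) (%ℕ-≅ u 8)
    where
    open import Data.Integer.DivMod using (n%ℕd<d)
    open import Data.Integer.Divisibility.Signed using (∣-trans)
    even : ∀ k → u ≅ + (2 ℕ.* k) ⟦ 8 ⟧ → ⊥
    even k (mk≅ d) = h (≅-∣ {2} {u} {+ (2 ℕ.* k)} (mk≅ (∣-trans (divides (+ 4) refl) d)) (∣ᵤ⇒∣ (ℕ.∣m⇒∣m*n k ℕ.∣-refl)))
    go : ∀ r → r ℕ.< 8 → u ≅ + r ⟦ 8 ⟧ → Odd₈ r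
    go 0 _ e = ⊥-elim (even 0 e)
    go 1 _ e = r1
    go 2 _ e = ⊥-elim (even 1 e)
    go 3 _ e = r3
    go 4 _ e = ⊥-elim (even 2 e)
    go 5 _ e = r5
    go 6 _ e = ⊥-elim (even 3 e)
    go 7 _ e = r7
    go (suc (suc (suc (suc (suc (suc (suc (suc r)))))))) (ℕ.s≤s (ℕ.s≤s (ℕ.s≤s (ℕ.s≤s (ℕ.s≤s (ℕ.s≤s (ℕ.s≤s (ℕ.s≤s ())))))))) e

  ρ₈-* : ∀ u v → ¬ + 2 ∣ u → ¬ + 2 ∣ v → ρ₈ ((u * v) %ℕ 8) ≡ ρ₈ (u %ℕ 8) ⊞ ρ₈ (v %ℕ 8)
  ρ₈-* u v hu hv = trans (cong ρ₈ (≅⇒%ℕ (≅-trans (≅-* (%ℕ-≅ u 8) (%ℕ-≅ v 8)) (≅-reflexive (sym (pos-* (u %ℕ 8) (v %ℕ 8)))))))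
    (table (odd₈ u hu) (odd₈ v hv))
    where
    open import Data.Integer.Properties using (pos-*)
    table : ∀ {r s} → Odd₈ r → Odd₈ s → ρ₈ ((r ℕ.* s) ℕ.% 8) ≡ ρ₈ r ⊞ ρ₈ s
    table r1 r1 = refl
    table r1 r3 = refl
    table r1 r5 = refl
    table r1 r7 = refl
    table r3 r1 = refl
    table r3 r3 = refl
    table r3 r5 = refl
    table r3 r7 = refl
    table r5 r1 = refl
    table r5 r3 = refl
    table r5 r5 = refl
    table r5 r7 = refl
    table r7 r1 = refl
    table r7 r3 = refl
    table r7 r5 = refl
    table r7 r7 = refl

  cls₂-* : ∀ {a b} → a ≢ 0ℤ → b ≢ 0ℤ → cls₂ (a * b) ≡ cls₂ a ⊞₂ cls₂ b
  cls₂-* {a} {b} ha hb = trans (cls₂-split (split-* prime[2] sa sb))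
    (cong₂ _,_ (ℙ.+-homo-+ (ord 2 a) (ord 2 b)) (ρ₈-* (unitPart 2 a) (unitPart 2 b) (isUnit sa) (isUnit sb)))
    where
    sa = split-ord prime[2] ha
    sb = split-ord prime[2] hb

  hilb₂-⊞ˡ : ∀ x y z → hilb₂ (x ⊞₂ y) z ≡ hilb₂ x z ⊕ hilb₂ y z
  hilb₂-⊞ˡ (i , e , w) (j , f , x) (k , g , y) = solve 9 (λ i e w j f x k g y → (e :+ f) :* g :+ ((i :+ j) :* y :+ k :* (w :+ x)) :=
    (e :* g :+ (i :* y :+ k :* w)) :+ (f :* g :+ (j :* y :+ k :* x))) refl i e w j f x k g y
    where open ℙ-Solver using (solve; _:=_; _:+_; _:*_)

  hilb₂-sym : ∀ x y → hilb₂ x y ≡ hilb₂ y x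
  hilb₂-sym (i , e , w) (j , f , x) = solve 6 (λ i e w j f x → e :* f :+ (i :* x :+ j :* w) := f :* e :+ (j :* w :+ i :* x)) refl i e w j f x
    where open ℙ-Solver using (solve; _:=_; _:+_; _:*_)

  h₂-sym : ∀ a b → h₂ a b ≡ h₂ b a
  h₂-sym a b = hilb₂-sym (cls₂ a) (cls₂ b)

  h₂-*ˡ : ∀ {a b} c → a ≢ 0ℤ → b ≢ 0ℤ → h₂ (a * b) c ≡ h₂ a c ⊕ h₂ b c
  h₂-*ˡ {a} {b} c ha hb = trans (cong (λ z → hilb₂ z (cls₂ c)) (cls₂-* ha hb)) (hilb₂-⊞ˡ (cls₂ a) (cls₂ b) (cls₂ c))

  -- Both components in the shape in which the supplementary laws deliver the residue symbols of
  -- `-1` and `2`. Each side has period 8, since four more summands of alternating parity add zero.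
  ρ₈-half : ∀ n → parity n ≡ 1ℙ → ρ₈ (n ℕ.% 8) ≡ (parity ⌊ n /2⌋ , sum {⌊ n /2⌋} (λ k → parity (suc (toℕ k))))
  ρ₈-half 1 e = refl
  ρ₈-half 3 e = refl
  ρ₈-half 5 e = refl
  ρ₈-half 7 e = refl
  ρ₈-half (suc (suc (suc (suc (suc (suc (suc (suc n)))))))) e =
    trans (cong ρ₈ (trans (cong (ℕ._% 8) (ℕ.+-comm 8 n)) (ℕ.[m+n]%n≡m%n n 8)))
      (trans (ρ₈-half n e) (cong (parity ⌊ n /2⌋ ,_) (sym (ℙ.⁻¹-involutive _))))

  sumOver : List ℕ → (ℕ → Parity) → Parity
  sumOver S f = foldr (λ ℓ z → f ℓ ⊕ z) 0ℙ S

  -- The sum over the places 2 and `S`. The product formula below takes its second argument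
  -- positive, so that the real place contributes zero.
  hsum : List ℕ → ℤ → ℤ → Parity
  hsum S a b = h₂ a b ⊕ sumOver S (λ ℓ → h ℓ a b)

  sumOver-⊕ : ∀ S f g → sumOver S (λ ℓ → f ℓ ⊕ g ℓ) ≡ sumOver S f ⊕ sumOver S g
  sumOver-⊕ [] f g = refl
  sumOver-⊕ (ℓ ∷ S) f g rewrite sumOver-⊕ S f g = solve 4 (λ a b c d → (a :+ b) :+ (c :+ d) := (a :+ c) :+ (b :+ d)) refl (f ℓ) (g ℓ) (sumOver S f) (sumOver S g)
    where open ℙ-Solver using (solve; _:=_; _:+_; _:*_)

  sumOver-cong : ∀ {S f g} → (∀ {ℓ} → ℓ ∈ S → f ℓ ≡ g ℓ) → sumOver S f ≡ sumOver S g
  sumOver-cong {[]} e = refl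
  sumOver-cong {ℓ ∷ S} e = cong₂ _⊕_ (e (here refl)) (sumOver-cong {S} (e ∘ there))

  sumOver-zero : ∀ S {f} → (∀ {ℓ} → ℓ ∈ S → f ℓ ≡ 0ℙ) → sumOver S f ≡ 0ℙ
  sumOver-zero [] e = refl
  sumOver-zero (ℓ ∷ S) e = cong₂ _⊕_ (e (here refl)) (sumOver-zero S (e ∘ there))

  sumOver-single : ∀ {S f ℓ} → Unique S → ℓ ∈ S → (∀ {μ} → μ ∈ S → μ ≢ ℓ → f μ ≡ 0ℙ) → sumOver S f ≡ f ℓ
  sumOver-single {ℓ ∷ S} {f} (n ∷ u) (here refl) e =
    trans (cong (f ℓ ⊕_) (sumOver-zero S (λ m → e (there m) (λ { refl → All.lookup n m refl })))) (ℙ.+-identityʳ _)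
  sumOver-single {μ ∷ S} {f} (n ∷ u) (there m) e =
    cong₂ _⊕_ (e (here refl) (λ { refl → All.lookup n m refl })) (sumOver-single u m (e ∘ there))

  sumOver-two : ∀ {S f ℓ ℓ'} → Unique S → ℓ ≢ ℓ' → ℓ ∈ S → ℓ' ∈ S → (∀ {μ} → μ ∈ S → μ ≢ ℓ → μ ≢ ℓ' → f μ ≡ 0ℙ) →
    sumOver S f ≡ f ℓ ⊕ f ℓ'
  sumOver-two {f = f} (n ∷ u) ne (here refl) (here refl) e = ⊥-elim (ne refl)
  sumOver-two {ℓ ∷ S} {f} (n ∷ u) ne (here refl) (there m) e =
    cong (f ℓ ⊕_) (sumOver-single u m (λ m' ne' → e (there m') (λ { refl → All.lookup n m' refl }) ne'))
  sumOver-two {ℓ' ∷ S} {f} {ℓ} (n ∷ u) ne (there m) (here refl) e =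
    trans (cong (f ℓ' ⊕_) (sumOver-single u m (λ m' ne' → e (there m') ne' (λ { refl → All.lookup n m' refl })))) (ℙ.+-comm (f ℓ') (f ℓ))
  sumOver-two {μ ∷ S} {f} (n ∷ u) ne (there m) (there m') e =
    cong₂ _⊕_ (e (here refl) (λ { refl → All.lookup n m refl }) (λ { refl → All.lookup n m' refl })) (sumOver-two u ne m m' (e ∘ there))

  data Generator (S : List ℕ) : ℤ → Set where
    two   : Generator S (+ 2)
    prime : ∀ {ℓ} → ℓ ∈ S → Generator S (+ ℓ)

  -- Words in the generators: bilinearity of `hsum` then reduces the product formula to pairs of
  -- generators by induction on the word.
  data PosUnit (S : List ℕ) : ℤ → Set where
    one : PosUnit S 1ℤ
    mul : ∀ {g a} → Generator S g → PosUnit S a → PosUnit S (g * a)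

  data SUnit (S : List ℕ) : ℤ → Set where
    pos : ∀ {a} → PosUnit S a → SUnit S a
    neg : ∀ {a} → PosUnit S a → SUnit S (-1ℤ * a)

  module ProductFormula {S : List ℕ} (odds : All OddPrime′ S) (uniq : Unique S) where
    op : ∀ {ℓ} → ℓ ∈ S → OddPrime′ ℓ
    op = All.lookup odds

    prime≢0 : ∀ {ℓ} → Prime ℓ → + ℓ ≢ 0ℤ
    prime≢0 pr e = Split⇒≢0 pr (split-prime pr) e

    generator≢0 : ∀ {g} → Generator S g → g ≢ 0ℤ
    generator≢0 two = λ ()
    generator≢0 (prime m) = prime≢0 (proj₁ (op m))

    PosUnit≢0 : ∀ {a} → PosUnit S a → a ≢ 0ℤ
    PosUnit≢0 one = λ ()
    PosUnit≢0 (mul g a) = *-≢0 (generator≢0 g) (PosUnit≢0 a)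

    hsum-sym : ∀ a b → hsum S a b ≡ hsum S b a
    hsum-sym a b = cong₂ _⊕_ (h₂-sym a b) (sumOver-cong {S} (λ {ℓ} _ → h-sym ℓ a b))

    hsum-*ˡ : ∀ {a b} c → a ≢ 0ℤ → b ≢ 0ℤ → hsum S (a * b) c ≡ hsum S a c ⊕ hsum S b c
    hsum-*ˡ {a} {b} c ha hb =
      trans (cong₂ _⊕_ (h₂-*ˡ c ha hb) (trans (sumOver-cong {S} (λ m → h-*ˡ (op m) c ha hb)) (sumOver-⊕ S (λ ℓ → h ℓ a c) (λ ℓ → h ℓ b c))))
        (solve 4 (λ a b c d → (a :+ b) :+ (c :+ d) := (a :+ c) :+ (b :+ d)) refl (h₂ a c) (h₂ b c) (sumOver S (λ ℓ → h ℓ a c)) (sumOver S (λ ℓ → h ℓ b c)))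
      where open ℙ-Solver using (solve; _:=_; _:+_; _:*_)

    hsum-*ʳ : ∀ c {a b} → a ≢ 0ℤ → b ≢ 0ℤ → hsum S c (a * b) ≡ hsum S c a ⊕ hsum S c b
    hsum-*ʳ c {a} {b} ha hb = trans (hsum-sym c (a * b)) (trans (hsum-*ˡ c ha hb) (cong₂ _⊕_ (hsum-sym a c) (hsum-sym b c)))

    hsum-1ˡ : ∀ b → hsum S 1ℤ b ≡ 0ℙ
    hsum-1ˡ b = lem (hsum S 1ℤ b) (hsum-*ˡ {1ℤ} {1ℤ} b (λ ()) (λ ()))
      where
      lem : ∀ x → x ≡ x ⊕ x → x ≡ 0ℙ
      lem x e = trans e (ℙ.p+p≡0ℙ x)

    private
      distinct-primes : ∀ {ℓ μ} → Prime ℓ → Prime μ → μ ≢ ℓ → ¬ + μ ∣ + ℓ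
      distinct-primes pℓ pμ ne d with prime⇒irreducible pℓ (∣⇒∣ᵤ d)
      ... | inj₁ refl = ¬prime[1] pμ
      ... | inj₂ e = ne e

      odd∤2 : ∀ {ℓ} → OddPrime′ ℓ → ¬ + ℓ ∣ + 2
      odd∤2 (pr , odd) = distinct-primes prime[2] pr (λ { refl → case odd })
        where
        case : parity 2 ≢ 1ℙ
        case ()

      2∤odd : ∀ {ℓ} → OddPrime′ ℓ → ¬ + 2 ∣ + ℓ
      2∤odd (pr , odd) = distinct-primes pr prime[2] (λ { refl → case odd })
        where
        case : parity 2 ≢ 1ℙ
        case ()

      cls₂-prime : ∀ {ℓ} → OddPrime′ ℓ → cls₂ (+ ℓ) ≡ (0ℙ , parity ⌊ ℓ /2⌋ , sum {⌊ ℓ /2⌋} (λ k → parity (suc (toℕ k))))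
      cls₂-prime {ℓ} o = trans (cls₂-split (split-unit (2∤odd o))) (cong (0ℙ ,_) (ρ₈-half ℓ (proj₂ o)))

      cls₂-2 : cls₂ (+ 2) ≡ (1ℙ , 0ℙ , 0ℙ)
      cls₂-2 = cls₂-split (split-prime prime[2])

      cls-self : ∀ {ℓ} → OddPrime′ ℓ → cls ℓ (+ ℓ) ≡ (1ℙ , 0ℙ)
      cls-self (pr , odd) = trans (cls-split pr (split-prime pr)) (cong (1ℙ ,_) (res-1 (pr , odd)))

      cls-unit : ∀ {ℓ} → OddPrime′ ℓ → ∀ {a} → ¬ + ℓ ∣ a → cls ℓ a ≡ (0ℙ , res ℓ a)
      cls-unit (pr , odd) h = cls-split pr (split-unit h)

      h-unit-self : ∀ {ℓ} → OddPrime′ ℓ → ∀ {a} → ¬ + ℓ ∣ a → h ℓ a (+ ℓ) ≡ res ℓ a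
      h-unit-self {ℓ} o {a} h = cong₂ (hilb (res ℓ -1ℤ)) (cls-unit o h) (cls-self o)

      unit-prime : ∀ {ℓ a} → ℓ ∈ S → (∀ {μ} → μ ∈ S → ¬ + μ ∣ a) → sumOver S (λ μ → h μ a (+ ℓ)) ≡ res ℓ a
      unit-prime {ℓ} {a} m units = trans (sumOver-single {f = λ μ → h μ a (+ ℓ)} uniq m
        (λ m' ne → h-units (proj₁ (op m')) (units m') (distinct-primes (proj₁ (op m)) (proj₁ (op m')) ne)))
        (h-unit-self (op m) (units m))

      ∤-1 : ∀ {μ} → μ ∈ S → ¬ + μ ∣ -1ℤ
      ∤-1 m d = prime∤1 (proj₁ (op m)) (∣ᵤ⇒∣ (∣⇒∣ᵤ d))

      res-neg1′ : ∀ {ℓ} → OddPrime′ ℓ → res ℓ -1ℤ ≡ parity ⌊ ℓ /2⌋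
      res-neg1′ {suc m} (pr , odd) = Eisenstein.res-neg1 pr odd

      res-2′ : ∀ {ℓ} → OddPrime′ ℓ → res ℓ (+ 2) ≡ sum {⌊ ℓ /2⌋} (λ k → parity (suc (toℕ k)))
      res-2′ {suc m} (pr , odd) = Eisenstein.res-2 pr odd

      -- The first supplementary law: against an odd prime `ℓ` the symbols at 2 and at `ℓ` are both
      -- the parity of `(ℓ - 1)/2`.
      minus-one : ∀ {g} → Generator S g → hsum S -1ℤ g ≡ 0ℙ
      minus-one two = cong₂ _⊕_ (cong (hilb₂ (cls₂ -1ℤ)) cls₂-2) (sumOver-zero S (λ m → h-units (proj₁ (op m)) (∤-1 m) (odd∤2 (op m))))
      minus-one (prime {ℓ} m) = trans (cong₂ _⊕_
          (trans (cong (hilb₂ (cls₂ -1ℤ)) (cls₂-prime (op m))) (lem (parity ⌊ ℓ /2⌋) (sum {⌊ ℓ /2⌋} (λ k → parity (suc (toℕ k))))))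
          (trans (unit-prime m ∤-1) (res-neg1′ (op m))))
        (ℙ.p+p≡0ℙ (parity ⌊ ℓ /2⌋))
        where
        lem : ∀ x y → 1ℙ ⊗ x ⊕ (0ℙ ⊗ y ⊕ 0ℙ ⊗ 0ℙ) ≡ x
        lem x y = ℙ.+-identityʳ x

      two-prime : ∀ {ℓ} → ℓ ∈ S → hsum S (+ 2) (+ ℓ) ≡ 0ℙ
      two-prime {ℓ} m = trans (cong₂ _⊕_
          (trans (cong₂ hilb₂ cls₂-2 (cls₂-prime (op m))) (lem (parity ⌊ ℓ /2⌋) τ))
          (trans (unit-prime m (odd∤2 ∘ op)) (res-2′ (op m))))
        (ℙ.p+p≡0ℙ τ)
        where
        τ = sum {⌊ ℓ /2⌋} (λ k → parity (suc (toℕ k)))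
        lem : ∀ x y → 0ℙ ⊗ x ⊕ (1ℙ ⊗ y ⊕ 0ℙ ⊗ 0ℙ) ≡ y
        lem x y = ℙ.+-identityʳ y

      τ : ℕ → Parity
      τ ℓ = sum {⌊ ℓ /2⌋} (λ k → parity (suc (toℕ k)))

      -- Mixed pairs are the second supplementary law. For `(ℓ, ℓ)` the symbols at 2 and at `ℓ` are
      -- both the parity of `(ℓ - 1)/2`. For distinct odd primes the symbol at 2 is the product of
      -- the two parities, which reciprocity equates with the sum of the other two symbols.
      pair : ∀ {g g'} → Generator S g → Generator S g' → hsum S g g' ≡ 0ℙ
      pair two two = cong₂ _⊕_ (cong₂ hilb₂ cls₂-2 cls₂-2) (sumOver-zero S (λ m → h-units (proj₁ (op m)) (odd∤2 (op m)) (odd∤2 (op m))))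
      pair two (prime m) = two-prime m
      pair (prime {ℓ} m) two = trans (hsum-sym (+ ℓ) (+ 2)) (two-prime m)
      pair (prime {ℓ} m) (prime {ℓ'} m') with ℓ ℕ.≟ ℓ'
      ... | yes refl = trans (cong₂ _⊕_
            (trans (cong₂ hilb₂ (cls₂-prime (op m)) (cls₂-prime (op m))) (lem (parity ⌊ ℓ /2⌋) (τ ℓ)))
            (trans (sumOver-single {f = λ μ → h μ (+ ℓ) (+ ℓ)} uniq m (λ m' ne → let d = distinct-primes (proj₁ (op m)) (proj₁ (op m')) ne in h-units (proj₁ (op m')) d d))
              (trans (cong₂ (hilb (res ℓ -1ℤ)) (cls-self (op m)) (cls-self (op m))) (trans (ℙ.+-identityʳ _) (res-neg1′ (op m))))))
          (ℙ.p+p≡0ℙ (parity ⌊ ℓ /2⌋))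
        where
        lem : ∀ x y → x ⊗ x ⊕ (0ℙ ⊗ y ⊕ 0ℙ ⊗ y) ≡ x
        lem x y = trans (ℙ.+-identityʳ (x ⊗ x)) (ℙ.*-idem x)
      ... | no ne = trans (cong₂ _⊕_
            (trans (cong₂ hilb₂ (cls₂-prime (op m)) (cls₂-prime (op m'))) (lem (parity ⌊ ℓ /2⌋) (parity ⌊ ℓ' /2⌋) (τ ℓ') (τ ℓ)))
            (trans (sumOver-two {f = λ μ → h μ (+ ℓ) (+ ℓ')} uniq ne m m' (λ m'' n n' → h-units (proj₁ (op m'')) (distinct-primes (proj₁ (op m)) (proj₁ (op m'')) n) (distinct-primes (proj₁ (op m')) (proj₁ (op m'')) n')))
              (trans (cong₂ _⊕_ (trans (h-sym ℓ (+ ℓ) (+ ℓ')) (h-unit-self (op m) (distinct-primes (proj₁ (op m')) (proj₁ (op m)) ne)))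
                                (h-unit-self (op m') (distinct-primes (proj₁ (op m)) (proj₁ (op m')) (ne ∘ sym))))
                (trans (quadratic-reciprocity (proj₁ (op m)) (proj₁ (op m')) (proj₂ (op m)) (proj₂ (op m')) ne) (ℙ.*-homo-* ⌊ ℓ /2⌋ ⌊ ℓ' /2⌋)))))
          (ℙ.p+p≡0ℙ (parity ⌊ ℓ /2⌋ ⊗ parity ⌊ ℓ' /2⌋))
        where
        lem : ∀ x y z w → x ⊗ y ⊕ (0ℙ ⊗ z ⊕ 0ℙ ⊗ w) ≡ x ⊗ y
        lem x y z w = ℙ.+-identityʳ (x ⊗ y)

      gen-pos : ∀ {g b} → g ≢ 0ℤ → (∀ {g'} → Generator S g' → hsum S g g' ≡ 0ℙ) → PosUnit S b → hsum S g b ≡ 0ℙ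
      gen-pos {g} hg e one = trans (hsum-sym g 1ℤ) (hsum-1ˡ g)
      gen-pos {g} hg e (mul g' b) = trans (hsum-*ʳ g (generator≢0 g') (PosUnit≢0 b)) (cong₂ _⊕_ (e g') (gen-pos hg e b))

    pos-product-formula : ∀ {a b} → PosUnit S a → PosUnit S b → hsum S a b ≡ 0ℙ
    pos-product-formula {b = b} one u = hsum-1ˡ b
    pos-product-formula {b = b} (mul g a) u = trans (hsum-*ˡ b (generator≢0 g) (PosUnit≢0 a))
      (cong₂ _⊕_ (gen-pos (generator≢0 g) (pair g) u) (pos-product-formula a u))

    product-formula : ∀ {a b} → SUnit S a → PosUnit S b → hsum S a b ≡ 0ℙ
    product-formula (pos a) u = pos-product-formula a u
    product-formula {b = b} (neg a) u = trans (hsum-*ˡ { -1ℤ} b (λ ()) (PosUnit≢0 a))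
      (cong₂ _⊕_ (gen-pos { -1ℤ} (λ ()) minus-one u) (pos-product-formula a u))

-- Bézout coefficients and the Chinese remainder theorem over the integers.

module ChineseRemainder where
  open Congruences
  open import Data.Nat as ℕ using (ℕ)
  import Data.Nat.Properties as ℕ
  import Data.Nat.Divisibility as ℕ
  open import Data.Nat.Coprimality as Coprime using (Coprime; coprime-Bézout; coprime-divisor)
  open import Data.Nat.GCD using (module Bézout)
  open import Data.Nat.Primality using (Prime; prime⇒irreducible)
  open import Data.Integer using (+_; -_; _+_; _-_; _*_; 1ℤ) renaming (∣_∣ to abs)
  open import Data.Integer.Properties using (pos-*; pos-+)
  open import Data.Integer.Divisibility.Signed using (_∣_; divides; ∣⇒∣ᵤ; ∣ᵤ⇒∣)
  open import Data.Integer.Tactic.RingSolver using (solve-∀)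
  open import Data.Product using (∃; ∃₂; _×_; _,_)
  open import Data.Sum using (inj₁; inj₂)
  open import Data.Empty using (⊥-elim)
  open import Relation.Nullary using (¬_)
  open import Relation.Binary.PropositionalEquality

  bézoutℤ : ∀ {m n} → Coprime m n → ∃₂ λ u v → u * + m + v * + n ≡ 1ℤ
  bézoutℤ {m} {n} c with coprime-Bézout c
  ... | Bézout.+- x y e = + x , - + y ,
    trans (cong (_+ - + y * + n) (trans (sym (pos-* x m)) (trans (cong +_ (sym e)) (trans (pos-+ 1 (y ℕ.* n)) (cong (λ z → 1ℤ + z) (pos-* y n))))))
      (lem (+ y) (+ n))
    where
    lem : ∀ y n → 1ℤ + y * n + - y * n ≡ 1ℤ
    lem = solve-∀
  ... | Bézout.-+ x y e = - + x , + y ,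
    trans (cong (λ z → - + x * + m + z) (trans (sym (pos-* y n)) (trans (cong +_ (sym e)) (trans (pos-+ 1 (x ℕ.* m)) (cong (λ z → 1ℤ + z) (pos-* x m))))))
      (lem (+ x) (+ m))
    where
    lem : ∀ x m → - x * m + (1ℤ + x * m) ≡ 1ℤ
    lem = solve-∀

  crt : ∀ {m n} → Coprime m n → ∀ r s → ∃ λ t → t ≅ r ⟦ m ⟧ × t ≅ s ⟦ n ⟧
  crt {m} {n} c r s with bézoutℤ c
  ... | u , v , e = r * (v * + n) + s * (u * + m) ,
    mk≅ (divides ((s - r) * u) (trans (cong (λ z → r * (v * + n) + s * (u * + m) - z) (split-by e r)) (lem₁ r s u v (+ m) (+ n)))) ,
    mk≅ (divides ((r - s) * v) (trans (cong (λ z → r * (v * + n) + s * (u * + m) - z) (split-by e s)) (lem₂ r s u v (+ m) (+ n))))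
    where
    split-by : ∀ {w} → w ≡ 1ℤ → ∀ r → r ≡ r * w
    split-by refl = solve-∀
    lem₁ : ∀ r s u v m n → r * (v * n) + s * (u * m) - r * (u * m + v * n) ≡ (s - r) * u * m
    lem₁ = solve-∀
    lem₂ : ∀ r s u v m n → r * (v * n) + s * (u * m) - s * (u * m + v * n) ≡ (r - s) * v * n
    lem₂ = solve-∀

  coprime-*-∣ : ∀ {m n} → Coprime m n → ∀ {a} → + m ∣ a → + n ∣ a → + (m ℕ.* n) ∣ a
  coprime-*-∣ {m} {n} c {a} hm hn = ∣ᵤ⇒∣ (lem (abs a) (∣⇒∣ᵤ hm) (∣⇒∣ᵤ hn))
    where
    lem : ∀ a → m ℕ.∣ a → n ℕ.∣ a → m ℕ.* n ℕ.∣ a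
    lem a (ℕ.divides q e) hn = subst (m ℕ.* n ℕ.∣_) (trans (ℕ.*-comm m q) (sym e))
      (ℕ.*-monoʳ-∣ m (coprime-divisor {n} {m} {q} (Coprime.sym c) (subst (n ℕ.∣_) (trans e (ℕ.*-comm q m)) hn)))

  prime-coprime : ∀ {p n} → Prime p → ¬ p ℕ.∣ n → Coprime p n
  prime-coprime pr p∤n (d∣p , d∣n) with prime⇒irreducible pr d∣p
  ... | inj₁ e = e
  ... | inj₂ refl = ⊥-elim (p∤n d∣n)

-- Legendre's theorem on `x² = a y² + b z²`.

module Legendre where
  open Congruences
  open Gauss
  open Hilbert
  open ChineseRemainder
  open import Data.Nat as ℕ using (ℕ; zero; suc; parity)
  import Data.Nat.Properties as ℕ
  import Data.Nat.Divisibility as ℕ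
  import Data.Nat.ListAction as List
  open import Data.Nat.Primality using (Prime; prime⇒nonTrivial)
  open import Data.Nat.Primality.Factorisation using (factorise; PrimeFactorisation)
  open import Data.Integer using (ℤ; +_; -[1+_]; -_; _+_; _-_; _*_; _<_; 0ℤ; 1ℤ; -1ℤ; +<+) renaming (∣_∣ to abs)
  open import Data.Integer.Properties using (abs-*; *-comm; *-assoc; *-zeroˡ; *-zeroʳ; ∣i∣≡0⇒i≡0; pos-*; ∣i-j∣≤∣i∣+∣j∣; i*j≡0⇒i≡0∨j≡0)
  import Data.Integer.Properties as ℤ
  open import Data.Integer.DivMod using (_%ℕ_; n%ℕd<d)
  open import Data.Integer.Divisibility.Signed using (_∣_; _∣?_; divides; ∣-refl; ∣⇒∣ᵤ; ∣ᵤ⇒∣; ∣-trans; ∣m⇒∣-m; ∣n⇒∣m*n)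
  open import Data.Integer.Tactic.RingSolver using (solve-∀)
  open import Data.Parity using (0ℙ; 1ℙ) renaming (_+_ to infixl 6 _⊕_)
  import Data.Parity.Properties as ℙ
  open import Data.Fin using (toℕ; fromℕ<)
  open import Data.Fin.Properties using (any?; toℕ-fromℕ<)
  open import Data.List using (List; []; _∷_)
  open import Data.List.Relation.Unary.All as All using (All; []; _∷_)
  open import Data.List.Relation.Unary.Any using (here; there)
  open import Data.List.Membership.Propositional using (_∈_)
  open import Data.Product using (∃; ∃₂; _×_; _,_; proj₁; proj₂)
  open import Data.Sum using (_⊎_; inj₁; inj₂; [_,_]′)
  open import Data.Empty using (⊥-elim)
  open import Function using (_∘_)
  open import Relation.Nullary using (¬_; Dec; yes; no)
  open import Relation.Binary.Definitions using (tri<; tri≈; tri>)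
  open import Relation.Binary.PropositionalEquality

  -- Equivalent to the splitting of `(a, b)` over `ℚ` for nonzero `a`, `b`. Asking that `y` and `z`
  -- do not both vanish excludes the zero solution, because `x` vanishes with them.
  record Isotropic (a b : ℤ) : Set where
    constructor isotropic
    field
      x y z    : ℤ
      equation : x * x ≡ a * (y * y) + b * (z * z)
      nonzero  : ¬ (y ≡ 0ℤ × z ≡ 0ℤ)

  isotropic-sym : ∀ {a b} → Isotropic a b → Isotropic b a
  isotropic-sym {a} {b} (isotropic x y z e n) = isotropic x z y (trans e (ℤ.+-comm (a * (y * y)) (b * (z * z)))) (λ (p , q) → n (q , p))

  isotropic-square : ∀ {a b} s → s ≢ 0ℤ → Isotropic a b → Isotropic a (b * (s * s))
  isotropic-square {a} {b} s s≢0 (isotropic x y z e n) = isotropic (s * x) (s * y) z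
    (trans (lem₁ s x) (trans (cong (s * s *_) e) (lem₂ a b s y z)))
    (λ (p , q) → n ([ (λ s0 → ⊥-elim (s≢0 s0)) , (λ y0 → y0) ]′ (i*j≡0⇒i≡0∨j≡0 s p) , q))
    where
    lem₁ : ∀ s x → s * x * (s * x) ≡ s * s * (x * x)
    lem₁ = solve-∀
    lem₂ : ∀ a b s y z → s * s * (a * (y * y) + b * (z * z)) ≡ a * (s * y * (s * y)) + b * (s * s) * (z * z)
    lem₂ = solve-∀

  -- Multiplying x² - a y² = b' z² by the norm t² - a = b b'.
  isotropic-norm : ∀ {a b b'} t → b' ≢ 0ℤ → t * t - a ≡ b' * b → Isotropic a b' → Isotropic a b
  isotropic-norm {a} {b} {b'} t b'≢0 c (isotropic x y z e n) with z ℤ.≟ 0ℤ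
  ... | yes refl = isotropic x y 0ℤ (trans e (cong (λ z → a * (y * y) + z) (trans (*-zeroʳ b') (sym (*-zeroʳ b))))) n
  ... | no z≢0 = isotropic (x * t + a * y) (x + t * y) (b' * z)
    (trans (lem₁ x t a y) (trans (cong₂ (λ u v → a * ((x + t * y) * (x + t * y)) + u * v) norm c) (lem₂ a b b' t x y z)))
    (λ (_ , q) → [ b'≢0 , z≢0 ]′ (i*j≡0⇒i≡0∨j≡0 b' q))
    where
    lem₁ : ∀ x t a y → (x * t + a * y) * (x * t + a * y) ≡ a * ((x + t * y) * (x + t * y)) + (x * x - a * (y * y)) * (t * t - a)
    lem₁ = solve-∀
    lem₂ : ∀ a b b' t x y z → a * ((x + t * y) * (x + t * y)) + b' * (z * z) * (b' * b) ≡ a * ((x + t * y) * (x + t * y)) + b * (b' * z * (b' * z))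
    lem₂ = solve-∀
    lem₃ : ∀ u v → u + v - u ≡ v
    lem₃ = solve-∀
    norm : x * x - a * (y * y) ≡ b' * (z * z)
    norm = trans (cong (_- a * (y * y)) e) (lem₃ (a * (y * y)) (b' * (z * z)))

  SquareFreeℤ : ℤ → Set
  SquareFreeℤ a = ∀ s → 2 ℕ.≤ s → ¬ + s * + s ∣ a

  squareFree? : ∀ a → a ≢ 0ℤ → SquareFreeℤ a ⊎ ∃₂ λ s b → 2 ℕ.≤ s × a ≡ b * (+ s * + s)
  squareFree? a a≢0 with any? {suc (abs a)} (λ i → + (2 ℕ.+ toℕ i) * + (2 ℕ.+ toℕ i) ∣? a)
  ... | yes (i , divides b e) = inj₂ (2 ℕ.+ toℕ i , b , ℕ.s≤s (ℕ.s≤s ℕ.z≤n) , e)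
  ... | no ¬h = inj₁ no-square
    where
    no-square : SquareFreeℤ a
    no-square (suc (suc s)) l d = ¬h (fromℕ< s<1+a , subst (λ k → + (2 ℕ.+ k) * + (2 ℕ.+ k) ∣ a) (sym (toℕ-fromℕ< s<1+a)) d)
      where
      s²≤a : suc (suc s) ℕ.* suc (suc s) ℕ.≤ abs a
      s²≤a = ℕ.∣⇒≤ {{ℕ.≢-nonZero (a≢0 ∘ ∣i∣≡0⇒i≡0)}} (subst (ℕ._∣ abs a) (abs-* (+ suc (suc s)) (+ suc (suc s))) (∣⇒∣ᵤ d))
      s<1+a : s ℕ.< suc (abs a)
      s<1+a = ℕ.s≤s (ℕ.≤-trans (ℕ.≤-trans (ℕ.m≤n+m s 2) (ℕ.m≤m*n (suc (suc s)) (suc (suc s)))) s²≤a)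
    no-square 0 () d
    no-square 1 (ℕ.s≤s ()) d

  h-squareʳ : ∀ {ℓ} → OddPrime′ ℓ → ∀ a {b} s → b ≢ 0ℤ → s ≢ 0ℤ → h ℓ a (b * (s * s)) ≡ h ℓ a b
  h-squareʳ {ℓ} op a {b} s hb hs = trans (h-*ʳ op a hb (*-≢0 hs hs))
    (trans (cong (h ℓ a b ⊕_) (trans (h-*ʳ op a hs hs) (ℙ.p+p≡0ℙ (h ℓ a s)))) (ℙ.+-identityʳ _))

  -- Square-freeness makes the primes in the list distinct, so that the local roots can be glued by
  -- the Chinese remainder theorem.
  sqrt-mod : ∀ a ps → All Prime ps → SquareFreeℤ (+ List.product ps) →
    (∀ {ℓ} → ℓ ∈ ps → ∃ λ t → + ℓ ∣ t * t - a) → ∃ λ t → + List.product ps ∣ t * t - a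
  sqrt-mod a [] _ _ _ = 0ℤ , ∣ᵤ⇒∣ (ℕ.1∣ abs (0ℤ * 0ℤ - a))
  sqrt-mod a (ℓ ∷ ps) (pr ∷ prs) sqf local with local (here refl) | sqrt-mod a ps prs sqf' (local ∘ there)
    where
    sqf' : SquareFreeℤ (+ List.product ps)
    sqf' s l d = sqf s l (subst (+ s * + s ∣_) (sym (pos-* ℓ (List.product ps))) (∣n⇒∣m*n (+ ℓ) d))
  ... | t₁ , d₁ | t₂ , d₂ = t , coprime-*-∣ coprime (transfer t≅t₁ d₁) (transfer t≅t₂ d₂)
    where
    ℓ∤ps : ¬ ℓ ℕ.∣ List.product ps
    ℓ∤ps d = sqf ℓ (ℕ.nonTrivial⇒n>1 ℓ {{prime⇒nonTrivial pr}})
      (subst (_∣ + (ℓ ℕ.* List.product ps)) (pos-* ℓ ℓ) (∣ᵤ⇒∣ (ℕ.*-monoʳ-∣ ℓ d)))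
    coprime = prime-coprime pr ℓ∤ps
    solution = crt coprime t₁ t₂
    t = proj₁ solution
    t≅t₁ = proj₁ (proj₂ solution)
    t≅t₂ = proj₂ (proj₂ solution)
    transfer : ∀ {m s} → t ≅ s ⟦ m ⟧ → + m ∣ s * s - a → + m ∣ t * t - a
    transfer e d = m∣a-b (≅-trans (≅-* e e) (mk≅ d))

  -- The place 2 is absent: modulo 2 every integer is a square, so the extraction of roots in the
  -- descent asks nothing of it.
  record LocallyIsotropic (a b : ℤ) : Set where
    field
      a≢0  : a ≢ 0ℤ
      b≢0  : b ≢ 0ℤ
      real : 0ℤ < a ⊎ 0ℤ < b
      odd  : ∀ {ℓ} → OddPrime′ ℓ → h ℓ a b ≡ 0ℙ
  open LocallyIsotropic

  locally-sym : ∀ {a b} → LocallyIsotropic a b → LocallyIsotropic b a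
  locally-sym {a} {b} l = record
    { a≢0 = b≢0 l ; b≢0 = a≢0 l ; real = [ inj₂ , inj₁ ]′ (real l) ; odd = λ {ℓ} op → trans (h-sym ℓ b a) (odd l op) }

  private
    pos-factor : ∀ {c s} → 0ℤ < c * s → 0ℤ < s → 0ℤ < c
    pos-factor {c} {s} h hs = ℤ.*-cancelʳ-<-nonNeg s {{nonNegative (ℤ.<⇒≤ hs)}} (subst (_< c * s) (sym (*-zeroˡ s)) h)
      where open import Data.Integer using (nonNegative)

    square-pos : ∀ s → 2 ℕ.≤ s → 0ℤ < + s * + s
    square-pos (suc s) _ = subst (0ℤ <_) (pos-* (suc s) (suc s)) (+<+ (ℕ.s≤s ℕ.z≤n))

    nonzero-factorˡ : ∀ {a b} → a * b ≢ 0ℤ → a ≢ 0ℤ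
    nonzero-factorˡ {b = b} h refl = h (*-zeroˡ b)

    two≤⇒≢0 : ∀ {s} → 2 ℕ.≤ s → + s ≢ 0ℤ
    two≤⇒≢0 {suc s} _ ()

  locally-square : ∀ {a b s} → 2 ℕ.≤ s → LocallyIsotropic a (b * (+ s * + s)) → LocallyIsotropic a b
  locally-square {a} {b} {s} 2≤s l = record
    { a≢0 = a≢0 l ; b≢0 = b≢0' ; real = [ inj₁ , (λ h → inj₂ (pos-factor h (square-pos s 2≤s))) ]′ (real l)
    ; odd = λ op → trans (sym (h-squareʳ op a (+ s) b≢0' (two≤⇒≢0 2≤s))) (odd l op) }
    where
    b≢0' = nonzero-factorˡ {b} {+ s * + s} (b≢0 l)

  abs-square-shrinks : ∀ {b s} → b ≢ 0ℤ → 2 ℕ.≤ s → abs b ℕ.< abs (b * (+ s * + s))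
  abs-square-shrinks {b} {s} hb 2≤s = subst (abs b ℕ.<_) (sym (trans (abs-* b (+ s * + s)) (cong (abs b ℕ.*_) (abs-* (+ s) (+ s)))))
    (ℕ.m<m*n (abs b) (s ℕ.* s) {{ℕ.≢-nonZero (hb ∘ ∣i∣≡0⇒i≡0)}} (ℕ.≤-trans 2≤s (ℕ.≤-trans (ℕ.≤-reflexive (sym (ℕ.*-identityʳ s))) (ℕ.*-monoʳ-≤ s (ℕ.<⇒≤ 2≤s)))))

  -- Each prime `ℓ` dividing the square-free `b` has valuation one, so at odd `ℓ` not dividing `a`
  -- the symbol of `a` and `b` is the residue symbol of `a`, and its vanishing provides a root. If
  -- `ℓ` divides `a` the root is 0; modulo 2 it is `a` itself.
  sqrt-mod-b : ∀ {a b} → LocallyIsotropic a b → SquareFreeℤ b → ∃ λ t → b ∣ t * t - a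
  sqrt-mod-b {a} {b} l sqf = proj₁ root , ∣-trans (subst (b ∣_) (cong +_ isFactorisation) b∣∣b∣) (proj₂ root)
    where
    open import Data.Integer.Divisibility.Signed using (m∣∣m∣; ∣m∣∣m)
    open PrimeFactorisation (factorise (abs b) {{ℕ.≢-nonZero (b≢0 l ∘ ∣i∣≡0⇒i≡0)}})
    b∣∣b∣ : b ∣ + abs b
    b∣∣b∣ = m∣∣m∣
    ∈⇒∣ : ∀ {ℓ ps} → ℓ ∈ ps → ℓ ℕ.∣ List.product ps
    ∈⇒∣ {ps = p ∷ ps} (here refl) = ℕ.m∣m*n (List.product ps)
    ∈⇒∣ {ps = p ∷ ps} (there m) = ℕ.∣n⇒∣m*n p (∈⇒∣ m)
    local : ∀ {ℓ} → ℓ ∈ factors → ∃ λ t → + ℓ ∣ t * t - a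
    local {ℓ} m = by-parity (parity ℓ) refl
      where
      pr : Prime ℓ
      pr = All.lookup factorsPrime m
      ℓ∣b : + ℓ ∣ b
      ℓ∣b = ∣-trans (subst (+ ℓ ∣_) (sym (cong +_ isFactorisation)) (∣ᵤ⇒∣ (∈⇒∣ m))) ∣m∣∣m
      even-prime : ∀ {ℓ} → Prime ℓ → parity ℓ ≡ 0ℙ → ℓ ≡ 2
      even-prime {ℓ} pr e with prime⇒irreducible pr (2∣ ℓ e)
        where
        open import Data.Nat.Primality using (prime⇒irreducible)
        2∣ : ∀ n → parity n ≡ 0ℙ → 2 ℕ.∣ n
        2∣ zero e = 2 ℕ.∣0
        2∣ (suc (suc n)) e = ℕ.∣m∣n⇒∣m+n ℕ.∣-refl (2∣ n e)
      ... | inj₂ e' = sym e'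
      even-square : ∀ a → + 2 ∣ a * a - a
      even-square a = go (a %ℕ 2) (n%ℕd<d a 2) (%ℕ-≅ a 2)
        where
        go : ∀ r → r ℕ.< 2 → a ≅ + r ⟦ 2 ⟧ → + 2 ∣ a * a - a
        go 0 _ e = m∣a-b (≅-trans (≅-* e e) (≅-sym e))
        go 1 _ e = m∣a-b (≅-trans (≅-* e e) (≅-sym e))
        go (suc (suc _)) (ℕ.s≤s (ℕ.s≤s ())) e
      by-parity : ∀ π → parity ℓ ≡ π → ∃ λ t → + ℓ ∣ t * t - a
      by-parity 0ℙ e = a , subst (λ k → + k ∣ a * a - a) (sym (even-prime pr e)) (even-square a)
      by-parity 1ℙ e = by-divisibility (+ ℓ ∣? a)
        where
        by-divisibility : Dec (+ ℓ ∣ a) → ∃ λ t → + ℓ ∣ t * t - a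
        by-divisibility (yes d) = 0ℤ , subst (+ ℓ ∣_) (sym (ℤ.+-identityˡ (- a))) (∣m⇒∣-m d)
        by-divisibility (no ℓ∤a) = from-split ℓ∣b
          where
          root-of : ∀ {ℓ} → OddPrime′ ℓ → ¬ + ℓ ∣ a → res ℓ a ≡ 0ℙ → ∃ λ t → + ℓ ∣ t * t - a
          root-of {suc k} (pr , odd) = OddPrime.sqrt-of-residue pr odd a
          from-split : + ℓ ∣ b → ∃ λ t → + ℓ ∣ t * t - a
          from-split (divides u b≡) = root-of (pr , e) ℓ∤a
            (trans (sym (cong₂ (hilb (res ℓ -1ℤ)) (cls-split pr (split-unit ℓ∤a))
                     (cls-split pr (subst (λ z → Split ℓ z 1 u) (trans (*-comm (+ ℓ) u) (sym b≡)) (split-times ℓ∤u)))))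
                   (odd l (pr , e)))
            where
            ℓ∤u : ¬ + ℓ ∣ u
            ℓ∤u (divides v u≡) = sqf ℓ (ℕ.nonTrivial⇒n>1 ℓ {{prime⇒nonTrivial pr}})
              (divides v (trans b≡ (trans (cong (_* + ℓ) u≡) (*-assoc v (+ ℓ) (+ ℓ)))))
    |b|-squareFree : SquareFreeℤ (+ List.product factors)
    |b|-squareFree s 2≤s d = sqf s 2≤s (∣-trans (subst (+ s * + s ∣_) (sym (cong +_ isFactorisation)) d) ∣m∣∣m)
    root = sqrt-mod a factors factorsPrime |b|-squareFree local

  -- Lagrange's descent on |a| + |b|.
  Descended : ℕ → Set
  Descended n = ∀ a b → abs a ℕ.+ abs b ℕ.≤ n → LocallyIsotropic a b → Isotropic a b

  reduced-root : ∀ {a b} → LocallyIsotropic a b → SquareFreeℤ b → ∃ λ t → t ℕ.< abs b × b ∣ + t * + t - a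
  reduced-root {a} {b} loc sqf = reduce (sqrt-mod-b loc sqf)
    where
    open import Data.Integer.Divisibility.Signed using (m∣∣m∣; ∣m∣∣m)
    instance
      nz : ℕ.NonZero (abs b)
      nz = ℕ.≢-nonZero (b≢0 loc ∘ ∣i∣≡0⇒i≡0)
    reduce : (∃ λ s → b ∣ s * s - a) → ∃ λ t → t ℕ.< abs b × b ∣ + t * + t - a
    reduce (s , d) = s %ℕ abs b , n%ℕd<d s (abs b) ,
      ∣-trans m∣∣m∣ (m∣a-b (≅-trans (≅-* s≅ s≅) (mk≅ {s * s} {a} (∣-trans ∣m∣∣m d))))
      where s≅ = ≅-sym (%ℕ-≅ s (abs b))

  module Step {fuel a b} (rec : Descended fuel) (2≤b : 2 ℕ.≤ abs b) (l : abs a ℕ.+ abs b ℕ.≤ suc fuel) (a≤b : abs a ℕ.≤ abs b)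
    (loc : LocallyIsotropic a b) (sqf-a : SquareFreeℤ a) (t : ℕ) (t<b : t ℕ.< abs b) (b' : ℤ) (c≡ : + t * + t - a ≡ b' * b) where

    exact-root : b' ≡ 0ℤ → Isotropic a b
    exact-root refl = isotropic (+ t) 1ℤ 0ℤ (trans (lem a (+ t)) (trans (cong (_+ a) (trans c≡ (*-zeroˡ b))) (lem₂ a b))) (λ { (() , _) })
      where
      lem : ∀ a t → t * t ≡ (t * t - a) + a
      lem = solve-∀
      lem₂ : ∀ a b → 0ℤ + a ≡ a * (1ℤ * 1ℤ) + b * (0ℤ * 0ℤ)
      lem₂ = solve-∀

    smaller : b' ≢ 0ℤ → Isotropic a b
    smaller b'≢0 = isotropic-norm (+ t) b'≢0 c≡ (rec a b' (ℕ.≤-pred (ℕ.≤-trans (ℕ.+-monoʳ-< (abs a) b'<b) l)) loc')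
      where
      open ℕ.≤-Reasoning
      c≢0 : + t * + t - a ≢ 0ℤ
      c≢0 e = *-≢0 b'≢0 (b≢0 loc) (trans (sym c≡) e)
      -- The least nonnegative root is small enough: `(B - 1)² + B < B²` as soon as `B ≥ 2`. This is
      -- also why `abs b = 1` is a separate case.
      bound : ∀ B → 2 ℕ.≤ B → t ℕ.< B → abs a ℕ.≤ B → t ℕ.* t ℕ.+ abs a ℕ.< B ℕ.* B
      bound 1 (ℕ.s≤s ()) _ _
      bound (suc (suc B)) _ (ℕ.s≤s t≤) a≤ = begin-strict
        t ℕ.* t ℕ.+ abs a                       ≤⟨ ℕ.+-mono-≤ (ℕ.*-mono-≤ t≤ t≤) a≤ ⟩
        suc B ℕ.* suc B ℕ.+ suc (suc B)         <⟨ ℕ.m<m+n _ {suc B} (ℕ.s≤s ℕ.z≤n) ⟩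
        suc B ℕ.* suc B ℕ.+ suc (suc B) ℕ.+ suc B ≡⟨ lem B ⟩
        suc (suc B) ℕ.* suc (suc B)             ∎
        where
        open import Data.Nat.Tactic.RingSolver using () renaming (solve-∀ to solve-∀ⁿ)
        lem : ∀ B → suc B ℕ.* suc B ℕ.+ suc (suc B) ℕ.+ suc B ≡ suc (suc B) ℕ.* suc (suc B)
        lem = solve-∀ⁿ
      b'<b : abs b' ℕ.< abs b
      b'<b = ℕ.*-cancelʳ-< (abs b) (abs b') (abs b) (begin-strict
        abs b' ℕ.* abs b          ≡⟨ abs-* b' b ⟨
        abs (b' * b)              ≡⟨ cong abs c≡ ⟨
        abs (+ t * + t - a)       ≤⟨ ∣i-j∣≤∣i∣+∣j∣ (+ t * + t) a ⟩
        abs (+ t * + t) ℕ.+ abs a ≡⟨ cong (ℕ._+ abs a) (abs-* (+ t) (+ t)) ⟩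
        t ℕ.* t ℕ.+ abs a         <⟨ bound (abs b) 2≤b t<b a≤b ⟩
        abs b ℕ.* abs b           ∎)
      cancel : ∀ x y → x ⊕ y ≡ 0ℙ → y ≡ 0ℙ → x ≡ 0ℙ
      cancel x .0ℙ e refl = trans (sym (ℙ.+-identityʳ x)) e
      norm-positive : 0ℤ < b → 0ℤ < a ⊎ 0ℤ < b'
      norm-positive 0<b with ℤ.<-cmp 0ℤ a
      ... | tri< h _ _ = inj₁ h
      ... | tri≈ _ e _ = ⊥-elim (a≢0 loc (sym e))
      -- If `a` is negative then `t² - a = b' b` is positive, so `b'` inherits the sign of `b`.
      ... | tri> _ _ h = inj₂ (pos-factor (subst (0ℤ <_) c≡ (minus-neg a h)) 0<b)
        where
        minus-neg : ∀ a → a < 0ℤ → 0ℤ < + t * + t - a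
        minus-neg -[1+ n ] _ = subst (λ z → 0ℤ < z + + suc n) (pos-* t t) (+<+ (ℕ.≤-trans (ℕ.s≤s ℕ.z≤n) (ℕ.m≤n+m (suc n) (t ℕ.* t))))
        minus-neg (+ n) (+<+ ())
      loc' : LocallyIsotropic a b'
      loc' = record
        { a≢0 = a≢0 loc
        ; b≢0 = b'≢0
        ; real = [ inj₁ , norm-positive ]′ (real loc)
        -- `t² - a` is a norm from `ℚ(√a)`, so its symbol with `a` vanishes and `b'` has the same
        -- symbol as `b`. The norm lemma asks that `ℓ²` does not divide `a`, hence the reduction to
        -- square-free `a`.
        ; odd = λ {ℓ} op → cancel (h ℓ a b') (h ℓ a b)
            (trans (sym (h-*ʳ op a b'≢0 (b≢0 loc))) (trans (cong (h ℓ a) (sym c≡))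
              (h-norm op (+ t) (sqf-a ℓ (ℕ.nonTrivial⇒n>1 ℓ {{prime⇒nonTrivial (proj₁ op)}})) c≢0)))
            (odd loc op)
        }

    conclude : Isotropic a b
    conclude with b' ℤ.≟ 0ℤ
    ... | yes e = exact-root e
    ... | no e = smaller e

  descent-step : ∀ {fuel} → Descended fuel → ∀ a b → 2 ℕ.≤ abs b → abs a ℕ.+ abs b ℕ.≤ suc fuel → abs a ℕ.≤ abs b →
    LocallyIsotropic a b → SquareFreeℤ a → SquareFreeℤ b → Isotropic a b
  descent-step rec a b 2≤b l a≤b loc sqf-a sqf-b = go (reduced-root loc sqf-b)
    where
    go : (∃ λ t → t ℕ.< abs b × b ∣ + t * + t - a) → Isotropic a b
    go (t , t<b , divides b' c≡) = Step.conclude rec 2≤b l a≤b loc sqf-a t t<b b' c≡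

  unit-case : ∀ a b → abs a ℕ.≤ abs b → abs b ≡ 1 → LocallyIsotropic a b → Isotropic a b
  unit-case a (+ 1) _ _ loc = isotropic 1ℤ 0ℤ 1ℤ (sym (cong (_+ 1ℤ) (*-zeroʳ a))) (λ { (_ , ()) })
  unit-case (+ 0) -[1+ 0 ] _ _ loc = ⊥-elim (a≢0 loc refl)
  unit-case (+ 1) -[1+ 0 ] _ _ loc = isotropic 1ℤ 1ℤ 0ℤ refl (λ { (() , _) })
  unit-case (+ suc (suc _)) -[1+ 0 ] (ℕ.s≤s ()) _ loc
  unit-case -[1+ _ ] -[1+ 0 ] _ _ loc = ⊥-elim ([ (λ ()) , (λ ()) ]′ (real loc))

  descent-squareFree : ∀ {fuel} → Descended fuel → ∀ a b → abs a ℕ.+ abs b ℕ.≤ suc fuel → abs a ℕ.≤ abs b →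
    LocallyIsotropic a b → SquareFreeℤ a → SquareFreeℤ b → Isotropic a b
  descent-squareFree rec a b l a≤b loc sqf-a sqf-b with abs b ℕ.≟ 1
  ... | yes e = unit-case a b a≤b e loc
  ... | no ne = descent-step rec a b (ℕ.≤∧≢⇒< (ℕ.n≢0⇒n>0 (b≢0 loc ∘ ∣i∣≡0⇒i≡0)) (ne ∘ sym)) l a≤b loc sqf-a sqf-b

  -- Removing a square factor from `a` or `b` already lowers `|a| + |b|` and keeps the square
  -- classes, so it counts as a descent step of its own.
  descent-≤ : ∀ {fuel} → Descended fuel → ∀ a b → abs a ℕ.+ abs b ℕ.≤ suc fuel → abs a ℕ.≤ abs b → LocallyIsotropic a b → Isotropic a b
  descent-≤ {fuel} rec a b l a≤b loc = go (squareFree? a (a≢0 loc)) (squareFree? b (b≢0 loc))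
    where
    reduce-a : ∀ {a} s a' → abs a ℕ.+ abs b ℕ.≤ suc fuel → LocallyIsotropic a b → 2 ℕ.≤ s → a ≡ a' * (+ s * + s) → Isotropic a b
    reduce-a s a' l loc 2≤s refl = isotropic-sym (isotropic-square (+ s) (two≤⇒≢0 2≤s)
      (isotropic-sym (rec a' b (ℕ.≤-pred (ℕ.≤-trans (ℕ.+-monoˡ-< (abs b) (abs-square-shrinks (nonzero-factorˡ {a'} (a≢0 loc)) 2≤s)) l))
        (locally-sym (locally-square 2≤s (locally-sym loc))))))
    reduce-b : ∀ {b} s b' → abs a ℕ.+ abs b ℕ.≤ suc fuel → LocallyIsotropic a b → 2 ℕ.≤ s → b ≡ b' * (+ s * + s) → Isotropic a b
    reduce-b s b' l loc 2≤s refl = isotropic-square (+ s) (two≤⇒≢0 2≤s)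
      (rec a b' (ℕ.≤-pred (ℕ.≤-trans (ℕ.+-monoʳ-< (abs a) (abs-square-shrinks (nonzero-factorˡ {b'} (b≢0 loc)) 2≤s)) l))
        (locally-square 2≤s loc))
    go : SquareFreeℤ a ⊎ (∃₂ λ s c → 2 ℕ.≤ s × a ≡ c * (+ s * + s)) → SquareFreeℤ b ⊎ (∃₂ λ s c → 2 ℕ.≤ s × b ≡ c * (+ s * + s)) → Isotropic a b
    go (inj₂ (s , a' , 2≤s , e)) _ = reduce-a s a' l loc 2≤s e
    go (inj₁ _) (inj₂ (s , b' , 2≤s , e)) = reduce-b s b' l loc 2≤s e
    go (inj₁ sqf-a) (inj₁ sqf-b) = descent-squareFree rec a b l a≤b loc sqf-a sqf-b

  descent : ∀ n → Descended n
  descent zero a b l loc = ⊥-elim (b≢0 loc (∣i∣≡0⇒i≡0 (ℕ.n≤0⇒n≡0 (ℕ.≤-trans (ℕ.m≤n+m (abs b) (abs a)) l))))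
  descent (suc n) a b l loc with ℕ.≤-total (abs a) (abs b)
  ... | inj₁ a≤b = descent-≤ (descent n) a b l a≤b loc
  ... | inj₂ b≤a = isotropic-sym (descent-≤ (descent n) b a (subst (ℕ._≤ suc n) (ℕ.+-comm (abs a) (abs b)) l) b≤a (locally-sym loc))

  legendre-theorem : ∀ {a b} → LocallyIsotropic a b → Isotropic a b
  legendre-theorem {a} {b} = descent (abs a ℕ.+ abs b) a b ℕ.≤-refl

-- Finite sums of rational numbers.

module RationalSums where
  open import Data.Nat as ℕ using (ℕ; zero; suc)
  import Data.Nat.Properties as ℕ
  open import Data.Rational using (ℚ; 0ℚ; 1ℚ; _+_; _-_; _*_; -_; _≤_; _<_; ∣_∣; nonNegative; positive) renaming (1/_ to recip)
  open import Data.Rational.Properties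
  open import Data.Maybe using (Maybe; just; nothing)
  open import Data.Empty using (⊥-elim)
  open import Relation.Nullary using (Dec; yes; no)
  open import Relation.Binary.PropositionalEquality
  open import Function using (_∘_)
  open import Level using (0ℓ)
  import Tactic.RingSolver as Solver
  import Tactic.RingSolver.Core.AlmostCommutativeRing as ACR

  ℚ-ring : ACR.AlmostCommutativeRing 0ℓ 0ℓ
  ℚ-ring = ACR.fromCommutativeRing +-*-commutativeRing (λ x → isZero (x ≟ 0ℚ))
    where
    isZero : ∀ {x} → Dec (x ≡ 0ℚ) → Maybe (0ℚ ≡ x)
    isZero (yes e) = just (sym e)
    isZero (no _) = nothing

  *-monoˡ : ∀ {c a b} → 0ℚ ≤ c → a ≤ b → c * a ≤ c * b
  *-monoˡ {c} h = *-monoˡ-≤-nonNeg c {{nonNegative h}}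

  *-monoʳ : ∀ {c a b} → 0ℚ ≤ c → a ≤ b → a * c ≤ b * c
  *-monoʳ {c} h = *-monoʳ-≤-nonNeg c {{nonNegative h}}

  *-mono : ∀ {a b c d} → 0ℚ ≤ a → 0ℚ ≤ d → a ≤ b → c ≤ d → a * c ≤ b * d
  *-mono ha hd h k = ≤-trans (*-monoˡ ha k) (*-monoʳ hd h)

  *-nonneg : ∀ {a b} → 0ℚ ≤ a → 0ℚ ≤ b → 0ℚ ≤ a * b
  *-nonneg {a} {b} ha hb = subst (_≤ a * b) (*-zeroʳ a) (*-monoˡ ha hb)

  +-nonneg : ∀ {a b} → 0ℚ ≤ a → 0ℚ ≤ b → 0ℚ ≤ a + b
  +-nonneg = +-mono-≤

  0≤1 : 0ℚ ≤ 1ℚ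
  0≤1 = nonNegative⁻¹ 1ℚ

  ι : ℕ → ℚ
  ι zero = 0ℚ
  ι (suc n) = 1ℚ + ι n

  ι-+ : ∀ m n → ι (m ℕ.+ n) ≡ ι m + ι n
  ι-+ zero n = sym (+-identityˡ (ι n))
  ι-+ (suc m) n = trans (cong (1ℚ +_) (ι-+ m n)) (sym (+-assoc 1ℚ (ι m) (ι n)))

  ι-* : ∀ m n → ι (m ℕ.* n) ≡ ι m * ι n
  ι-* zero n = sym (*-zeroˡ (ι n))
  ι-* (suc m) n = trans (ι-+ n (m ℕ.* n)) (trans (cong (ι n +_) (ι-* m n)) (lem (ι m) (ι n)))
    where
    lem : ∀ m n → n + m * n ≡ (1ℚ + m) * n
    lem = Solver.solve-∀ ℚ-ring

  0≤ι : ∀ n → 0ℚ ≤ ι n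
  0≤ι zero = ≤-refl
  0≤ι (suc n) = +-nonneg 0≤1 (0≤ι n)

  ι-mono : ∀ {m n} → m ℕ.≤ n → ι m ≤ ι n
  ι-mono {n = n} ℕ.z≤n = 0≤ι n
  ι-mono (ℕ.s≤s h) = +-monoʳ-≤ 1ℚ (ι-mono h)

  ι-positive : ∀ n → 0ℚ < ι (suc n)
  ι-positive n = <-≤-trans (positive⁻¹ 1ℚ) (subst (_≤ ι (suc n)) (+-identityʳ 1ℚ) (ι-mono {1} {suc n} (ℕ.s≤s ℕ.z≤n)))

  ι-mono-< : ∀ {m n} → m ℕ.< n → ι m < ι n
  ι-mono-< {m} h = <-≤-trans (subst (_< ι (suc m)) (+-identityˡ (ι m)) (+-monoˡ-< (ι m) (positive⁻¹ 1ℚ))) (ι-mono h)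

  -- 1/n, with the value 0 at n = 0.
  inv : ℕ → ℚ
  inv zero = 0ℚ
  inv (suc n) = recip (ι (suc n)) {{pos⇒nonZero (ι (suc n)) {{positive (ι-positive n)}}}}

  ι-inv : ∀ n → ι (suc n) * inv (suc n) ≡ 1ℚ
  ι-inv n = *-inverseʳ (ι (suc n)) {{pos⇒nonZero (ι (suc n)) {{positive (ι-positive n)}}}}

  0≤inv : ∀ n → 0ℚ ≤ inv n
  0≤inv zero = ≤-refl
  0≤inv (suc n) = nonNegative⁻¹ _ {{pos⇒nonNeg (inv (suc n)) {{1/pos⇒pos (ι (suc n)) {{positive (ι-positive n)}}}}}}

  ι-cancel-≤ : ∀ n {a b} → ι (suc n) * a ≤ ι (suc n) * b → a ≤ b
  ι-cancel-≤ n = *-cancelˡ-≤-pos (ι (suc n)) {{positive (ι-positive n)}}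

  -- Σ_{i=1}^{n} f i
  ∑ : ℕ → (ℕ → ℚ) → ℚ
  ∑ zero f = 0ℚ
  ∑ (suc n) f = ∑ n f + f (suc n)

  ∑-cong : ∀ n {f g} → (∀ i → 1 ℕ.≤ i → i ℕ.≤ n → f i ≡ g i) → ∑ n f ≡ ∑ n g
  ∑-cong zero h = refl
  ∑-cong (suc n) h = cong₂ _+_ (∑-cong n (λ i l u → h i l (ℕ.m≤n⇒m≤1+n u))) (h (suc n) (ℕ.s≤s ℕ.z≤n) ℕ.≤-refl)

  ∑-zero : ∀ n {f} → (∀ i → 1 ℕ.≤ i → i ℕ.≤ n → f i ≡ 0ℚ) → ∑ n f ≡ 0ℚ
  ∑-zero zero h = refl
  ∑-zero (suc n) h = cong₂ _+_ (∑-zero n (λ i l u → h i l (ℕ.m≤n⇒m≤1+n u))) (h (suc n) (ℕ.s≤s ℕ.z≤n) ℕ.≤-refl)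

  ∑-+ : ∀ n f g → ∑ n (λ i → f i + g i) ≡ ∑ n f + ∑ n g
  ∑-+ zero f g = refl
  ∑-+ (suc n) f g = trans (cong (_+ (f (suc n) + g (suc n))) (∑-+ n f g)) (lem (∑ n f) (∑ n g) (f (suc n)) (g (suc n)))
    where
    lem : ∀ a b c d → a + b + (c + d) ≡ a + c + (b + d)
    lem = Solver.solve-∀ ℚ-ring

  ∑-*ˡ : ∀ n c f → ∑ n (λ i → c * f i) ≡ c * ∑ n f
  ∑-*ˡ zero c f = sym (*-zeroʳ c)
  ∑-*ˡ (suc n) c f = trans (cong (_+ c * f (suc n)) (∑-*ˡ n c f)) (sym (*-distribˡ-+ c (∑ n f) (f (suc n))))

  ∑-*ʳ : ∀ n f c → ∑ n (λ i → f i * c) ≡ ∑ n f * c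
  ∑-*ʳ zero f c = sym (*-zeroˡ c)
  ∑-*ʳ (suc n) f c = trans (cong (_+ f (suc n) * c) (∑-*ʳ n f c)) (sym (*-distribʳ-+ c (∑ n f) (f (suc n))))

  ∑-neg : ∀ n f → ∑ n (λ i → - f i) ≡ - ∑ n f
  ∑-neg zero f = refl
  ∑-neg (suc n) f = trans (cong (_+ - f (suc n)) (∑-neg n f)) (sym (neg-distrib-+ (∑ n f) (f (suc n))))

  ∑-swap : ∀ m n (f : ℕ → ℕ → ℚ) → ∑ m (λ i → ∑ n (λ j → f i j)) ≡ ∑ n (λ j → ∑ m (λ i → f i j))
  ∑-swap zero n f = sym (∑-zero n (λ _ _ _ → refl))
  ∑-swap (suc m) n f = trans (cong (_+ ∑ n (f (suc m))) (∑-swap m n f)) (sym (∑-+ n (λ j → ∑ m (λ i → f i j)) (f (suc m))))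

  ∑-mono : ∀ n {f g} → (∀ i → 1 ℕ.≤ i → i ℕ.≤ n → f i ≤ g i) → ∑ n f ≤ ∑ n g
  ∑-mono zero h = ≤-refl
  ∑-mono (suc n) h = +-mono-≤ (∑-mono n (λ i l u → h i l (ℕ.m≤n⇒m≤1+n u))) (h (suc n) (ℕ.s≤s ℕ.z≤n) ℕ.≤-refl)

  ∑-nonneg : ∀ n {f} → (∀ i → 1 ℕ.≤ i → i ℕ.≤ n → 0ℚ ≤ f i) → 0ℚ ≤ ∑ n f
  ∑-nonneg zero h = ≤-refl
  ∑-nonneg (suc n) h = +-nonneg (∑-nonneg n (λ i l u → h i l (ℕ.m≤n⇒m≤1+n u))) (h (suc n) (ℕ.s≤s ℕ.z≤n) ℕ.≤-refl)

  ∑-abs : ∀ n f → ∣ ∑ n f ∣ ≤ ∑ n (λ i → ∣ f i ∣)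
  ∑-abs zero f = ≤-refl
  ∑-abs (suc n) f = ≤-trans (∣p+q∣≤∣p∣+∣q∣ (∑ n f) (f (suc n))) (+-monoˡ-≤ ∣ f (suc n) ∣ (∑-abs n f))

  ∑-const : ∀ n c → ∑ n (λ _ → c) ≡ ι n * c
  ∑-const zero c = sym (*-zeroˡ c)
  ∑-const (suc n) c = trans (cong (_+ c) (∑-const n c)) (lem (ι n) c)
    where
    lem : ∀ n c → n * c + c ≡ (1ℚ + n) * c
    lem = Solver.solve-∀ ℚ-ring

  ∑-bound : ∀ n {f c} → (∀ i → 1 ℕ.≤ i → i ℕ.≤ n → ∣ f i ∣ ≤ c) → ∣ ∑ n f ∣ ≤ ι n * c
  ∑-bound n {f} {c} h = ≤-trans (∑-abs n f) (≤-trans (∑-mono n h) (≤-reflexive (∑-const n c)))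

  ∑-single : ∀ n {f} x → 1 ℕ.≤ x → x ℕ.≤ n → (∀ i → 1 ℕ.≤ i → i ℕ.≤ n → i ≢ x → f i ≡ 0ℚ) → ∑ n f ≡ f x
  ∑-single zero x l u h = ⊥-elim (ℕ.<⇒≱ l u)
  ∑-single (suc n) {f} x l u h with x ℕ.≟ suc n
  ... | yes refl = trans (cong (_+ f (suc n)) (∑-zero n (λ i l' u' → h i l' (ℕ.m≤n⇒m≤1+n u') (λ { refl → ℕ.1+n≰n u' })))) (+-identityˡ _)
  ... | no ne = trans (cong₂ _+_ (∑-single n x l (ℕ.≤-pred (ℕ.≤∧≢⇒< u ne)) (λ i l' u' → h i l' (ℕ.m≤n⇒m≤1+n u')))
                  (h (suc n) (ℕ.s≤s ℕ.z≤n) ℕ.≤-refl (ne ∘ sym))) (+-identityʳ _)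

  ∑-front : ∀ n f → ∑ (suc n) f ≡ f 1 + ∑ n (f ∘ suc)
  ∑-front zero f = trans (+-identityˡ (f 1)) (sym (+-identityʳ (f 1)))
  ∑-front (suc n) f = trans (cong (_+ f (suc (suc n))) (∑-front n f)) (+-assoc (f 1) (∑ n (f ∘ suc)) (f (suc (suc n))))

  ∑-extend : ∀ {f} m n → m ℕ.< n → (∀ i → 1 ℕ.≤ i → i ℕ.≤ n → 0ℚ ≤ f i) → ∑ m f + f n ≤ ∑ n f
  ∑-extend {f} m (suc n) (ℕ.s≤s m≤n) h = +-monoˡ-≤ (f (suc n)) (grow m≤n (λ i l u → h i l (ℕ.m≤n⇒m≤1+n u)))
    where
    grow : ∀ {m n} → m ℕ.≤ n → (∀ i → 1 ℕ.≤ i → i ℕ.≤ n → 0ℚ ≤ f i) → ∑ m f ≤ ∑ n f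
    grow {m} {zero} ℕ.z≤n h = ≤-refl
    grow {m} {suc n} m≤n h with m ℕ.≟ suc n
    ... | yes refl = ≤-refl
    ... | no ne = ≤-trans (grow (ℕ.≤-pred (ℕ.≤∧≢⇒< m≤n ne)) (λ i l u → h i l (ℕ.m≤n⇒m≤1+n u)))
        (subst (_≤ ∑ (suc n) f) (+-identityʳ (∑ n f)) (+-monoʳ-≤ (∑ n f) (h (suc n) (ℕ.s≤s ℕ.z≤n) ℕ.≤-refl)))

  -- Serves to keep only the squares in a sum of nonnegative terms.
  ∑-subsequence : ∀ {f} (σ : ℕ → ℕ) L n → (∀ i → σ i ℕ.< σ (suc i)) → σ L ℕ.≤ n → (∀ i → 1 ℕ.≤ i → i ℕ.≤ n → 0ℚ ≤ f i) →
    ∑ L (f ∘ σ) ≤ ∑ n f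
  ∑-subsequence {f} σ zero n inc b h = ∑-nonneg n h
  ∑-subsequence {f} σ (suc L) n inc b h = ≤-trans
    (+-monoˡ-≤ (f (σ (suc L))) (∑-subsequence {f} σ L (σ L) inc ℕ.≤-refl (λ i l u → h i l (ℕ.≤-trans u (ℕ.≤-trans (ℕ.<⇒≤ (inc L)) b)))))
    (≤-trans (∑-extend (σ L) (σ (suc L)) (inc L) (λ i l u → h i l (ℕ.≤-trans u b))) (top (σ (suc L)) b))
    where
    top : ∀ m → m ℕ.≤ n → ∑ m f ≤ ∑ n f
    top m m≤n with m ℕ.≟ n
    ... | yes refl = ≤-refl
    ... | no ne = ≤-trans (subst (_≤ ∑ m f + f n) (+-identityʳ (∑ m f)) (+-monoʳ-≤ (∑ m f) (h n (ℕ.≤-<-trans ℕ.z≤n m<n) ℕ.≤-refl))) (∑-extend m n m<n h)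
      where m<n = ℕ.≤∧≢⇒< m≤n ne

  -- Sums over divisors are written as sums over a full box weighted by `δ`, so that every
  -- rearrangement becomes an instance of `∑-swap`.
  δ : ℕ → ℕ → ℚ
  δ m n with m ℕ.≟ n
  ... | yes _ = 1ℚ
  ... | no _ = 0ℚ

  δ-yes : ∀ {m n} → m ≡ n → δ m n ≡ 1ℚ
  δ-yes {m} {n} e with m ℕ.≟ n
  ... | yes _ = refl
  ... | no ne = ⊥-elim (ne e)

  δ-no : ∀ {m n} → m ≢ n → δ m n ≡ 0ℚ
  δ-no {m} {n} ne with m ℕ.≟ n
  ... | yes e = ⊥-elim (ne e)
  ... | no _ = refl

  ∑-δ : ∀ n x (f : ℕ → ℚ) → 1 ℕ.≤ x → x ℕ.≤ n → ∑ n (λ i → δ x i * f i) ≡ f x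
  ∑-δ n x f l u = trans (∑-single n {λ i → δ x i * f i} x l u (λ i _ _ ne → trans (cong (_* f i) (δ-no (ne ∘ sym))) (*-zeroˡ (f i))))
    (trans (cong (_* f x) (δ-yes {x} refl)) (*-identityˡ (f x)))

-- Dirichlet convolution and the Euler factors of `r`.

module Convolution where
  import Tactic.RingSolver as Solver
  open RationalSums
  open import Data.Nat as ℕ using (ℕ; zero; suc)
  import Data.Nat.Properties as ℕ
  import Data.Nat.Divisibility as ℕ
  open import Data.Nat.Primality using (Prime; euclidsLemma; prime⇒nonZero; prime⇒nonTrivial)
  open import Data.Nat.Primality.Factorisation using (factorise)
  open import Data.Nat.Induction using (<-rec)
  open import Data.Nat.Tactic.RingSolver using () renaming (solve-∀ to solve-∀ⁿ)
  open import Data.Rational using (ℚ; 0ℚ; 1ℚ; _+_; _-_; _*_; -_; _≤_; _<_)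
  open import Data.Rational.Properties
  open import Data.List using ([]; _∷_)
  open import Data.List.Relation.Unary.All using ([]; _∷_)
  open import Data.Product using (_×_; _,_; ∃; ∃₂; proj₁; proj₂)
  open import Data.Sum using (_⊎_; inj₁; inj₂; [_,_]′)
  open import Data.Empty using (⊥-elim)
  open import Relation.Nullary using (¬_; Dec; yes; no)
  open import Relation.Binary.PropositionalEquality
  open import Function using (_∘_)

  δ-vanish : ∀ {m n} x → m ≢ n → δ m n * x ≡ 0ℚ
  δ-vanish x ne = trans (cong (_* x) (δ-no ne)) (*-zeroˡ x)

  δ-one : ∀ {m n} x → m ≡ n → δ m n * x ≡ x
  δ-one x e = trans (cong (_* x) (δ-yes e)) (*-identityˡ x)

  1≤-factorˡ : ∀ {b m n} → 1 ℕ.≤ n → b ℕ.* m ≡ n → 1 ℕ.≤ b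
  1≤-factorˡ {zero} h refl = h
  1≤-factorˡ {suc b} _ _ = ℕ.s≤s ℕ.z≤n

  1≤-factorʳ : ∀ {b m n} → 1 ℕ.≤ n → b ℕ.* m ≡ n → 1 ℕ.≤ m
  1≤-factorʳ {b} {m} h e = 1≤-factorˡ h (trans (ℕ.*-comm m b) e)

  1≤-* : ∀ {b m} → 1 ℕ.≤ b → 1 ℕ.≤ m → 1 ℕ.≤ b ℕ.* m
  1≤-* {suc b} {suc m} _ _ = ℕ.s≤s ℕ.z≤n

  prime>1 : ∀ {ℓ} → Prime ℓ → 2 ℕ.≤ ℓ
  prime>1 {ℓ} pr = ℕ.nonTrivial⇒n>1 ℓ {{prime⇒nonTrivial pr}}

  splitPower : ∀ {ℓ} → Prime ℓ → ∀ n → 1 ℕ.≤ n → ∃₂ λ j v → n ≡ ℓ ℕ.^ j ℕ.* v × 1 ℕ.≤ v × ¬ ℓ ℕ.∣ v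
  splitPower {ℓ} pr = <-rec _ step
    where
    step : ∀ n → (∀ {m} → m ℕ.< n → 1 ℕ.≤ m → ∃₂ λ j v → m ≡ ℓ ℕ.^ j ℕ.* v × 1 ℕ.≤ v × ¬ ℓ ℕ.∣ v) →
           1 ℕ.≤ n → ∃₂ λ j v → n ≡ ℓ ℕ.^ j ℕ.* v × 1 ℕ.≤ v × ¬ ℓ ℕ.∣ v
    step n rec 1≤n with ℓ ℕ.∣? n
    ... | no ∤ = 0 , n , sym (ℕ.+-identityʳ n) , 1≤n , ∤
    ... | yes (ℕ.divides q e) with rec (subst (q ℕ.<_) (sym e) (ℕ.m<m*n q ℓ {{ℕ.>-nonZero 1≤q}} (prime>1 pr))) 1≤q
      where
      1≤q : 1 ℕ.≤ q
      1≤q = 1≤-factorˡ 1≤n (sym e)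
    ...   | j , v , e' , 1≤v , ∤ = suc j , v , trans e (trans (cong (ℕ._* ℓ) e') (lem (ℓ ℕ.^ j) v ℓ)) , 1≤v , ∤
      where
      lem : ∀ x v ℓ → x ℕ.* v ℕ.* ℓ ≡ ℓ ℕ.* x ℕ.* v
      lem = solve-∀ⁿ

  coprime-power : ∀ {ℓ} → Prime ℓ → ∀ J {b m v} → ¬ ℓ ℕ.∣ b → b ℕ.* m ≡ ℓ ℕ.^ J ℕ.* v → ∃ λ m₀ → m ≡ ℓ ℕ.^ J ℕ.* m₀
  coprime-power pr zero {m = m} ∤ e = m , sym (ℕ.+-identityʳ m)
  coprime-power {ℓ} pr (suc J) {b} {m} {v} ∤ e = go (euclidsLemma b m pr (subst (ℓ ℕ.∣_) (sym (trans e (ℕ.*-assoc ℓ (ℓ ℕ.^ J) v))) (ℕ.m∣m*n (ℓ ℕ.^ J ℕ.* v))))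
    where
    instance nz = prime⇒nonZero pr
    lem : ∀ b k ℓ → ℓ ℕ.* (b ℕ.* k) ≡ b ℕ.* (k ℕ.* ℓ)
    lem = solve-∀ⁿ
    go : ℓ ℕ.∣ b ⊎ ℓ ℕ.∣ m → ∃ λ m₀ → m ≡ ℓ ℕ.^ suc J ℕ.* m₀
    go (inj₁ d) = ⊥-elim (∤ d)
    go (inj₂ (ℕ.divides k refl)) with coprime-power pr J {b} {k} {v} ∤ (ℕ.*-cancelˡ-≡ (b ℕ.* k) (ℓ ℕ.^ J ℕ.* v) ℓ (trans (lem b k ℓ) (trans e (ℕ.*-assoc ℓ (ℓ ℕ.^ J) v))))
    ... | m₀ , refl = m₀ , trans (ℕ.*-comm (ℓ ℕ.^ J ℕ.* m₀) ℓ) (sym (ℕ.*-assoc ℓ (ℓ ℕ.^ J) m₀))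

  double : ℕ → ℕ
  double zero = zero
  double (suc k) = suc (suc (double k))

  Sign : ℚ → Set
  Sign x = x ≡ 1ℚ ⊎ x ≡ - 1ℚ

  prime-factor : ∀ n → 2 ℕ.≤ n → ∃ λ ℓ → Prime ℓ × ℓ ℕ.∣ n
  prime-factor n 2≤n with factorise n {{ℕ.>-nonZero (ℕ.<⇒≤ 2≤n)}}
  ... | record { factors = [] ; isFactorisation = refl } = ⊥-elim (ℕ.<⇒≱ 2≤n ℕ.≤-refl)
  ... | record { factors = ℓ ∷ ps ; isFactorisation = refl ; factorsPrime = pr ∷ _ } = ℓ , pr , ℕ.m∣m*n _

  -- Dirichlet convolution; the truncation at N is immaterial for arguments up to N.
  module Truncated (N : ℕ) where

    conv : (ℕ → ℚ) → (ℕ → ℚ) → ℕ → ℚ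
    conv χ g n = ∑ N (λ b → ∑ N (λ m → δ (b ℕ.* m) n * (χ b * g m)))

    collapse : ∀ x (f : ℕ → ℚ) r → 1 ℕ.≤ x → (N ℕ.< x → r ≡ 0ℚ) → (x ℕ.≤ N → f x ≡ r) → ∑ N (λ i → δ x i * f i) ≡ r
    collapse x f r 1≤x big small with x ℕ.≤? N
    ... | yes x≤N = trans (∑-δ N x f 1≤x x≤N) (small x≤N)
    ... | no x≰N = trans (∑-zero N (λ i _ i≤N → δ-vanish {x} {i} (f i) (λ { refl → x≰N i≤N }))) (sym (big (ℕ.≰⇒> x≰N)))

    -- `G` has to vanish beyond `N`: the box on the right contains products `b m > N`, which the
    -- left side never meets.
    conv-sum : ∀ (χ g G : ℕ → ℚ) → (∀ n → N ℕ.< n → G n ≡ 0ℚ) →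
      ∑ N (λ n → conv χ g n * G n) ≡ ∑ N (λ b → χ b * ∑ N (λ m → g m * G (b ℕ.* m)))
    conv-sum χ g G big = begin
      ∑ N (λ n → conv χ g n * G n)
        ≡⟨ ∑-cong N (λ n _ _ → trans (sym (∑-*ʳ N (λ b → ∑ N (λ m → δ (b ℕ.* m) n * (χ b * g m))) (G n)))
             (∑-cong N (λ b _ _ → sym (∑-*ʳ N (λ m → δ (b ℕ.* m) n * (χ b * g m)) (G n))))) ⟩
      ∑ N (λ n → ∑ N (λ b → ∑ N (λ m → δ (b ℕ.* m) n * (χ b * g m) * G n)))
        ≡⟨ ∑-swap N N (λ n b → ∑ N (λ m → δ (b ℕ.* m) n * (χ b * g m) * G n)) ⟩
      ∑ N (λ b → ∑ N (λ n → ∑ N (λ m → δ (b ℕ.* m) n * (χ b * g m) * G n)))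
        ≡⟨ ∑-cong N (λ b lb _ → trans (∑-swap N N (λ n m → δ (b ℕ.* m) n * (χ b * g m) * G n))
             (trans (∑-cong N (λ m lm _ → inner b m lb lm)) (∑-*ˡ N (χ b) (λ m → g m * G (b ℕ.* m))))) ⟩
      ∑ N (λ b → χ b * ∑ N (λ m → g m * G (b ℕ.* m))) ∎
      where
      open ≡-Reasoning
      inner : ∀ b m → 1 ℕ.≤ b → 1 ℕ.≤ m → ∑ N (λ n → δ (b ℕ.* m) n * (χ b * g m) * G n) ≡ χ b * (g m * G (b ℕ.* m))
      inner b m lb lm = trans (∑-cong N (λ n _ _ → *-assoc (δ (b ℕ.* m) n) (χ b * g m) (G n)))
        (trans (collapse (b ℕ.* m) (λ n → χ b * g m * G n) (χ b * g m * G (b ℕ.* m)) (1≤-* lb lm)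
          (λ h → trans (cong (χ b * g m *_) (big _ h)) (*-zeroʳ (χ b * g m))) (λ _ → refl))
          (*-assoc (χ b) (g m) (G (b ℕ.* m))))

    -- The Euler factor at `ℓ`, with coefficients `c`, splits off from `g`. The property is stated
    -- one prime at a time because in this form it is inherited by convolution with a completely
    -- multiplicative function.
    LocallyMultiplicative : ℕ → (ℕ → ℚ) → (ℕ → ℚ) → Set
    LocallyMultiplicative ℓ g c = ∀ j v → 1 ℕ.≤ v → ¬ ℓ ℕ.∣ v → ℓ ℕ.^ j ℕ.* v ℕ.≤ N → g (ℓ ℕ.^ j ℕ.* v) ≡ c j * g v

    module _ {ℓ : ℕ} (pr : Prime ℓ) (χ g c : ℕ → ℚ) (χ-* : ∀ m n → χ (m ℕ.* n) ≡ χ m * χ n) (local : LocallyMultiplicative ℓ g c) where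
      private
        instance
          nz : ℕ.NonZero ℓ
          nz = prime⇒nonZero pr
        F : ℕ → ℕ → ℚ
        F b m = χ b * g m

      module _ (j v : ℕ) (1≤v : 1 ℕ.≤ v) (ℓ∤v : ¬ ℓ ℕ.∣ v) (bound : ℓ ℕ.^ suc j ℕ.* v ℕ.≤ N) where
        private
          n = ℓ ℕ.^ j ℕ.* v
          L = ℓ ℕ.^ suc j
          Lv≡ℓn : L ℕ.* v ≡ ℓ ℕ.* n
          Lv≡ℓn = ℕ.*-assoc ℓ (ℓ ℕ.^ j) v
          pow≥1 : ∀ i → 1 ℕ.≤ ℓ ℕ.^ i
          pow≥1 i = ℕ.m^n>0 ℓ i
          1≤n : 1 ℕ.≤ n
          1≤n = 1≤-* (pow≥1 j) 1≤v
          lem₁ : ∀ ℓ b m → ℓ ℕ.* b ℕ.* m ≡ ℓ ℕ.* (b ℕ.* m)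
          lem₁ = solve-∀ⁿ
          lem₂ : ∀ L b m → b ℕ.* (L ℕ.* m) ≡ L ℕ.* (b ℕ.* m)
          lem₂ = solve-∀ⁿ

          A B : ℕ → ℕ → ℕ → ℚ
          A b m b' = δ (ℓ ℕ.* b') b * (δ (b' ℕ.* m) n * F b m)
          B b m m' = δ (L ℕ.* m') m * (δ (b ℕ.* m') v * F b m)

          -- A divisor b of ℓ n is either ℓ b' with b' | n, or prime to ℓ and then a divisor of v.
          pointwise : ∀ b m → 1 ℕ.≤ b → b ℕ.≤ N → 1 ℕ.≤ m → m ℕ.≤ N → δ (b ℕ.* m) (L ℕ.* v) * F b m ≡ ∑ N (A b m) + ∑ N (B b m)
          pointwise b m 1≤b b≤N 1≤m m≤N with b ℕ.* m ℕ.≟ L ℕ.* v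
          ... | no ne = trans (*-zeroˡ (F b m)) (sym (cong₂ _+_
              (∑-zero N (λ b' _ _ → A-zero b')) (∑-zero N (λ m' _ _ → B-zero m'))))
            where
            A-zero : ∀ b' → A b m b' ≡ 0ℚ
            A-zero b' with ℓ ℕ.* b' ℕ.≟ b
            ... | no _ = *-zeroˡ (δ (b' ℕ.* m) n * F b m)
            ... | yes refl = trans (*-identityˡ _) (δ-vanish (F b m) (λ e → ne (trans (lem₁ ℓ b' m) (trans (cong (ℓ ℕ.*_) e) (sym Lv≡ℓn)))))
            B-zero : ∀ m' → B b m m' ≡ 0ℚ
            B-zero m' with L ℕ.* m' ℕ.≟ m
            ... | no _ = *-zeroˡ (δ (b ℕ.* m') v * F b m)
            ... | yes refl = trans (*-identityˡ _) (δ-vanish (F b m) (λ e → ne (trans (lem₂ L b m') (cong (L ℕ.*_) e))))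
          ... | yes e = trans (*-identityˡ (F b m)) (go (ℓ ℕ.∣? b))
            where
            go : Dec (ℓ ℕ.∣ b) → F b m ≡ ∑ N (A b m) + ∑ N (B b m)
            go (yes (ℕ.divides k b≡)) = sym (trans (cong₂ _+_ (trans (∑-single N {A b m} k 1≤k k≤N others) at-k) (∑-zero N (λ m' _ _ → B-zero m'))) (+-identityʳ (F b m)))
              where
              ℓk≡b : ℓ ℕ.* k ≡ b
              ℓk≡b = trans (ℕ.*-comm ℓ k) (sym b≡)
              1≤k : 1 ℕ.≤ k
              1≤k = 1≤-factorʳ {ℓ} 1≤b ℓk≡b
              k≤N : k ℕ.≤ N
              k≤N = ℕ.≤-trans (ℕ.m≤n*m k ℓ) (ℕ.≤-trans (ℕ.≤-reflexive ℓk≡b) b≤N)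
              others : ∀ i → 1 ℕ.≤ i → i ℕ.≤ N → i ≢ k → A b m i ≡ 0ℚ
              others i _ _ ne = δ-vanish (δ (i ℕ.* m) n * F b m) (λ e' → ne (ℕ.*-cancelˡ-≡ i k ℓ (trans e' (sym ℓk≡b))))
              at-k : A b m k ≡ F b m
              at-k = trans (δ-one (δ (k ℕ.* m) n * F b m) ℓk≡b)
                (δ-one (F b m) (ℕ.*-cancelˡ-≡ (k ℕ.* m) n ℓ (trans (sym (lem₁ ℓ k m)) (trans (cong (ℕ._* m) ℓk≡b) (trans e Lv≡ℓn)))))
              B-zero : ∀ m' → B b m m' ≡ 0ℚ
              B-zero m' = trans (cong (δ (L ℕ.* m') m *_) (δ-vanish (F b m) (λ e' → ℓ∤v (subst (ℓ ℕ.∣_) e' (ℕ.∣m⇒∣m*n m' (ℕ.divides k b≡))))))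
                                (*-zeroʳ (δ (L ℕ.* m') m))
            go (no ℓ∤b) with coprime-power pr (suc j) {b} {m} {v} ℓ∤b e
            ... | m₀ , m≡ = sym (trans (cong₂ _+_ (∑-zero N (λ b' _ _ → A-zero b')) (trans (∑-single N {B b m} m₀ 1≤m₀ m₀≤N others) at-m₀)) (+-identityˡ (F b m)))
              where
              instance
                nzL : ℕ.NonZero L
                nzL = ℕ.>-nonZero (pow≥1 (suc j))
              A-zero : ∀ b' → A b m b' ≡ 0ℚ
              A-zero b' = δ-vanish (δ (b' ℕ.* m) n * F b m) (λ e' → ℓ∤b (ℕ.divides b' (trans (sym e') (ℕ.*-comm ℓ b'))))
              1≤m₀ : 1 ℕ.≤ m₀
              1≤m₀ = 1≤-factorʳ {L} 1≤m (sym m≡)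
              m₀≤N : m₀ ℕ.≤ N
              m₀≤N = ℕ.≤-trans (ℕ.m≤n*m m₀ L) (ℕ.≤-trans (ℕ.≤-reflexive (sym m≡)) m≤N)
              others : ∀ i → 1 ℕ.≤ i → i ℕ.≤ N → i ≢ m₀ → B b m i ≡ 0ℚ
              others i _ _ ne = δ-vanish (δ (b ℕ.* i) v * F b m) (λ e' → ne (ℕ.*-cancelˡ-≡ i m₀ L (trans e' m≡)))
              at-m₀ : B b m m₀ ≡ F b m
              at-m₀ = trans (δ-one (δ (b ℕ.* m₀) v * F b m) (sym m≡))
                (δ-one (F b m) (ℕ.*-cancelˡ-≡ (b ℕ.* m₀) v L (trans (sym (lem₂ L b m₀)) (trans (cong (b ℕ.*_) (sym m≡)) e))))

          sum-A : ∑ N (λ b → ∑ N (λ m → ∑ N (A b m))) ≡ χ ℓ * conv χ g n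
          sum-A = begin
            ∑ N (λ b → ∑ N (λ m → ∑ N (A b m)))             ≡⟨ ∑-cong N (λ b _ _ → ∑-swap N N (A b)) ⟩
            ∑ N (λ b → ∑ N (λ b' → ∑ N (λ m → A b m b')))    ≡⟨ ∑-swap N N (λ b b' → ∑ N (λ m → A b m b')) ⟩
            ∑ N (λ b' → ∑ N (λ b → ∑ N (λ m → A b m b')))    ≡⟨ ∑-cong N (λ b' _ _ → ∑-swap N N (λ b m → A b m b')) ⟩
            ∑ N (λ b' → ∑ N (λ m → ∑ N (λ b → A b m b')))    ≡⟨ ∑-cong N (λ b' lb _ → ∑-cong N (λ m lm _ → inner b' m lb lm)) ⟩
            ∑ N (λ b' → ∑ N (λ m → χ ℓ * (δ (b' ℕ.* m) n * F b' m))) ≡⟨ ∑-cong N (λ b' _ _ → ∑-*ˡ N (χ ℓ) (λ m → δ (b' ℕ.* m) n * F b' m)) ⟩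
            ∑ N (λ b' → χ ℓ * ∑ N (λ m → δ (b' ℕ.* m) n * F b' m))   ≡⟨ ∑-*ˡ N (χ ℓ) (λ b' → ∑ N (λ m → δ (b' ℕ.* m) n * F b' m)) ⟩
            χ ℓ * conv χ g n ∎
            where
            open ≡-Reasoning
            lem : ∀ d x b g → d * (x * b * g) ≡ x * (d * (b * g))
            lem = Solver.solve-∀ ℚ-ring
            inner : ∀ b' m → 1 ℕ.≤ b' → 1 ℕ.≤ m → ∑ N (λ b → A b m b') ≡ χ ℓ * (δ (b' ℕ.* m) n * F b' m)
            inner b' m lb lm = collapse (ℓ ℕ.* b') (λ b → δ (b' ℕ.* m) n * F b m) _ (1≤-* (ℕ.>-nonZero⁻¹ ℓ) lb)
              (λ big → trans (cong (χ ℓ *_) (δ-vanish (F b' m) (λ e → ℕ.<⇒≱ big (ℕ.≤-trans (ℕ.*-monoʳ-≤ ℓ (ℕ.≤-trans (ℕ.m≤m*n b' m {{ℕ.>-nonZero lm}}) (ℕ.≤-reflexive e))) (subst (ℕ._≤ N) Lv≡ℓn bound))))) (*-zeroʳ (χ ℓ)))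
              (λ _ → trans (cong (λ z → δ (b' ℕ.* m) n * (z * g m)) (χ-* ℓ b')) (lem (δ (b' ℕ.* m) n) (χ ℓ) (χ b') (g m)))

          sum-B : ∑ N (λ b → ∑ N (λ m → ∑ N (B b m))) ≡ c (suc j) * conv χ g v
          sum-B = begin
            ∑ N (λ b → ∑ N (λ m → ∑ N (B b m)))             ≡⟨ ∑-cong N (λ b _ _ → ∑-swap N N (B b)) ⟩
            ∑ N (λ b → ∑ N (λ m' → ∑ N (λ m → B b m m')))    ≡⟨ ∑-cong N (λ b lb _ → ∑-cong N (λ m' lm _ → inner b m' lb lm)) ⟩
            ∑ N (λ b → ∑ N (λ m → c (suc j) * (δ (b ℕ.* m) v * F b m))) ≡⟨ ∑-cong N (λ b _ _ → ∑-*ˡ N (c (suc j)) (λ m → δ (b ℕ.* m) v * F b m)) ⟩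
            ∑ N (λ b → c (suc j) * ∑ N (λ m → δ (b ℕ.* m) v * F b m))   ≡⟨ ∑-*ˡ N (c (suc j)) (λ b → ∑ N (λ m → δ (b ℕ.* m) v * F b m)) ⟩
            c (suc j) * conv χ g v ∎
            where
            open ≡-Reasoning
            lem : ∀ d x b g → d * (b * (x * g)) ≡ x * (d * (b * g))
            lem = Solver.solve-∀ ℚ-ring
            inner : ∀ b m' → 1 ℕ.≤ b → 1 ℕ.≤ m' → ∑ N (λ m → B b m m') ≡ c (suc j) * (δ (b ℕ.* m') v * F b m')
            inner b m' lb lm = collapse (L ℕ.* m') (λ m → δ (b ℕ.* m') v * F b m) _ (1≤-* (pow≥1 (suc j)) lm)
              (λ big → trans (cong (c (suc j) *_) (δ-vanish (F b m') (λ e → ℕ.<⇒≱ big (Lm≤N e)))) (*-zeroʳ (c (suc j))))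
              (λ _ → at-value (b ℕ.* m' ℕ.≟ v))
              where
              Lm≤N : b ℕ.* m' ≡ v → L ℕ.* m' ℕ.≤ N
              Lm≤N e = ℕ.≤-trans (ℕ.*-monoʳ-≤ L (ℕ.≤-trans (ℕ.m≤n*m m' b {{ℕ.>-nonZero lb}}) (ℕ.≤-reflexive e))) bound
              at-value : Dec (b ℕ.* m' ≡ v) → δ (b ℕ.* m') v * F b (L ℕ.* m') ≡ c (suc j) * (δ (b ℕ.* m') v * F b m')
              at-value (no ne) = trans (δ-vanish (F b (L ℕ.* m')) ne) (sym (trans (cong (c (suc j) *_) (δ-vanish (F b m') ne)) (*-zeroʳ (c (suc j)))))
              at-value (yes e) = trans (cong (λ z → δ (b ℕ.* m') v * (χ b * z)) (local (suc j) m' lm (λ d → ℓ∤v (subst (ℓ ℕ.∣_) e (ℕ.∣n⇒∣m*n b d))) (Lm≤N e)))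
                (lem (δ (b ℕ.* m') v) (c (suc j)) (χ b) (g m'))

        -- In terms of generating functions at `ℓ`: convolution with `χ` multiplies the factor by
        -- `1/(1 - χ(ℓ) x)`, and this is the resulting recursion for the coefficients.
        conv-step : conv χ g (ℓ ℕ.^ suc j ℕ.* v) ≡ χ ℓ * conv χ g (ℓ ℕ.^ j ℕ.* v) + c (suc j) * conv χ g v
        conv-step = begin
          conv χ g (L ℕ.* v)
            ≡⟨ ∑-cong N (λ b lb ub → trans (∑-cong N (λ m lm um → pointwise b m lb ub lm um)) (∑-+ N (λ m → ∑ N (A b m)) (λ m → ∑ N (B b m)))) ⟩
          ∑ N (λ b → ∑ N (λ m → ∑ N (A b m)) + ∑ N (λ m → ∑ N (B b m)))
            ≡⟨ ∑-+ N (λ b → ∑ N (λ m → ∑ N (A b m))) (λ b → ∑ N (λ m → ∑ N (B b m))) ⟩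
          ∑ N (λ b → ∑ N (λ m → ∑ N (A b m))) + ∑ N (λ b → ∑ N (λ m → ∑ N (B b m)))
            ≡⟨ cong₂ _+_ sum-A sum-B ⟩
          χ ℓ * conv χ g n + c (suc j) * conv χ g v ∎
          where open ≡-Reasoning

    -- Coefficients of c(x)/(1 - s x).
    series : ℚ → (ℕ → ℚ) → ℕ → ℚ
    series s c zero = 1ℚ
    series s c (suc j) = s * series s c j + c (suc j)

    conv-local : ∀ {ℓ} → Prime ℓ → ∀ χ g c → (∀ m n → χ (m ℕ.* n) ≡ χ m * χ n) →
      LocallyMultiplicative ℓ g c → LocallyMultiplicative ℓ (conv χ g) (series (χ ℓ) c)
    conv-local {ℓ} pr χ g c χ-* local zero v 1≤v ℓ∤v b = trans (cong (conv χ g) (ℕ.+-identityʳ v)) (sym (*-identityˡ (conv χ g v)))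
    conv-local {ℓ} pr χ g c χ-* local (suc j) v 1≤v ℓ∤v b =
      trans (conv-step pr χ g c χ-* local j v 1≤v ℓ∤v b)
        (trans (cong (λ z → χ ℓ * z + c (suc j) * conv χ g v) (conv-local pr χ g c χ-* local j v 1≤v ℓ∤v b'))
          (lem (χ ℓ) (series (χ ℓ) c j) (conv χ g v) (c (suc j))))
      where
      b' : ℓ ℕ.^ j ℕ.* v ℕ.≤ N
      b' = ℕ.≤-trans (ℕ.*-monoˡ-≤ v (ℕ.m≤n*m (ℓ ℕ.^ j) ℓ {{prime⇒nonZero pr}})) b
      lem : ∀ x s h c → x * (s * h) + c * h ≡ (x * s + c) * h
      lem = Solver.solve-∀ ℚ-ring

    conv-1 : 1 ℕ.≤ N → ∀ χ g → χ 1 ≡ 1ℚ → g 1 ≡ 1ℚ → conv χ g 1 ≡ 1ℚ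
    conv-1 1≤N χ g χ1 g1 = trans (∑-single N 1 ℕ.≤-refl 1≤N (λ b _ _ ne → ∑-zero N (λ m _ _ → δ-vanish (χ b * g m) (λ e → ne (ℕ.m*n≡1⇒m≡1 b m e)))))
      (trans (∑-single N {λ m → δ (1 ℕ.* m) 1 * (χ 1 * g m)} 1 ℕ.≤-refl 1≤N (λ m _ _ ne → δ-vanish (χ 1 * g m) (λ e → ne (ℕ.m*n≡1⇒n≡1 1 m e))))
        (trans (δ-one {1} {1} (χ 1 * g 1) refl) (trans (cong₂ _*_ χ1 g1) (*-identityʳ 1ℚ))))

    -- r below plays the part of the coefficients of the zeta function of a biquadratic field.
    module Biquadratic (1≤N : 1 ℕ.≤ N) (χ₁ χ₂ : ℕ → ℚ)
      (χ₁-* : ∀ m n → χ₁ (m ℕ.* n) ≡ χ₁ m * χ₁ n) (χ₂-* : ∀ m n → χ₂ (m ℕ.* n) ≡ χ₂ m * χ₂ n)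
      (χ₁-1 : χ₁ 1 ≡ 1ℚ) (χ₂-1 : χ₂ 1 ≡ 1ℚ) where

      χ₃ : ℕ → ℚ
      χ₃ n = χ₁ n * χ₂ n

      χ₃-* : ∀ m n → χ₃ (m ℕ.* n) ≡ χ₃ m * χ₃ n
      χ₃-* m n = trans (cong₂ _*_ (χ₁-* m n) (χ₂-* m n)) (lem (χ₁ m) (χ₁ n) (χ₂ m) (χ₂ n))
        where
        lem : ∀ a b c d → a * b * (c * d) ≡ a * c * (b * d)
        lem = Solver.solve-∀ ℚ-ring

      r₂ r₃ r : ℕ → ℚ
      r₂ = conv χ₁ (λ _ → 1ℚ)
      r₃ = conv χ₂ r₂
      r = conv χ₃ r₃

      r-1 : r 1 ≡ 1ℚ
      r-1 = conv-1 1≤N χ₃ r₃ (trans (cong₂ _*_ χ₁-1 χ₂-1) (*-identityʳ 1ℚ)) (conv-1 1≤N χ₂ r₂ χ₂-1 (conv-1 1≤N χ₁ (λ _ → 1ℚ) χ₁-1 refl))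

      -- `S₄ s t` lists the coefficients of `1/((1 - x)(1 - s x)(1 - t x)(1 - s t x))`, the Euler
      -- factor of `r` at a prime where `χ₁ = s` and `χ₂ = t`; `S₂` and `S₃` are its partial
      -- products.
      S₂ S₃ S₄ : ℚ → ℚ → ℕ → ℚ
      S₂ s t = series s (λ _ → 1ℚ)
      S₃ s t = series t (S₂ s t)
      S₄ s t = series (s * t) (S₃ s t)

      r-local : ∀ {ℓ} → Prime ℓ → LocallyMultiplicative ℓ r (S₄ (χ₁ ℓ) (χ₂ ℓ))
      r-local {ℓ} pr = conv-local pr χ₃ r₃ (S₃ (χ₁ ℓ) (χ₂ ℓ)) χ₃-* (conv-local pr χ₂ r₂ (S₂ (χ₁ ℓ) (χ₂ ℓ)) χ₂-* (conv-local pr χ₁ (λ _ → 1ℚ) (λ _ → 1ℚ) χ₁-* (λ _ _ _ _ _ → refl)))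

      -- For `s = t = 1` the factor is `1/(1 - x)⁴`. For any other signs two of `1, s, t, s t` are
      -- `1` and two are `-1`, so it is `1/(1 - x²)²`, with coefficient `k + 1` at `x^(2k)` and zero
      -- at odd exponents.
      record Pattern (s t : ℚ) : Set where
        field
          even-pos : ∀ k → 1ℚ ≤ S₄ s t (double k)
          nonneg   : ∀ j → 0ℚ ≤ S₄ s t j
          odd-zero : (s ≡ 1ℚ × t ≡ 1ℚ) ⊎ (∀ k → S₄ s t (suc (double k)) ≡ 0ℚ)

      private
        by-parity : ∀ (P : ℕ → Set) → (∀ k → P (double k)) → (∀ k → P (suc (double k))) → ∀ j → P j
        by-parity P e o zero = e 0
        by-parity P e o (suc zero) = o 0
        by-parity P e o (suc (suc j)) = by-parity (λ j → P (suc (suc j))) (λ k → e (suc k)) (λ k → o (suc k)) j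

        1≤1+ι : ∀ k → 1ℚ ≤ 1ℚ + ι k
        1≤1+ι k = subst (_≤ 1ℚ + ι k) (+-identityʳ 1ℚ) (+-monoʳ-≤ 1ℚ (0≤ι k))

        closed-form⇒pattern : ∀ s t → (∀ k → S₄ s t (double k) ≡ 1ℚ + ι k) → (∀ k → S₄ s t (suc (double k)) ≡ 0ℚ) → Pattern s t
        closed-form⇒pattern s t e o = record
          { even-pos = λ k → subst (1ℚ ≤_) (sym (e k)) (1≤1+ι k)
          ; nonneg = by-parity (λ j → 0ℚ ≤ S₄ s t j) (λ k → subst (0ℚ ≤_) (sym (e k)) (≤-trans 0≤1 (1≤1+ι k))) (λ k → ≤-reflexive (sym (o k)))
          ; odd-zero = inj₂ o }

        -- Treats the three nontrivial sign pairs together: at exponent `2k` the coefficient of `S₂`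
        -- is `1 + α k`, with `α = 2` for `s = 1` and `α = 0` for `s = -1`, and that of `S₃` is
        -- `1 + k`. `Σ₂`, `Σ₃` and `Σ₄` are the recursions in this form.
        module _ (s t : ℚ) (α : ℚ)
          (Σ₂ : ∀ x → s * (s * x + 1ℚ) + 1ℚ ≡ x + α)
          (Σ₃ : ∀ x → t * (t * (1ℚ + x) + (s * (1ℚ + α * x) + 1ℚ)) + (1ℚ + α * (1ℚ + x)) ≡ 1ℚ + (1ℚ + x))
          (Σ₄ : ∀ x → s * t * (1ℚ + x) + (t * (1ℚ + x) + (s * (1ℚ + α * x) + 1ℚ)) ≡ 0ℚ) where
          f₂ : ∀ k → S₂ s t (double k) ≡ 1ℚ + α * ι k
          f₂ zero = sym (trans (cong (1ℚ +_) (*-zeroʳ α)) (+-identityʳ 1ℚ))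
          f₂ (suc k) = trans (Σ₂ (S₂ s t (double k))) (trans (cong (_+ α) (f₂ k)) (lem α (ι k)))
            where
            lem : ∀ a x → 1ℚ + a * x + a ≡ 1ℚ + a * (1ℚ + x)
            lem = Solver.solve-∀ ℚ-ring
          f₃ : ∀ k → S₃ s t (double k) ≡ 1ℚ + ι k
          f₃ zero = refl
          f₃ (suc k) = trans (cong₂ (λ x y → t * (t * x + (s * y + 1ℚ)) + S₂ s t (double (suc k))) (f₃ k) (f₂ k))
            (trans (cong (λ z → t * (t * (1ℚ + ι k) + (s * (1ℚ + α * ι k) + 1ℚ)) + z) (f₂ (suc k))) (Σ₃ (ι k)))
          odd : ∀ k → S₄ s t (double k) ≡ 1ℚ + ι k → S₄ s t (suc (double k)) ≡ 0ℚ
          odd k f₄ = trans (cong₂ (λ x y → s * t * x + (t * y + (s * S₂ s t (double k) + 1ℚ))) f₄ (f₃ k))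
            (trans (cong (λ z → s * t * (1ℚ + ι k) + (t * (1ℚ + ι k) + (s * z + 1ℚ))) (f₂ k)) (Σ₄ (ι k)))
          f₄ : ∀ k → S₄ s t (double k) ≡ 1ℚ + ι k
          f₄ zero = refl
          f₄ (suc k) = trans (cong₂ (λ x y → s * t * x + y) (odd k (f₄ k)) (f₃ (suc k))) (trans (cong (_+ ι (suc (suc k))) (*-zeroʳ (s * t))) (+-identityˡ _))

          affine⇒pattern : Pattern s t
          affine⇒pattern = closed-form⇒pattern s t f₄ (λ k → odd k (f₄ k))

      pattern++ : Pattern 1ℚ 1ℚ
      pattern++ = record { even-pos = λ k → ≥1 _ (S₃≥1) (double k) ; nonneg = λ j → ≤-trans 0≤1 (≥1 _ S₃≥1 j) ; odd-zero = inj₁ (refl , refl) }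
        where
        ≥1 : ∀ c → (∀ j → 1ℚ ≤ c j) → ∀ j → 1ℚ ≤ series 1ℚ c j
        ≥1 c h zero = ≤-refl
        ≥1 c h (suc j) = subst (_≤ series 1ℚ c (suc j)) (+-identityˡ 1ℚ)
          (+-mono-≤ (≤-trans 0≤1 (subst (1ℚ ≤_) (sym (*-identityˡ (series 1ℚ c j))) (≥1 c h j))) (h (suc j)))
        S₃≥1 : ∀ j → 1ℚ ≤ S₃ 1ℚ 1ℚ j
        S₃≥1 = ≥1 _ (≥1 _ (λ _ → ≤-refl))

      pattern+- : Pattern (1ℚ) ((- 1ℚ))
      pattern+- = affine⇒pattern (1ℚ) ((- 1ℚ)) (1ℚ + 1ℚ) lem₁ lem₂ lem₃
        where
        lem₁ : ∀ x → 1ℚ * (1ℚ * x + 1ℚ) + 1ℚ ≡ x + (1ℚ + 1ℚ)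
        lem₁ = Solver.solve-∀ ℚ-ring
        lem₂ : ∀ x → (- 1ℚ) * ((- 1ℚ) * (1ℚ + x) + (1ℚ * (1ℚ + (1ℚ + 1ℚ) * x) + 1ℚ)) + (1ℚ + (1ℚ + 1ℚ) * (1ℚ + x)) ≡ 1ℚ + (1ℚ + x)
        lem₂ = Solver.solve-∀ ℚ-ring
        lem₃ : ∀ x → 1ℚ * (- 1ℚ) * (1ℚ + x) + ((- 1ℚ) * (1ℚ + x) + (1ℚ * (1ℚ + (1ℚ + 1ℚ) * x) + 1ℚ)) ≡ 0ℚ
        lem₃ = Solver.solve-∀ ℚ-ring

      pattern-+ : Pattern ((- 1ℚ)) (1ℚ)
      pattern-+ = affine⇒pattern ((- 1ℚ)) (1ℚ) (0ℚ) lem₁ lem₂ lem₃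
        where
        lem₁ : ∀ x → (- 1ℚ) * ((- 1ℚ) * x + 1ℚ) + 1ℚ ≡ x + (0ℚ)
        lem₁ = Solver.solve-∀ ℚ-ring
        lem₂ : ∀ x → 1ℚ * (1ℚ * (1ℚ + x) + ((- 1ℚ) * (1ℚ + (0ℚ) * x) + 1ℚ)) + (1ℚ + (0ℚ) * (1ℚ + x)) ≡ 1ℚ + (1ℚ + x)
        lem₂ = Solver.solve-∀ ℚ-ring
        lem₃ : ∀ x → (- 1ℚ) * 1ℚ * (1ℚ + x) + (1ℚ * (1ℚ + x) + ((- 1ℚ) * (1ℚ + (0ℚ) * x) + 1ℚ)) ≡ 0ℚ
        lem₃ = Solver.solve-∀ ℚ-ring

      pattern-- : Pattern ((- 1ℚ)) ((- 1ℚ))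
      pattern-- = affine⇒pattern ((- 1ℚ)) ((- 1ℚ)) (0ℚ) lem₁ lem₂ lem₃
        where
        lem₁ : ∀ x → (- 1ℚ) * ((- 1ℚ) * x + 1ℚ) + 1ℚ ≡ x + (0ℚ)
        lem₁ = Solver.solve-∀ ℚ-ring
        lem₂ : ∀ x → (- 1ℚ) * ((- 1ℚ) * (1ℚ + x) + ((- 1ℚ) * (1ℚ + (0ℚ) * x) + 1ℚ)) + (1ℚ + (0ℚ) * (1ℚ + x)) ≡ 1ℚ + (1ℚ + x)
        lem₂ = Solver.solve-∀ ℚ-ring
        lem₃ : ∀ x → (- 1ℚ) * (- 1ℚ) * (1ℚ + x) + ((- 1ℚ) * (1ℚ + x) + ((- 1ℚ) * (1ℚ + (0ℚ) * x) + 1ℚ)) ≡ 0ℚ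
        lem₃ = Solver.solve-∀ ℚ-ring

      signs⇒pattern : ∀ {s t} → Sign s → Sign t → Pattern s t
      signs⇒pattern (inj₁ refl) (inj₁ refl) = pattern++
      signs⇒pattern (inj₁ refl) (inj₂ refl) = pattern+-
      signs⇒pattern (inj₂ refl) (inj₁ refl) = pattern-+
      signs⇒pattern (inj₂ refl) (inj₂ refl) = pattern--

      SignsAt : ℕ → Set
      SignsAt n = ∀ {ℓ} → Prime ℓ → ℓ ℕ.∣ n → Sign (χ₁ ℓ) × Sign (χ₂ ℓ)

      private
        pattern-at : ∀ {n ℓ} → SignsAt n → Prime ℓ → ℓ ℕ.∣ n → Pattern (χ₁ ℓ) (χ₂ ℓ)
        pattern-at sg pr d = signs⇒pattern (proj₁ (sg pr d)) (proj₂ (sg pr d))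

        record Peeled (n : ℕ) : Set where
          field
            ℓ j v     : ℕ
            pr        : Prime ℓ
            equation  : n ≡ ℓ ℕ.^ j ℕ.* v
            1≤v       : 1 ℕ.≤ v
            coprime   : ¬ ℓ ℕ.∣ v
            ℓ∣n       : ℓ ℕ.∣ n
            v<n       : v ℕ.< n

        peel : ∀ n → 2 ℕ.≤ n → Peeled n
        peel n 2≤n = go (prime-factor n 2≤n)
          where
          go : (∃ λ ℓ → Prime ℓ × ℓ ℕ.∣ n) → Peeled n
          go (ℓ , pr , ℓ∣n) with splitPower pr n (ℕ.<⇒≤ 2≤n)
          ... | zero , v , e , 1≤v , ∤ = ⊥-elim (∤ (subst (ℓ ℕ.∣_) (trans e (ℕ.+-identityʳ v)) ℓ∣n))
          ... | suc j , v , e , 1≤v , ∤ = record { ℓ = ℓ ; j = suc j ; v = v ; pr = pr ; equation = e ; 1≤v = 1≤v ; coprime = ∤ ; ℓ∣n = ℓ∣n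
            ; v<n = subst (v ℕ.<_) (trans (ℕ.*-comm v (ℓ ℕ.^ suc j)) (sym e)) (ℕ.m<m*n v (ℓ ℕ.^ suc j) {{ℕ.>-nonZero 1≤v}}
                      (ℕ.≤-trans (prime>1 pr) (ℕ.m≤m*n ℓ (ℓ ℕ.^ j) {{ℕ.>-nonZero (ℕ.m^n>0 ℓ {{prime⇒nonZero pr}} j)}}))) }

        smaller-signs : ∀ {n m} → m ℕ.∣ n → SignsAt n → SignsAt m
        smaller-signs d sg pr d' = sg pr (ℕ.∣-trans d' d)

      r-nonneg : ∀ n → 1 ℕ.≤ n → n ℕ.≤ N → SignsAt n → 0ℚ ≤ r n
      r-nonneg = <-rec _ step
        where
        step : ∀ n → (∀ {m} → m ℕ.< n → 1 ℕ.≤ m → m ℕ.≤ N → SignsAt m → 0ℚ ≤ r m) → 1 ℕ.≤ n → n ℕ.≤ N → SignsAt n → 0ℚ ≤ r n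
        step n rec 1≤n n≤N sg with n ℕ.≟ 1
        ... | yes refl = subst (0ℚ ≤_) (sym r-1) 0≤1
        ... | no ne = subst (0ℚ ≤_) (sym (trans (cong r equation) (r-local pr j v 1≤v coprime (subst (ℕ._≤ N) equation n≤N))))
            (*-nonneg (Pattern.nonneg (pattern-at sg pr ℓ∣n) j) (rec v<n 1≤v (ℕ.≤-trans (ℕ.<⇒≤ v<n) n≤N) (smaller-signs (subst (v ℕ.∣_) (sym equation) (ℕ.n∣m*n (ℓ ℕ.^ j))) sg)))
          where open Peeled (peel n (ℕ.≤∧≢⇒< 1≤n (ne ∘ sym)))

      -- All exponents of a square are even, and every even coefficient is at least 1; the induction
      -- removes one prime with its full power.
      r-square : ∀ k → 1 ℕ.≤ k → k ℕ.* k ℕ.≤ N → SignsAt k → 1ℚ ≤ r (k ℕ.* k)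
      r-square = <-rec _ step
        where
        pow-double : ∀ ℓ j → ℓ ℕ.^ double j ≡ ℓ ℕ.^ j ℕ.* ℓ ℕ.^ j
        pow-double ℓ zero = refl
        pow-double ℓ (suc j) = trans (cong (λ z → ℓ ℕ.* (ℓ ℕ.* z)) (pow-double ℓ j)) (lem ℓ (ℓ ℕ.^ j))
          where
          lem : ∀ ℓ x → ℓ ℕ.* (ℓ ℕ.* (x ℕ.* x)) ≡ ℓ ℕ.* x ℕ.* (ℓ ℕ.* x)
          lem = solve-∀ⁿ
        lem : ∀ x v → x ℕ.* v ℕ.* (x ℕ.* v) ≡ x ℕ.* x ℕ.* (v ℕ.* v)
        lem = solve-∀ⁿ
        step : ∀ k → (∀ {m} → m ℕ.< k → 1 ℕ.≤ m → m ℕ.* m ℕ.≤ N → SignsAt m → 1ℚ ≤ r (m ℕ.* m)) → 1 ℕ.≤ k → k ℕ.* k ℕ.≤ N → SignsAt k → 1ℚ ≤ r (k ℕ.* k)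
        step k rec 1≤k k²≤N sg with k ℕ.≟ 1
        ... | yes refl = ≤-reflexive (sym r-1)
        ... | no ne = subst (1ℚ ≤_) (sym (trans (cong r k²≡) (r-local pr (double j) (v ℕ.* v) (1≤-* 1≤v 1≤v) (λ d → [ coprime , coprime ]′ (euclidsLemma v v pr d)) (subst (ℕ._≤ N) k²≡ k²≤N))))
            (≤-trans (≤-reflexive (sym (*-identityʳ 1ℚ))) (*-mono 0≤1 (≤-trans 0≤1 rv) (Pattern.even-pos (pattern-at sg pr ℓ∣n) j) rv))
          where
          open Peeled (peel k (ℕ.≤∧≢⇒< 1≤k (ne ∘ sym)))
          k²≡ : k ℕ.* k ≡ ℓ ℕ.^ double j ℕ.* (v ℕ.* v)
          k²≡ = trans (cong₂ ℕ._*_ equation equation) (trans (lem (ℓ ℕ.^ j) v) (cong (ℕ._* (v ℕ.* v)) (sym (pow-double ℓ j))))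
          rv : 1ℚ ≤ r (v ℕ.* v)
          rv = rec v<n 1≤v (ℕ.≤-trans (ℕ.*-mono-≤ (ℕ.<⇒≤ v<n) (ℕ.<⇒≤ v<n)) k²≤N) (smaller-signs (subst (v ℕ.∣_) (sym equation) (ℕ.n∣m*n (ℓ ℕ.^ j))) sg)

      -- An odd exponent with nonzero coefficient excludes the factor `1/(1 - x²)²`, hence forces
      -- both signs to be 1.
      r-odd-power : ∀ {ℓ} → Prime ℓ → ∀ i v → 1 ℕ.≤ v → ¬ ℓ ℕ.∣ v → ℓ ℕ.^ suc (double i) ℕ.* v ℕ.≤ N → Sign (χ₁ ℓ) × Sign (χ₂ ℓ) →
        r (ℓ ℕ.^ suc (double i) ℕ.* v) ≢ 0ℚ → χ₁ ℓ ≡ 1ℚ × χ₂ ℓ ≡ 1ℚ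
      r-odd-power {ℓ} pr i v 1≤v ∤ b (s₁ , s₂) ne with Pattern.odd-zero (signs⇒pattern s₁ s₂)
      ... | inj₁ h = h
      ... | inj₂ z = ⊥-elim (ne (trans (r-local pr (suc (double i)) v 1≤v ∤ b) (trans (cong (_* r v) (z i)) (*-zeroˡ (r v)))))

      r-sum : ∀ (G : ℕ → ℚ) → (∀ n → N ℕ.< n → G n ≡ 0ℚ) → ∑ N (λ n → r n * G n) ≡
        ∑ N (λ e → χ₃ e * ∑ N (λ c → χ₂ c * ∑ N (λ b → χ₁ b * ∑ N (λ a → 1ℚ * G (e ℕ.* (c ℕ.* (b ℕ.* a)))))))
      r-sum G big = trans (conv-sum χ₃ r₃ G big) (∑-cong N (λ e le _ → cong (χ₃ e *_)
        (trans (conv-sum χ₂ r₂ (λ n → G (e ℕ.* n)) (λ n h → big _ (ℕ.<-≤-trans h (ℕ.m≤n*m n e {{ℕ.>-nonZero le}}))))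
          (∑-cong N (λ c lc _ → cong (χ₂ c *_) (conv-sum χ₁ (λ _ → 1ℚ) (λ n → G (e ℕ.* (c ℕ.* n)))
            (λ n h → big _ (ℕ.<-≤-trans h (ℕ.≤-trans (ℕ.m≤n*m n c {{ℕ.>-nonZero lc}}) (ℕ.m≤n*m (c ℕ.* n) e {{ℕ.>-nonZero le}}))))))))))

-- Summation by parts in several variables, with rational weights.

module Abel where
  import Tactic.RingSolver as Solver
  open RationalSums
  open import Data.Nat as ℕ using (ℕ; zero; suc)
  import Data.Nat.Properties as ℕ
  import Data.Nat.DivMod as ℕ
  open import Data.Nat.Tactic.RingSolver using () renaming (solve-∀ to solve-∀ⁿ)
  open import Data.Rational using (ℚ; 0ℚ; 1ℚ; _+_; _-_; _*_; -_; _≤_; ∣_∣)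
  open import Data.Rational.Properties
  open import Data.Product using (_×_; _,_)
  open import Relation.Binary.PropositionalEquality

  -- Curried, so that a partial sum over the outermost variable is again a function of the remaining
  -- ones and the induction on the number of variables is structural.
  Fn : ℕ → Set
  Fn zero = ℚ
  Fn (suc k) = ℕ → Fn k

  infix 4 _≐_
  _≐_ : ∀ {k} → Fn k → Fn k → Set
  _≐_ {zero} f g = f ≡ g
  _≐_ {suc k} f g = ∀ a → f a ≐ g a

  ≐-refl : ∀ {k} {f : Fn k} → f ≐ f
  ≐-refl {zero} = refl
  ≐-refl {suc k} a = ≐-refl

  ≐-sym : ∀ {k} {f g : Fn k} → f ≐ g → g ≐ f
  ≐-sym {zero} e = sym e
  ≐-sym {suc k} e a = ≐-sym (e a)

  ≐-trans : ∀ {k} {f g h : Fn k} → f ≐ g → g ≐ h → f ≐ h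
  ≐-trans {zero} e e' = trans e e'
  ≐-trans {suc k} e e' a = ≐-trans (e a) (e' a)

  0F : ∀ {k} → Fn k
  0F {zero} = 0ℚ
  0F {suc k} a = 0F

  infixl 6 _⊕_
  _⊕_ : ∀ {k} → Fn k → Fn k → Fn k
  _⊕_ {zero} f g = f + g
  _⊕_ {suc k} f g a = f a ⊕ g a

  ⊕-cong : ∀ {k} {f f' g g' : Fn k} → f ≐ f' → g ≐ g' → f ⊕ g ≐ f' ⊕ g'
  ⊕-cong {zero} e e' = cong₂ _+_ e e'
  ⊕-cong {suc k} e e' a = ⊕-cong (e a) (e' a)

  ⊕-0 : ∀ {k} → 0F {k} ⊕ 0F ≐ 0F
  ⊕-0 {zero} = refl
  ⊕-0 {suc k} a = ⊕-0

  ⊕-interchange : ∀ {k} (f g f' g' : Fn k) → (f ⊕ g) ⊕ (f' ⊕ g') ≐ (f ⊕ f') ⊕ (g ⊕ g')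
  ⊕-interchange {zero} = lem
    where
    lem : ∀ a b c d → a + b + (c + d) ≡ a + c + (b + d)
    lem = Solver.solve-∀ ℚ-ring
  ⊕-interchange {suc k} f g f' g' a = ⊕-interchange (f a) (g a) (f' a) (g' a)

  ⊕-identityˡ : ∀ {k} (f : Fn k) → 0F ⊕ f ≐ f
  ⊕-identityˡ {zero} f = +-identityˡ f
  ⊕-identityˡ {suc k} f a = ⊕-identityˡ (f a)

  psum : ∀ {k} → ℕ → (ℕ → Fn k) → Fn k
  psum zero f = 0F
  psum (suc n) f = psum n f ⊕ f (suc n)

  psum-⊕ : ∀ {k} n (f g : ℕ → Fn k) → psum n (λ a → f a ⊕ g a) ≐ psum n f ⊕ psum n g
  psum-⊕ zero f g = ≐-sym ⊕-0
  psum-⊕ (suc n) f g = ≐-trans (⊕-cong (psum-⊕ n f g) ≐-refl) (⊕-interchange (psum n f) (psum n g) (f (suc n)) (g (suc n)))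

  psum-cong : ∀ {k} n {f g : ℕ → Fn k} → (∀ a → f a ≐ g a) → psum n f ≐ psum n g
  psum-cong zero e = ≐-refl
  psum-cong (suc n) e = ⊕-cong (psum-cong n e) (e (suc n))

  psum-0 : ∀ {k} n {f : ℕ → Fn k} → (∀ a → f a ≐ 0F) → psum n f ≐ 0F
  psum-0 zero e = ≐-refl
  psum-0 (suc n) e = ≐-trans (⊕-cong (psum-0 n e) (e (suc n))) ⊕-0

  psum-eval : ∀ {k} n (f : ℕ → Fn (suc k)) a → psum n f a ≐ psum n (λ i → f i a)
  psum-eval zero f a = ≐-refl
  psum-eval (suc n) f a = ⊕-cong (psum-eval n f a) ≐-refl

  pow : ℚ → ℕ → ℚ
  pow x zero = 1ℚ
  pow x (suc k) = x * pow x k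

  pow-nonneg : ∀ {x} k → 0ℚ ≤ x → 0ℚ ≤ pow x k
  pow-nonneg zero h = 0≤1
  pow-nonneg (suc k) h = *-nonneg h (pow-nonneg k h)

  module Weighted (N : ℕ) where

    -- Σ f(a₁, ..., a_k) φ(a₁ ⋯ a_k) over all 1 ≤ aᵢ ≤ N.
    S : ∀ k → Fn k → (ℕ → ℚ) → ℚ
    S zero f φ = f * φ 1
    S (suc k) f φ = ∑ N (λ a → S k (f a) (λ n → φ (a ℕ.* n)))

    S-cong : ∀ k {f g φ ψ} → f ≐ g → (∀ n → φ n ≡ ψ n) → S k f φ ≡ S k g ψ
    S-cong zero e e' = cong₂ _*_ e (e' 1)
    S-cong (suc k) e e' = ∑-cong N (λ a _ _ → S-cong k (e a) (λ n → e' (a ℕ.* n)))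

    S-⊕ : ∀ k f g φ → S k (f ⊕ g) φ ≡ S k f φ + S k g φ
    S-⊕ zero f g φ = *-distribʳ-+ (φ 1) f g
    S-⊕ (suc k) f g φ = trans (∑-cong N (λ a _ _ → S-⊕ k (f a) (g a) (λ n → φ (a ℕ.* n)))) (∑-+ N (λ a → S k (f a) (λ n → φ (a ℕ.* n))) (λ a → S k (g a) (λ n → φ (a ℕ.* n))))

    S-0 : ∀ k φ → S k 0F φ ≡ 0ℚ
    S-0 zero φ = *-zeroˡ (φ 1)
    S-0 (suc k) φ = ∑-zero N (λ a _ _ → S-0 k (λ n → φ (a ℕ.* n)))

    S-minus : ∀ k f φ ψ → S k f (λ n → φ n - ψ n) ≡ S k f φ - S k f ψ
    S-minus zero f φ ψ = lem f (φ 1) (ψ 1)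
      where
      lem : ∀ f x y → f * (x - y) ≡ f * x - f * y
      lem = Solver.solve-∀ ℚ-ring
    S-minus (suc k) f φ ψ = trans (∑-cong N (λ a _ _ → S-minus k (f a) (λ n → φ (a ℕ.* n)) (λ n → ψ (a ℕ.* n))))
      (trans (∑-+ N (λ a → S k (f a) (λ n → φ (a ℕ.* n))) (λ a → - S k (f a) (λ n → ψ (a ℕ.* n))))
        (cong (S (suc k) f φ +_) (∑-neg N (λ a → S k (f a) (λ n → ψ (a ℕ.* n))))))

    S-scale : ∀ k f c φ → S k f (λ n → c * φ n) ≡ c * S k f φ
    S-scale zero f c φ = lem f c (φ 1)
      where
      lem : ∀ f c x → f * (c * x) ≡ c * (f * x)
      lem = Solver.solve-∀ ℚ-ring
    S-scale (suc k) f c φ = trans (∑-cong N (λ a _ _ → S-scale k (f a) c (λ n → φ (a ℕ.* n)))) (∑-*ˡ N c (λ a → S k (f a) (λ n → φ (a ℕ.* n))))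

    -- Summation by parts in the outermost variable. The weight depends on the product of the
    -- variables only, so its difference compares the dilations of `φ` by `a` and by `a + 1`.
    abel : ∀ k (f : Fn (suc k)) (φ : ℕ → ℚ) n → ∑ n (λ a → S k (f a) (λ x → φ (a ℕ.* x))) ≡
      ∑ n (λ a → S k (psum a f) (λ x → φ (a ℕ.* x) - φ (suc a ℕ.* x))) + S k (psum n f) (λ x → φ (suc n ℕ.* x))
    abel k f φ zero = sym (trans (cong (0ℚ +_) (S-0 k (λ x → φ (1 ℕ.* x)))) (+-identityˡ 0ℚ))
    abel k f φ (suc n) = begin
      ∑ n (λ a → S k (f a) (λ x → φ (a ℕ.* x))) + S k (f (suc n)) φ₁
        ≡⟨ cong (_+ S k (f (suc n)) φ₁) (abel k f φ n) ⟩
      A + S k (psum n f) φ₁ + S k (f (suc n)) φ₁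
        ≡⟨ +-assoc A (S k (psum n f) φ₁) (S k (f (suc n)) φ₁) ⟩
      A + (S k (psum n f) φ₁ + S k (f (suc n)) φ₁)
        ≡⟨ cong (A +_) (sym (S-⊕ k (psum n f) (f (suc n)) φ₁)) ⟩
      A + S k (psum (suc n) f) φ₁
        ≡⟨ lem A (S k (psum (suc n) f) φ₁) (S k (psum (suc n) f) φ₂) ⟩
      A + (S k (psum (suc n) f) φ₁ - S k (psum (suc n) f) φ₂) + S k (psum (suc n) f) φ₂
        ≡⟨ cong (λ z → A + z + S k (psum (suc n) f) φ₂) (sym (S-minus k (psum (suc n) f) φ₁ φ₂)) ⟩
      A + S k (psum (suc n) f) (λ x → φ₁ x - φ₂ x) + S k (psum (suc n) f) φ₂ ∎
      where
      open ≡-Reasoning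
      φ₁ φ₂ : ℕ → ℚ
      φ₁ x = φ (suc n ℕ.* x)
      φ₂ x = φ (suc (suc n) ℕ.* x)
      A = ∑ n (λ a → S k (psum a f) (λ x → φ (a ℕ.* x) - φ (suc a ℕ.* x)))
      lem : ∀ a x y → a + x ≡ a + (x - y) + y
      lem = Solver.solve-∀ ℚ-ring

    module Periodic (M : ℕ) .{{nzM : ℕ.NonZero M}} where

      -- Periodicity and mean zero hold in each variable separately, the others being arbitrary;
      -- therefore a partial sum in one variable still oscillates in the rest.
      Oscillating : ∀ k → ℚ → Fn k → Set
      Oscillating zero β f = ∣ f ∣ ≤ β
      Oscillating (suc k) β f = (∀ a → Oscillating k β (f a)) × (∀ a → f (a ℕ.+ M) ≐ f a) × (psum M f ≐ 0F)

      osc-resp : ∀ k {β f g} → f ≐ g → Oscillating k β f → Oscillating k β g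
      osc-resp zero e h = subst (λ z → ∣ z ∣ ≤ _) e h
      osc-resp (suc k) e (h , p , z) = (λ a → osc-resp k (e a) (h a)) ,
        (λ a → ≐-trans (≐-sym (e (a ℕ.+ M))) (≐-trans (p a) (e a))) , ≐-trans (psum-cong M (λ a → ≐-sym (e a))) z

      osc-mono : ∀ k {β β' f} → β ≤ β' → Oscillating k β f → Oscillating k β' f
      osc-mono zero le h = ≤-trans h le
      osc-mono (suc k) le (h , p , z) = (λ a → osc-mono k le (h a)) , p , z

      osc-0 : ∀ k → Oscillating k 0ℚ 0F
      osc-0 zero = ≤-refl
      osc-0 (suc k) = (λ a → osc-0 k) , (λ a → ≐-refl) , psum-0 M (λ a → ≐-refl)

      osc-⊕ : ∀ k {β β' f g} → Oscillating k β f → Oscillating k β' g → Oscillating k (β + β') (f ⊕ g)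
      osc-⊕ zero {f = f} {g} h h' = ≤-trans (∣p+q∣≤∣p∣+∣q∣ f g) (+-mono-≤ h h')
      osc-⊕ (suc k) {f = f} {g} (h , p , z) (h' , p' , z') = (λ a → osc-⊕ k (h a) (h' a)) , (λ a → ⊕-cong (p a) (p' a)) ,
        ≐-trans (psum-⊕ M f g) (≐-trans (⊕-cong z z') ⊕-0)

      osc-psum : ∀ k {β f} n → (∀ a → Oscillating k β (f a)) → Oscillating k (ι n * β) (psum n f)
      osc-psum k {β} zero h = subst (λ z → Oscillating k z 0F) (sym (*-zeroˡ β)) (osc-0 k)
      osc-psum k {β} {f} (suc n) h = subst (λ z → Oscillating k z (psum (suc n) f)) (lem (ι n) β) (osc-⊕ k (osc-psum k n h) (h (suc n)))
        where
        lem : ∀ n b → n * b + b ≡ (1ℚ + n) * b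
        lem = Solver.solve-∀ ℚ-ring

      psum-period : ∀ {k} {f : ℕ → Fn k} → (∀ a → f (a ℕ.+ M) ≐ f a) → psum M f ≐ 0F → ∀ n → psum (n ℕ.+ M) f ≐ psum n f
      psum-period p z zero = z
      psum-period p z (suc n) = ⊕-cong (psum-period p z n) (p (suc n))

      psum-periods : ∀ {k} {f : ℕ → Fn k} → (∀ a → f (a ℕ.+ M) ≐ f a) → psum M f ≐ 0F → ∀ n q → psum (n ℕ.+ q ℕ.* M) f ≐ psum n f
      psum-periods {f = f} p z n zero = subst (λ x → psum x f ≐ psum n f) (sym (ℕ.+-identityʳ n)) ≐-refl
      psum-periods {f = f} p z n (suc q) = subst (λ x → psum x f ≐ psum n f) (lem n M (q ℕ.* M)) (≐-trans (psum-period p z (n ℕ.+ q ℕ.* M)) (psum-periods p z n q))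
        where
        lem : ∀ a b c → a ℕ.+ c ℕ.+ b ≡ a ℕ.+ (b ℕ.+ c)
        lem = solve-∀ⁿ

      -- Complete periods cancel, so at most `M` terms of a partial sum remain, whatever its length.
      osc-partial : ∀ k {β f} → 0ℚ ≤ β → Oscillating (suc k) β f → ∀ a → Oscillating k (ι M * β) (psum a f)
      osc-partial k {β} {f} 0≤β (h , p , z) a = osc-mono k (*-monoʳ 0≤β (ι-mono (ℕ.m%n≤n a M)))
        (osc-resp k (subst (λ x → psum (a ℕ.% M) f ≐ psum x f) (sym (ℕ.m≡m%n+[m/n]*n a M)) (≐-sym (psum-periods p z (a ℕ.% M) (a ℕ./ M))))
          (osc-psum k (a ℕ.% M) h))

      harmonic : ℚ
      harmonic = ∑ N inv

      -- The dilation difference in each variable gains a factor `1/a`, and iterating over `k`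
      -- variables costs only the constant `C`.
      Smooth : ℕ → ℚ → (ℕ → ℚ) → Set
      Smooth zero C φ = ∀ n → ∣ φ n ∣ ≤ C
      Smooth (suc k) C φ = ∀ a → Smooth k C (λ n → ι a * (φ (a ℕ.* n) - φ (suc a ℕ.* n)))

      module _ (q : ℕ) (N≡ : N ≡ q ℕ.* M) where
        -- One summation by parts per variable: each contributes a factor `M` from the partial sums
        -- of `f` and a harmonic sum from the factors `1/a`.
        oscillation-bound : ∀ k {β C f φ} → 0ℚ ≤ β → 0ℚ ≤ C → Oscillating k β f → Smooth k C φ →
          ∣ S k f φ ∣ ≤ β * pow (ι M) k * (C * pow harmonic k)
        oscillation-bound zero {β} {C} {f} {φ} 0≤β 0≤C h s = ≤-trans (≤-reflexive (∣p*q∣≡∣p∣*∣q∣ f (φ 1)))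
          (≤-trans (*-mono (0≤∣p∣ f) 0≤C h (s 1)) (≤-reflexive (cong₂ _*_ (sym (*-identityʳ β)) (sym (*-identityʳ C)))))
        oscillation-bound (suc k) {β} {C} {f} {φ} 0≤β 0≤C osc@(h , p , z) s = begin
          ∣ S (suc k) f φ ∣                                           ≡⟨ cong ∣_∣ (trans (abel k f φ N) (trans (cong (∑ N T +_) last-zero) (+-identityʳ (∑ N T)))) ⟩
          ∣ ∑ N T ∣                                                   ≤⟨ ∑-abs N T ⟩
          ∑ N (λ a → ∣ T a ∣)                                         ≤⟨ ∑-mono N term ⟩
          ∑ N (λ a → inv a * K)                                       ≡⟨ ∑-*ʳ N inv K ⟩
          harmonic * K                                                ≡⟨ lem harmonic (ι M) β (pow (ι M) k) C (pow harmonic k) ⟩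
          β * (ι M * pow (ι M) k) * (C * (harmonic * pow harmonic k)) ∎
          where
          open ≤-Reasoning
          T : ℕ → ℚ
          T a = S k (psum a f) (λ x → φ (a ℕ.* x) - φ (suc a ℕ.* x))
          K = ι M * β * pow (ι M) k * (C * pow harmonic k)
          lem : ∀ H M β P C Q → H * (M * β * P * (C * Q)) ≡ β * (M * P) * (C * (H * Q))
          lem = Solver.solve-∀ ℚ-ring
          -- `N` is a whole number of periods, so the boundary term vanishes.
          last-zero : S k (psum N f) (λ x → φ (suc N ℕ.* x)) ≡ 0ℚ
          last-zero = trans (S-cong k (subst (λ n → psum n f ≐ 0F) (sym N≡) (psum-periods p z 0 q)) (λ _ → refl)) (S-0 k (λ x → φ (suc N ℕ.* x)))
          cancel : ∀ a x → inv (suc a) * (ι (suc a) * x) ≡ x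
          cancel a x = trans (sym (*-assoc (inv (suc a)) (ι (suc a)) x)) (trans (cong (_* x) (trans (*-comm (inv (suc a)) (ι (suc a))) (ι-inv a))) (*-identityˡ x))
          term : ∀ a → 1 ℕ.≤ a → a ℕ.≤ N → ∣ T a ∣ ≤ inv a * K
          term (suc a) _ _ = begin
            ∣ T (suc a) ∣                   ≡⟨ cong ∣_∣ (trans (S-cong k ≐-refl (λ x → sym (cancel a (φ (suc a ℕ.* x) - φ (suc (suc a) ℕ.* x)))))
                                                           (S-scale k (psum (suc a) f) (inv (suc a)) (λ n → ι (suc a) * (φ (suc a ℕ.* n) - φ (suc (suc a) ℕ.* n))))) ⟩
            ∣ inv (suc a) * S' ∣            ≡⟨ trans (∣p*q∣≡∣p∣*∣q∣ (inv (suc a)) S') (cong (_* ∣ S' ∣) (0≤p⇒∣p∣≡p (0≤inv (suc a)))) ⟩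
            inv (suc a) * ∣ S' ∣            ≤⟨ *-monoˡ (0≤inv (suc a)) (oscillation-bound k {ι M * β} {C} {psum (suc a) f} (*-nonneg (0≤ι M) 0≤β) 0≤C (osc-partial k 0≤β osc (suc a)) (s (suc a))) ⟩
            inv (suc a) * K                 ∎
            where S' = S k (psum (suc a) f) (λ n → ι (suc a) * (φ (suc a ℕ.* n) - φ (suc (suc a) ℕ.* n)))

  -- V c stands for n ↦ X/(X + c n) and U c for 1 - V c. Multiplicative differences of V are again
  -- products of such functions, so smoothness is a syntactic matter.
  data Shape : Set where
    v u     : Shape
    _·_ _⊹_ : Shape → Shape → Shape
    neg     : Shape → Shape

  data Expr : Shape → Set where
    V   : ℕ → Expr v
    U   : ℕ → Expr u
    _·_ : ∀ {s t} → Expr s → Expr t → Expr (s · t)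
    _⊹_ : ∀ {s t} → Expr s → Expr t → Expr (s ⊹ t)
    neg : ∀ {s} → Expr s → Expr (neg s)

  ∇ˢ : Shape → Shape
  ∇ˢ v = u · v
  ∇ˢ u = neg (u · v)
  ∇ˢ (s · t) = (∇ˢ s · t) ⊹ (s · ∇ˢ t)
  ∇ˢ (s ⊹ t) = ∇ˢ s ⊹ ∇ˢ t
  ∇ˢ (neg s) = neg (∇ˢ s)

  size : Shape → ℕ
  size v = 1
  size u = 1
  size (s · t) = size s ℕ.* size t
  size (s ⊹ t) = size s ℕ.+ size t
  size (neg s) = size s

  dilate : ℕ → ∀ {s} → Expr s → Expr s
  dilate a (V c) = V (c ℕ.* a)
  dilate a (U c) = U (c ℕ.* a)
  dilate a (E · F) = dilate a E · dilate a F
  dilate a (E ⊹ F) = dilate a E ⊹ dilate a F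
  dilate a (neg E) = neg (dilate a E)

  ∇ : ℕ → ∀ {s} → Expr s → Expr (∇ˢ s)
  ∇ a (V c) = U (c ℕ.* a) · V (c ℕ.* suc a)
  ∇ a (U c) = neg (U (c ℕ.* a) · V (c ℕ.* suc a))
  ∇ a (E · F) = (∇ a E · dilate a F) ⊹ (dilate (suc a) E · ∇ a F)
  ∇ a (E ⊹ F) = ∇ a E ⊹ ∇ a F
  ∇ a (neg E) = neg (∇ a E)

  iterate∇ˢ : ℕ → Shape → Shape
  iterate∇ˢ zero s = s
  iterate∇ˢ (suc k) s = iterate∇ˢ k (∇ˢ s)

  module Evaluate (X' : ℕ) where
    X = suc X'

    decay : ℕ → ℚ
    decay y = ι X * inv (X ℕ.+ y)

    decay-eq : ∀ y → (ι X + ι y) * inv (X ℕ.+ y) ≡ 1ℚ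
    decay-eq y = trans (cong (_* inv (X ℕ.+ y)) (sym (ι-+ X y))) (ι-inv (X' ℕ.+ y))

    0≤decay : ∀ y → 0ℚ ≤ decay y
    0≤decay y = *-nonneg (0≤ι X) (0≤inv (X ℕ.+ y))

    1-decay : ∀ y → 1ℚ - decay y ≡ ι y * inv (X ℕ.+ y)
    1-decay y = trans (cong (_- decay y) (sym (decay-eq y))) (lem (ι X) (ι y) (inv (X ℕ.+ y)))
      where
      lem : ∀ x y i → (x + y) * i - x * i ≡ y * i
      lem = Solver.solve-∀ ℚ-ring

    decay≤1 : ∀ y → decay y ≤ 1ℚ
    decay≤1 y = subst (_≤ 1ℚ) (+-identityʳ (decay y)) (≤-trans (+-monoʳ-≤ (decay y) (*-nonneg (0≤ι y) (0≤inv (X ℕ.+ y))))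
      (≤-reflexive (trans (cong (decay y +_) (sym (1-decay y))) (lem (decay y)))))
      where
      lem : ∀ x → x + (1ℚ - x) ≡ 1ℚ
      lem = Solver.solve-∀ ℚ-ring

    eval : ∀ {s} → Expr s → ℕ → ℚ
    eval (V c) n = decay (c ℕ.* n)
    eval (U c) n = 1ℚ - decay (c ℕ.* n)
    eval (E · F) n = eval E n * eval F n
    eval (E ⊹ F) n = eval E n + eval F n
    eval (neg E) n = - eval E n

    eval-bound : ∀ {s} (E : Expr s) n → ∣ eval E n ∣ ≤ ι (size s)
    eval-bound (V c) n = ≤-trans (≤-reflexive (0≤p⇒∣p∣≡p (0≤decay (c ℕ.* n)))) (≤-trans (decay≤1 (c ℕ.* n)) (≤-reflexive (sym (+-identityʳ 1ℚ))))
    eval-bound (U c) n = ≤-trans (≤-reflexive (0≤p⇒∣p∣≡p (subst (0ℚ ≤_) (sym (1-decay (c ℕ.* n))) (*-nonneg (0≤ι (c ℕ.* n)) (0≤inv (X ℕ.+ c ℕ.* n))))))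
      (≤-trans (+-monoʳ-≤ 1ℚ (neg-antimono-≤ (0≤decay (c ℕ.* n)))) ≤-refl)
    eval-bound {s · t} (E · F) n = ≤-trans (≤-reflexive (∣p*q∣≡∣p∣*∣q∣ (eval E n) (eval F n)))
      (≤-trans (*-mono (0≤∣p∣ (eval E n)) (0≤ι (size t)) (eval-bound E n) (eval-bound F n)) (≤-reflexive (sym (ι-* (size s) (size t)))))
    eval-bound {s ⊹ t} (E ⊹ F) n = ≤-trans (∣p+q∣≤∣p∣+∣q∣ (eval E n) (eval F n))
      (≤-trans (+-mono-≤ (eval-bound E n) (eval-bound F n)) (≤-reflexive (sym (ι-+ (size s) (size t)))))
    eval-bound (neg E) n = ≤-trans (≤-reflexive (∣-p∣≡∣p∣ (eval E n))) (eval-bound E n)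

    eval-dilate : ∀ a {s} (E : Expr s) n → eval (dilate a E) n ≡ eval E (a ℕ.* n)
    eval-dilate a (V c) n = cong decay (ℕ.*-assoc c a n)
    eval-dilate a (U c) n = cong (λ z → 1ℚ - decay z) (ℕ.*-assoc c a n)
    eval-dilate a (E · F) n = cong₂ _*_ (eval-dilate a E n) (eval-dilate a F n)
    eval-dilate a (E ⊹ F) n = cong₂ _+_ (eval-dilate a E n) (eval-dilate a F n)
    eval-dilate a (neg E) n = cong -_ (eval-dilate a E n)

    -- The reason for the weight `X/(X + n)`: `a` times its dilation difference is again a product
    -- of functions with values between 0 and 1, uniformly in `X`, and the process can be repeated.
    decay-difference : ∀ a y → (1ℚ - decay (a ℕ.* y)) * decay (suc a ℕ.* y) ≡ ι a * (decay (a ℕ.* y) - decay (suc a ℕ.* y))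
    decay-difference a y = begin
      (1ℚ - x * I₁) * (x * I₂)                   ≡⟨ cong (_* (x * I₂)) (1-decay (a ℕ.* y)) ⟩
      ι (a ℕ.* y) * I₁ * (x * I₂)                ≡⟨ cong (λ z → z * I₁ * (x * I₂)) (ι-* a y) ⟩
      ι a * ι y * I₁ * (x * I₂)                  ≡⟨ lem₁ (ι a) (ι y) x I₁ I₂ ⟩
      ι a * (x * (((x + (ι y + ι a * ι y)) * I₂) * I₁ - ((x + ι a * ι y) * I₁) * I₂))
        ≡⟨ cong₂ (λ p q → ι a * (x * (p * I₁ - q * I₂)))
             (trans (cong (λ z → (x + z) * I₂) (sym (trans (ι-+ y (a ℕ.* y)) (cong (ι y +_) (ι-* a y))))) (decay-eq (suc a ℕ.* y)))
             (trans (cong (λ z → (x + z) * I₁) (sym (ι-* a y))) (decay-eq (a ℕ.* y))) ⟩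
      ι a * (x * (1ℚ * I₁ - 1ℚ * I₂))            ≡⟨ lem₂ (ι a) x I₁ I₂ ⟩
      ι a * (x * I₁ - x * I₂)                    ∎
      where
      open ≡-Reasoning
      x = ι X
      I₁ = inv (X ℕ.+ a ℕ.* y)
      I₂ = inv (X ℕ.+ suc a ℕ.* y)
      lem₁ : ∀ a y x I J → a * y * I * (x * J) ≡ a * (x * (((x + (y + a * y)) * J) * I - ((x + a * y) * I) * J))
      lem₁ = Solver.solve-∀ ℚ-ring
      lem₂ : ∀ a x I J → a * (x * (1ℚ * I - 1ℚ * J)) ≡ a * (x * I - x * J)
      lem₂ = Solver.solve-∀ ℚ-ring

    private
      V-difference : ∀ a c n → (1ℚ - decay (c ℕ.* a ℕ.* n)) * decay (c ℕ.* suc a ℕ.* n) ≡ ι a * (decay (c ℕ.* (a ℕ.* n)) - decay (c ℕ.* (suc a ℕ.* n)))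
      V-difference a c n = trans (cong₂ (λ y z → (1ℚ - decay y) * decay z) (lem₁ c a n) (lem₂ c a n))
        (trans (decay-difference a (c ℕ.* n)) (cong₂ (λ y z → ι a * (decay y - decay z)) (lem₃ c a n) (lem₄ c a n)))
        where
        lem₁ : ∀ c a n → c ℕ.* a ℕ.* n ≡ a ℕ.* (c ℕ.* n)
        lem₁ = solve-∀ⁿ
        lem₂ : ∀ c a n → c ℕ.* suc a ℕ.* n ≡ suc a ℕ.* (c ℕ.* n)
        lem₂ = solve-∀ⁿ
        lem₃ : ∀ c a n → a ℕ.* (c ℕ.* n) ≡ c ℕ.* (a ℕ.* n)
        lem₃ = solve-∀ⁿ
        lem₄ : ∀ c a n → suc a ℕ.* (c ℕ.* n) ≡ c ℕ.* (suc a ℕ.* n)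
        lem₄ = solve-∀ⁿ

    eval-∇ : ∀ a {s} (E : Expr s) n → eval (∇ a E) n ≡ ι a * (eval E (a ℕ.* n) - eval E (suc a ℕ.* n))
    eval-∇ a (V c) n = V-difference a c n
    eval-∇ a (U c) n = trans (cong -_ (V-difference a c n)) (lem (ι a) (decay (c ℕ.* (a ℕ.* n))) (decay (c ℕ.* (suc a ℕ.* n))))
      where
      lem : ∀ a x y → - (a * (x - y)) ≡ a * (1ℚ - x - (1ℚ - y))
      lem = Solver.solve-∀ ℚ-ring
    eval-∇ a (E · F) n = trans (cong₂ _+_ (cong₂ _*_ (eval-∇ a E n) (eval-dilate a F n)) (cong₂ _*_ (eval-dilate (suc a) E n) (eval-∇ a F n)))
      (lem (ι a) (eval E (a ℕ.* n)) (eval E (suc a ℕ.* n)) (eval F (a ℕ.* n)) (eval F (suc a ℕ.* n)))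
      where
      lem : ∀ a x y z w → a * (x - y) * z + y * (a * (z - w)) ≡ a * (x * z - y * w)
      lem = Solver.solve-∀ ℚ-ring
    eval-∇ a (E ⊹ F) n = trans (cong₂ _+_ (eval-∇ a E n) (eval-∇ a F n)) (lem (ι a) (eval E (a ℕ.* n)) (eval E (suc a ℕ.* n)) (eval F (a ℕ.* n)) (eval F (suc a ℕ.* n)))
      where
      lem : ∀ a x y z w → a * (x - y) + a * (z - w) ≡ a * (x + z - (y + w))
      lem = Solver.solve-∀ ℚ-ring
    eval-∇ a (neg E) n = trans (cong -_ (eval-∇ a E n)) (lem (ι a) (eval E (a ℕ.* n)) (eval E (suc a ℕ.* n)))
      where
      lem : ∀ a x y → - (a * (x - y)) ≡ a * (- x - - y)
      lem = Solver.solve-∀ ℚ-ring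

    module _ (N M : ℕ) .{{nzM : ℕ.NonZero M}} where
      open Weighted N
      open Periodic M

      smooth-resp : ∀ k {C φ ψ} → (∀ n → φ n ≡ ψ n) → Smooth k C φ → Smooth k C ψ
      smooth-resp zero e s n = subst (λ z → ∣ z ∣ ≤ _) (e n) (s n)
      smooth-resp (suc k) e s a = smooth-resp k (λ n → cong₂ (λ x y → ι a * (x - y)) (e (a ℕ.* n)) (e (suc a ℕ.* n))) (s a)

      -- The bound depends on the shape alone, hence neither on `X` nor on the coefficients
      -- occurring in the expression.
      eval-smooth : ∀ k {s} (E : Expr s) → Smooth k (ι (size (iterate∇ˢ k s))) (eval E)
      eval-smooth zero E n = eval-bound E n
      eval-smooth (suc k) E a = smooth-resp k (eval-∇ a E) (eval-smooth k (∇ a E))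

-- Characters modulo `M` and the difference of two residue classes.

module ResidueClasses where
  import Tactic.RingSolver as Solver
  open RationalSums
  open Convolution
  open Abel hiding (v; u)
  open Congruences using (_≅_⟦_⟧; mk≅; m∣a-b; ≅-refl; ≅-sym; ≅-trans; ≅-reflexive; ≅-*; ≅⇒%ℕ; %ℕ⇒≅; %ℕ-≅; ≅-∣)
  open Gauss using (injective⇒permutation)
  open ChineseRemainder using (bézoutℤ)
  open import Data.Nat as ℕ using (ℕ; zero; suc)
  import Data.Nat.Properties as ℕ
  import Data.Nat.Divisibility as ℕ
  import Data.Nat.DivMod as ℕ
  open import Data.Nat.Coprimality using (Coprime)
  open import Data.Nat.Tactic.RingSolver using () renaming (solve-∀ to solve-∀ⁿ)
  open import Data.Integer as ℤ using (ℤ; +_)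
  import Data.Integer.Properties as ℤ
  open import Data.Integer.DivMod using (_%ℕ_)
  import Data.Integer.Divisibility.Signed as ℤ
  open import Data.Integer.Tactic.RingSolver using () renaming (solve-∀ to solve-∀ℤ)
  open import Data.Rational using (ℚ; 0ℚ; 1ℚ; _+_; _-_; _*_; -_; _≤_; ∣_∣)
  open import Data.Rational.Properties
  open import Data.Fin using (Fin; toℕ; fromℕ<)
  open import Data.Fin.Properties using (toℕ<n; toℕ-fromℕ<; toℕ-injective)
  open import Data.Product using (_,_; ∃; proj₁; proj₂)
  open import Data.Sum using (inj₁; inj₂)
  open import Relation.Nullary using (yes; no)
  open import Relation.Binary.PropositionalEquality
  open import Function using (_∘_)
  open import Algebra.Properties.CommutativeMonoid.Sum +-0-commutativeMonoid using (sum; sum-cong-≗; sum-permute)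

  coprime-mod : ∀ {m r n} .{{_ : ℕ.NonZero m}} → n ℕ.% m ≡ r ℕ.% m → Coprime r m → Coprime n m
  coprime-mod {m} {r} {n} e c {d} (d∣n , d∣m) = c (ℤ.∣⇒∣ᵤ (≅-∣ {d} {+ r} {+ n} (mk≅ (ℤ.∣-trans (ℤ.∣ᵤ⇒∣ d∣m) (m∣a-b (≅-sym (%ℕ⇒≅ {m} {+ n} {+ r} e))))) (ℤ.∣ᵤ⇒∣ d∣n)) , d∣m)

  inverse-mod : ∀ {m r} .{{_ : ℕ.NonZero m}} → Coprime r m → ∃ λ s → + r ℤ.* + s ≅ + 1 ⟦ m ⟧
  inverse-mod {m} {r} c with bézoutℤ c
  ... | u , w , e = u %ℕ m , ≅-trans (≅-* {a = + r} ≅-refl (≅-sym (%ℕ-≅ u m)))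
    (mk≅ (ℤ.divides (ℤ.- w) (trans (cong (λ z → + r ℤ.* u ℤ.- z) (sym e)) (lem (+ r) u w (+ m)))))
    where
    lem : ∀ r u w m → r ℤ.* u ℤ.- (u ℤ.* r ℤ.+ w ℤ.* m) ≡ ℤ.- w ℤ.* m
    lem = solve-∀ℤ

  δ-iff : ∀ {a b c d} → (a ≡ b → c ≡ d) → (c ≡ d → a ≡ b) → δ a b ≡ δ c d
  δ-iff {a} {b} f g with a ℕ.≟ b
  ... | yes e = sym (δ-yes (f e))
  ... | no ne = sym (δ-no (ne ∘ g))

  0≤δ : ∀ a b → 0ℚ ≤ δ a b
  0≤δ a b with a ℕ.≟ b
  ... | yes _ = 0≤1
  ... | no _ = ≤-refl

  ∣δ∣≤1 : ∀ a b → ∣ δ a b ∣ ≤ 1ℚ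
  ∣δ∣≤1 a b with a ℕ.≟ b
  ... | yes _ = ≤-refl
  ... | no _ = 0≤1

  ∑-as-sum : ∀ n g → ∑ n g ≡ sum {n} (λ i → g (suc (toℕ i)))
  ∑-as-sum zero g = refl
  ∑-as-sum (suc n) g = trans (∑-front n g) (cong (λ ζ → g 1 + ζ) (∑-as-sum n (g ∘ suc)))

  psum≡∑ : ∀ n (f : ℕ → ℚ) → psum n f ≡ ∑ n f
  psum≡∑ zero f = refl
  psum≡∑ (suc n) f = cong (_+ f (suc n)) (psum≡∑ n f)

  module Residues (M : ℕ) .{{nzM : ℕ.NonZero M}} where

    Periodicℕ : (ℕ → ℚ) → Set
    Periodicℕ g = ∀ n → g (n ℕ.+ M) ≡ g n

    periodic-mod : ∀ {g} → Periodicℕ g → ∀ {m n} → m ℕ.% M ≡ n ℕ.% M → g m ≡ g n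
    periodic-mod {g} p {m} {n} e = trans (reduce m) (trans (cong g e) (sym (reduce n)))
      where
      shift : ∀ r q → g (r ℕ.+ q ℕ.* M) ≡ g r
      shift r zero = cong g (ℕ.+-identityʳ r)
      shift r (suc q) = trans (cong g (lem r M (q ℕ.* M))) (trans (p (r ℕ.+ q ℕ.* M)) (shift r q))
        where
        lem : ∀ r a b → r ℕ.+ (a ℕ.+ b) ≡ r ℕ.+ b ℕ.+ a
        lem = solve-∀ⁿ
      reduce : ∀ n → g n ≡ g (n ℕ.% M)
      reduce n = trans (cong g (ℕ.m≡m%n+[m/n]*n n M)) (shift (n ℕ.% M) (n ℕ./ M))

    ∑-period : ∀ {g} → Periodicℕ g → ∑ M g ≡ sum {M} (g ∘ toℕ)
    ∑-period {g} p = go M p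
      where
      go : ∀ m → (∀ n → g (n ℕ.+ m) ≡ g n) → ∑ m g ≡ sum {m} (g ∘ toℕ)
      go zero p = refl
      go (suc m) p = trans (cong₂ _+_ (∑-as-sum m g) (p 0)) (+-comm (sum {m} (λ i → g (suc (toℕ i)))) (g 0))

    ∑-permuted : ∀ {g} → Periodicℕ g → ∀ {u v} → + u ℤ.* + v ≅ + 1 ⟦ M ⟧ → ∑ M (λ x → g (v ℕ.* x)) ≡ ∑ M g
    ∑-permuted {g} p {u} {v} uv = begin
      ∑ M (λ x → g (v ℕ.* x))            ≡⟨ ∑-period (λ n → periodic-mod p (mod-shift n)) ⟩
      sum {M} (λ i → g (v ℕ.* toℕ i))     ≡⟨ sum-cong-≗ {M} (λ i → periodic-mod p (sym (trans (cong (ℕ._% M) (toℕ-fromℕ< _)) (ℕ.m%n%n≡m%n (v ℕ.* toℕ i) M)))) ⟩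
      sum {M} (λ i → g (toℕ (τ i)))       ≡⟨ sum-permute (g ∘ toℕ) (injective⇒permutation τ (λ {i} {j} → τ-injective i j)) ⟨
      sum {M} (g ∘ toℕ)                   ≡⟨ ∑-period p ⟨
      ∑ M g                               ∎
      where
      open ≡-Reasoning
      mod-shift : ∀ n → (v ℕ.* (n ℕ.+ M)) ℕ.% M ≡ (v ℕ.* n) ℕ.% M
      mod-shift n = trans (cong (ℕ._% M) (ℕ.*-distribˡ-+ v n M)) (ℕ.[m+kn]%n≡m%n (v ℕ.* n) v M)
      τ : Fin M → Fin M
      τ i = fromℕ< (ℕ.m%n<n (v ℕ.* toℕ i) M)
      unscale : ∀ x → + u ℤ.* + (v ℕ.* x) ≅ + x ⟦ M ⟧
      unscale x = ≅-trans (≅-reflexive (trans (cong (+ u ℤ.*_) (ℤ.pos-* v x)) (sym (ℤ.*-assoc (+ u) (+ v) (+ x)))))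
        (≅-trans (≅-* uv (≅-refl {a = + x})) (≅-reflexive (ℤ.*-identityˡ (+ x))))
      τ-injective : ∀ i j → τ i ≡ τ j → i ≡ j
      τ-injective i j e = toℕ-injective (trans (sym (ℕ.m<n⇒m%n≡m (toℕ<n i))) (trans
        (≅⇒%ℕ (≅-trans (≅-sym (unscale (toℕ i))) (≅-trans (≅-* {a = + u} ≅-refl (%ℕ⇒≅ {M} {+ (v ℕ.* toℕ i)} {+ (v ℕ.* toℕ j)} vi≡vj)) (unscale (toℕ j)))))
        (ℕ.m<n⇒m%n≡m (toℕ<n j))))
        where
        vi≡vj : (v ℕ.* toℕ i) ℕ.% M ≡ (v ℕ.* toℕ j) ℕ.% M
        vi≡vj = trans (sym (toℕ-fromℕ< _)) (trans (cong toℕ e) (toℕ-fromℕ< _))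

    record Character (χ : ℕ → ℚ) : Set where
      field
        χ-*      : ∀ m n → χ (m ℕ.* n) ≡ χ m * χ n
        χ-1      : χ 1 ≡ 1ℚ
        periodic : Periodicℕ χ
        bounded  : ∀ n → ∣ χ n ∣ ≤ 1ℚ
        signs    : ∀ {n} → Coprime n M → Sign (χ n)

    product-character : ∀ {χ ψ} → Character χ → Character ψ → Character (λ n → χ n * ψ n)
    product-character {χ} {ψ} X Y = record
      { χ-* = λ m n → trans (cong₂ _*_ (χ-* X m n) (χ-* Y m n)) (lem (χ m) (χ n) (ψ m) (ψ n))
      ; χ-1 = trans (cong₂ _*_ (χ-1 X) (χ-1 Y)) (*-identityʳ 1ℚ)
      ; periodic = λ n → cong₂ _*_ (periodic X n) (periodic Y n)
      ; bounded = λ n → ≤-trans (≤-reflexive (∣p*q∣≡∣p∣*∣q∣ (χ n) (ψ n))) (≤-trans (*-mono (0≤∣p∣ (χ n)) 0≤1 (bounded X n) (bounded Y n)) (≤-reflexive (*-identityʳ 1ℚ)))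
      ; signs = λ c → sign-* (signs X c) (signs Y c) }
      where
      open Character
      lem : ∀ a b c d → a * b * (c * d) ≡ a * c * (b * d)
      lem = Solver.solve-∀ ℚ-ring
      sign-* : ∀ {x y} → Sign x → Sign y → Sign (x * y)
      sign-* (inj₁ refl) (inj₁ refl) = inj₁ refl
      sign-* (inj₁ refl) (inj₂ refl) = inj₂ refl
      sign-* (inj₂ refl) (inj₁ refl) = inj₂ refl
      sign-* (inj₂ refl) (inj₂ refl) = inj₁ refl

    trivial-character : Character (λ _ → 1ℚ)
    trivial-character = record { χ-* = λ _ _ → sym (*-identityʳ 1ℚ) ; χ-1 = refl ; periodic = λ _ → refl ; bounded = λ _ → ≤-refl ; signs = λ _ → inj₁ refl }

    class : ℕ → ℕ → ℚ
    class r n = δ (n ℕ.% M) (r ℕ.% M)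

    class-periodic : ∀ r {m n} → m ℕ.% M ≡ n ℕ.% M → class r m ≡ class r n
    class-periodic r e = cong (λ z → δ z (r ℕ.% M)) e

    mul-mod : ∀ {m n} k → m ℕ.% M ≡ n ℕ.% M → (m ℕ.* k) ℕ.% M ≡ (n ℕ.* k) ℕ.% M
    mul-mod {m} {n} k e = trans (ℕ.%-distribˡ-* m k M) (trans (cong (λ z → (z ℕ.* (k ℕ.% M)) ℕ.% M) e) (sym (ℕ.%-distribˡ-* n k M)))

    module Balanced (u₀ : ℕ) (coprime : Coprime u₀ M) where
      γ : (n : ℕ) → ℚ
      γ n = class u₀ n - class 1 n

      γ-periodic : ∀ {m n} → m ℕ.% M ≡ n ℕ.% M → γ m ≡ γ n
      γ-periodic e = cong₂ _-_ (class-periodic u₀ e) (class-periodic 1 e)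

      private
        v = proj₁ (inverse-mod coprime)
        uv : + u₀ ℤ.* + v ≅ + 1 ⟦ M ⟧
        uv = proj₂ (inverse-mod coprime)

      shift-class : ∀ n → class u₀ n ≡ class 1 (v ℕ.* n)
      shift-class n = δ-iff
        (λ e → ≅⇒%ℕ {M} {+ (v ℕ.* n)} {+ 1} (≅-trans (≅-reflexive (ℤ.pos-* v n)) (≅-trans (≅-* {a = + v} ≅-refl (%ℕ⇒≅ {M} {+ n} {+ u₀} e)) (≅-trans (≅-reflexive (ℤ.*-comm (+ v) (+ u₀))) uv))))
        (λ e → ≅⇒%ℕ {M} {+ n} {+ u₀} (≅-trans (≅-reflexive (sym (ℤ.*-identityˡ (+ n)))) (≅-trans (≅-* (≅-sym uv) (≅-refl {a = + n}))
          (≅-trans (≅-reflexive (trans (ℤ.*-assoc (+ u₀) (+ v) (+ n)) (cong (+ u₀ ℤ.*_) (sym (ℤ.pos-* v n)))))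
            (≅-trans (≅-* {a = + u₀} ≅-refl (%ℕ⇒≅ {M} {+ (v ℕ.* n)} {+ 1} e)) (≅-reflexive (ℤ.*-identityʳ (+ u₀))))))))

      -- Substitute `x ↦ v x` with `v` inverse to `u₀`. This carries the class of 1 to that of `u₀`
      -- and leaves `χ` unchanged because `χ(u₀) = 1`, so the two sums over a period agree for every
      -- `m`.
      mean-zero : ∀ {χ} → Character χ → χ u₀ ≡ 1ℚ → ∀ m → ∑ M (λ x → χ x * γ (x ℕ.* m)) ≡ 0ℚ
      mean-zero {χ} X χu₀ m = begin
        ∑ M (λ x → χ x * (class u₀ (x ℕ.* m) - class 1 (x ℕ.* m)))
          ≡⟨ ∑-cong M (λ x _ _ → lem₁ (χ x) (class u₀ (x ℕ.* m)) (class 1 (x ℕ.* m))) ⟩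
        ∑ M (λ x → χ x * class u₀ (x ℕ.* m) + - g x)
          ≡⟨ trans (∑-+ M (λ x → χ x * class u₀ (x ℕ.* m)) (λ x → - g x)) (cong (λ ζ → ∑ M (λ x → χ x * class u₀ (x ℕ.* m)) + ζ) (∑-neg M g)) ⟩
        ∑ M (λ x → χ x * class u₀ (x ℕ.* m)) - ∑ M g
          ≡⟨ cong (_- ∑ M g) (∑-cong M (λ x _ _ → cong₂ _*_ (sym (trans (χ-* v x) (trans (cong (_* χ x) χv) (*-identityˡ (χ x)))))
               (trans (shift-class (x ℕ.* m)) (cong (class 1) (sym (ℕ.*-assoc v x m)))))) ⟩
        ∑ M (λ x → g (v ℕ.* x)) - ∑ M g
          ≡⟨ cong (_- ∑ M g) (∑-permuted g-periodic {u₀} {v} uv) ⟩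
        ∑ M g - ∑ M g ≡⟨ +-inverseʳ (∑ M g) ⟩
        0ℚ ∎
        where
        open ≡-Reasoning
        open Character X
        g : ℕ → ℚ
        g y = χ y * class 1 (y ℕ.* m)
        g-periodic : Periodicℕ g
        g-periodic n = cong₂ _*_ (periodic n) (class-periodic 1 (mul-mod m (ℕ.[m+n]%n≡m%n n M)))
        lem₁ : ∀ c a b → c * (a - b) ≡ c * a + - (c * b)
        lem₁ = Solver.solve-∀ ℚ-ring
        χv : χ v ≡ 1ℚ
        χv = trans (sym (*-identityˡ (χ v))) (trans (cong (_* χ v) (sym χu₀)) (trans (sym (χ-* u₀ v))
          (trans (periodic-mod periodic (≅⇒%ℕ {M} {+ (u₀ ℕ.* v)} {+ 1} (≅-trans (≅-reflexive (ℤ.pos-* u₀ v)) uv))) χ-1)))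

      module Quadruples {χ₁ χ₂ : ℕ → ℚ} (X₁ : Character χ₁) (X₂ : Character χ₂) (χ₁u₀ : χ₁ u₀ ≡ 1ℚ) (χ₂u₀ : χ₂ u₀ ≡ 1ℚ) where
        χ₃ : ℕ → ℚ
        χ₃ n = χ₁ n * χ₂ n

        X₃ : Character χ₃
        X₃ = product-character X₁ X₂

        weights : Fn 4
        weights e c b a = χ₃ e * (χ₂ c * (χ₁ b * 1ℚ))

        -- The summand belonging to a factorisation into `e`, `c`, `b`, `a`. The innermost factor 1
        -- is the argument at which `S` evaluates its weight in the base case.
        f : Fn 4
        f e c b a = weights e c b a * γ (e ℕ.* (c ℕ.* (b ℕ.* (a ℕ.* 1))))

        module _ (N : ℕ) where
          open Weighted N
          open Periodic M
          open Character

          private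
            ∣×∣≤1 : ∀ {x y} → ∣ x ∣ ≤ 1ℚ → ∣ y ∣ ≤ 1ℚ → ∣ x * y ∣ ≤ 1ℚ
            ∣×∣≤1 {x} {y} hx hy = ≤-trans (≤-reflexive (∣p*q∣≡∣p∣*∣q∣ x y)) (≤-trans (*-mono (0≤∣p∣ x) 0≤1 hx hy) (≤-reflexive (*-identityʳ 1ℚ)))

            scalar-zero : ∀ {χ} (g : ℕ → ℚ) m K → Character χ → χ u₀ ≡ 1ℚ → (∀ x → g x ≡ (χ x * γ (x ℕ.* m)) * K) → psum M g ≡ 0ℚ
            scalar-zero {χ} g m K X e h = trans (psum≡∑ M g) (trans (∑-cong M (λ x _ _ → h x)) (trans (∑-*ʳ M (λ x → χ x * γ (x ℕ.* m)) K)
              (trans (cong (_* K) (mean-zero X e m)) (*-zeroˡ K))))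

          weights-bounded : ∀ e c b a → ∣ weights e c b a ∣ ≤ 1ℚ
          weights-bounded e c b a = ∣×∣≤1 (bounded X₃ e) (∣×∣≤1 (bounded X₂ c) (∣×∣≤1 {χ₁ b} {1ℚ} (bounded X₁ b) ≤-refl))

          γ-bounded : ∀ n → ∣ γ n ∣ ≤ ι 2
          γ-bounded n = ≤-trans (∣p-q∣≤∣p∣+∣q∣ (class u₀ n) (class 1 n)) (+-mono-≤ (∣δ∣≤1 (n ℕ.% M) (u₀ ℕ.% M)) (∣δ∣≤1 (n ℕ.% M) (1 ℕ.% M)))

          f-bounded : ∀ e c b a → ∣ f e c b a ∣ ≤ ι 2
          f-bounded e c b a = ≤-trans (≤-reflexive (∣p*q∣≡∣p∣*∣q∣ (weights e c b a) (γ n))) (≤-trans (*-mono (0≤∣p∣ (weights e c b a)) (0≤ι 2) (weights-bounded e c b a) (γ-bounded n)) (≤-reflexive (*-identityˡ (ι 2))))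
            where n = e ℕ.* (c ℕ.* (b ℕ.* (a ℕ.* 1)))

          -- With three variables fixed, `f` is a constant times `χ x · γ (x m)`, where `m` is the
          -- product of the fixed ones and `χ` is `1`, `χ₁`, `χ₂` or `χ₃`. All four characters are 1
          -- at `u₀`. The subtraction of the class of 1 in `γ` is what gives mean zero even for the
          -- trivial character.
          f-oscillates : Oscillating 4 (ι 2) f
          f-oscillates = (λ e → (λ c → (λ b → (λ a → f-bounded e c b a) ,
                (λ a → cong (weights e c b a *_) (period (λ z → e ℕ.* (c ℕ.* (b ℕ.* (z ℕ.* 1)))) (e ℕ.* (c ℕ.* b)) (perm-a e c b) a)) ,
                scalar-zero (λ a → f e c b a) (e ℕ.* (c ℕ.* b)) (χ₃ e * (χ₂ c * (χ₁ b * 1ℚ))) trivial-character refl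
                  (λ a → trans (cong (λ z → weights e c b a * γ z) (perm-a e c b a)) (val-a (χ₃ e) (χ₂ c) (χ₁ b) (γ (a ℕ.* (e ℕ.* (c ℕ.* b))))))) ,
              (λ b a → cong₂ (λ x y → χ₃ e * (χ₂ c * (x * 1ℚ)) * y) (periodic X₁ b) (period (λ z → e ℕ.* (c ℕ.* (z ℕ.* (a ℕ.* 1)))) (e ℕ.* (c ℕ.* a)) (perm-b e c a) b)) ,
              (λ a → ≐-trans (psum-eval M (f e c) a) (scalar-zero (λ b → f e c b a) (e ℕ.* (c ℕ.* a)) (χ₃ e * χ₂ c) X₁ χ₁u₀
                  (λ b → trans (cong (λ z → weights e c b a * γ z) (perm-b e c a b)) (val-b (χ₃ e) (χ₂ c) (χ₁ b) (γ (b ℕ.* (e ℕ.* (c ℕ.* a)))))))) ) ,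
            (λ c b a → cong₂ (λ x y → χ₃ e * (x * (χ₁ b * 1ℚ)) * y) (periodic X₂ c) (period (λ z → e ℕ.* (z ℕ.* (b ℕ.* (a ℕ.* 1)))) (e ℕ.* (b ℕ.* a)) (perm-c e b a) c)) ,
            (λ b a → ≐-trans (psum-eval M (f e) b a) (≐-trans (psum-eval M (λ c → f e c b) a) (scalar-zero (λ c → f e c b a) (e ℕ.* (b ℕ.* a)) (χ₃ e * χ₁ b) X₂ χ₂u₀
                  (λ c → trans (cong (λ z → weights e c b a * γ z) (perm-c e b a c)) (val-c (χ₃ e) (χ₂ c) (χ₁ b) (γ (c ℕ.* (e ℕ.* (b ℕ.* a))))))))) ) ,
            (λ e c b a → cong₂ (λ x y → x * (χ₂ c * (χ₁ b * 1ℚ)) * y) (periodic X₃ e) (period (λ z → z ℕ.* (c ℕ.* (b ℕ.* (a ℕ.* 1)))) (c ℕ.* (b ℕ.* a)) (perm-e c b a) e)) ,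
            (λ c b a → ≐-trans (psum-eval M f c b a) (≐-trans (psum-eval M (λ e → f e c) b a) (≐-trans (psum-eval M (λ e → f e c b) a)
                (scalar-zero (λ e → f e c b a) (c ℕ.* (b ℕ.* a)) (χ₂ c * χ₁ b) X₃ (trans (cong₂ _*_ χ₁u₀ χ₂u₀) (*-identityʳ 1ℚ))
                  (λ e → trans (cong (λ z → weights e c b a * γ z) (perm-e c b a e)) (val-e (χ₃ e) (χ₂ c) (χ₁ b) (γ (e ℕ.* (c ℕ.* (b ℕ.* a))))))))))
            where
            period : ∀ (F : ℕ → ℕ) m → (∀ x → F x ≡ x ℕ.* m) → ∀ x → γ (F (x ℕ.+ M)) ≡ γ (F x)
            period F m h x = trans (cong γ (h (x ℕ.+ M))) (trans (γ-periodic (mul-mod m (ℕ.[m+n]%n≡m%n x M))) (cong γ (sym (h x))))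
            perm-a : ∀ e c b a → e ℕ.* (c ℕ.* (b ℕ.* (a ℕ.* 1))) ≡ a ℕ.* (e ℕ.* (c ℕ.* b))
            perm-a = solve-∀ⁿ
            perm-b : ∀ e c a b → e ℕ.* (c ℕ.* (b ℕ.* (a ℕ.* 1))) ≡ b ℕ.* (e ℕ.* (c ℕ.* a))
            perm-b = solve-∀ⁿ
            perm-c : ∀ e b a c → e ℕ.* (c ℕ.* (b ℕ.* (a ℕ.* 1))) ≡ c ℕ.* (e ℕ.* (b ℕ.* a))
            perm-c = solve-∀ⁿ
            perm-e : ∀ c b a e → e ℕ.* (c ℕ.* (b ℕ.* (a ℕ.* 1))) ≡ e ℕ.* (c ℕ.* (b ℕ.* a))
            perm-e = solve-∀ⁿ
            val-a : ∀ x y z g → x * (y * (z * 1ℚ)) * g ≡ 1ℚ * g * (x * (y * (z * 1ℚ)))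
            val-a = Solver.solve-∀ ℚ-ring
            val-b : ∀ x y z g → x * (y * (z * 1ℚ)) * g ≡ z * g * (x * y)
            val-b = Solver.solve-∀ ℚ-ring
            val-c : ∀ x y z g → x * (y * (z * 1ℚ)) * g ≡ y * g * (x * z)
            val-c = Solver.solve-∀ ℚ-ring
            val-e : ∀ x y z g → x * (y * (z * 1ℚ)) * g ≡ x * g * (y * z)
            val-e = Solver.solve-∀ ℚ-ring

-- Comparison of the class of `u₀` with the class of 1.

module ClassComparison where
  import Tactic.RingSolver as Solver
  open RationalSums
  open Convolution
  open Abel hiding (v; u)
  open ResidueClasses
  open import Data.Nat as ℕ using (ℕ; zero; suc)
  import Data.Nat.Properties as ℕ
  import Data.Nat.Divisibility as ℕ
  import Data.Nat.DivMod as ℕ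
  open import Data.Nat.Coprimality as Coprime using (Coprime)
  open import Data.Nat.Primality using (Prime)
  open import Data.Rational using (ℚ; 0ℚ; 1ℚ; _+_; _-_; _*_; -_; _≤_; _<_; ∣_∣)
  open import Data.Rational.Properties
  open import Data.Fin using (Fin; toℕ; fromℕ<)
  open import Data.Fin.Properties using (toℕ<n; toℕ-fromℕ<; any?)
  open import Data.Product using (_×_; _,_; ∃)
  open import Data.Empty using (⊥-elim)
  open import Relation.Nullary using (¬_; Dec; yes; no; ¬?; _×-dec_)
  open import Relation.Binary.PropositionalEquality

  BoundedF : ∀ k → ℚ → Fn k → Set
  BoundedF zero B f = ∣ f ∣ ≤ B
  BoundedF (suc k) B f = ∀ a → BoundedF k B (f a)

  S-bounded : ∀ N k {B τ f φ} → 0ℚ ≤ B → 0ℚ ≤ τ → BoundedF k B f → (∀ n → ∣ φ n ∣ ≤ τ) → ∣ Weighted.S N k f φ ∣ ≤ pow (ι N) k * (B * τ)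
  S-bounded N zero {B} {τ} {f} {φ} 0≤B 0≤τ h t = ≤-trans (≤-reflexive (∣p*q∣≡∣p∣*∣q∣ f (φ 1)))
    (≤-trans (*-mono (0≤∣p∣ f) 0≤τ h (t 1)) (≤-reflexive (sym (*-identityˡ (B * τ)))))
  S-bounded N (suc k) {B} {τ} {f} {φ} 0≤B 0≤τ h t = ≤-trans
    (∑-bound N {λ a → Weighted.S N k (f a) (λ n → φ (a ℕ.* n))} {pow (ι N) k * (B * τ)} (λ a _ _ → S-bounded N k {f = f a} {λ n → φ (a ℕ.* n)} 0≤B 0≤τ (h a) (λ n → t (a ℕ.* n))))
    (≤-reflexive (sym (*-assoc (ι N) (pow (ι N) k) (B * τ))))

  pow-* : ∀ x y k → pow (x * y) k ≡ pow x k * pow y k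
  pow-* x y zero = sym (*-identityʳ 1ℚ)
  pow-* x y (suc k) = trans (cong (x * y *_) (pow-* x y k)) (lem x y (pow x k) (pow y k))
    where
    lem : ∀ x y p q → x * y * (p * q) ≡ x * p * (y * q)
    lem = Solver.solve-∀ ℚ-ring

  pow-mono : ∀ {x y} k → 0ℚ ≤ x → x ≤ y → pow x k ≤ pow y k
  pow-mono zero h l = ≤-refl
  pow-mono (suc k) h l = *-mono h (pow-nonneg k (≤-trans h l)) l (pow-mono k h l)

  pow-1 : ∀ k → pow 1ℚ k ≡ 1ℚ
  pow-1 zero = refl
  pow-1 (suc k) = trans (*-identityˡ (pow 1ℚ k)) (pow-1 k)

  ι-^ : ∀ x k → ι (x ℕ.^ k) ≡ pow (ι x) k
  ι-^ x zero = +-identityʳ 1ℚ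
  ι-^ x (suc k) = trans (ι-* x (x ℕ.^ k)) (cong (ι x *_) (ι-^ x k))

  -- The exponent is five because there are four variables: beyond `N` the weight is at most
  -- `(X/N)⁵`, and over the `N⁴` quadruples this sums to at most `X⁵/N ≤ 1`.
  kernel : Expr _
  kernel = V 1 · (V 1 · (V 1 · (V 1 · V 1)))

  -- Abstract, since its value is irrelevant and its normal form is large.
  abstract
    kernelSize : ℕ
    kernelSize = size (iterate∇ˢ 4 (Abel.v · (Abel.v · (Abel.v · (Abel.v · Abel.v)))))

    kernel-smooth : ∀ X' N M .{{nzM : ℕ.NonZero M}} → Weighted.Periodic.Smooth N M 4 (ι kernelSize) (Evaluate.eval X' kernel)
    kernel-smooth X' N M = Evaluate.eval-smooth X' N M 4 kernel

  module Comparison (M : ℕ) .{{nzM : ℕ.NonZero M}} (u₀ : ℕ) (coprime : Coprime u₀ M) where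
   open Residues M
   open Balanced u₀ coprime
   -- `X = (1 + L M)²` makes room for the `L` squares `(1 + i M)²`, all congruent to 1. The cut-off
   -- `N = M X⁵` is a multiple of the period, which kills the boundary terms, and at least `X⁵`,
   -- which bounds the tail.
   module _ {χ₁ χ₂ : ℕ → ℚ} (X₁ : Character χ₁) (X₂ : Character χ₂) (χ₁u₀ : χ₁ u₀ ≡ 1ℚ) (χ₂u₀ : χ₂ u₀ ≡ 1ℚ)
    (L X' q N : ℕ) (X≡ : suc X' ≡ suc (L ℕ.* M) ℕ.* suc (L ℕ.* M)) (N≡ : N ≡ q ℕ.* M) (q≡ : q ≡ suc X' ℕ.^ 5) where
    open Quadruples X₁ X₂ χ₁u₀ χ₂u₀
    open Evaluate X'
    open Weighted N
    open Periodic M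
    open Character

    private
      X≤N : X ℕ.≤ N
      X≤N = ℕ.≤-trans (ℕ.m≤m*n X (X ℕ.^ 4) {{ℕ.>-nonZero (ℕ.m^n>0 X 4)}}) (subst₂ ℕ._≤_ q≡ (sym N≡) (ℕ.m≤m*n q M))
      1≤N : 1 ℕ.≤ N
      1≤N = ℕ.≤-trans (ℕ.s≤s ℕ.z≤n) X≤N
      X⁵≤N : pow (ι X) 5 ≤ ι N
      X⁵≤N = subst (_≤ ι N) (ι-^ X 5) (ι-mono (subst₂ ℕ._≤_ q≡ (sym N≡) (ℕ.m≤m*n q M)))

    open Truncated.Biquadratic N 1≤N χ₁ χ₂ (χ-* X₁) (χ-* X₂) (χ-1 X₁) (χ-1 X₂) hiding (χ₃) public

    w : ℕ → ℚ
    w = eval kernel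

    w-pow : ∀ n → w n ≡ pow (decay n) 5
    w-pow n = trans (cong (λ m → decay m * (decay m * (decay m * (decay m * decay m)))) (ℕ.*-identityˡ n)) (lem (decay n))
      where
      lem : ∀ d → d * (d * (d * (d * d))) ≡ d * (d * (d * (d * (d * 1ℚ))))
      lem = Solver.solve-∀ ℚ-ring

    0≤w : ∀ n → 0ℚ ≤ w n
    0≤w n = subst (0ℚ ≤_) (sym (w-pow n)) (pow-nonneg 5 (0≤decay n))

    -- `G<` is `G` cut off at `N`, as required for rewriting the sum of `r` as a sum over
    -- quadruples; the sum over quadruples of the part cut off stays bounded.
    G G< : ℕ → ℚ
    G n = γ n * w n
    G< n with n ℕ.≤? N
    ... | yes _ = G n
    ... | no _ = 0ℚ

    G<-small : ∀ n → n ℕ.≤ N → G< n ≡ G n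
    G<-small n h with n ℕ.≤? N
    ... | yes _ = refl
    ... | no ne = ⊥-elim (ne h)

    G<-big : ∀ n → N ℕ.< n → G< n ≡ 0ℚ
    G<-big n h with n ℕ.≤? N
    ... | yes l = ⊥-elim (ℕ.<⇒≱ h l)
    ... | no _ = refl

    τ : ℚ
    τ = pow (inv N) 4

    N-inv : ι N * inv N ≡ 1ℚ
    N-inv = lem 1≤N
      where
      lem : ∀ {n} → 1 ℕ.≤ n → ι n * inv n ≡ 1ℚ
      lem {suc n} _ = ι-inv n

    w-tail : ∀ n → N ℕ.< n → w n ≤ τ
    w-tail n N<n = begin
      w n                               ≡⟨ w-pow n ⟩
      pow (decay n) 5                   ≤⟨ pow-mono 5 (0≤decay n) decay≤ ⟩
      pow (ι X * inv N) 5               ≡⟨ pow-* (ι X) (inv N) 5 ⟩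
      pow (ι X) 5 * pow (inv N) 5       ≤⟨ *-monoʳ (pow-nonneg 5 (0≤inv N)) X⁵≤N ⟩
      ι N * (inv N * τ)                 ≡⟨ sym (*-assoc (ι N) (inv N) τ) ⟩
      ι N * inv N * τ                   ≡⟨ cong (_* τ) N-inv ⟩
      1ℚ * τ                            ≡⟨ *-identityˡ τ ⟩
      τ                                 ∎
      where
      open ≤-Reasoning
      decay≤ : decay n ≤ ι X * inv N
      decay≤ = begin
        decay n                           ≡⟨ sym (*-identityʳ (decay n)) ⟩
        decay n * 1ℚ                      ≡⟨ cong (decay n *_) (sym N-inv) ⟩
        decay n * (ι N * inv N)           ≡⟨ sym (*-assoc (decay n) (ι N) (inv N)) ⟩
        decay n * ι N * inv N             ≤⟨ *-monoʳ (0≤inv N) (*-monoˡ (0≤decay n) (≤-trans (ι-mono (ℕ.<⇒≤ N<n)) (subst (_≤ ι X + ι n) (+-identityˡ (ι n)) (+-monoˡ-≤ (ι n) (0≤ι X))))) ⟩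
        decay n * (ι X + ι n) * inv N     ≡⟨ cong (_* inv N) (lem (ι X) (inv (X ℕ.+ n)) (ι X + ι n)) ⟩
        ι X * ((ι X + ι n) * inv (X ℕ.+ n)) * inv N ≡⟨ cong (λ z → ι X * z * inv N) (decay-eq n) ⟩
        ι X * 1ℚ * inv N                  ≡⟨ cong (_* inv N) (*-identityʳ (ι X)) ⟩
        ι X * inv N ∎
        where
        lem : ∀ x i y → x * i * y ≡ x * (y * i)
        lem = Solver.solve-∀ ℚ-ring

    tail : ℕ → ℚ
    tail n = G n - G< n

    tail-bound : ∀ n → ∣ tail n ∣ ≤ ι 2 * τ
    tail-bound n = go (n ℕ.≤? N)
      where
      0≤2τ : 0ℚ ≤ ι 2 * τ
      0≤2τ = *-nonneg (0≤ι 2) (pow-nonneg 4 (0≤inv N))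
      go : Dec (n ℕ.≤ N) → ∣ tail n ∣ ≤ ι 2 * τ
      go (yes l) = subst (λ z → ∣ z ∣ ≤ ι 2 * τ) (sym (trans (cong (λ ζ → G n - ζ) (G<-small n l)) (+-inverseʳ (G n)))) 0≤2τ
      go (no l) = subst (λ z → ∣ z ∣ ≤ ι 2 * τ) (sym (trans (cong (λ ζ → G n - ζ) (G<-big n (ℕ.≰⇒> l))) (+-identityʳ (G n))))
        (≤-trans (≤-reflexive (∣p*q∣≡∣p∣*∣q∣ (γ n) (w n))) (*-mono (0≤∣p∣ (γ n)) (pow-nonneg 4 (0≤inv N)) (γ-bounded 0 n)
          (≤-trans (≤-reflexive (0≤p⇒∣p∣≡p (0≤w n))) (w-tail n (ℕ.≰⇒> l)))))

    tail-sum : ∣ S 4 weights tail ∣ ≤ ι 2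
    tail-sum = ≤-trans (S-bounded N 4 {1ℚ} {ι 2 * τ} {weights} {tail} 0≤1 (*-nonneg (0≤ι 2) (pow-nonneg 4 (0≤inv N))) (weights-bounded 0) tail-bound)
      (≤-reflexive (trans (lem (pow (ι N) 4) (ι 2) τ) (trans (cong (ι 2 *_) (trans (sym (pow-* (ι N) (inv N) 4)) (trans (cong (λ z → pow z 4) N-inv) (pow-1 4)))) (*-identityʳ (ι 2)))))
      where
      lem : ∀ p t x → p * (1ℚ * (t * x)) ≡ t * (p * x)
      lem = Solver.solve-∀ ℚ-ring

    r-sum-S : ∑ N (λ n → r n * G< n) ≡ S 4 weights G<
    r-sum-S = trans (r-sum G< G<-big) (∑-cong N (λ e _ _ →
        trans (sym (∑-*ˡ N (χ₃ e) (λ c → χ₂ c * Σb e c))) (∑-cong N (λ c _ _ → at-c e c))))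
      where
      Σa : ℕ → ℕ → ℕ → ℚ
      Σa e c b = ∑ N (λ a → 1ℚ * G< (e ℕ.* (c ℕ.* (b ℕ.* a))))
      Σb : ℕ → ℕ → ℚ
      Σb e c = ∑ N (λ b → χ₁ b * Σa e c b)
      pull : ∀ x y z (g : ℕ → ℚ) → x * (y * (z * ∑ N (λ a → 1ℚ * g a))) ≡ ∑ N (λ a → x * (y * (z * 1ℚ)) * g a)
      pull x y z g = trans (cong (λ s → x * (y * (z * s))) (∑-*ˡ N 1ℚ g)) (trans (lem x y z (∑ N g)) (sym (∑-*ˡ N (x * (y * (z * 1ℚ))) g)))
        where
        lem : ∀ x y z s → x * (y * (z * (1ℚ * s))) ≡ x * (y * (z * 1ℚ)) * s
        lem = Solver.solve-∀ ℚ-ring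
      at-b : ∀ e c b → χ₃ e * (χ₂ c * (χ₁ b * Σa e c b)) ≡ S 1 (weights e c b) (λ n → G< (e ℕ.* (c ℕ.* (b ℕ.* n))))
      at-b e c b = trans (pull (χ₃ e) (χ₂ c) (χ₁ b) (λ a → G< (e ℕ.* (c ℕ.* (b ℕ.* a)))))
        (∑-cong N (λ a _ _ → cong (λ z → weights e c b a * G< (e ℕ.* (c ℕ.* (b ℕ.* z)))) (sym (ℕ.*-identityʳ a))))
      at-c : ∀ e c → χ₃ e * (χ₂ c * Σb e c) ≡ S 2 (weights e c) (λ n → G< (e ℕ.* (c ℕ.* n)))
      at-c e c = trans (cong (χ₃ e *_) (sym (∑-*ˡ N (χ₂ c) (λ b → χ₁ b * Σa e c b))))
        (trans (sym (∑-*ˡ N (χ₃ e) (λ b → χ₂ c * (χ₁ b * Σa e c b)))) (∑-cong N (λ b _ _ → at-b e c b)))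

    S-weights-f : S 4 weights G ≡ S 4 f w
    S-weights-f = ∑-cong N (λ e _ _ → ∑-cong N (λ c _ _ → ∑-cong N (λ b _ _ → ∑-cong N (λ a _ _ →
      let n = e ℕ.* (c ℕ.* (b ℕ.* (a ℕ.* 1))) in sym (*-assoc (weights e c b a) (γ n) (w n))))))

    upper : ∣ ∑ N (λ n → r n * G< n) ∣ ≤ ι 2 * pow (ι M) 4 * (ι kernelSize * pow harmonic 4) + ι 2
    upper = begin
      ∣ ∑ N (λ n → r n * G< n) ∣           ≡⟨ cong ∣_∣ (trans r-sum-S (trans (lem (S 4 weights G) (S 4 weights G<)) (cong₂ _-_ S-weights-f (sym (S-minus 4 weights G G<))))) ⟩
      ∣ S 4 f w - S 4 weights tail ∣       ≤⟨ ∣p-q∣≤∣p∣+∣q∣ (S 4 f w) (S 4 weights tail) ⟩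
      ∣ S 4 f w ∣ + ∣ S 4 weights tail ∣   ≤⟨ +-mono-≤ (oscillation-bound q N≡ 4 {ι 2} {ι kernelSize} {f} {w} (0≤ι 2) (0≤ι kernelSize) (f-oscillates N) (kernel-smooth X' N M)) tail-sum ⟩
      ι 2 * pow (ι M) 4 * (ι kernelSize * pow harmonic 4) + ι 2 ∎
      where
      open ≤-Reasoning
      lem : ∀ x y → y ≡ x - (x - y)
      lem = Solver.solve-∀ ℚ-ring

    signs-at : ∀ {n s} → n ℕ.% M ≡ s ℕ.% M → Coprime s M → SignsAt n
    signs-at {n} {s} e c pr d = signs X₁ c' , signs X₂ c'
      where
      c' : Coprime _ M
      c' (d₁ , d₂) = coprime-mod {M} {s} {n} e c (ℕ.∣-trans d₁ d , d₂)

    Found : Set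
    Found = ∃ λ n → (1 ℕ.≤ n × n ℕ.≤ N) × n ℕ.% M ≡ u₀ ℕ.% M × r n ≢ 0ℚ

    -- If no n ≡ u₀ is found, the class of 1 alone contributes, and squares make its contribution large.
    module Absent (absent : ¬ Found) where
      H : ℕ → ℚ
      H n = r n * class 1 n * w n

      negated : ∀ n → 1 ℕ.≤ n → n ℕ.≤ N → r n * G< n ≡ - H n
      negated n l u = trans (cong (r n *_) (G<-small n u)) (go (r n ≟ 0ℚ) (n ℕ.% M ℕ.≟ u₀ ℕ.% M))
        where
        go : Dec (r n ≡ 0ℚ) → Dec (n ℕ.% M ≡ u₀ ℕ.% M) → r n * (γ n * w n) ≡ - H n
        go (yes e) _ = trans (cong (_* (γ n * w n)) e) (trans (*-zeroˡ (γ n * w n)) (sym (trans (cong (λ z → - (z * class 1 n * w n)) e) (lem (class 1 n) (w n)))))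
          where
          lem : ∀ a b → - (0ℚ * a * b) ≡ 0ℚ
          lem = Solver.solve-∀ ℚ-ring
        go (no ne) (yes e) = ⊥-elim (absent (n , (l , u) , e , ne))
        go (no _) (no ne) = trans (cong (λ z → r n * ((z - class 1 n) * w n)) (δ-no ne)) (lem (r n) (class 1 n) (w n))
          where
          lem : ∀ r c w → r * ((0ℚ - c) * w) ≡ - (r * c * w)
          lem = Solver.solve-∀ ℚ-ring

      0≤H : ∀ n → 1 ℕ.≤ n → n ℕ.≤ N → 0ℚ ≤ H n
      0≤H n l u = go (n ℕ.% M ℕ.≟ 1 ℕ.% M)
        where
        go : Dec (n ℕ.% M ≡ 1 ℕ.% M) → 0ℚ ≤ H n
        go (yes e) = *-nonneg (*-nonneg (r-nonneg n l u (signs-at e (Coprime.1-coprimeTo M))) (0≤δ (n ℕ.% M) (1 ℕ.% M))) (0≤w n)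
        go (no ne) = ≤-reflexive (sym (trans (cong (λ z → r n * z * w n) (δ-no ne)) (lem (r n) (w n))))
          where
          lem : ∀ a b → a * 0ℚ * b ≡ 0ℚ
          lem = Solver.solve-∀ ℚ-ring

      root σ : ℕ → ℕ
      root i = suc (i ℕ.* M)
      σ i = root i ℕ.* root i

      σ-increasing : ∀ i → σ i ℕ.< σ (suc i)
      σ-increasing i = ℕ.*-mono-< lt lt
        where
        lt : root i ℕ.< root (suc i)
        lt = ℕ.s≤s (ℕ.m<n+m (i ℕ.* M) (ℕ.>-nonZero⁻¹ M))

      σL≤X : σ L ℕ.≤ X
      σL≤X = ℕ.≤-reflexive (sym X≡)

      root-mod : ∀ i → root i ℕ.% M ≡ 1 ℕ.% M
      root-mod i = ℕ.[m+kn]%n≡m%n 1 i M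

      σ-mod : ∀ i → σ i ℕ.% M ≡ 1 ℕ.% M
      σ-mod i = trans (mul-mod (root i) (root-mod i)) (trans (cong (ℕ._% M) (ℕ.*-identityˡ (root i))) (root-mod i))

      -- Up to `X` the function `X/(X + n)` is at least one half, and 32 is the fifth power of 2.
      1≤32w : ∀ n → n ℕ.≤ X → 1ℚ ≤ ι 32 * w n
      1≤32w n n≤X = begin
        1ℚ                              ≡⟨ sym (pow-1 5) ⟩
        pow 1ℚ 5                        ≤⟨ pow-mono 5 0≤1 half ⟩
        pow (ι 2 * decay n) 5           ≡⟨ pow-* (ι 2) (decay n) 5 ⟩
        pow (ι 2) 5 * pow (decay n) 5   ≡⟨ cong (λ z → ι 32 * z) (sym (w-pow n)) ⟩
        ι 32 * w n                      ∎
        where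
        open ≤-Reasoning
        lem : ∀ x i → (x + x) * i ≡ (1ℚ + (1ℚ + 0ℚ)) * (x * i)
        lem = Solver.solve-∀ ℚ-ring
        half : 1ℚ ≤ ι 2 * decay n
        half = begin
          1ℚ                               ≡⟨ sym (decay-eq n) ⟩
          (ι X + ι n) * inv (X ℕ.+ n)      ≤⟨ *-monoʳ (0≤inv (X ℕ.+ n)) (+-monoʳ-≤ (ι X) (ι-mono n≤X)) ⟩
          (ι X + ι X) * inv (X ℕ.+ n)      ≡⟨ lem (ι X) (inv (X ℕ.+ n)) ⟩
          ι 2 * decay n                    ∎

      σ≤X : ∀ i → i ℕ.≤ L → σ i ℕ.≤ X
      σ≤X i i≤L = ℕ.≤-trans (ℕ.*-mono-≤ lt lt) σL≤X
        where
        lt : root i ℕ.≤ root L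
        lt = ℕ.s≤s (ℕ.*-monoˡ-≤ M i≤L)

      1≤32H : ∀ i → 1 ℕ.≤ i → i ℕ.≤ L → 1ℚ ≤ ι 32 * H (σ i)
      1≤32H i l u = begin
        1ℚ                              ≤⟨ 1≤32w (σ i) (σ≤X i u) ⟩
        ι 32 * w (σ i)                  ≡⟨ cong (ι 32 *_) (sym (*-identityˡ (w (σ i)))) ⟩
        ι 32 * (1ℚ * w (σ i))           ≤⟨ *-monoˡ (0≤ι 32) (*-monoʳ (0≤w (σ i)) (r-square (root i) (ℕ.s≤s ℕ.z≤n) (ℕ.≤-trans (σ≤X i u) X≤N) (signs-at (root-mod i) (Coprime.1-coprimeTo M)))) ⟩
        ι 32 * (r (σ i) * w (σ i))      ≡⟨ cong (λ z → ι 32 * (z * w (σ i))) (trans (sym (*-identityʳ (r (σ i)))) (cong (r (σ i) *_) (sym (δ-yes (σ-mod i))))) ⟩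
        ι 32 * H (σ i)                  ∎
        where open ≤-Reasoning

      lower : ι L ≤ ι 32 * ∣ ∑ N (λ n → r n * G< n) ∣
      lower = begin
        ι L                                  ≡⟨ trans (sym (*-identityʳ (ι L))) (sym (∑-const L 1ℚ)) ⟩
        ∑ L (λ _ → 1ℚ)                       ≤⟨ ∑-mono L 1≤32H ⟩
        ∑ L (λ i → ι 32 * H (σ i))           ≡⟨ ∑-*ˡ L (ι 32) (λ i → H (σ i)) ⟩
        ι 32 * ∑ L (λ i → H (σ i))           ≤⟨ *-monoˡ (0≤ι 32) (∑-subsequence {H} σ L N σ-increasing (ℕ.≤-trans σL≤X X≤N) 0≤H) ⟩
        ι 32 * ∑ N H                         ≡⟨ cong (ι 32 *_) (sym (trans (cong ∣_∣ (trans (∑-cong N negated) (∑-neg N H))) (trans (∣-p∣≡∣p∣ (∑ N H)) (0≤p⇒∣p∣≡p (∑-nonneg N 0≤H))))) ⟩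
        ι 32 * ∣ ∑ N (λ n → r n * G< n) ∣    ∎
        where open ≤-Reasoning

    -- The numbers up to `N` are searched, so that the clash of `Absent.lower` with `upper` produces
    -- an actual witness.
    found : ∀ h → harmonic ≤ ι h → 32 ℕ.* (2 ℕ.* M ℕ.^ 4 ℕ.* (kernelSize ℕ.* h ℕ.^ 4) ℕ.+ 2) ℕ.< L → Found
    found h harmonic≤h big = by-search (any? {N} (λ i → suc (toℕ i) ℕ.% M ℕ.≟ u₀ ℕ.% M ×-dec ¬? (r (suc (toℕ i)) ≟ 0ℚ)))
      where
      by-search : Dec (∃ λ (i : Fin N) → suc (toℕ i) ℕ.% M ≡ u₀ ℕ.% M × r (suc (toℕ i)) ≢ 0ℚ) → Found
      by-search (yes (i , e , ne)) = suc (toℕ i) , (ℕ.s≤s ℕ.z≤n , toℕ<n i) , e , ne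
      by-search (no ¬h) = ⊥-elim (<-irrefl refl (<-≤-trans (ι-mono-< big) (begin
          ι L                                                 ≤⟨ Absent.lower absent ⟩
          ι 32 * ∣ ∑ N (λ n → r n * G< n) ∣                   ≤⟨ *-monoˡ (0≤ι 32) upper ⟩
          ι 32 * (ι 2 * pow (ι M) 4 * (ι kernelSize * pow harmonic 4) + ι 2)
            ≤⟨ *-monoˡ (0≤ι 32) (+-monoˡ-≤ (ι 2) (*-monoˡ (*-nonneg (0≤ι 2) (pow-nonneg 4 (0≤ι M))) (*-monoˡ (0≤ι kernelSize) (pow-mono 4 (∑-nonneg N (λ i _ _ → 0≤inv i)) harmonic≤h)))) ⟩
          ι 32 * (ι 2 * pow (ι M) 4 * (ι kernelSize * pow (ι h) 4) + ι 2) ≡⟨ collect ⟩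
          ι (32 ℕ.* (2 ℕ.* M ℕ.^ 4 ℕ.* (kernelSize ℕ.* h ℕ.^ 4) ℕ.+ 2)) ∎)))
        where
        open ≤-Reasoning
        absent : ¬ Found
        absent (suc n , (_ , n<N) , e , ne) = ¬h (fromℕ< n<N , subst (λ z → suc z ℕ.% M ≡ u₀ ℕ.% M) (sym (toℕ-fromℕ< n<N)) e , subst (λ z → r (suc z) ≢ 0ℚ) (sym (toℕ-fromℕ< n<N)) ne)
        collect-general : ∀ C D E → ι C * (ι 2 * pow (ι M) 4 * (ι D * pow (ι h) 4) + ι E) ≡ ι (C ℕ.* (2 ℕ.* M ℕ.^ 4 ℕ.* (D ℕ.* h ℕ.^ 4) ℕ.+ E))
        collect-general C D E = sym (trans (ι-* C _) (cong (ι C *_) (trans (ι-+ (2 ℕ.* M ℕ.^ 4 ℕ.* (D ℕ.* h ℕ.^ 4)) E) (cong (_+ ι E)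
          (trans (ι-* (2 ℕ.* M ℕ.^ 4) (D ℕ.* h ℕ.^ 4)) (cong₂ _*_ (trans (ι-* 2 (M ℕ.^ 4)) (cong (ι 2 *_) (ι-^ M 4))) (trans (ι-* D (h ℕ.^ 4)) (cong (ι D *_) (ι-^ h 4)))))))))
        collect = collect-general 32 kernelSize 2

    found-odd-powers : ((n , _) : Found) → ∀ {ℓ} → Prime ℓ → ∀ i v → n ≡ ℓ ℕ.^ suc (double i) ℕ.* v → ¬ ℓ ℕ.∣ v → χ₁ ℓ ≡ 1ℚ × χ₂ ℓ ≡ 1ℚ
    found-odd-powers (n , (1≤n , n≤N) , e , ne) {ℓ} pr i v n≡ ∤ = r-odd-power pr i v (1≤-factorʳ {ℓ ℕ.^ suc (double i)} 1≤n (sym n≡)) ∤ (subst (ℕ._≤ N) n≡ n≤N)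
      (signs-at e coprime pr (subst (ℓ ℕ.∣_) (sym n≡) (ℕ.∣m⇒∣m*n v (ℕ.m∣m*n (ℓ ℕ.^ double i))))) (subst (λ z → r z ≢ 0ℚ) n≡ ne)

-- Choice of the sizes, and existence of a good member of the class.

module PrescribedClass where
  open ResidueClasses using (module Residues)
  open RationalSums
  open Convolution using (double)
  open ClassComparison
  open import Data.Nat using (ℕ; zero; suc; _+_; _*_; _^_; _≤_; _<_; z≤n; s≤s)
  import Data.Nat as ℕ
  open import Data.Nat.Properties
  open import Data.Nat.Divisibility using (_∣_)
  open import Data.Nat.Coprimality using (Coprime)
  open import Data.Nat.Primality using (Prime)
  open import Data.Nat.Tactic.RingSolver using () renaming (solve-∀ to solve-∀ⁿ)
  open import Data.Rational as ℚ using (ℚ; 1ℚ)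
  import Data.Rational.Properties as ℚ
  open import Data.Product using (_×_; _,_; ∃; proj₁; proj₂)
  open import Relation.Nullary using (¬_; yes; no)
  open import Relation.Binary.PropositionalEquality

  n<2^n : ∀ n → n < 2 ^ n
  n<2^n zero = s≤s z≤n
  n<2^n (suc n) = ≤-trans (s≤s (n<2^n n)) (≤-trans (+-monoˡ-≤ (2 ^ n) (m^n>0 2 n)) (≤-reflexive (cong (2 ^ n +_) (sym (+-identityʳ (2 ^ n))))))

  inv-antitone : ∀ {m n} → 1 ≤ m → m ≤ n → inv n ℚ.≤ inv m
  inv-antitone {suc m} {suc n} _ m≤n = ι-cancel-≤ m (subst (ι (suc m) ℚ.* inv (suc n) ℚ.≤_) (trans (ι-inv n) (sym (ι-inv m))) (*-monoʳ (0≤inv (suc n)) (ι-mono m≤n)))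

  ∑-split : ∀ m n f → ∑ (m + n) f ≡ ∑ m f ℚ.+ ∑ n (λ i → f (m + i))
  ∑-split m zero f = trans (cong (λ k → ∑ k f) (+-identityʳ m)) (sym (ℚ.+-identityʳ (∑ m f)))
  ∑-split m (suc n) f = trans (cong (λ k → ∑ k f) (+-suc m n)) (trans (cong₂ (λ x k → x ℚ.+ f k) (∑-split m n f) (sym (+-suc m n)))
    (ℚ.+-assoc (∑ m f) (∑ n (λ i → f (m + i))) (f (m + suc n))))

  -- The terms from `2^h` up to `2^(h+1)` number at most `2^h` and are at most `2^(-h)` each, so
  -- every dyadic block adds at most 1.
  harmonic-bound : ∀ h n → n < 2 ^ h → ∑ n inv ℚ.≤ ι h
  harmonic-bound zero zero _ = ℚ.≤-refl
  harmonic-bound zero (suc n) (s≤s ())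
  harmonic-bound (suc h) n n<2^ with n <? 2 ^ h
  ... | yes n<2^h = ℚ.≤-trans (harmonic-bound h n n<2^h) (ι-mono (n≤1+n h))
  ... | no n≮2^h = dyadic (2 ^ h) (m^n>0 2 h) (≮⇒≥ n≮2^h) (subst (n <_) (cong (2 ^ h +_) (+-identityʳ (2 ^ h))) n<2^) (harmonic-bound h)
    where
    dyadic : ∀ x → 1 ≤ x → x ≤ n → n < x + x → (∀ n → n < x → ∑ n inv ℚ.≤ ι h) → ∑ n inv ℚ.≤ ι (suc h)
    dyadic (suc m) _ m<n n<2m ih = subst (λ k → ∑ k inv ℚ.≤ ι (suc h)) (m+[n∸m]≡n {m} (<⇒≤ m<n))
      (subst (ℚ._≤ ι (suc h)) (sym (∑-split m t inv)) (subst (∑ m inv ℚ.+ ∑ t (λ i → inv (m + i)) ℚ.≤_) (ℚ.+-comm (ι h) 1ℚ)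
        (ℚ.+-mono-≤ (ih m ≤-refl) block)))
      where
      t = n ℕ.∸ m
      t≤ : t ≤ suc m
      t≤ = m≤n+o⇒m∸n≤o n m (≤-pred n<2m)
      block : ∑ t (λ i → inv (m + i)) ℚ.≤ 1ℚ
      block = ℚ.≤-trans (∑-mono t (λ i 1≤i _ → inv-antitone {suc m} (s≤s z≤n) (subst (_≤ m + i) (+-comm m 1) (+-monoʳ-≤ m 1≤i))))
        (ℚ.≤-trans (ℚ.≤-reflexive (∑-const t (inv (suc m)))) (ℚ.≤-trans (*-monoʳ (0≤inv (suc m)) (ι-mono t≤)) (ℚ.≤-reflexive (ι-inv m))))

  private
    ^-mono : ∀ {x y} k → x ≤ y → x ^ k ≤ y ^ k
    ^-mono k = ^-monoˡ-≤ k

    ^-* : ∀ x y k → (x * y) ^ k ≡ x ^ k * y ^ k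
    ^-* x y zero = refl
    ^-* x y (suc k) = trans (cong (x * y *_) (^-* x y k)) (lem x y (x ^ k) (y ^ k))
      where
      lem : ∀ x y p q → x * y * (p * q) ≡ x * p * (y * q)
      lem = solve-∀ⁿ

    -- The left side has degree 4 in `h`, so it is at most `64 (M⁴ C D⁴ + 1) (k + 1)⁴`. Taking `k`
    -- equal to the constant in front leaves `k (k + 1)⁴ < (k + 1)⁸ ≤ 2^(8k)`.
    dominated : ∀ C M h D k → h ≤ D * suc k → k ≡ 64 * (M ^ 4 * (C * D ^ 4) + 1) → 32 * (2 * M ^ 4 * (C * h ^ 4) + 2) < 2 ^ (k * 8)
    dominated C M h D k h≤ k≡ = begin-strict
      32 * (2 * M ^ 4 * (C * h ^ 4) + 2)
        ≤⟨ *-monoʳ-≤ 32 (+-monoˡ-≤ 2 (*-monoʳ-≤ (2 * M ^ 4) (*-monoʳ-≤ C (≤-trans (^-mono 4 h≤) (≤-reflexive (^-* D (suc k) 4)))))) ⟩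
      32 * (2 * M ^ 4 * (C * (D ^ 4 * K)) + 2)
        ≡⟨ lem₁ (M ^ 4) C (D ^ 4) K ⟩
      64 * (M ^ 4 * (C * D ^ 4)) * K + 64 * 1
        ≤⟨ +-monoʳ-≤ (64 * (M ^ 4 * (C * D ^ 4)) * K) (*-monoʳ-≤ 64 (m^n>0 (suc k) 4)) ⟩
      64 * (M ^ 4 * (C * D ^ 4)) * K + 64 * K
        ≡⟨ lem₂ (M ^ 4 * (C * D ^ 4)) K ⟩
      64 * (M ^ 4 * (C * D ^ 4) + 1) * K
        ≡⟨ cong (_* K) (sym k≡) ⟩
      k * K
        <⟨ *-monoˡ-< K {{ℕ.>-nonZero (m^n>0 (suc k) 4)}} (≤-trans (≤-reflexive (sym (*-identityʳ (suc k)))) (*-monoʳ-≤ (suc k) (m^n>0 (suc k) 3))) ⟩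
      K * K
        ≡⟨ sym (^-distribˡ-+-* (suc k) 4 4) ⟩
      suc k ^ 8
        ≤⟨ ^-mono 8 (n<2^n k) ⟩
      (2 ^ k) ^ 8
        ≡⟨ ^-*-assoc 2 k 8 ⟩
      2 ^ (k * 8) ∎
      where
      open ≤-Reasoning
      K = suc k ^ 4
      lem₁ : ∀ m c d k → 32 * (2 * m * (c * (d * k)) + 2) ≡ 64 * (m * (c * d)) * k + 64 * 1
      lem₁ = solve-∀ⁿ
      lem₂ : ∀ x k → 64 * x * k + 64 * k ≡ 64 * (x + 1) * k
      lem₂ = solve-∀ⁿ

  module _ (M : ℕ) .{{nzM : ℕ.NonZero M}} (u₀ : ℕ) (coprime : Coprime u₀ M) where
    open Residues M

    GoodClassMember : (ℕ → ℚ) → (ℕ → ℚ) → Set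
    GoodClassMember χ₁ χ₂ = ∃ λ n → 1 ≤ n × n ℕ.% M ≡ u₀ ℕ.% M ×
      (∀ {ℓ} → Prime ℓ → ∀ i v → n ≡ ℓ ^ suc (double i) * v → ¬ ℓ ∣ v → χ₁ ℓ ≡ 1ℚ × χ₂ ℓ ≡ 1ℚ)

    existence : ∀ {χ₁ χ₂} → Character χ₁ → Character χ₂ → χ₁ u₀ ≡ 1ℚ → χ₂ u₀ ≡ 1ℚ → GoodClassMember χ₁ χ₂
    existence {χ₁} {χ₂} X₁ X₂ e₁ e₂ = choose _ refl
      where
      -- `80 + 11 M` bounds the exponent `h` chosen below relative to `k + 1`, as
      -- `h = 10 (8k + M) + M = 80 k + 11 M`.
      choose : ∀ k → k ≡ 64 * (M ^ 4 * (kernelSize * (80 + 11 * M) ^ 4) + 1) → GoodClassMember χ₁ χ₂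
      choose k k≡ = with-sizes L refl (L * M + L * M * suc (L * M)) refl (suc (L * M + L * M * suc (L * M)) ^ 5) refl
        where
        L = 2 ^ (k * 8)
        with-sizes : ∀ L → L ≡ 2 ^ (k * 8) → ∀ X' → suc X' ≡ suc (L * M) * suc (L * M) → ∀ q → q ≡ suc X' ^ 5 → GoodClassMember χ₁ χ₂
        with-sizes L L≡ X' X≡ q q≡ = proj₁ F , proj₁ (proj₁ (proj₂ F)) , proj₁ (proj₂ (proj₂ F)) , odd-powers F
          where
          open Comparison M u₀ coprime
          j = k * 8
          -- From `1 + L M ≤ 2^(j+M)`: doubled for `X`, five times that for `X⁵`, and a last `M` for
          -- the factor `M < 2^M` of `N`.
          h = (j + M + (j + M)) * 5 + M
          N<2^h : q * M < 2 ^ h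
          N<2^h = begin-strict
            q * M                            <⟨ *-monoʳ-< q {{ℕ.>-nonZero (subst (1 ≤_) (sym q≡) (m^n>0 (suc X') 5))}} (n<2^n M) ⟩
            q * 2 ^ M                        ≤⟨ *-monoˡ-≤ (2 ^ M) q≤ ⟩
            2 ^ ((j + M + (j + M)) * 5) * 2 ^ M ≡⟨ sym (^-distribˡ-+-* 2 ((j + M + (j + M)) * 5) M) ⟩
            2 ^ h                            ∎
            where
            open ≤-Reasoning
            root≤ : suc (L * M) ≤ 2 ^ (j + M)
            root≤ = begin
              suc (L * M)        ≤⟨ +-monoˡ-≤ (L * M) (subst (1 ≤_) (sym L≡) (m^n>0 2 j)) ⟩
              L + L * M          ≡⟨ sym (*-suc L M) ⟩
              L * suc M          ≤⟨ *-monoʳ-≤ L (n<2^n M) ⟩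
              L * 2 ^ M          ≡⟨ cong (_* 2 ^ M) L≡ ⟩
              2 ^ j * 2 ^ M      ≡⟨ sym (^-distribˡ-+-* 2 j M) ⟩
              2 ^ (j + M)        ∎
            q≤ : q ≤ 2 ^ ((j + M + (j + M)) * 5)
            q≤ = begin
              q                                     ≡⟨ q≡ ⟩
              suc X' ^ 5                            ≤⟨ ^-mono 5 (≤-trans (≤-reflexive X≡) (≤-trans (*-mono-≤ root≤ root≤) (≤-reflexive (sym (^-distribˡ-+-* 2 (j + M) (j + M)))))) ⟩
              (2 ^ (j + M + (j + M))) ^ 5           ≡⟨ ^-*-assoc 2 (j + M + (j + M)) 5 ⟩
              2 ^ ((j + M + (j + M)) * 5)           ∎
          h≤ : h ≤ (80 + 11 * M) * suc k
          h≤ = ≤-trans (m≤m+n h (80 + 11 * M * k)) (≤-reflexive (lem k M))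
            where
            lem : ∀ k M → (k * 8 + M + (k * 8 + M)) * 5 + M + (80 + 11 * M * k) ≡ (80 + 11 * M) * suc k
            lem = solve-∀ⁿ
          F = found X₁ X₂ e₁ e₂ L X' q (q * M) X≡ refl q≡ h (harmonic-bound h (q * M) N<2^h)
                (subst (32 * (2 * M ^ 4 * (kernelSize * h ^ 4) + 2) <_) (sym L≡) (dominated kernelSize M h (80 + 11 * M) k h≤ k≡))
          odd-powers = found-odd-powers X₁ X₂ e₁ e₂ L X' q (q * M) X≡ refl q≡

-- The local choice of `n`, by exhaustive check.

module LocalTables where
  open Hilbert
  open import Data.Nat using (zero; suc)
  open import Data.Parity using (Parity; 0ℙ; 1ℙ)
  open import Data.Bool using (Bool; true; false; _∧_; _∨_)
  open import Data.Product using (∃; _×_; _,_)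
  open import Data.Vec using (Vec; []; _∷_)
  open import Data.Empty using (⊥-elim)
  open import Relation.Binary.PropositionalEquality

  private
    all any : ∀ n → (Vec Parity n → Bool) → Bool
    all zero f = f []
    all (suc n) f = all n (λ v → f (0ℙ ∷ v)) ∧ all n (λ v → f (1ℙ ∷ v))
    any zero f = f []
    any (suc n) f = any n (λ v → f (0ℙ ∷ v)) ∨ any n (λ v → f (1ℙ ∷ v))

    ∧-sound : ∀ {x y} → x ∧ y ≡ true → x ≡ true × y ≡ true
    ∧-sound {true} e = refl , e

    all-sound : ∀ n f → all n f ≡ true → ∀ v → f v ≡ true
    all-sound zero f e [] = e
    all-sound (suc n) f e (x ∷ v) with ∧-sound {all n (λ v → f (0ℙ ∷ v))} e
    all-sound (suc n) f e (0ℙ ∷ v) | a , _ = all-sound n _ a v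
    all-sound (suc n) f e (1ℙ ∷ v) | _ , b = all-sound n _ b v

    any-sound : ∀ n f → any n f ≡ true → ∃ λ v → f v ≡ true
    any-sound zero f e = [] , e
    any-sound (suc n) f e with any n (λ v → f (0ℙ ∷ v)) in eq
    ... | true = let (v , r) = any-sound n _ eq in 0ℙ ∷ v , r
    ... | false = let (v , r) = any-sound n _ e in 1ℙ ∷ v , r

    zero? : Parity → Bool
    zero? 0ℙ = true
    zero? 1ℙ = false

    zero?-sound : ∀ {x} → zero? x ≡ true → x ≡ 0ℙ
    zero?-sound {0ℙ} _ = refl

    ∨-sound : ∀ {x y} → x ∨ y ≡ true → x ≢ true → y ≡ true
    ∨-sound {true} _ h = ⊥-elim (h refl)
    ∨-sound {false} e _ = e

    -- The bits are the class of `-1` followed by the square classes of `P`, `Q` and `D`, flattened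
    -- so that `all` can enumerate them; the second vector is the class sought for `n`.
    admissible : Vec Parity 7 → Vec Parity 2 → Bool
    admissible (ε ∷ a ∷ b ∷ c ∷ d ∷ e ∷ f ∷ []) (x ∷ y ∷ []) =
      zero? (hilb ε (a , b) ((c , d) ⊞ (x , y))) ∧ zero? (hilb ε ((a , b) ⊞ (e , f)) (x , y))

    trivial : Vec Parity 7 → Bool
    trivial (ε ∷ a ∷ b ∷ c ∷ d ∷ e ∷ f ∷ []) = zero? e ∧ zero? f

    admissible₂ : Vec Parity 9 → Vec Parity 3 → Bool
    admissible₂ (a ∷ b ∷ c ∷ d ∷ e ∷ f ∷ g ∷ h ∷ i ∷ []) (x ∷ y ∷ z ∷ []) =
      zero? (hilb₂ (a , b , c) ((d , e , f) ⊞₂ (x , y , z))) ∧ zero? (hilb₂ ((a , b , c) ⊞₂ (g , h , i)) (x , y , z))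

    trivial₂ : Vec Parity 9 → Bool
    trivial₂ (a ∷ b ∷ c ∷ d ∷ e ∷ f ∷ g ∷ h ∷ i ∷ []) = zero? g ∧ (zero? h ∧ zero? i)

    row : Vec Parity 7 → Bool
    row v = trivial v ∨ any 2 (admissible v)

    row₂ : Vec Parity 9 → Bool
    row₂ v = trivial₂ v ∨ any 3 (admissible₂ v)

    odd-table : all 7 row ≡ true
    odd-table = refl

    two-table : all 9 row₂ ≡ true
    two-table = refl

  -- A quadratic extension ℚ_ℓ(√D) splits every quaternion algebra (P, Q) over ℚ_ℓ: there is a class n with
  -- (P, Q n) and (P D, n) both split. This is checked on all square classes.
  local-choice : ∀ ε P Q D → D ≢ (0ℙ , 0ℙ) → ∃ λ n → hilb ε P (Q ⊞ n) ≡ 0ℙ × hilb ε (P ⊞ D) n ≡ 0ℙ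
  local-choice ε (a , b) (c , d) (e , f) h = go (any-sound 2 (admissible v) (∨-sound (all-sound 7 row odd-table v)
      (λ t → let (s , s') = ∧-sound {zero? e} t in h (cong₂ _,_ (zero?-sound s) (zero?-sound s')))))
    where
    v = ε ∷ a ∷ b ∷ c ∷ d ∷ e ∷ f ∷ []
    go : (∃ λ w → admissible v w ≡ true) → _
    go (x ∷ y ∷ [] , r) = let (s , s') = ∧-sound {zero? (hilb ε (a , b) ((c , d) ⊞ (x , y)))} r in (x , y) , zero?-sound s , zero?-sound s'

  local-choice₂ : ∀ P Q D → D ≢ (0ℙ , 0ℙ , 0ℙ) → ∃ λ n → hilb₂ P (Q ⊞₂ n) ≡ 0ℙ × hilb₂ (P ⊞₂ D) n ≡ 0ℙ
  local-choice₂ (a , b , c) (d , e , f) (g , h , i) ne = go (any-sound 3 (admissible₂ v) (∨-sound (all-sound 9 row₂ two-table v)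
      (λ t → let (s , t') = ∧-sound {zero? g} t ; (s' , s'') = ∧-sound {zero? h} t'
             in ne (cong₂ _,_ (zero?-sound s) (cong₂ _,_ (zero?-sound s') (zero?-sound s''))))))
    where
    v = a ∷ b ∷ c ∷ d ∷ e ∷ f ∷ g ∷ h ∷ i ∷ []
    go : (∃ λ w → admissible₂ v w ≡ true) → _
    go (x ∷ y ∷ z ∷ [] , r) = let (s , s') = ∧-sound {zero? (hilb₂ (a , b , c) ((d , e , f) ⊞₂ (x , y , z)))} r in (x , y , z) , zero?-sound s , zero?-sound s'

-- Sums of Hilbert symbols as characters.

module SymbolCharacters where
  open Congruences
  open Gauss using (res; res-cong)
  open Hilbert
  open ChineseRemainder
  open LocalTables
  open RationalSums using (0≤1)
  open Convolution using (Sign; prime-factor)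
  open ResidueClasses using (module Residues; coprime-mod)
  open import Data.Nat as ℕ using (ℕ; zero; suc; parity)
  import Data.Nat.Properties as ℕ
  import Data.Nat.Divisibility as ℕ
  import Data.Nat.DivMod as ℕ
  open import Data.Nat.ListAction using (product)
  open import Data.Nat.Coprimality as Coprime using (Coprime; coprime?)
  open import Data.Nat.Primality using (Prime; euclidsLemma; prime⇒irreducible; ¬prime[1]; prime[2]; productOfPrimes≢0)
  open import Data.Nat.Primality.Factorisation using (factorise; PrimeFactorisation; factorisationHasAllPrimeFactors)
  open import Data.Integer using (ℤ; +_; -[1+_]; -_; _*_; _<_; 0ℤ; 1ℤ; -1ℤ; +<+) renaming (∣_∣ to abs)
  open import Data.Integer.Properties using (pos-*; *-assoc; *-identityˡ; *-identityʳ; -1*i≡-i)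
  open import Data.Integer.Divisibility.Signed using (_∣_; divides; ∣⇒∣ᵤ; ∣ᵤ⇒∣; ∣-trans; ∣m⇒∣m*n; ∣n⇒∣m*n)
  open import Data.Integer.Tactic.RingSolver using (solve-∀)
  open import Data.Parity using (Parity; 0ℙ; 1ℙ) renaming (_+_ to infixl 6 _⊕_)
  import Data.Parity.Properties as ℙ
  open import Data.Rational as ℚ using (ℚ; 0ℚ; 1ℚ)
  import Data.Rational.Properties as ℚ
  open import Data.List using (List; []; _∷_; filter; deduplicate)
  open import Data.List.Relation.Unary.All as All using (All; []; _∷_)
  open import Data.List.Relation.Unary.AllPairs using ([]; _∷_)
  open import Data.List.Relation.Unary.Any using (here; there)
  open import Data.List.Relation.Unary.Unique.Propositional using (Unique)
  open import Data.List.Relation.Unary.Unique.DecPropositional.Properties ℕ._≟_ using (deduplicate-!)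
  open import Data.List.Membership.Propositional using (_∈_)
  open import Data.List.Membership.Propositional.Properties using (∈-filter⁺; ∈-filter⁻; ∈-deduplicate⁺; ∈-deduplicate⁻)
  open import Data.Product using (∃; _,_; proj₁)
  open import Data.Sum using (_⊎_; inj₁; inj₂; [_,_]′)
  open import Data.Empty using (⊥; ⊥-elim)
  open import Function using (_∘_)
  open import Relation.Nullary using (¬_; Dec; yes; no)
  open import Relation.Binary.PropositionalEquality

  ∈⇒∣product : ∀ {ℓ ps} → ℓ ∈ ps → ℓ ℕ.∣ product ps
  ∈⇒∣product {ps = p ∷ ps} (here refl) = ℕ.m∣m*n (product ps)
  ∈⇒∣product {ps = p ∷ ps} (there m) = ℕ.∣n⇒∣m*n p (∈⇒∣product m)

  odd≢2 : ∀ {ℓ} → OddPrime′ ℓ → ℓ ≢ 2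
  odd≢2 (_ , ()) refl

  2-or-odd : ∀ {ℓ} → Prime ℓ → ℓ ≡ 2 ⊎ OddPrime′ ℓ
  2-or-odd {ℓ} pr = go (parity ℓ) refl
    where
    2∣ : ∀ n → parity n ≡ 0ℙ → 2 ℕ.∣ n
    2∣ zero e = 2 ℕ.∣0
    2∣ (suc (suc n)) e = ℕ.∣m∣n⇒∣m+n ℕ.∣-refl (2∣ n e)
    go : ∀ π → parity ℓ ≡ π → ℓ ≡ 2 ⊎ OddPrime′ ℓ
    go 1ℙ e = inj₂ (pr , e)
    go 0ℙ e with prime⇒irreducible pr (2∣ ℓ e)
    ... | inj₂ e' = inj₁ (sym e')

  prime-∣-prime : ∀ {p q} → Prime p → Prime q → p ℕ.∣ q → p ≡ q
  prime-∣-prime pp pq d with prime⇒irreducible pq d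
  ... | inj₁ refl = ⊥-elim (¬prime[1] pp)
  ... | inj₂ e = e

  record OddPrimeDivisors (n : ℕ) : Set where
    field
      S        : List ℕ
      odds     : All OddPrime′ S
      unique   : Unique S
      complete : ∀ {ℓ} → OddPrime′ ℓ → ℓ ℕ.∣ n → ℓ ∈ S
      sound    : ∀ {ℓ} → ℓ ∈ S → ℓ ℕ.∣ n

  oddPrimeDivisors : ∀ n → .{{_ : ℕ.NonZero n}} → OddPrimeDivisors n
  oddPrimeDivisors n = record
    { S = deduplicate ℕ._≟_ oddFactors
    ; odds = All.tabulate (λ m → let (m' , o) = ∈-filter⁻ odd? {xs = factors} (∈-deduplicate⁻ ℕ._≟_ oddFactors m) in All.lookup factorsPrime m' , o)
    ; unique = deduplicate-! oddFactors
    ; complete = λ (pr , o) d → ∈-deduplicate⁺ ℕ._≟_ (∈-filter⁺ odd? (factorisationHasAllPrimeFactors pr (subst (_ ℕ.∣_) isFactorisation d) factorsPrime) o)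
    ; sound = λ m → subst (_ ℕ.∣_) (sym isFactorisation) (∈⇒∣product (proj₁ (∈-filter⁻ odd? {xs = factors} (∈-deduplicate⁻ ℕ._≟_ oddFactors m)))) }
    where
    open PrimeFactorisation (factorise n)
    odd? : ∀ ℓ → Dec (parity ℓ ≡ 1ℙ)
    odd? ℓ = parity ℓ ℙ.≟ 1ℙ
    oddFactors = filter odd? factors

  posUnit-* : ∀ {S a b} → PosUnit S a → PosUnit S b → PosUnit S (a * b)
  posUnit-* {S} {b = b} one y = subst (PosUnit S) (sym (*-identityˡ b)) y
  posUnit-* {S} {b = b} (mul {g} {a} γ x) y = subst (PosUnit S) (sym (*-assoc g a b)) (mul γ (posUnit-* x y))

  generator-posUnit : ∀ {S g} → Generator S g → PosUnit S g
  generator-posUnit {S} {g} γ = subst (PosUnit S) (*-identityʳ g) (mul γ one)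

  sUnit-* : ∀ {S a b} → PosUnit S a → SUnit S b → SUnit S (a * b)
  sUnit-* x (pos y) = pos (posUnit-* x y)
  sUnit-* {S} {a} x (neg {b} y) = subst (SUnit S) (lem a b) (neg (posUnit-* x y))
    where
    lem : ∀ a b → -1ℤ * (a * b) ≡ a * (-1ℤ * b)
    lem = solve-∀

  posUnit-weaken : ∀ {S μ a} → PosUnit S a → PosUnit (μ ∷ S) a
  posUnit-weaken one = one
  posUnit-weaken (mul two x) = mul two (posUnit-weaken x)
  posUnit-weaken (mul (prime m) x) = mul (prime (there m)) (posUnit-weaken x)

  sUnit-weaken : ∀ {S μ a} → SUnit S a → SUnit (μ ∷ S) a
  sUnit-weaken (pos x) = pos (posUnit-weaken x)
  sUnit-weaken (neg x) = neg (posUnit-weaken x)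

  posUnit-of : ∀ {S} n .{{_ : ℕ.NonZero n}} → (∀ {ℓ} → OddPrime′ ℓ → ℓ ℕ.∣ n → ℓ ∈ S) → PosUnit S (+ n)
  posUnit-of {S} n complete = subst (λ k → PosUnit S (+ k)) (sym isFactorisation)
    (go factors factorsPrime (λ {ℓ} m → subst (ℓ ℕ.∣_) (sym isFactorisation) (∈⇒∣product m)))
    where
    open PrimeFactorisation (factorise n)
    go : ∀ ps → All Prime ps → (∀ {ℓ} → ℓ ∈ ps → ℓ ℕ.∣ n) → PosUnit S (+ product ps)
    go [] _ _ = one
    go (ℓ ∷ ps) (pr ∷ prs) d = subst (PosUnit S) (sym (pos-* ℓ (product ps))) (by (2-or-odd pr))
      where
      rest = go ps prs (d ∘ there)
      by : ℓ ≡ 2 ⊎ OddPrime′ ℓ → PosUnit S (+ ℓ * + product ps)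
      by (inj₁ refl) = mul two rest
      by (inj₂ o) = mul (prime (complete o (d (here refl)))) rest

  sUnit-of : ∀ {S} a → a ≢ 0ℤ → (∀ {ℓ} → OddPrime′ ℓ → ℓ ℕ.∣ abs a → ℓ ∈ S) → SUnit S a
  sUnit-of (+ zero) h c = ⊥-elim (h refl)
  sUnit-of (+ suc n) h c = pos (posUnit-of (suc n) c)
  sUnit-of {S} -[1+ n ] h c = subst (SUnit S) (-1*i≡-i (+ suc n)) (neg (posUnit-of (suc n) c))

  Positiveℤ : ℤ → Set
  Positiveℤ a = ∃ λ k → a ≡ + suc k

  positive-* : ∀ {a b} → Positiveℤ a → Positiveℤ b → Positiveℤ (a * b)
  positive-* (k , refl) (l , refl) = l ℕ.+ k ℕ.* suc l , sym (pos-* (suc k) (suc l))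

  positive-prime : ∀ {ℓ} → Prime ℓ → Positiveℤ (+ ℓ)
  positive-prime {suc k} _ = k , refl
  positive-prime {zero} pr = ⊥-elim (¬prime[0] pr)
    where open import Data.Nat.Primality using (¬prime[0])

  0<positive : ∀ {a} → Positiveℤ a → 0ℤ < a
  0<positive (k , refl) = +<+ (ℕ.s≤s ℕ.z≤n)

  positive≢0 : ∀ {a} → Positiveℤ a → a ≢ 0ℤ
  positive≢0 (k , refl) ()

  coprime-by-primes : ∀ {a b} → b ≢ 0 → (∀ {ℓ} → Prime ℓ → ℓ ℕ.∣ a → ℓ ℕ.∣ b → ⊥) → Coprime a b
  coprime-by-primes h n {0} (_ , d) = ⊥-elim (h (ℕ.0∣⇒≡0 d))
  coprime-by-primes h n {1} _ = refl
  coprime-by-primes h n {suc (suc k)} (d , d') with prime-factor (suc (suc k)) (ℕ.s≤s (ℕ.s≤s ℕ.z≤n))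
  ... | ℓ , pr , e = ⊥-elim (n pr (ℕ.∣-trans e d) (ℕ.∣-trans e d'))

  sgnℚ : Parity → ℚ
  sgnℚ 0ℙ = 1ℚ
  sgnℚ 1ℙ = ℚ.- 1ℚ

  sgnℚ-⊕ : ∀ s t → sgnℚ (s ⊕ t) ≡ sgnℚ s ℚ.* sgnℚ t
  sgnℚ-⊕ 0ℙ 0ℙ = refl
  sgnℚ-⊕ 0ℙ 1ℙ = refl
  sgnℚ-⊕ 1ℙ 0ℙ = refl
  sgnℚ-⊕ 1ℙ 1ℙ = refl

  sgnℚ-sign : ∀ s → Sign (sgnℚ s)
  sgnℚ-sign 0ℙ = inj₁ refl
  sgnℚ-sign 1ℙ = inj₂ refl

  sgnℚ-bounded : ∀ s → ℚ.∣ sgnℚ s ∣ ℚ.≤ 1ℚ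
  sgnℚ-bounded 0ℙ = ℚ.≤-refl
  sgnℚ-bounded 1ℙ = ℚ.≤-refl

  sgnℚ≡1 : ∀ {s} → sgnℚ s ≡ 1ℚ → s ≡ 0ℙ
  sgnℚ≡1 {0ℙ} _ = refl
  sgnℚ≡1 {1ℙ} ()

  ⊕-cancelˡ : ∀ {x y} → x ⊕ y ≡ 0ℙ → x ≡ 0ℙ → y ≡ 0ℙ
  ⊕-cancelˡ e refl = e

  module Characters {S : List ℕ} (odds : All OddPrime′ S) (uniq : Unique S) where
    open ProductFormula odds uniq public

    -- 2 occurs three times because unit classes at 2 are read modulo 8. As a product of listed
    -- primes the modulus has its prime divisors at hand.
    allPrimes : List ℕ
    allPrimes = 2 ∷ 2 ∷ 2 ∷ S

    M : ℕ
    M = product allPrimes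

    allPrimes-prime : All Prime allPrimes
    allPrimes-prime = prime[2] ∷ prime[2] ∷ prime[2] ∷ All.map proj₁ odds

    instance
      M-nonZero : ℕ.NonZero M
      M-nonZero = productOfPrimes≢0 allPrimes-prime

    open Residues M using (Character)

    8∣M : 8 ℕ.∣ M
    8∣M = ℕ.divides (product S) (lem (product S))
      where
      open import Data.Nat.Tactic.RingSolver using () renaming (solve-∀ to solve-∀ⁿ)
      lem : ∀ x → 2 ℕ.* (2 ℕ.* (2 ℕ.* x)) ≡ x ℕ.* 8
      lem = solve-∀ⁿ

    2∣M : 2 ℕ.∣ M
    2∣M = ∈⇒∣product {ps = allPrimes} (here refl)

    ∈⇒∣M : ∀ {ℓ} → ℓ ∈ S → ℓ ℕ.∣ M
    ∈⇒∣M m = ∈⇒∣product {ps = allPrimes} (there (there (there m)))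

    ∣M⇒ : ∀ {ℓ} → Prime ℓ → ℓ ℕ.∣ M → ℓ ≡ 2 ⊎ ℓ ∈ S
    ∣M⇒ pr d with factorisationHasAllPrimeFactors pr d allPrimes-prime
    ... | here e = inj₁ e
    ... | there (here e) = inj₁ e
    ... | there (there (here e)) = inj₁ e
    ... | there (there (there m)) = inj₂ m

    coarsen : ∀ {m a b} → m ℕ.∣ M → a ≅ b ⟦ M ⟧ → a ≅ b ⟦ m ⟧
    coarsen d (mk≅ e) = mk≅ (∣-trans (∣ᵤ⇒∣ d) e)

    coprime⇒∤ : ∀ {n ℓ} → Coprime n M → Prime ℓ → ℓ ℕ.∣ M → ¬ + ℓ ∣ + n
    coprime⇒∤ c pr d d' = ¬prime[1] (subst Prime (c (∣⇒∣ᵤ d' , d)) pr)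

    coprime⇒≢0 : ∀ {n} → Coprime n M → + n ≢ 0ℤ
    coprime⇒≢0 {n} c e = coprime⇒∤ {n} c prime[2] 2∣M (subst (+ 2 ∣_) (sym e) (divides 0ℤ refl))

    cls₂-coprime : ∀ {n} → Coprime n M → cls₂ (+ n) ≡ (0ℙ , ρ₈ (n ℕ.% 8))
    cls₂-coprime {n} c = cls₂-split (split-unit (coprime⇒∤ {n} c prime[2] 2∣M))

    cls-coprime : ∀ {n ℓ} → ℓ ∈ S → Coprime n M → cls ℓ (+ n) ≡ (0ℙ , res ℓ (+ n))
    cls-coprime {n} m c = cls-split (proj₁ (op m)) (split-unit (coprime⇒∤ {n} c (proj₁ (op m)) (∈⇒∣M m)))

    cls-mod : ∀ {m n ℓ} → ℓ ∈ S → Coprime m M → Coprime n M → m ℕ.% M ≡ n ℕ.% M → cls ℓ (+ m) ≡ cls ℓ (+ n)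
    cls-mod {m} {n} {ℓ} ℓ∈ cm cn e = trans (cls-coprime {m} ℓ∈ cm) (trans (cong (0ℙ ,_) (res-cong {ℓ} (coarsen (∈⇒∣M ℓ∈) (%ℕ⇒≅ {M} {+ m} {+ n} e)))) (sym (cls-coprime {n} ℓ∈ cn)))

    cls₂-mod : ∀ {m n} → Coprime m M → Coprime n M → m ℕ.% M ≡ n ℕ.% M → cls₂ (+ m) ≡ cls₂ (+ n)
    cls₂-mod {m} {n} cm cn e = trans (cls₂-coprime {m} cm) (trans (cong (λ r → 0ℙ , ρ₈ r) (≅⇒%ℕ {8} {+ m} {+ n} (coarsen 8∣M (%ℕ⇒≅ {M} {+ m} {+ n} e)))) (sym (cls₂-coprime {n} cn)))

    hsum-mod : ∀ a {m n} → Coprime m M → Coprime n M → m ℕ.% M ≡ n ℕ.% M → hsum S a (+ m) ≡ hsum S a (+ n)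
    hsum-mod a {m} {n} cm cn e = cong₂ _⊕_ (cong (hilb₂ (cls₂ a)) (cls₂-mod {m} {n} cm cn e))
      (sumOver-cong {S} (λ {ℓ} ℓ∈ → cong (hilb (res ℓ -1ℤ) (cls ℓ a)) (cls-mod {m} {n} ℓ∈ cm cn e)))

    -- n ↦ Π_{v ∈ S ∪ {2}} (a, n)_v, extended by 0.
    χ : ℤ → ℕ → ℚ
    χ a n with coprime? n M
    ... | yes _ = sgnℚ (hsum S a (+ n))
    ... | no _ = 0ℚ

    χ-coprime : ∀ a {n} → Coprime n M → χ a n ≡ sgnℚ (hsum S a (+ n))
    χ-coprime a {n} c with coprime? n M
    ... | yes _ = refl
    ... | no h = ⊥-elim (h c)

    χ-not-coprime : ∀ a {n} → ¬ Coprime n M → χ a n ≡ 0ℚ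
    χ-not-coprime a {n} c with coprime? n M
    ... | yes h = ⊥-elim (c h)
    ... | no h = refl

    coprime-*ˡ : ∀ {m n} → Coprime (m ℕ.* n) M → Coprime m M
    coprime-*ˡ {m} {n} c (d , d') = c (ℕ.∣m⇒∣m*n n d , d')

    coprime-*ʳ : ∀ {m n} → Coprime (m ℕ.* n) M → Coprime n M
    coprime-*ʳ {m} {n} c (d , d') = c (ℕ.∣n⇒∣m*n m d , d')

    M≢0 : M ≢ 0
    M≢0 = ℕ.≢-nonZero⁻¹ M

    coprime-* : ∀ {m n} → Coprime m M → Coprime n M → Coprime (m ℕ.* n) M
    coprime-* {m} {n} cm cn = coprime-by-primes M≢0 (λ {ℓ} pr d d' → [ (λ e → ¬prime[1] (subst Prime (cm (e , d')) pr)) , (λ e → ¬prime[1] (subst Prime (cn (e , d')) pr)) ]′ (euclidsLemma m n pr d))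

    χ-character : ∀ a → Character (χ a)
    χ-character a = record
      { χ-* = λ m n → mult m n (coprime? m M) (coprime? n M)
      ; χ-1 = trans (χ-coprime a {1} (Coprime.1-coprimeTo M)) (cong sgnℚ (trans (hsum-sym a 1ℤ) (hsum-1ˡ a)))
      ; periodic = λ n → per n (coprime? n M)
      ; bounded = λ n → bound n (coprime? n M)
      ; signs = λ {n} c → subst Sign (sym (χ-coprime a {n} c)) (sgnℚ-sign (hsum S a (+ n)))
      }
      where
      mult : ∀ m n → Dec (Coprime m M) → Dec (Coprime n M) → χ a (m ℕ.* n) ≡ χ a m ℚ.* χ a n
      mult m n (yes cm) (yes cn) = trans (χ-coprime a {m ℕ.* n} (coprime-* {m} {n} cm cn))
        (trans (cong sgnℚ (trans (cong (hsum S a) (pos-* m n)) (hsum-*ʳ a (coprime⇒≢0 {m} cm) (coprime⇒≢0 {n} cn))))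
          (trans (sgnℚ-⊕ (hsum S a (+ m)) (hsum S a (+ n))) (sym (cong₂ ℚ._*_ (χ-coprime a {m} cm) (χ-coprime a {n} cn)))))
      mult m n (no cm) _ = trans (χ-not-coprime a {m ℕ.* n} (λ c → cm (coprime-*ˡ {m} {n} c))) (sym (trans (cong (ℚ._* χ a n) (χ-not-coprime a {m} cm)) (ℚ.*-zeroˡ (χ a n))))
      mult m n (yes _) (no cn) = trans (χ-not-coprime a {m ℕ.* n} (λ c → cn (coprime-*ʳ {m} {n} c))) (sym (trans (cong (χ a m ℚ.*_) (χ-not-coprime a {n} cn)) (ℚ.*-zeroʳ (χ a m))))
      shift : ∀ n → (n ℕ.+ M) ℕ.% M ≡ n ℕ.% M
      shift n = ℕ.[m+n]%n≡m%n n M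
      per : ∀ n → Dec (Coprime n M) → χ a (n ℕ.+ M) ≡ χ a n
      per n (yes c) = trans (χ-coprime a {n ℕ.+ M} c') (trans (cong sgnℚ (hsum-mod a {n ℕ.+ M} {n} c' c (shift n))) (sym (χ-coprime a {n} c)))
        where
        c' : Coprime (n ℕ.+ M) M
        c' = coprime-mod {M} {n} {n ℕ.+ M} (shift n) c
      per n (no c) = trans (χ-not-coprime a {n ℕ.+ M} (λ c' → c (coprime-mod {M} {n ℕ.+ M} {n} (sym (shift n)) c'))) (sym (χ-not-coprime a {n} c))
      bound : ∀ n → Dec (Coprime n M) → ℚ.∣ χ a n ∣ ℚ.≤ 1ℚ
      bound n (yes c) = subst (λ z → ℚ.∣ z ∣ ℚ.≤ 1ℚ) (sym (χ-coprime a {n} c)) (sgnℚ-bounded (hsum S a (+ n)))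
      bound n (no c) = subst (λ z → ℚ.∣ z ∣ ℚ.≤ 1ℚ) (sym (χ-not-coprime a {n} c)) 0≤1

    odd∤M : ∀ {μ} → OddPrime′ μ → ¬ μ ∈ S → ¬ μ ℕ.∣ M
    odd∤M o μ∉ d with ∣M⇒ (proj₁ o) d
    ... | inj₁ e = odd≢2 o e
    ... | inj₂ m = μ∉ m

    -- By the product formula, χ a μ is the Legendre symbol (a/μ).
    χ≡1⇒residue : ∀ {a μ} → SUnit S a → OddPrime′ μ → ¬ μ ∈ S → ¬ + μ ∣ a → χ a μ ≡ 1ℚ → res μ a ≡ 0ℙ
    χ≡1⇒residue {a} {μ} ua o μ∉ μ∤a e = trans (sym (cong₂ (hilb (res μ -1ℤ)) (cls-split pr (split-unit μ∤a)) (trans (cls-split pr (split-prime pr)) (cong (1ℙ ,_) (res-1 o)))))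
      (trans (sym (ℙ.+-identityʳ _)) (⊕-cancelˡ (trans (lem (h₂ a (+ μ)) (h μ a (+ μ)) (sumOver S (λ ℓ → h ℓ a (+ μ)))) formula) hsum≡0))
      where
      pr = proj₁ o
      coprime : Coprime μ M
      coprime = coprime-by-primes M≢0 (λ pr' d d' → odd∤M o μ∉ (subst (ℕ._∣ M) (prime-∣-prime pr' pr d) d'))
      hsum≡0 : hsum S a (+ μ) ≡ 0ℙ
      hsum≡0 = sgnℚ≡1 (trans (sym (χ-coprime a {μ} coprime)) e)
      fresh : All (μ ≢_) S
      fresh = All.tabulate (λ {x} m e → μ∉ (subst (_∈ S) (sym e) m))
      -- With `μ` adjoined to `S` the product formula balances the symbol at `μ` against those at 2
      -- and `S`, which are what `χ a μ` records.
      formula : hsum (μ ∷ S) a (+ μ) ≡ 0ℙ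
      formula = ProductFormula.product-formula (o ∷ odds) (fresh ∷ uniq) (sUnit-weaken ua) (generator-posUnit (prime (here refl)))
      lem : ∀ x y z → (x ⊕ z) ⊕ (y ⊕ 0ℙ) ≡ x ⊕ (y ⊕ z)
      lem x y z = solve 3 (λ x y z → (x :+ z) :+ (y :+ con 0ℙ) := x :+ (y :+ z)) refl x y z
        where open ℙ-Solver using (solve; _:=_; _:+_; con)

-- Construction of the linking number `n`.

module LinkingNumber where
  open Congruences
  open Gauss using (res; res-cong; module OddPrime)
  open Hilbert
  open ChineseRemainder
  open LocalTables
  open Legendre using (LocallyIsotropic)
  open Convolution using (double; splitPower)
  open ResidueClasses using (coprime-mod)
  open PrescribedClass using (existence; GoodClassMember)
  open SymbolCharacters
  open import Data.Nat as ℕ using (ℕ; zero; suc; parity)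
  import Data.Nat.Properties as ℕ
  import Data.Nat.Divisibility as ℕ
  import Data.Nat.DivMod as ℕ
  open import Data.Nat.ListAction using (product)
  open import Data.Nat.Coprimality using (Coprime)
  open import Data.Nat.Primality using (Prime; euclidsLemma; prime⇒nonZero; prime[2])
  open import Data.Integer using (ℤ; +_; _*_; _^_; 0ℤ; 1ℤ; -1ℤ) renaming (∣_∣ to abs)
  open import Data.Integer.Properties using (pos-*; *-assoc; ∣i∣≡0⇒i≡0)
  open import Data.Integer.DivMod using (_%ℕ_)
  open import Data.Integer.Divisibility.Signed using (_∣_; divides; ∣⇒∣ᵤ; ∣ᵤ⇒∣; ∣-trans; ∣m⇒∣m*n; ∣n⇒∣m*n)
  open import Data.Parity using (Parity; 0ℙ; 1ℙ) renaming (_+_ to infixl 6 _⊕_; _*_ to _⊗_)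
  import Data.Parity.Properties as ℙ
  open import Data.Rational using (1ℚ)
  open import Data.List using (List; []; _∷_)
  open import Data.List.Relation.Unary.All as All using (All; []; _∷_)
  open import Data.List.Relation.Unary.AllPairs using ([]; _∷_)
  open import Data.List.Relation.Unary.Any using (here; there)
  open import Data.List.Relation.Unary.Unique.Propositional using (Unique)
  open import Data.List.Membership.Propositional using (_∈_)
  open import Data.List.Membership.DecPropositional ℕ._≟_ using (_∈?_)
  open import Data.Nat.Primality.Factorisation using (factorisationHasAllPrimeFactors)
  open import Data.Product using (∃; _×_; _,_; proj₁; proj₂)
  open import Data.Product.Properties using (≡-dec)
  open import Data.Sum using (inj₁; inj₂; [_,_]′)
  open import Data.Empty using (⊥; ⊥-elim)
  open import Function using (_∘_)
  open import Relation.Nullary using (¬_; Dec; yes; no)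
  open import Relation.Nullary.Decidable using (from-no)
  open import Relation.Binary.PropositionalEquality

  unit₈ : Parity × Parity → ℕ
  unit₈ (0ℙ , 0ℙ) = 1
  unit₈ (1ℙ , 1ℙ) = 3
  unit₈ (0ℙ , 1ℙ) = 5
  unit₈ (1ℙ , 0ℙ) = 7

  ρ₈-unit₈ : ∀ x → ρ₈ (unit₈ x) ≡ x
  ρ₈-unit₈ (0ℙ , 0ℙ) = refl
  ρ₈-unit₈ (1ℙ , 1ℙ) = refl
  ρ₈-unit₈ (0ℙ , 1ℙ) = refl
  ρ₈-unit₈ (1ℙ , 0ℙ) = refl

  unit₈-small : ∀ x → unit₈ x ℕ.% 8 ≡ unit₈ x
  unit₈-small (0ℙ , 0ℙ) = refl
  unit₈-small (1ℙ , 1ℙ) = refl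
  unit₈-small (0ℙ , 1ℙ) = refl
  unit₈-small (1ℙ , 0ℙ) = refl

  unit₈-odd : ∀ x → ¬ 2 ℕ.∣ unit₈ x
  unit₈-odd (0ℙ , 0ℙ) = from-no (2 ℕ.∣? 1)
  unit₈-odd (1ℙ , 1ℙ) = from-no (2 ℕ.∣? 3)
  unit₈-odd (0ℙ , 1ℙ) = from-no (2 ℕ.∣? 5)
  unit₈-odd (1ℙ , 0ℙ) = from-no (2 ℕ.∣? 7)

  unitWithResidue : ∀ {ℓ} → OddPrime′ ℓ → ∀ s → ∃ λ r → ¬ + ℓ ∣ r × res ℓ r ≡ s
  unitWithResidue (pr , odd) 0ℙ = 1ℤ , prime∤1 pr , res-1 (pr , odd)
  unitWithResidue {suc m} (pr , odd) 1ℙ with OddPrime.nonresidue pr odd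
  ... | a , (0<a , a<p) , e = + a , OddPrime.small∤ pr odd 0<a a<p , e

  crt-list : ∀ T → All OddPrime′ T → Unique T → ∀ (r₂ : ℤ) (r : ℕ → ℤ) →
    ∃ λ x → x ≅ r₂ ⟦ 8 ⟧ × (∀ {ℓ} → ℓ ∈ T → x ≅ r ℓ ⟦ ℓ ⟧)
  crt-list [] _ _ r₂ r = r₂ , ≅-refl , λ ()
  crt-list (ℓ ∷ T) (o ∷ os) (n ∷ u) r₂ r with crt-list T os u r₂ r
  ... | x' , e₂ , e = x , ≅-trans (coarser (ℕ.m∣m*n (product T)) x≅x') e₂ , at
    where
    m = 8 ℕ.* product T
    ℓ∤m : ¬ ℓ ℕ.∣ m
    ℓ∤m d with euclidsLemma 8 (product T) (proj₁ o) d
    ... | inj₁ d' = odd≢2 o (only-2 (factorisationHasAllPrimeFactors {2 ∷ 2 ∷ 2 ∷ []} (proj₁ o) d' (prime[2] ∷ prime[2] ∷ prime[2] ∷ [])))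
      where
      only-2 : ∀ {ℓ} → ℓ ∈ 2 ∷ 2 ∷ 2 ∷ [] → ℓ ≡ 2
      only-2 (here e) = e
      only-2 (there (here e)) = e
      only-2 (there (there (here e))) = e
    ... | inj₂ d' = All.lookup n (factorisationHasAllPrimeFactors (proj₁ o) d' (All.map proj₁ os)) refl
    combined = crt (prime-coprime (proj₁ o) ℓ∤m) (r ℓ) x'
    x = proj₁ combined
    x≅x' : x ≅ x' ⟦ m ⟧
    x≅x' = proj₂ (proj₂ combined)
    coarser : ∀ {k a b} → k ℕ.∣ m → a ≅ b ⟦ m ⟧ → a ≅ b ⟦ k ⟧
    coarser d (mk≅ e) = mk≅ (∣-trans (∣ᵤ⇒∣ d) e)
    at : ∀ {μ} → μ ∈ ℓ ∷ T → x ≅ r μ ⟦ μ ⟧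
    at (here refl) = proj₁ (proj₂ combined)
    at (there μ∈) = ≅-trans (coarser (ℕ.∣n⇒∣m*n 8 (∈⇒∣product μ∈)) x≅x') (e μ∈)

  primePower : ℕ → Parity → ℤ
  primePower ℓ 0ℙ = 1ℤ
  primePower ℓ 1ℙ = + ℓ

  odd-form : ∀ n → parity n ≡ 1ℙ → ∃ λ i → n ≡ suc (double i)
  odd-form (suc zero) e = 0 , refl
  odd-form (suc (suc n)) e with odd-form n e
  ... | i , refl = suc i , refl

  ⊞-assoc-cancel : ∀ i s c → (i , c) ⊞ (0ℙ , s ⊕ c) ≡ (i , s)
  ⊞-assoc-cancel i s c = cong₂ _,_ (ℙ.+-identityʳ i) (solve 2 (λ s c → c :+ (s :+ c) := s :+ (c :+ c)) refl s c ∙ (cong (s ⊕_) (ℙ.p+p≡0ℙ c) ∙ ℙ.+-identityʳ s))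
    where
    open ℙ-Solver using (solve; _:=_; _:+_)
    infixr 4 _∙_
    _∙_ : ∀ {a b c : Parity} → a ≡ b → b ≡ c → a ≡ c
    _∙_ = trans

  -- The last two hypotheses say that `d` is no local square at 2 and at the odd primes dividing
  -- `p q d`, as the local tables require; at these primes alone can `p`, `q` or `p d` fail to be
  -- units.
  module Construction (p q : ℕ) (pp : Prime p) (pq : Prime q) (d : ℤ) (d≢0 : d ≢ 0ℤ)
    (nonsplit : ∀ {ℓ} → OddPrime′ ℓ → ℓ ℕ.∣ p ℕ.* (q ℕ.* abs d) → cls ℓ d ≢ (0ℙ , 0ℙ))
    (nonsplit₂ : cls₂ d ≢ (0ℙ , 0ℙ , 0ℙ)) where

    private
      instance
        nzN : ℕ.NonZero (p ℕ.* (q ℕ.* abs d))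
        nzN = ℕ.m*n≢0 p (q ℕ.* abs d) {{prime⇒nonZero pp}} {{ℕ.m*n≢0 q (abs d) {{prime⇒nonZero pq}} {{ℕ.≢-nonZero (d≢0 ∘ ∣i∣≡0⇒i≡0)}}}}

    open OddPrimeDivisors (oddPrimeDivisors (p ℕ.* (q ℕ.* abs d)))
    open Characters odds unique

    P Q : ℤ
    P = + p
    Q = + q

    P-unit : PosUnit S P
    P-unit = posUnit-of p {{prime⇒nonZero pp}} (λ o e → complete o (ℕ.∣m⇒∣m*n (q ℕ.* abs d) e))

    Q-unit : PosUnit S Q
    Q-unit = posUnit-of q {{prime⇒nonZero pq}} (λ o e → complete o (ℕ.∣n⇒∣m*n p (ℕ.∣m⇒∣m*n (abs d) e)))

    d-unit : SUnit S d
    d-unit = sUnit-of d d≢0 (λ o e → complete o (ℕ.∣n⇒∣m*n p (ℕ.∣n⇒∣m*n q e)))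

    Pd-unit : SUnit S (P * d)
    Pd-unit = sUnit-* P-unit d-unit

    P≢0 = PosUnit≢0 P-unit
    Q≢0 = PosUnit≢0 Q-unit

    Admissible : ℕ → Parity × Parity → Set
    Admissible ℓ n = hilb (res ℓ -1ℤ) (cls ℓ P) (cls ℓ Q ⊞ n) ≡ 0ℙ × hilb (res ℓ -1ℤ) (cls ℓ P ⊞ cls ℓ d) n ≡ 0ℙ

    class : ℕ → Parity × Parity
    class ℓ with ≡-dec ℙ._≟_ ℙ._≟_ (cls ℓ d) (0ℙ , 0ℙ)
    -- A default for primes outside `S`; at the primes of `S` this case contradicts `nonsplit`.
    ... | yes _ = 0ℙ , 0ℙ
    ... | no h = proj₁ (local-choice (res ℓ -1ℤ) (cls ℓ P) (cls ℓ Q) (cls ℓ d) h)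

    class-admissible : ∀ {ℓ} → ℓ ∈ S → Admissible ℓ (class ℓ)
    class-admissible {ℓ} m with ≡-dec ℙ._≟_ ℙ._≟_ (cls ℓ d) (0ℙ , 0ℙ)
    ... | yes e = ⊥-elim (nonsplit (op m) (sound m) e)
    ... | no h = proj₂ (local-choice (res ℓ -1ℤ) (cls ℓ P) (cls ℓ Q) (cls ℓ d) h)

    class₂ : Parity × Parity × Parity
    class₂ = proj₁ (local-choice₂ (cls₂ P) (cls₂ Q) (cls₂ d) nonsplit₂)

    class₂-admissible : hilb₂ (cls₂ P) (cls₂ Q ⊞₂ class₂) ≡ 0ℙ × hilb₂ (cls₂ P ⊞₂ cls₂ d) class₂ ≡ 0ℙ
    class₂-admissible = proj₂ (local-choice₂ (cls₂ P) (cls₂ Q) (cls₂ d) nonsplit₂)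

    valuations : List ℕ → ℤ
    valuations [] = 1ℤ
    valuations (ℓ ∷ T) = primePower ℓ (proj₁ (class ℓ)) * valuations T

    -- Square classes see valuations only modulo 2, so exponents 0 and 1 are enough.
    t : ℤ
    t = primePower 2 (proj₁ class₂) * valuations S

    private
      primePower-unit : ∀ {ℓ} → Generator S (+ ℓ) → ∀ i → PosUnit S (primePower ℓ i)
      primePower-unit g 0ℙ = one
      primePower-unit g 1ℙ = generator-posUnit g

      valuations-unit : ∀ T → (∀ {ℓ} → ℓ ∈ T → ℓ ∈ S) → PosUnit S (valuations T)
      valuations-unit [] _ = one
      valuations-unit (ℓ ∷ T) s = posUnit-* (primePower-unit (prime (s (here refl))) (proj₁ (class ℓ))) (valuations-unit T (s ∘ there))

      primePower-positive : ∀ {ℓ} → Prime ℓ → ∀ i → Positiveℤ (primePower ℓ i)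
      primePower-positive pr 0ℙ = 0 , refl
      primePower-positive pr 1ℙ = positive-prime pr

      valuations-positive : ∀ T → (∀ {ℓ} → ℓ ∈ T → ℓ ∈ S) → Positiveℤ (valuations T)
      valuations-positive [] _ = 0 , refl
      valuations-positive (ℓ ∷ T) s = positive-* (primePower-positive (proj₁ (op (s (here refl)))) (proj₁ (class ℓ))) (valuations-positive T (s ∘ there))

      distinct∤ : ∀ {ℓ μ} → Prime ℓ → Prime μ → μ ≢ ℓ → ¬ + μ ∣ + ℓ
      distinct∤ pℓ pμ ne d = ne (prime-∣-prime pμ pℓ (∣⇒∣ᵤ d))

      ord-other : ∀ {ℓ μ} → Prime ℓ → Prime μ → μ ≢ ℓ → ∀ i → Split μ (primePower ℓ i) 0 (primePower ℓ i)
      ord-other pℓ pμ ne 0ℙ = split-unit (prime∤1 pμ)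
      ord-other pℓ pμ ne 1ℙ = split-unit (distinct∤ pℓ pμ ne)

      ord-self : ∀ {ℓ} → Prime ℓ → ∀ i → ∃ λ k → parity k ≡ i × Split ℓ (primePower ℓ i) k 1ℤ
      ord-self pr 0ℙ = 0 , refl , split-unit (prime∤1 pr)
      ord-self pr 1ℙ = 1 , refl , split-prime pr

    t-unit : PosUnit S t
    t-unit = posUnit-* (primePower-unit two (proj₁ class₂)) (valuations-unit S (λ m → m))

    t-positive : Positiveℤ t
    t-positive = positive-* (primePower-positive prime[2] (proj₁ class₂)) (valuations-positive S (λ m → m))

    t≢0 = positive≢0 t-positive

    private
      valuations≢0 : ∀ T → (∀ {ℓ} → ℓ ∈ T → ℓ ∈ S) → valuations T ≢ 0ℤ
      valuations≢0 T s = positive≢0 (valuations-positive T s)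

      primePower≢0 : ∀ {ℓ} → Prime ℓ → ∀ i → primePower ℓ i ≢ 0ℤ
      primePower≢0 pr i = positive≢0 (primePower-positive pr i)

      ord-valuations : ∀ {μ} → OddPrime′ μ → ∀ T → (∀ {ℓ} → ℓ ∈ T → ℓ ∈ S) →
        proj₁ (cls μ (valuations T)) ≡ sumOver T (λ ℓ → proj₁ (cls μ (primePower ℓ (proj₁ (class ℓ)))))
      ord-valuations o [] s = cong proj₁ (cls-split (proj₁ o) (split-unit (prime∤1 (proj₁ o))))
      ord-valuations {μ} o (ℓ ∷ T) s = trans (cong proj₁ (cls-* o (primePower≢0 (proj₁ (op (s (here refl)))) (proj₁ (class ℓ))) (valuations≢0 T (s ∘ there))))
        (cong (proj₁ (cls μ (primePower ℓ (proj₁ (class ℓ)))) ⊕_) (ord-valuations o T (s ∘ there)))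

      ord₂-valuations : ∀ T → (∀ {ℓ} → ℓ ∈ T → ℓ ∈ S) → proj₁ (cls₂ (valuations T)) ≡ 0ℙ
      ord₂-valuations [] s = cong proj₁ (cls₂-split (split-unit (prime∤1 prime[2])))
      ord₂-valuations (ℓ ∷ T) s = trans (cong proj₁ (cls₂-* (primePower≢0 (proj₁ o) i) (valuations≢0 T (s ∘ there))))
        (cong₂ _⊕_ (cong proj₁ (cls₂-split (ord-other (proj₁ o) prime[2] (odd≢2 o ∘ sym) i))) (ord₂-valuations T (s ∘ there)))
        where
        o = op (s (here refl))
        i = proj₁ (class ℓ)

    ord-t : ∀ {μ} → μ ∈ S → proj₁ (cls μ t) ≡ proj₁ (class μ)
    ord-t {μ} m = trans (cong proj₁ (cls-* (op m) (primePower≢0 prime[2] (proj₁ class₂)) (valuations≢0 S (λ m → m))))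
      (cong₂ _⊕_ (cong proj₁ (cls-split pμ (ord-other prime[2] pμ (odd≢2 (op m)) (proj₁ class₂))))
        (trans (ord-valuations (op m) S (λ m → m)) (trans (sumOver-single {f = λ ℓ → proj₁ (cls μ (primePower ℓ (proj₁ (class ℓ))))} unique m
            (λ {ℓ} ℓ∈ ne → cong proj₁ (cls-split pμ (ord-other (proj₁ (op ℓ∈)) pμ (ne ∘ sym) (proj₁ (class ℓ))))))
          (trans (cong proj₁ (cls-split pμ (proj₂ (proj₂ self)))) (proj₁ (proj₂ self))))))
      where
      pμ = proj₁ (op m)
      self = ord-self pμ (proj₁ (class μ))

    ord₂-t : proj₁ (cls₂ t) ≡ proj₁ class₂
    ord₂-t = trans (cong proj₁ (cls₂-* (primePower≢0 prime[2] (proj₁ class₂)) (valuations≢0 S (λ m → m))))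
      (trans (cong₂ _⊕_ (trans (cong proj₁ (cls₂-split (proj₂ (proj₂ self)))) (proj₁ (proj₂ self))) (ord₂-valuations S (λ m → m))) (ℙ.+-identityʳ _))
      where
      self = ord-self prime[2] (proj₁ class₂)

    -- t has the chosen valuations, and u₀ corrects its unit part at every place.
    residueAt : ∀ {ℓ} → ℓ ∈ S → ∃ λ r → ¬ + ℓ ∣ r × res ℓ r ≡ proj₂ (class ℓ) ⊕ proj₂ (cls ℓ t)
    residueAt {ℓ} m = unitWithResidue (op m) (proj₂ (class ℓ) ⊕ proj₂ (cls ℓ t))

    residue : ℕ → ℤ
    residue ℓ with ℓ ∈? S
    ... | yes m = proj₁ (residueAt m)
    ... | no _ = 1ℤ

    residue-spec : ∀ {ℓ} → ℓ ∈ S → ¬ + ℓ ∣ residue ℓ × res ℓ (residue ℓ) ≡ proj₂ (class ℓ) ⊕ proj₂ (cls ℓ t)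
    residue-spec {ℓ} m with ℓ ∈? S
    ... | yes m' = proj₂ (residueAt m')
    ... | no n = ⊥-elim (n m)

    target₂ : Parity × Parity
    target₂ = proj₂ class₂ ⊞ proj₂ (cls₂ t)

    private
      solution = crt-list S odds unique (+ unit₈ target₂) residue
      x = proj₁ solution

    u₀ : ℕ
    u₀ = x %ℕ M

    private
      u₀≅x : + u₀ ≅ x ⟦ M ⟧
      u₀≅x = ≅-sym (%ℕ-≅ x M)

      u₀≅₂ : + u₀ ≅ + unit₈ target₂ ⟦ 8 ⟧
      u₀≅₂ = ≅-trans (coarsen 8∣M u₀≅x) (proj₁ (proj₂ solution))

      u₀≅ : ∀ {ℓ} → ℓ ∈ S → + u₀ ≅ residue ℓ ⟦ ℓ ⟧
      u₀≅ m = ≅-trans (coarsen (∈⇒∣M m) u₀≅x) (proj₂ (proj₂ solution) m)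

    u₀-coprime : Coprime u₀ M
    u₀-coprime = coprime-by-primes M≢0 (λ pr e e' → [ (λ { refl → at-2 e }) , (λ m → at-odd m e) ]′ (∣M⇒ pr e'))
      where
      at-2 : 2 ℕ.∣ u₀ → ⊥
      at-2 e = unit₈-odd target₂ (∣⇒∣ᵤ (≅-∣ {2} {+ unit₈ target₂} {+ u₀} (≅-sym (weaken u₀≅₂)) (∣ᵤ⇒∣ e)))
        where
        weaken : ∀ {a b} → a ≅ b ⟦ 8 ⟧ → a ≅ b ⟦ 2 ⟧
        weaken (mk≅ h) = mk≅ (∣-trans (divides (+ 4) refl) h)
      at-odd : ∀ {ℓ} → ℓ ∈ S → ℓ ℕ.∣ u₀ → ⊥
      at-odd m e = proj₁ (residue-spec m) (≅-∣ (≅-sym (u₀≅ m)) (∣ᵤ⇒∣ e))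

    cls-u₀ : ∀ {ℓ} → ℓ ∈ S → cls ℓ t ⊞ cls ℓ (+ u₀) ≡ class ℓ
    cls-u₀ {ℓ} m = trans (cong₂ _⊞_ (cong (_, proj₂ (cls ℓ t)) (ord-t m)) (trans (cls-coprime {u₀} m u₀-coprime) (cong (0ℙ ,_) (trans (res-cong {ℓ} (u₀≅ m)) (proj₂ (residue-spec m))))))
      (⊞-assoc-cancel (proj₁ (class ℓ)) (proj₂ (class ℓ)) (proj₂ (cls ℓ t)))

    cls₂-u₀ : cls₂ t ⊞₂ cls₂ (+ u₀) ≡ class₂
    cls₂-u₀ = trans (cong₂ _⊞₂_ (cong (_, proj₂ (cls₂ t)) ord₂-t) (trans (cls₂-coprime {u₀} u₀-coprime)
        (cong (0ℙ ,_) (trans (cong ρ₈ (trans (≅⇒%ℕ {8} {+ u₀} {+ unit₈ target₂} u₀≅₂) (unit₈-small target₂))) (ρ₈-unit₈ target₂)))))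
      (cong₂ _,_ (ℙ.+-identityʳ _) (cong₂ _,_ (cancel (proj₁ (proj₂ (cls₂ t))) (proj₁ (proj₂ class₂))) (cancel (proj₂ (proj₂ (cls₂ t))) (proj₂ (proj₂ class₂)))))
      where
      cancel : ∀ c s → c ⊕ (s ⊕ c) ≡ s
      cancel c s = cong proj₂ (⊞-assoc-cancel 0ℙ s c)

    n-of : ℕ → ℤ
    n-of u = t * + u

    -- At 2 and at the primes of `S` only the residue of `u` modulo `M` counts, so every member of
    -- the progression of `u₀` gives an `n` with the chosen local classes.
    module Member (u : ℕ) (u≡u₀ : u ℕ.% M ≡ u₀ ℕ.% M) where
      u-coprime : Coprime u M
      u-coprime = coprime-mod {M} {u₀} {u} u≡u₀ u₀-coprime

      u≢0 : + u ≢ 0ℤ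
      u≢0 = coprime⇒≢0 {u} u-coprime

      n = n-of u

      n≢0 : n ≢ 0ℤ
      n≢0 = *-≢0 t≢0 u≢0

      cls-n : ∀ {ℓ} → ℓ ∈ S → cls ℓ n ≡ class ℓ
      cls-n {ℓ} m = trans (cls-* (op m) t≢0 u≢0) (trans (cong (cls ℓ t ⊞_) (cls-mod {u} {u₀} m u-coprime u₀-coprime u≡u₀)) (cls-u₀ m))

      cls₂-n : cls₂ n ≡ class₂
      cls₂-n = trans (cls₂-* t≢0 u≢0) (trans (cong (cls₂ t ⊞₂_) (cls₂-mod {u} {u₀} u-coprime u₀-coprime u≡u₀)) cls₂-u₀)

      first-at : ∀ {ℓ} → ℓ ∈ S → h ℓ P (Q * n) ≡ 0ℙ
      first-at {ℓ} m = trans (cong (hilb (res ℓ -1ℤ) (cls ℓ P)) (trans (cls-* (op m) Q≢0 n≢0) (cong (cls ℓ Q ⊞_) (cls-n m)))) (proj₁ (class-admissible m))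

      second-at : ∀ {ℓ} → ℓ ∈ S → h ℓ (P * d) n ≡ 0ℙ
      second-at {ℓ} m = trans (cong₂ (hilb (res ℓ -1ℤ)) (cls-* (op m) P≢0 d≢0) (cls-n m)) (proj₂ (class-admissible m))

      first-at₂ : h₂ P (Q * n) ≡ 0ℙ
      first-at₂ = trans (cong (hilb₂ (cls₂ P)) (trans (cls₂-* Q≢0 n≢0) (cong (cls₂ Q ⊞₂_) cls₂-n))) (proj₁ class₂-admissible)

      second-at₂ : h₂ (P * d) n ≡ 0ℙ
      second-at₂ = trans (cong₂ hilb₂ (cls₂-* P≢0 d≢0) cls₂-n) (proj₂ class₂-admissible)

    private
      module M₀ = Member u₀ refl

    private
      first-sum : hsum S P (Q * M₀.n) ≡ 0ℙ
      first-sum = cong₂ _⊕_ M₀.first-at₂ (sumOver-zero S {λ ℓ → h ℓ P (Q * M₀.n)} M₀.first-at)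

      second-sum : hsum S (P * d) M₀.n ≡ 0ℙ
      second-sum = cong₂ _⊕_ M₀.second-at₂ (sumOver-zero S {λ ℓ → h ℓ (P * d) M₀.n} M₀.second-at)

      first-split : hsum S P (Q * M₀.n) ≡ hsum S P (Q * t) ⊕ hsum S P (+ u₀)
      first-split = trans (cong (hsum S P) (sym (*-assoc Q t (+ u₀)))) (hsum-*ʳ P {Q * t} {+ u₀} (*-≢0 Q≢0 t≢0) M₀.u≢0)

      second-split : hsum S (P * d) M₀.n ≡ hsum S (P * d) t ⊕ hsum S (P * d) (+ u₀)
      second-split = hsum-*ʳ (P * d) {t} {+ u₀} t≢0 M₀.u≢0

    -- The local choices make the symbols of `P` with `Q t u₀` vanish at 2 and on `S`. As `Q t` is
    -- an `S`-unit, its symbols with `P` sum to zero by the product formula, so those of `u₀` do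
    -- too. The same reasoning with `P d` and `t` gives `χPd-u₀`.
    χP-u₀ : χ P u₀ ≡ 1ℚ
    χP-u₀ = trans (χ-coprime P {u₀} u₀-coprime) (cong sgnℚ
      (⊕-cancelˡ {hsum S P (Q * t)} {hsum S P (+ u₀)} (trans (sym first-split) first-sum) (pos-product-formula P-unit (posUnit-* Q-unit t-unit))))

    χPd-u₀ : χ (P * d) u₀ ≡ 1ℚ
    χPd-u₀ = trans (χ-coprime (P * d) {u₀} u₀-coprime) (cong sgnℚ
      (⊕-cancelˡ {hsum S (P * d) t} {hsum S (P * d) (+ u₀)} (trans (sym second-split) second-sum) (product-formula Pd-unit t-unit)))

    module Finish (u : ℕ) (1≤u : 1 ℕ.≤ u) (u≡u₀ : u ℕ.% M ≡ u₀ ℕ.% M)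
      (odd-primes : ∀ {ℓ} → Prime ℓ → ∀ i v → u ≡ ℓ ℕ.^ suc (double i) ℕ.* v → ¬ ℓ ℕ.∣ v → χ P ℓ ≡ 1ℚ × χ (P * d) ℓ ≡ 1ℚ) where
      module Mu = Member u u≡u₀

      -- At μ all of p, q, t, d are units, and P and P d are squares if μ divides u to an odd power.
      module Outside {μ} (o : OddPrime′ μ) (μ∉ : ¬ μ ∈ S) where
        pr = proj₁ o
        μ∤ : ∀ {m} → m ℕ.∣ p ℕ.* (q ℕ.* abs d) → ¬ μ ℕ.∣ m
        μ∤ e e' = μ∉ (complete o (ℕ.∣-trans e' e))
        μ∤P : ¬ + μ ∣ P
        μ∤P e = μ∤ (ℕ.m∣m*n (q ℕ.* abs d)) (∣⇒∣ᵤ e)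
        μ∤Q : ¬ + μ ∣ Q
        μ∤Q e = μ∤ (ℕ.∣n⇒∣m*n p (ℕ.m∣m*n (abs d))) (∣⇒∣ᵤ e)
        μ∤d : ¬ + μ ∣ d
        μ∤d e = μ∤ (ℕ.∣n⇒∣m*n p (ℕ.n∣m*n q)) (∣⇒∣ᵤ e)
        μ∤Pd : ¬ + μ ∣ P * d
        μ∤Pd e = [ μ∤P , μ∤d ]′ (euclid pr P d e)
        μ∤posUnit : ∀ {a} → PosUnit S a → ¬ + μ ∣ a
        μ∤posUnit one = prime∤1 pr
        μ∤posUnit (mul {g} {a} γ x) e = [ gen γ , μ∤posUnit x ]′ (euclid pr g a e)
          where
          gen : ∀ {g} → Generator S g → ¬ + μ ∣ g
          gen two e = odd≢2 o (prime-∣-prime pr prime[2] (∣⇒∣ᵤ e))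
          gen (prime {ℓ} m) e = μ∉ (subst (_∈ S) (sym (prime-∣-prime pr (proj₁ (op m)) (∣⇒∣ᵤ e))) m)

        -- For a unit `a` the tame symbol reduces to the valuation of `c` times the residue symbol
        -- of `a`; only an odd valuation makes a demand on `a`.
        unramified : ∀ {a c} → ¬ + μ ∣ a → (proj₁ (cls μ c) ≡ 1ℙ → res μ a ≡ 0ℙ) → h μ a c ≡ 0ℙ
        unramified {a} {c} μ∤a e = trans (cong (λ z → hilb (res μ -1ℤ) z (cls μ c)) (cls-split pr (split-unit μ∤a))) (go (proj₁ (cls μ c)) e)
          where
          go : ∀ j → (j ≡ 1ℙ → res μ a ≡ 0ℙ) → j ⊗ res μ a ≡ 0ℙ
          go 0ℙ _ = refl
          go 1ℙ e = e refl

        ord-unit-* : ∀ {a b} → ¬ + μ ∣ a → a ≢ 0ℤ → b ≢ 0ℤ → proj₁ (cls μ (a * b)) ≡ proj₁ (cls μ b)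
        ord-unit-* {a} {b} μ∤a a≢0 b≢0 = trans (cong proj₁ (cls-* o a≢0 b≢0)) (cong (λ z → proj₁ z ⊕ proj₁ (cls μ b)) (cls-split pr (split-unit μ∤a)))

        ord-n : proj₁ (cls μ Mu.n) ≡ proj₁ (cls μ (+ u))
        ord-n = ord-unit-* {t} {+ u} (μ∤posUnit t-unit) t≢0 Mu.u≢0

        splits : proj₁ (cls μ (+ u)) ≡ 1ℙ → χ P μ ≡ 1ℚ × χ (P * d) μ ≡ 1ℚ
        splits e = from-split (splitPower pr u 1≤u)
          where
          pos-^ : ∀ j → + (μ ℕ.^ j) ≡ (+ μ) ^ j
          pos-^ zero = refl
          pos-^ (suc j) = trans (pos-* μ (μ ℕ.^ j)) (cong (+ μ *_) (pos-^ j))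
          ord-u : ∀ j v → u ≡ μ ℕ.^ j ℕ.* v → ¬ μ ℕ.∣ v → proj₁ (cls μ (+ u)) ≡ parity j
          ord-u j v u≡ μ∤v = cong proj₁ (cls-split pr {+ u} {j} {+ v} (split (trans (cong +_ u≡) (trans (pos-* (μ ℕ.^ j) v) (cong (_* + v) (pos-^ j)))) (λ d → μ∤v (∣⇒∣ᵤ d))))
          from-odd : ∀ j v → u ≡ μ ℕ.^ j ℕ.* v → ¬ μ ℕ.∣ v → (∃ λ i → j ≡ suc (double i)) → χ P μ ≡ 1ℚ × χ (P * d) μ ≡ 1ℚ
          from-odd j v u≡ μ∤v (i , j≡) = odd-primes pr i v (trans u≡ (cong (λ k → μ ℕ.^ k ℕ.* v) j≡)) μ∤v
          from-split : (∃ λ j → ∃ λ v → u ≡ μ ℕ.^ j ℕ.* v × 1 ℕ.≤ v × ¬ μ ℕ.∣ v) → χ P μ ≡ 1ℚ × χ (P * d) μ ≡ 1ℚ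
          from-split (j , v , u≡ , _ , μ∤v) = from-odd j v u≡ μ∤v (odd-form j (trans (sym (ord-u j v u≡ μ∤v)) e))

        first-outside : h μ P (Q * Mu.n) ≡ 0ℙ
        first-outside = unramified {P} {Q * Mu.n} μ∤P (λ e → χ≡1⇒residue (pos P-unit) o μ∉ μ∤P (proj₁ (splits (trans (sym (trans (ord-unit-* {Q} {Mu.n} μ∤Q Q≢0 Mu.n≢0) ord-n)) e))))

        second-outside : h μ (P * d) Mu.n ≡ 0ℙ
        second-outside = unramified {P * d} {Mu.n} μ∤Pd (λ e → χ≡1⇒residue Pd-unit o μ∉ μ∤Pd (proj₂ (splits (trans (sym ord-n) e))))

      linking-pair : ∃ λ n → n ≢ 0ℤ × LocallyIsotropic P (Q * n) × LocallyIsotropic (P * d) n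
      linking-pair = Mu.n , Mu.n≢0 ,
        -- At the real place the first pair relies on `P > 0`. In the second `P d` may be negative,
        -- so there it is `n = t u` that is positive.
        record { a≢0 = P≢0 ; b≢0 = *-≢0 Q≢0 Mu.n≢0 ; real = inj₁ (0<positive (positive-prime pp)) ; odd = λ {μ} o → first o (μ ∈? S) } ,
        record { a≢0 = *-≢0 P≢0 d≢0 ; b≢0 = Mu.n≢0 ; real = inj₂ (0<positive (positive-* t-positive (positive-u 1≤u))) ; odd = λ {μ} o → second o (μ ∈? S) }
        where
        positive-u : ∀ {u} → 1 ℕ.≤ u → Positiveℤ (+ u)
        positive-u {suc k} _ = k , refl
        first : ∀ {μ} → OddPrime′ μ → Dec (μ ∈ S) → h μ P (Q * Mu.n) ≡ 0ℙ
        first o (yes m) = Mu.first-at m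
        first o (no n) = Outside.first-outside o n
        second : ∀ {μ} → OddPrime′ μ → Dec (μ ∈ S) → h μ (P * d) Mu.n ≡ 0ℙ
        second o (yes m) = Mu.second-at m
        second o (no n) = Outside.second-outside o n

    linking-number : ∃ λ n → n ≢ 0ℤ × LocallyIsotropic P (Q * n) × LocallyIsotropic (P * d) n
    linking-number = finish (existence M u₀ u₀-coprime (χ-character P) (χ-character (P * d)) χP-u₀ χPd-u₀)
      where
      finish : GoodClassMember M u₀ u₀-coprime (χ P) (χ (P * d)) → ∃ λ n → n ≢ 0ℤ × LocallyIsotropic P (Q * n) × LocallyIsotropic (P * d) n
      finish (u , 1≤u , e , odd-primes) = Finish.linking-pair u 1≤u e odd-primes

-- An explicit isomorphism with `M2` when `b` is a norm.

module Splitting where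
  import Tactic.RingSolver as Solver
  open import Defs
  open RationalSums using (ℚ-ring)
  open import Data.Integer using (ℤ; +_)
  open import Data.Rational as ℚ using (ℚ; 0ℚ; 1ℚ)
  import Data.Rational.Properties as ℚ
  open import Data.Product using (_,_)
  open import Relation.Nullary using (yes; no)
  open import Relation.Binary.PropositionalEquality
  open import Relation.Binary.PropositionalEquality.Algebra using (isMagma)
  open import Algebra.Bundles using (CommutativeRing)
  open import Level using (0ℓ)
  open import Data.Maybe using (Maybe; just; nothing)
  import Algebra.Solver.Ring
  import Algebra.Solver.Ring.AlmostCommutativeRing as ACR

  module QuadraticField (d : ℤ) where
    open QuadField d

    pair : ∀ {a b c e} → a ≡ c → b ≡ e → (a +√ b) ≡ (c +√ e)
    pair refl refl = refl

    ⊕-assoc : ∀ x y z → (x ⊕ y) ⊕ z ≡ x ⊕ (y ⊕ z)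
    ⊕-assoc (a +√ b) (c +√ e) (f +√ g) = pair (ℚ.+-assoc a c f) (ℚ.+-assoc b e g)

    ⊕-comm : ∀ x y → x ⊕ y ≡ y ⊕ x
    ⊕-comm (a +√ b) (c +√ e) = pair (ℚ.+-comm a c) (ℚ.+-comm b e)

    ⊕-identityˡ : ∀ x → 0K ⊕ x ≡ x
    ⊕-identityˡ (a +√ b) = pair (ℚ.+-identityˡ a) (ℚ.+-identityˡ b)

    ⊕-inverseˡ : ∀ x → (⊖ x) ⊕ x ≡ 0K
    ⊕-inverseˡ (a +√ b) = pair (ℚ.+-inverseˡ a) (ℚ.+-inverseˡ b)

    ⊗-comm : ∀ x y → x ⊗ y ≡ y ⊗ x
    ⊗-comm (a +√ b) (c +√ e) = pair (lem₁ dℚ a b c e) (lem₂ a b c e)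
      where
      lem₁ : ∀ D a b c e → a ℚ.* c ℚ.+ D ℚ.* (b ℚ.* e) ≡ c ℚ.* a ℚ.+ D ℚ.* (e ℚ.* b)
      lem₁ = Solver.solve-∀ ℚ-ring
      lem₂ : ∀ a b c e → a ℚ.* e ℚ.+ b ℚ.* c ≡ c ℚ.* b ℚ.+ e ℚ.* a
      lem₂ = Solver.solve-∀ ℚ-ring

    ⊗-assoc : ∀ x y z → (x ⊗ y) ⊗ z ≡ x ⊗ (y ⊗ z)
    ⊗-assoc (a +√ b) (c +√ e) (f +√ g) = pair (lem₁ dℚ a b c e f g) (lem₂ dℚ a b c e f g)
      where
      lem₁ : ∀ D a b c e f g → (a ℚ.* c ℚ.+ D ℚ.* (b ℚ.* e)) ℚ.* f ℚ.+ D ℚ.* ((a ℚ.* e ℚ.+ b ℚ.* c) ℚ.* g)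
        ≡ a ℚ.* (c ℚ.* f ℚ.+ D ℚ.* (e ℚ.* g)) ℚ.+ D ℚ.* (b ℚ.* (c ℚ.* g ℚ.+ e ℚ.* f))
      lem₁ = Solver.solve-∀ ℚ-ring
      lem₂ : ∀ D a b c e f g → (a ℚ.* c ℚ.+ D ℚ.* (b ℚ.* e)) ℚ.* g ℚ.+ (a ℚ.* e ℚ.+ b ℚ.* c) ℚ.* f
        ≡ a ℚ.* (c ℚ.* g ℚ.+ e ℚ.* f) ℚ.+ b ℚ.* (c ℚ.* f ℚ.+ D ℚ.* (e ℚ.* g))
      lem₂ = Solver.solve-∀ ℚ-ring

    ⊗-identityˡ : ∀ x → 1K ⊗ x ≡ x
    ⊗-identityˡ (a +√ b) = pair (lem₁ dℚ a b) (lem₂ a b)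
      where
      lem₁ : ∀ D a b → 1ℚ ℚ.* a ℚ.+ D ℚ.* (0ℚ ℚ.* b) ≡ a
      lem₁ = Solver.solve-∀ ℚ-ring
      lem₂ : ∀ a b → 1ℚ ℚ.* b ℚ.+ 0ℚ ℚ.* a ≡ b
      lem₂ = Solver.solve-∀ ℚ-ring

    ⊗-distribʳ : ∀ z x y → (x ⊕ y) ⊗ z ≡ (x ⊗ z) ⊕ (y ⊗ z)
    ⊗-distribʳ (f +√ g) (a +√ b) (c +√ e) = pair (lem₁ dℚ a b c e f g) (lem₂ a b c e f g)
      where
      lem₁ : ∀ D a b c e f g → (a ℚ.+ c) ℚ.* f ℚ.+ D ℚ.* ((b ℚ.+ e) ℚ.* g)
        ≡ (a ℚ.* f ℚ.+ D ℚ.* (b ℚ.* g)) ℚ.+ (c ℚ.* f ℚ.+ D ℚ.* (e ℚ.* g))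
      lem₁ = Solver.solve-∀ ℚ-ring
      lem₂ : ∀ a b c e f g → (a ℚ.+ c) ℚ.* g ℚ.+ (b ℚ.+ e) ℚ.* f ≡ (a ℚ.* g ℚ.+ b ℚ.* f) ℚ.+ (c ℚ.* g ℚ.+ e ℚ.* f)
      lem₂ = Solver.solve-∀ ℚ-ring

    K-ring : CommutativeRing 0ℓ 0ℓ
    K-ring = record
      { Carrier = K ; _≈_ = _≡_ ; _+_ = _⊕_ ; _*_ = _⊗_ ; -_ = ⊖_ ; 0# = 0K ; 1# = 1K
      ; isCommutativeRing = record
        { isRing = record
          { +-isAbelianGroup = record
            { isGroup = record
              { isMonoid = record
                { isSemigroup = record { isMagma = isMagma _⊕_ ; assoc = ⊕-assoc }
                ; identity = ⊕-identityˡ , λ x → trans (⊕-comm x 0K) (⊕-identityˡ x) }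
              ; inverse = ⊕-inverseˡ , λ x → trans (⊕-comm x (⊖ x)) (⊕-inverseˡ x)
              ; ⁻¹-cong = cong ⊖_ }
            ; comm = ⊕-comm }
          ; *-cong = cong₂ _⊗_
          ; *-assoc = ⊗-assoc
          ; *-identity = ⊗-identityˡ , λ x → trans (⊗-comm x 1K) (⊗-identityˡ x)
          ; distrib = (λ x y z → trans (⊗-comm x (y ⊕ z)) (trans (⊗-distribʳ x y z) (cong₂ _⊕_ (⊗-comm y x) (⊗-comm z x)))) , ⊗-distribʳ }
        ; *-comm = ⊗-comm } }

    ι-* : ∀ x y → ι (x ℚ.* y) ≡ ι x ⊗ ι y
    ι-* x y = pair (lem₁ dℚ x y) (lem₂ x y)
      where
      lem₁ : ∀ D x y → x ℚ.* y ≡ x ℚ.* y ℚ.+ D ℚ.* (0ℚ ℚ.* 0ℚ)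
      lem₁ = Solver.solve-∀ ℚ-ring
      lem₂ : ∀ x y → 0ℚ ≡ x ℚ.* 0ℚ ℚ.+ 0ℚ ℚ.* y
      lem₂ = Solver.solve-∀ ℚ-ring

    private
      coefficients : ℚ.+-*-rawRing ACR.-Raw-AlmostCommutative⟶ ACR.fromCommutativeRing K-ring
      coefficients = record
        { ⟦_⟧ = ι
        ; +-homo = λ x y → refl
        ; *-homo = ι-*
        ; -‿homo = λ x → refl
        ; 0-homo = refl
        ; 1-homo = refl }

      coefficient≟ : ∀ x y → Maybe (ι x ≡ ι y)
      coefficient≟ x y with x ℚ.≟ y
      ... | yes refl = just refl
      ... | no _ = nothing

    module K-Solver = Algebra.Solver.Ring ℚ.+-*-rawRing (ACR.fromCommutativeRing K-ring) coefficients coefficient≟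

    quat-≡ : ∀ {x₀ x₁ x₂ x₃ y₀ y₁ y₂ y₃} → x₀ ≡ y₀ → x₁ ≡ y₁ → x₂ ≡ y₂ → x₃ ≡ y₃ → quat x₀ x₁ x₂ x₃ ≡ quat y₀ y₁ y₂ y₃
    quat-≡ refl refl refl refl = refl

    mat-≡ : ∀ {x₀ x₁ x₂ x₃ y₀ y₁ y₂ y₃} → x₀ ≡ y₀ → x₁ ≡ y₁ → x₂ ≡ y₂ → x₃ ≡ y₃ → mat x₀ x₁ x₂ x₃ ≡ mat y₀ y₁ y₂ y₃
    mat-≡ refl refl refl refl = refl

    -- If b = α² - a β², send e₁, e₂ to [[0, a], [1, 0]] and [[α, - a β], [β, - α]].
    module Representation (a α β : K) where
      b : K
      b = α ⊗ α ⊕ ⊖ (a ⊗ (β ⊗ β))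
      open QuatOps a b

      φ : H → M2
      φ (quat x₀ x₁ x₂ x₃) = mat
        (x₀ ⊕ (α ⊗ x₂ ⊕ a ⊗ (β ⊗ x₃)))
        (a ⊗ (x₁ ⊕ ⊖ (β ⊗ x₂ ⊕ α ⊗ x₃)))
        (x₁ ⊕ (β ⊗ x₂ ⊕ α ⊗ x₃))
        (x₀ ⊕ ⊖ (α ⊗ x₂ ⊕ a ⊗ (β ⊗ x₃)))

      φ-* : ∀ x y → φ (x ·H y) ≡ φ x ·M φ y
      φ-* (quat x₀ x₁ x₂ x₃) (quat y₀ y₁ y₂ y₃) = mat-≡
        (solve 11 (λ a α β x₀ x₁ x₂ x₃ y₀ y₁ y₂ y₃ →
          ((x₀ :* y₀ :+ a :* (x₁ :* y₁) :+ (α :* α :+ :- (a :* (β :* β))) :* (x₂ :* y₂) :+ :- (a :* (α :* α :+ :- (a :* (β :* β))) :* (x₃ :* y₃))) :+ (α :* (x₀ :* y₂ :+ x₂ :* y₀ :+ a :* (x₁ :* y₃) :+ :- (a :* (x₃ :* y₁))) :+ a :* (β :* (x₀ :* y₃ :+ x₃ :* y₀ :+ x₁ :* y₂ :+ :- (x₂ :* y₁)))))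
          := (x₀ :+ (α :* x₂ :+ a :* (β :* x₃))) :* (y₀ :+ (α :* y₂ :+ a :* (β :* y₃))) :+ (a :* (x₁ :+ :- (β :* x₂ :+ α :* x₃))) :* (y₁ :+ (β :* y₂ :+ α :* y₃))) refl a α β x₀ x₁ x₂ x₃ y₀ y₁ y₂ y₃)
        (solve 11 (λ a α β x₀ x₁ x₂ x₃ y₀ y₁ y₂ y₃ →
          (a :* ((x₀ :* y₁ :+ x₁ :* y₀ :+ :- ((α :* α :+ :- (a :* (β :* β))) :* (x₂ :* y₃)) :+ (α :* α :+ :- (a :* (β :* β))) :* (x₃ :* y₂)) :+ :- (β :* (x₀ :* y₂ :+ x₂ :* y₀ :+ a :* (x₁ :* y₃) :+ :- (a :* (x₃ :* y₁))) :+ α :* (x₀ :* y₃ :+ x₃ :* y₀ :+ x₁ :* y₂ :+ :- (x₂ :* y₁)))))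
          := (x₀ :+ (α :* x₂ :+ a :* (β :* x₃))) :* (a :* (y₁ :+ :- (β :* y₂ :+ α :* y₃))) :+ (a :* (x₁ :+ :- (β :* x₂ :+ α :* x₃))) :* (y₀ :+ :- (α :* y₂ :+ a :* (β :* y₃)))) refl a α β x₀ x₁ x₂ x₃ y₀ y₁ y₂ y₃)
        (solve 11 (λ a α β x₀ x₁ x₂ x₃ y₀ y₁ y₂ y₃ →
          ((x₀ :* y₁ :+ x₁ :* y₀ :+ :- ((α :* α :+ :- (a :* (β :* β))) :* (x₂ :* y₃)) :+ (α :* α :+ :- (a :* (β :* β))) :* (x₃ :* y₂)) :+ (β :* (x₀ :* y₂ :+ x₂ :* y₀ :+ a :* (x₁ :* y₃) :+ :- (a :* (x₃ :* y₁))) :+ α :* (x₀ :* y₃ :+ x₃ :* y₀ :+ x₁ :* y₂ :+ :- (x₂ :* y₁))))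
          := (x₁ :+ (β :* x₂ :+ α :* x₃)) :* (y₀ :+ (α :* y₂ :+ a :* (β :* y₃))) :+ (x₀ :+ :- (α :* x₂ :+ a :* (β :* x₃))) :* (y₁ :+ (β :* y₂ :+ α :* y₃))) refl a α β x₀ x₁ x₂ x₃ y₀ y₁ y₂ y₃)
        (solve 11 (λ a α β x₀ x₁ x₂ x₃ y₀ y₁ y₂ y₃ →
          ((x₀ :* y₀ :+ a :* (x₁ :* y₁) :+ (α :* α :+ :- (a :* (β :* β))) :* (x₂ :* y₂) :+ :- (a :* (α :* α :+ :- (a :* (β :* β))) :* (x₃ :* y₃))) :+ :- (α :* (x₀ :* y₂ :+ x₂ :* y₀ :+ a :* (x₁ :* y₃) :+ :- (a :* (x₃ :* y₁))) :+ a :* (β :* (x₀ :* y₃ :+ x₃ :* y₀ :+ x₁ :* y₂ :+ :- (x₂ :* y₁)))))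
          := (x₁ :+ (β :* x₂ :+ α :* x₃)) :* (a :* (y₁ :+ :- (β :* y₂ :+ α :* y₃))) :+ (x₀ :+ :- (α :* x₂ :+ a :* (β :* x₃))) :* (y₀ :+ :- (α :* y₂ :+ a :* (β :* y₃)))) refl a α β x₀ x₁ x₂ x₃ y₀ y₁ y₂ y₃)
        where open K-Solver using (solve; _:=_; _:+_; _:*_; :-_)

      φ-+ : ∀ x y → φ (x +H y) ≡ φ x +M φ y
      φ-+ (quat x₀ x₁ x₂ x₃) (quat y₀ y₁ y₂ y₃) = mat-≡
        (solve 9 (λ a α β x₀ x₂ x₃ y₀ y₂ y₃ →
          (x₀ :+ y₀) :+ (α :* (x₂ :+ y₂) :+ a :* (β :* (x₃ :+ y₃))) := (x₀ :+ (α :* x₂ :+ a :* (β :* x₃))) :+ (y₀ :+ (α :* y₂ :+ a :* (β :* y₃))))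
          refl a α β x₀ x₂ x₃ y₀ y₂ y₃)
        (solve 9 (λ a α β x₁ x₂ x₃ y₁ y₂ y₃ →
          a :* ((x₁ :+ y₁) :+ :- (β :* (x₂ :+ y₂) :+ α :* (x₃ :+ y₃))) := a :* (x₁ :+ :- (β :* x₂ :+ α :* x₃)) :+ a :* (y₁ :+ :- (β :* y₂ :+ α :* y₃)))
          refl a α β x₁ x₂ x₃ y₁ y₂ y₃)
        (solve 8 (λ α β x₁ x₂ x₃ y₁ y₂ y₃ →
          (x₁ :+ y₁) :+ (β :* (x₂ :+ y₂) :+ α :* (x₃ :+ y₃)) := (x₁ :+ (β :* x₂ :+ α :* x₃)) :+ (y₁ :+ (β :* y₂ :+ α :* y₃)))
          refl α β x₁ x₂ x₃ y₁ y₂ y₃)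
        (solve 9 (λ a α β x₀ x₂ x₃ y₀ y₂ y₃ →
          (x₀ :+ y₀) :+ :- (α :* (x₂ :+ y₂) :+ a :* (β :* (x₃ :+ y₃))) := (x₀ :+ :- (α :* x₂ :+ a :* (β :* x₃))) :+ (y₀ :+ :- (α :* y₂ :+ a :* (β :* y₃))))
          refl a α β x₀ x₂ x₃ y₀ y₂ y₃)
        where open K-Solver using (solve; _:=_; _:+_; _:*_; :-_)

      φ-• : ∀ c x → φ (c •H x) ≡ c •M φ x
      φ-• c (quat x₀ x₁ x₂ x₃) = mat-≡
        (solve 7 (λ a α β c x₀ x₂ x₃ →
          c :* x₀ :+ (α :* (c :* x₂) :+ a :* (β :* (c :* x₃))) := c :* (x₀ :+ (α :* x₂ :+ a :* (β :* x₃))))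
          refl a α β c x₀ x₂ x₃)
        (solve 7 (λ a α β c x₁ x₂ x₃ →
          a :* (c :* x₁ :+ :- (β :* (c :* x₂) :+ α :* (c :* x₃))) := c :* (a :* (x₁ :+ :- (β :* x₂ :+ α :* x₃))))
          refl a α β c x₁ x₂ x₃)
        (solve 6 (λ α β c x₁ x₂ x₃ →
          c :* x₁ :+ (β :* (c :* x₂) :+ α :* (c :* x₃)) := c :* (x₁ :+ (β :* x₂ :+ α :* x₃)))
          refl α β c x₁ x₂ x₃)
        (solve 7 (λ a α β c x₀ x₂ x₃ →
          c :* x₀ :+ :- (α :* (c :* x₂) :+ a :* (β :* (c :* x₃))) := c :* (x₀ :+ :- (α :* x₂ :+ a :* (β :* x₃))))
          refl a α β c x₀ x₂ x₃)
        where open K-Solver using (solve; _:=_; _:+_; _:*_; :-_)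

      φ-1 : φ 1H ≡ 1M
      φ-1 = mat-≡
        (solve 3 (λ a α β → con 1ℚ :+ (α :* con 0ℚ :+ a :* (β :* con 0ℚ)) := con 1ℚ) refl a α β)
        (solve 3 (λ a α β → a :* (con 0ℚ :+ :- (β :* con 0ℚ :+ α :* con 0ℚ)) := con 0ℚ) refl a α β)
        (solve 2 (λ α β → con 0ℚ :+ (β :* con 0ℚ :+ α :* con 0ℚ) := con 0ℚ) refl α β)
        (solve 3 (λ a α β → con 1ℚ :+ :- (α :* con 0ℚ :+ a :* (β :* con 0ℚ)) := con 1ℚ) refl a α β)
        where open K-Solver using (solve; _:=_; _:+_; _:*_; :-_; con)

      module Inverse (½ a⁻¹ b⁻¹ : K) (½+½ : ½ ⊕ ½ ≡ 1K) (aa⁻¹ : a ⊗ a⁻¹ ≡ 1K) (bb⁻¹ : b ⊗ b⁻¹ ≡ 1K) where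
        -- Half sums and half differences of the entries give `x₀`, `x₁` and the values
        -- `U = α x₂ + a β x₃`, `V = β x₂ + α x₃`. This linear system has determinant
        -- `α² - a β² = b`, and Cramer's rule yields the last two components.
        ψ : M2 → H
        ψ (mat m₁₁ m₁₂ m₂₁ m₂₂) = quat
          (½ ⊗ (m₁₁ ⊕ m₂₂))
          (½ ⊗ (m₂₁ ⊕ a⁻¹ ⊗ m₁₂))
          (b⁻¹ ⊗ (α ⊗ (½ ⊗ (m₁₁ ⊕ ⊖ m₂₂)) ⊕ ⊖ (a ⊗ (β ⊗ (½ ⊗ (m₂₁ ⊕ ⊖ (a⁻¹ ⊗ m₁₂)))))))
          (b⁻¹ ⊗ (α ⊗ (½ ⊗ (m₂₁ ⊕ ⊖ (a⁻¹ ⊗ m₁₂))) ⊕ ⊖ (β ⊗ (½ ⊗ (m₁₁ ⊕ ⊖ m₂₂)))))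

        private
          open K-Solver using (solve; _:=_; _:+_; _:*_; :-_; con)

          halves : ∀ x → (½ ⊕ ½) ⊗ x ≡ x
          halves x = trans (cong (_⊗ x) ½+½) (⊗-identityˡ x)

          halves-b : ∀ x → (½ ⊕ ½) ⊗ ((b ⊗ b⁻¹) ⊗ x) ≡ x
          halves-b x = trans (halves _) (trans (cong (_⊗ x) bb⁻¹) (⊗-identityˡ x))

          sum-half : ∀ x y → ½ ⊗ (x ⊕ y) ⊕ (b ⊗ b⁻¹) ⊗ (½ ⊗ (x ⊕ ⊖ y)) ≡ x
          sum-half x y = trans (cong (λ z → ½ ⊗ (x ⊕ y) ⊕ z ⊗ (½ ⊗ (x ⊕ ⊖ y))) bb⁻¹)
            (trans (solve 3 (λ h x y → h :* (x :+ y) :+ con 1ℚ :* (h :* (x :+ :- y)) := (h :+ h) :* x) refl ½ x y) (halves x))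

          difference-half : ∀ x y → ½ ⊗ (x ⊕ y) ⊕ ⊖ ((b ⊗ b⁻¹) ⊗ (½ ⊗ (x ⊕ ⊖ y))) ≡ y
          difference-half x y = trans (cong (λ z → ½ ⊗ (x ⊕ y) ⊕ ⊖ (z ⊗ (½ ⊗ (x ⊕ ⊖ y)))) bb⁻¹)
            (trans (solve 3 (λ h x y → h :* (x :+ y) :+ :- (con 1ℚ :* (h :* (x :+ :- y))) := (h :+ h) :* y) refl ½ x y) (halves y))

        φψ : ∀ m → φ (ψ m) ≡ m
        φψ (mat m₁₁ m₁₂ m₂₁ m₂₂) = mat-≡
          (trans (solve 7 (λ a α β i S U V → let b = α :* α :+ :- (a :* (β :* β)) in
              S :+ (α :* (i :* (α :* U :+ :- (a :* (β :* V)))) :+ a :* (β :* (i :* (α :* V :+ :- (β :* U))))) := S :+ (b :* i) :* U)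
              refl a α β b⁻¹ (½ ⊗ (m₁₁ ⊕ m₂₂)) U V)
            (sum-half m₁₁ m₂₂))
          (trans (solve 7 (λ a α β i T U V → let b = α :* α :+ :- (a :* (β :* β)) in
              a :* (T :+ :- (β :* (i :* (α :* U :+ :- (a :* (β :* V)))) :+ α :* (i :* (α :* V :+ :- (β :* U))))) := a :* (T :+ :- ((b :* i) :* V)))
              refl a α β b⁻¹ (½ ⊗ (m₂₁ ⊕ a⁻¹ ⊗ m₁₂)) U V)
            (trans (cong (a ⊗_) (difference-half m₂₁ (a⁻¹ ⊗ m₁₂))) (trans (sym (⊗-assoc a a⁻¹ m₁₂)) (trans (cong (_⊗ m₁₂) aa⁻¹) (⊗-identityˡ m₁₂)))))
          (trans (solve 7 (λ a α β i T U V → let b = α :* α :+ :- (a :* (β :* β)) in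
              T :+ (β :* (i :* (α :* U :+ :- (a :* (β :* V)))) :+ α :* (i :* (α :* V :+ :- (β :* U)))) := T :+ (b :* i) :* V)
              refl a α β b⁻¹ (½ ⊗ (m₂₁ ⊕ a⁻¹ ⊗ m₁₂)) U V)
            (sum-half m₂₁ (a⁻¹ ⊗ m₁₂)))
          (trans (solve 7 (λ a α β i S U V → let b = α :* α :+ :- (a :* (β :* β)) in
              S :+ :- (α :* (i :* (α :* U :+ :- (a :* (β :* V)))) :+ a :* (β :* (i :* (α :* V :+ :- (β :* U))))) := S :+ :- ((b :* i) :* U))
              refl a α β b⁻¹ (½ ⊗ (m₁₁ ⊕ m₂₂)) U V)
            (difference-half m₁₁ m₂₂))
          where
          U = ½ ⊗ (m₁₁ ⊕ ⊖ m₂₂)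
          V = ½ ⊗ (m₂₁ ⊕ ⊖ (a⁻¹ ⊗ m₁₂))

        ψφ : ∀ x → ψ (φ x) ≡ x
        ψφ (quat x₀ x₁ x₂ x₃) = quat-≡
          (trans (solve 3 (λ h x s → h :* ((x :+ s) :+ (x :+ :- s)) := (h :+ h) :* x) refl ½ x₀ s) (halves x₀))
          (trans (cong (λ z → ½ ⊗ ((x₁ ⊕ r) ⊕ z)) cancel-a) (trans (solve 3 (λ h x r → h :* ((x :+ r) :+ (x :+ :- r)) := (h :+ h) :* x) refl ½ x₁ r) (halves x₁)))
          (trans (cong (λ z → b⁻¹ ⊗ (α ⊗ (½ ⊗ ((x₀ ⊕ s) ⊕ ⊖ (x₀ ⊕ ⊖ s))) ⊕ ⊖ (a ⊗ (β ⊗ (½ ⊗ ((x₁ ⊕ r) ⊕ ⊖ z)))))) cancel-a)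
            (trans (solve 9 (λ a α β i h x₀ x₁ x₂ x₃ → let b = α :* α :+ :- (a :* (β :* β)) ; s = α :* x₂ :+ a :* (β :* x₃) ; r = β :* x₂ :+ α :* x₃ in
                i :* (α :* (h :* ((x₀ :+ s) :+ :- (x₀ :+ :- s))) :+ :- (a :* (β :* (h :* ((x₁ :+ r) :+ :- (x₁ :+ :- r)))))) := (h :+ h) :* ((b :* i) :* x₂))
                refl a α β b⁻¹ ½ x₀ x₁ x₂ x₃)
              (halves-b x₂)))
          (trans (cong (λ z → b⁻¹ ⊗ (α ⊗ (½ ⊗ ((x₁ ⊕ r) ⊕ ⊖ z)) ⊕ ⊖ (β ⊗ (½ ⊗ ((x₀ ⊕ s) ⊕ ⊖ (x₀ ⊕ ⊖ s)))))) cancel-a)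
            (trans (solve 9 (λ a α β i h x₀ x₁ x₂ x₃ → let b = α :* α :+ :- (a :* (β :* β)) ; s = α :* x₂ :+ a :* (β :* x₃) ; r = β :* x₂ :+ α :* x₃ in
                i :* (α :* (h :* ((x₁ :+ r) :+ :- (x₁ :+ :- r))) :+ :- (β :* (h :* ((x₀ :+ s) :+ :- (x₀ :+ :- s))))) := (h :+ h) :* ((b :* i) :* x₃))
                refl a α β b⁻¹ ½ x₀ x₁ x₂ x₃)
              (halves-b x₃)))
          where
          s = α ⊗ x₂ ⊕ a ⊗ (β ⊗ x₃)
          r = β ⊗ x₂ ⊕ α ⊗ x₃
          cancel-a : a⁻¹ ⊗ (a ⊗ (x₁ ⊕ ⊖ r)) ≡ x₁ ⊕ ⊖ r
          cancel-a = trans (sym (⊗-assoc a⁻¹ a (x₁ ⊕ ⊖ r))) (trans (cong (_⊗ (x₁ ⊕ ⊖ r)) (trans (⊗-comm a⁻¹ a) aa⁻¹)) (⊗-identityˡ (x₁ ⊕ ⊖ r)))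

        iso : AlgIso a b
        iso = record
          { φ = φ ; φ-+ = φ-+ ; φ-• = φ-• ; φ-· = φ-* ; φ-1 = φ-1
          ; φ-inj = λ {x} {y} e → trans (sym (ψφ x)) (trans (cong ψ e) (ψφ y))
          ; φ-surj = λ m → ψ m , λ e → trans (cong φ e) (φψ m) }

-- From two rational solutions to a norm equation over `K`, and the local conditions on `d`.

module NormForms where
  import Tactic.RingSolver as Solver
  open import Defs
  open RationalSums using (ℚ-ring)
  open Gauss using (res; module OddPrime)
  open Hilbert
  open Legendre using (Isotropic; isotropic; legendre-theorem)
  open SymbolCharacters using (odd≢2; prime-∣-prime)
  open LinkingNumber using (module Construction)
  open Splitting
  open import Data.Nat as ℕ using (ℕ; suc; _≥_)
  import Data.Nat.Properties as ℕ
  import Data.Nat.Divisibility as ℕ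
  open import Data.Nat.Primality using (Prime; euclidsLemma; ¬prime[1]; prime[2])
  open import Data.Integer as ℤ using (ℤ; +_; 0ℤ) renaming (∣_∣ to abs)
  import Data.Integer.Properties as ℤ
  open import Data.Integer.DivMod using (_%ℕ_)
  open import Data.Integer.Divisibility.Signed using (_∣_; divides; ∣⇒∣ᵤ; ∣ᵤ⇒∣; _∣?_; ∣n⇒∣m*n)
  open import Data.Integer.Tactic.RingSolver using (solve-∀)
  open import Data.Parity using (0ℙ; 1ℙ)
  open import Data.Rational as ℚ using (ℚ; 0ℚ; 1ℚ; ½; _+_; _-_; _*_; -_)
  import Data.Rational.Properties as ℚ
  import Data.Rational.Unnormalised as ℚᵘ
  import Data.Rational.Unnormalised.Properties as ℚᵘ
  open import Data.Product using (∃; ∃₂; _×_; _,_; proj₁; proj₂)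
  open import Data.Sum using (_⊎_; inj₁; inj₂; [_,_]′)
  open import Data.Empty using (⊥; ⊥-elim)
  open import Relation.Nullary using (¬_; Dec; yes; no)
  open import Relation.Binary.PropositionalEquality hiding (J)
  open import Function using (_∘_)

  J : ℤ → ℚ
  J i = i ℚ./ 1

  J-ᵘ : ∀ i → ℚ.toℚᵘ (J i) ℚᵘ.≃ ℚᵘ.mkℚᵘ i 0
  J-ᵘ i = ℚ.toℚᵘ-fromℚᵘ (ℚᵘ.mkℚᵘ i 0)

  J-* : ∀ i j → J (i ℤ.* j) ≡ J i * J j
  J-* i j = ℚ.toℚᵘ-injective (ℚᵘ.≃-trans (J-ᵘ (i ℤ.* j)) (ℚᵘ.≃-sym (ℚᵘ.≃-trans (ℚ.toℚᵘ-homo-* (J i) (J j)) (ℚᵘ.*-cong (J-ᵘ i) (J-ᵘ j)))))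

  J-+ : ∀ i j → J (i ℤ.+ j) ≡ J i + J j
  J-+ i j = ℚ.toℚᵘ-injective (ℚᵘ.≃-trans (J-ᵘ (i ℤ.+ j)) (ℚᵘ.≃-sym (ℚᵘ.≃-trans (ℚ.toℚᵘ-homo-+ (J i) (J j)) (ℚᵘ.≃-trans (ℚᵘ.+-cong (J-ᵘ i) (J-ᵘ j)) (ℚᵘ.*≡* (lem i j))))))
    where
    lem : ∀ i j → (i ℤ.* + 1 ℤ.+ j ℤ.* + 1) ℤ.* + 1 ≡ (i ℤ.+ j) ℤ.* + 1
    lem = solve-∀

  J-zero : ∀ {i} → J i ≡ 0ℚ → i ≡ 0ℤ
  J-zero {i} e with ℚᵘ.≃-trans (ℚᵘ.≃-sym (J-ᵘ i)) (ℚᵘ.≃-reflexive (cong ℚ.toℚᵘ e))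
  ... | ℚᵘ.*≡* h = trans (sym (ℤ.*-identityʳ i)) h

  J-inverse : ∀ {i} → i ≢ 0ℤ → ∃ λ r → J i * r ≡ 1ℚ
  J-inverse {i} h = ℚ.1/_ (J i) {{ℚ.≢-nonZero (h ∘ J-zero)}} , ℚ.*-inverseʳ (J i) {{ℚ.≢-nonZero (h ∘ J-zero)}}

  isotropic-J : ∀ {a b} → (s : Isotropic a b) → let open Isotropic s in J x * J x ≡ J a * (J y * J y) + J b * (J z * J z)
  isotropic-J {a} {b} (isotropic x y z e n) = trans (sym (J-* x x)) (trans (cong J e) (trans (J-+ (a ℤ.* (y ℤ.* y)) (b ℤ.* (z ℤ.* z)))
    (cong₂ _+_ (term a y) (term b z))))
    where
    term : ∀ c t → J (c ℤ.* (t ℤ.* t)) ≡ J c * (J t * J t)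
    term c t = trans (J-* c (t ℤ.* t)) (cong (J c *_) (J-* t t))

  module NormEquation (d : ℤ) (d≢0 : d ≢ 0ℤ) (P Q : ℤ) (P≢0 : P ≢ 0ℤ) where
    open QuadField d
    open QuadraticField d

    NormForm : Set
    NormForm = ∃₂ λ α β → α ⊗ α ⊕ ⊖ (ι (J P) ⊗ (β ⊗ β)) ≡ ι (J Q)

    -- If P = γ² then every Q is a norm: Q = ((Q+1)/2)² - γ² ((Q-1)/(2γ))².
    from-square : ∀ γ → γ ⊗ γ ≡ ι (J P) → NormForm
    from-square γ γ² = ι α , γ ⊗ ι β , (begin
      ι α ⊗ ι α ⊕ ⊖ (ι p ⊗ ((γ ⊗ ι β) ⊗ (γ ⊗ ι β)))
        ≡⟨ solve 4 (λ a p g b → a :* a :+ :- (p :* ((g :* b) :* (g :* b))) := a :* a :+ :- (p :* ((g :* g) :* (b :* b)))) refl (ι α) (ι p) γ (ι β) ⟩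
      ι α ⊗ ι α ⊕ ⊖ (ι p ⊗ ((γ ⊗ γ) ⊗ (ι β ⊗ ι β)))
        ≡⟨ cong (λ z → ι α ⊗ ι α ⊕ ⊖ (ι p ⊗ (z ⊗ (ι β ⊗ ι β)))) γ² ⟩
      ι α ⊗ ι α ⊕ ⊖ (ι p ⊗ (ι p ⊗ (ι β ⊗ ι β)))
        ≡⟨ sym (cong₂ (λ x y → x ⊕ ⊖ y) (ι-* α α) (trans (ι-* p (p * (β * β))) (cong (ι p ⊗_) (trans (ι-* p (β * β)) (cong (ι p ⊗_) (ι-* β β)))))) ⟩
      ι (α * α) ⊕ ⊖ ι (p * (p * (β * β)))
        ≡⟨ cong ι value ⟩
      ι (J Q) ∎)
      where
      open ≡-Reasoning
      open K-Solver using (solve; _:=_; _:+_; _:*_; :-_)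
      p = J P
      q = J Q
      i = proj₁ (J-inverse P≢0)
      α = (q + 1ℚ) * ½
      β = (q - 1ℚ) * (½ * i)
      lem₁ : ∀ p q h i → (q + 1ℚ) * h * ((q + 1ℚ) * h) - p * (p * ((q - 1ℚ) * (h * i) * ((q - 1ℚ) * (h * i))))
        ≡ (q + 1ℚ) * h * ((q + 1ℚ) * h) - (p * i) * (p * i) * ((q - 1ℚ) * h * ((q - 1ℚ) * h))
      lem₁ = Solver.solve-∀ ℚ-ring
      lem₂ : ∀ q h → (q + 1ℚ) * h * ((q + 1ℚ) * h) - 1ℚ * 1ℚ * ((q - 1ℚ) * h * ((q - 1ℚ) * h)) ≡ (h + h) * (h + h) * q
      lem₂ = Solver.solve-∀ ℚ-ring
      value : α * α - p * (p * (β * β)) ≡ q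
      value = trans (lem₁ p q ½ i) (trans (cong (λ z → (q + 1ℚ) * ½ * ((q + 1ℚ) * ½) - z * z * ((q - 1ℚ) * ½ * ((q - 1ℚ) * ½))) (proj₂ (J-inverse P≢0)))
        (trans (lem₂ q ½) (ℚ.*-identityˡ q)))

    -- A norm q n from ℚ(√P) times a norm n from ℚ(√(P d)): over K both are norms from K(√P).
    from-pair : ∀ {n} → n ≢ 0ℤ → Isotropic P (Q ℤ.* n) → Isotropic (P ℤ.* d) n → NormForm
    from-pair {n} n≢0 s₁@(isotropic x y z _ nz₁) s₂@(isotropic x' y' z' _ nz₂) = by-cases (z ℤ.≟ 0ℤ) (z' ℤ.≟ 0ℤ)
      where
      D = dℚ
      p = J P
      q = J Q
      N = J n
      X = J x
      Y = J y
      Z = J z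
      X' = J x'
      Y' = J y'
      Z' = J z'
      eq₁ : X * X ≡ p * (Y * Y) + q * N * (Z * Z)
      eq₁ = trans (isotropic-J s₁) (cong (λ c → p * (Y * Y) + c * (Z * Z)) (J-* Q n))
      eq₂ : X' * X' ≡ p * D * (Y' * Y') + N * (Z' * Z')
      eq₂ = trans (isotropic-J s₂) (cong (λ c → c * (Y' * Y') + N * (Z' * Z')) (J-* P d))

      degenerate₁ : z ≡ 0ℤ → NormForm
      degenerate₁ z≡0 = from-square (ι (X * i)) (trans (sym (ι-* (X * i) (X * i))) (cong ι value))
        where
        inverse = J-inverse (λ y≡0 → nz₁ (y≡0 , z≡0))
        i = proj₁ inverse
        lem₁ : ∀ x i → x * i * (x * i) ≡ x * x * (i * i)
        lem₁ = Solver.solve-∀ ℚ-ring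
        lem₂ : ∀ p y c i → (p * (y * y) + c * (0ℚ * 0ℚ)) * (i * i) ≡ p * (y * i * (y * i))
        lem₂ = Solver.solve-∀ ℚ-ring
        value : X * i * (X * i) ≡ p
        value = trans (lem₁ X i) (trans (cong (_* (i * i)) (trans eq₁ (cong (λ w → p * (Y * Y) + q * N * (w * w)) (cong J z≡0))))
          (trans (lem₂ p Y (q * N) i) (trans (cong (λ w → p * (w * w)) (proj₂ inverse)) (ℚ.*-identityʳ p))))

      degenerate₂ : z' ≡ 0ℤ → NormForm
      -- With `z' = 0` the product `P d` is the square of `X'/Y'`, so `P` is the square of
      -- `(X'/(Y' d)) √d` in `K`.
      degenerate₂ z'≡0 = from-square (0ℚ +√ g) (pair value (lem₀ g))
        where
        inverse = J-inverse (λ y≡0 → nz₂ (y≡0 , z'≡0))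
        i = proj₁ inverse
        j = proj₁ (J-inverse d≢0)
        g = X' * (i * j)
        lem₀ : ∀ g → 0ℚ * g + g * 0ℚ ≡ 0ℚ
        lem₀ = Solver.solve-∀ ℚ-ring
        lem₁ : ∀ D x i j → 0ℚ * 0ℚ + D * (x * (i * j) * (x * (i * j))) ≡ D * (x * x * (i * j * (i * j)))
        lem₁ = Solver.solve-∀ ℚ-ring
        lem₂ : ∀ D p y c i j → D * ((p * D * (y * y) + c * (0ℚ * 0ℚ)) * (i * j * (i * j))) ≡ p * (y * i * (y * i)) * (D * j * (D * j))
        lem₂ = Solver.solve-∀ ℚ-ring
        value : 0ℚ * 0ℚ + D * (g * g) ≡ p
        value = trans (lem₁ D X' i j) (trans (cong (λ w → D * (w * (i * j * (i * j)))) (trans eq₂ (cong (λ w → p * D * (Y' * Y') + N * (w * w)) (cong J z'≡0))))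
          (trans (lem₂ D p Y' N i j) (trans (cong₂ (λ u v → p * (u * u) * (v * v)) (proj₂ inverse) (proj₂ (J-inverse d≢0))) (trans (ℚ.*-identityʳ (p * 1ℚ)) (ℚ.*-identityʳ p)))))

      generic : z ≢ 0ℤ → z' ≢ 0ℤ → NormForm
      -- The coefficients of 1 and `√P` in `(X + Y √P)(X' + Y' √P √d) / (n Z Z')`. The norms of the
      -- two factors are `q n Z²` and `n Z'²`, so the quotient has norm `q`.
      generic z≢0 z'≢0 = ((X * X' * w) +√ (p * (Y * Y') * w)) , ((Y * X' * w) +√ (X * Y' * w)) , pair real imaginary
        where
        i = proj₁ (J-inverse n≢0)
        k = proj₁ (J-inverse z≢0)
        l = proj₁ (J-inverse z'≢0)
        w = i * (k * l)
        lem₁ : ∀ D p X Y X' Y' w →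
          (X * X' * w) * (X * X' * w) + D * ((p * (Y * Y') * w) * (p * (Y * Y') * w))
            + - (p * ((Y * X' * w) * (Y * X' * w) + D * ((X * Y' * w) * (X * Y' * w))) + D * (0ℚ * ((Y * X' * w) * (X * Y' * w) + (X * Y' * w) * (Y * X' * w))))
          ≡ (X * X - p * (Y * Y)) * (X' * X' - p * D * (Y' * Y')) * (w * w)
        lem₁ = Solver.solve-∀ ℚ-ring
        lem₂ : ∀ p X Y X' Y' w D →
          (X * X' * w) * (p * (Y * Y') * w) + (p * (Y * Y') * w) * (X * X' * w)
            + - (p * ((Y * X' * w) * (X * Y' * w) + (X * Y' * w) * (Y * X' * w)) + 0ℚ * ((Y * X' * w) * (Y * X' * w) + D * ((X * Y' * w) * (X * Y' * w))))
          ≡ 0ℚ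
        lem₂ = Solver.solve-∀ ℚ-ring
        lem₃ : ∀ u v → u + v - u ≡ v
        lem₃ = Solver.solve-∀ ℚ-ring
        lem₄ : ∀ q N Z Z' i k l → q * N * (Z * Z) * (N * (Z' * Z')) * (i * (k * l) * (i * (k * l))) ≡ q * (N * i * (N * i)) * (Z * k * (Z * k)) * (Z' * l * (Z' * l))
        lem₄ = Solver.solve-∀ ℚ-ring
        lem₅ : ∀ q → q * (1ℚ * 1ℚ) * (1ℚ * 1ℚ) * (1ℚ * 1ℚ) ≡ q
        lem₅ = Solver.solve-∀ ℚ-ring
        real = trans (lem₁ D p X Y X' Y' w) (trans
          (cong₂ (λ u v → u * v * (w * w)) (trans (cong (_- p * (Y * Y)) eq₁) (lem₃ (p * (Y * Y)) (q * N * (Z * Z)))) (trans (cong (_- p * D * (Y' * Y')) eq₂) (lem₃ (p * D * (Y' * Y')) (N * (Z' * Z')))))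
          (trans (lem₄ q N Z Z' i k l) (trans (cong₂ (λ u v → q * (u * u) * (v * v) * (Z' * l * (Z' * l))) (proj₂ (J-inverse n≢0)) (proj₂ (J-inverse z≢0)))
            (trans (cong (λ u → q * (1ℚ * 1ℚ) * (1ℚ * 1ℚ) * (u * u)) (proj₂ (J-inverse z'≢0))) (lem₅ q)))))
        imaginary = lem₂ p X Y X' Y' w D

      by-cases : Dec (z ≡ 0ℤ) → Dec (z' ≡ 0ℤ) → NormForm
      by-cases (yes e) _ = degenerate₁ e
      by-cases (no _) (yes e) = degenerate₂ e
      by-cases (no h) (no h') = generic h h'

    normForm⇒splits : Q ≢ 0ℤ → NormForm → Splits (ι (J P)) (ι (J Q))
    normForm⇒splits Q≢0 (α , β , e) = subst (AlgIso (ι (J P))) e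
      (Representation.Inverse.iso (ι (J P)) α β (ι ½) (ι (proj₁ P⁻¹)) (ι (proj₁ Q⁻¹)) refl
        (trans (sym (ι-* (J P) (proj₁ P⁻¹))) (cong ι (proj₂ P⁻¹)))
        (trans (cong (_⊗ ι (proj₁ Q⁻¹)) e) (trans (sym (ι-* (J Q) (proj₁ Q⁻¹))) (cong ι (proj₂ Q⁻¹)))))
      where
      P⁻¹ = J-inverse P≢0
      Q⁻¹ = J-inverse Q≢0

  disc-cases : ∀ d → disc d ≡ d ⊎ disc d ≡ + 4 ℤ.* d
  disc-cases d with d %ℕ 4
  ... | 0 = inj₂ refl
  ... | 1 = inj₁ refl
  ... | suc (suc _) = inj₂ refl

  module _ {d : ℤ} (squareFree : SquareFree d) where

    ramified-class : ∀ {ℓ} → Prime ℓ → + ℓ ∣ d → ∃ λ u → Split ℓ d 1 u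
    ramified-class {ℓ} pr (divides u e) = u , subst (λ z → Split ℓ z 1 u) (trans (ℤ.*-comm (+ ℓ) u) (sym e)) (split-times ℓ∤u)
      where
      ℓ∤u : ¬ + ℓ ∣ u
      ℓ∤u (divides v e') = ¬prime[1] (subst Prime (squareFree ℓ (∣⇒∣ᵤ {+ (ℓ ℕ.* ℓ)} (divides v
        (trans e (trans (cong (ℤ._* + ℓ) e') (trans (ℤ.*-assoc v (+ ℓ) (+ ℓ)) (cong (v ℤ.*_) (sym (ℤ.pos-* ℓ ℓ))))))))) pr)

    -- If `ℓ` divides the square-free `d`, the valuation is odd. Otherwise a trivial class makes `d`
    -- a square modulo `ℓ`, and with it the discriminant, which differs from `d` at most by the
    -- square 4. The Legendre condition is therefore asked only when `ℓ` does not divide `d`.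
    odd-class-nontrivial : ∀ {ℓ} → OddPrime′ ℓ → (¬ + ℓ ∣ d → ¬ LegendreIsOne (disc d) ℓ) → cls ℓ d ≢ (0ℙ , 0ℙ)
    odd-class-nontrivial {ℓ} (pr , odd) nonresidue e = go (+ ℓ ∣? d)
      where
      go : Dec (+ ℓ ∣ d) → ⊥
      go (yes ℓ∣d) = 1ℙ≢0ℙ (trans (sym (cong proj₁ (cls-split pr (proj₂ (ramified-class pr ℓ∣d))))) (cong proj₁ e))
        where
        1ℙ≢0ℙ : 1ℙ ≢ 0ℙ
        1ℙ≢0ℙ ()
      go (no ℓ∤d) = nonresidue ℓ∤d (legendre (disc-cases d) (root (pr , odd) (trans (sym (cong proj₂ (cls-split pr (split-unit ℓ∤d)))) (cong proj₂ e))))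
        where
        root : ∀ {ℓ} → OddPrime′ ℓ → res ℓ d ≡ 0ℙ → ¬ + ℓ ∣ d → ∃ λ x → + ℓ ∣ x ℤ.* x ℤ.- d
        root {suc m} (pr , odd) r ℓ∤d = OddPrime.sqrt-of-residue pr odd d ℓ∤d r
        2∤ : ¬ ℓ ℕ.∣ 2
        2∤ h = odd≢2 (pr , odd) (prime-∣-prime pr prime[2] h)
        ℓ∤4d : ¬ ℓ ℕ.∣ abs (+ 4 ℤ.* d)
        ℓ∤4d h = [ (λ h → [ 2∤ , 2∤ ]′ (euclidsLemma 2 2 pr h)) , (λ h → ℓ∤d (∣ᵤ⇒∣ h)) ]′ (euclidsLemma 4 (abs d) pr (subst (ℓ ℕ.∣_) (ℤ.abs-* (+ 4) d) h))
        lem : ∀ x d → + 2 ℤ.* x ℤ.* (+ 2 ℤ.* x) ℤ.- + 4 ℤ.* d ≡ + 4 ℤ.* (x ℤ.* x ℤ.- d)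
        lem = solve-∀
        legendre : disc d ≡ d ⊎ disc d ≡ + 4 ℤ.* d → (¬ + ℓ ∣ d → ∃ λ x → + ℓ ∣ x ℤ.* x ℤ.- d) → LegendreIsOne (disc d) ℓ
        legendre (inj₁ e) r = subst (λ D → LegendreIsOne D ℓ) (sym e) ((λ h → ℓ∤d (∣ᵤ⇒∣ h)) , proj₁ (r ℓ∤d) , ∣⇒∣ᵤ (proj₂ (r ℓ∤d)))
        legendre (inj₂ e) r = subst (λ D → LegendreIsOne D ℓ) (sym e) (ℓ∤4d , + 2 ℤ.* proj₁ (r ℓ∤d) ,
          ∣⇒∣ᵤ (subst (+ ℓ ∣_) (sym (lem (proj₁ (r ℓ∤d)) d)) (∣n⇒∣m*n (+ 4) (proj₂ (r ℓ∤d)))))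

    -- An even square-free `d` has valuation one at 2, and among odd units only those congruent to 1
    -- modulo 8 are squares in `ℚ₂`.
    two-class-nontrivial : d %ℕ 8 ≢ 1 → cls₂ d ≢ (0ℙ , 0ℙ , 0ℙ)
    two-class-nontrivial d≢1 e = go (+ 2 ∣? d)
      where
      go : Dec (+ 2 ∣ d) → ⊥
      go (yes h) = 1ℙ≢0ℙ (trans (sym (cong proj₁ (cls₂-split (proj₂ (ramified-class prime[2] h))))) (cong proj₁ e))
        where
        1ℙ≢0ℙ : 1ℙ ≢ 0ℙ
        1ℙ≢0ℙ ()
      go (no h) = trivial (odd₈ d h) d≢1 (trans (sym (cong proj₂ (cls₂-split (split-unit h)))) (cong proj₂ e))
        where
        trivial : ∀ {r} → Odd₈ r → r ≢ 1 → ρ₈ r ≢ (0ℙ , 0ℙ)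
        trivial r1 h _ = h refl
        trivial r3 _ ()
        trivial r5 _ ()
        trivial r7 _ ()

  -- Covers odd `p` and `p = 2` at once: the Legendre condition is asked at the odd primes among `p`
  -- and `q`, while the place 2 is governed by `d` modulo 8.
  splits : ∀ d → d ≢ 0ℤ → SquareFree d → d %ℕ 8 ≢ 1 → ∀ p q → Prime p → Prime q →
    (∀ {ℓ} → OddPrime′ ℓ → ℓ ≡ p ⊎ ℓ ≡ q → ¬ LegendreIsOne (disc d) ℓ) → QuatSplits d p q
  splits d d≢0 squareFree d≢1 p q pp pq nonsplit = from (Construction.linking-number p q pp pq d d≢0 nontrivial (two-class-nontrivial {d} squareFree d≢1))
    where
    nontrivial : ∀ {ℓ} → OddPrime′ ℓ → ℓ ℕ.∣ p ℕ.* (q ℕ.* abs d) → cls ℓ d ≢ (0ℙ , 0ℙ)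
    nontrivial {ℓ} o h = odd-class-nontrivial {d} squareFree o (λ ℓ∤d → nonsplit o
      ([ (λ h → inj₁ (prime-∣-prime (proj₁ o) pp h)) ,
         (λ h → [ (λ h → inj₂ (prime-∣-prime (proj₁ o) pq h)) , (λ h → ⊥-elim (ℓ∤d (∣ᵤ⇒∣ h))) ]′ (euclidsLemma q (abs d) (proj₁ o) h)) ]′
        (euclidsLemma p (q ℕ.* abs d) (proj₁ o) h)))
    prime≢0 : ∀ {ℓ} → Prime ℓ → + ℓ ≢ 0ℤ
    prime≢0 pr e = Split⇒≢0 pr (split-prime pr) e
    open NormEquation d d≢0 (+ p) (+ q) (prime≢0 pp)
    from : (∃ λ n → n ≢ 0ℤ × _ × _) → QuatSplits d p q
    from (n , n≢0 , l₁ , l₂) = normForm⇒splits (prime≢0 pq) (from-pair n≢0 (legendre-theorem l₁) (legendre-theorem l₂))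

-- Specialisation to odd `p` and to `p = 2`.

open import Defs
open import Data.Nat using (ℕ; _≥_)
open import Data.Nat.Primality using (Prime)
open import Data.Integer using (ℤ; +_)
open import Data.Integer.DivMod using (_%ℕ_)
open import Data.Product using (_×_; _,_)
open import Relation.Nullary using (¬_)
open import Relation.Binary.PropositionalEquality using (_≡_; _≢_; refl)
open import Data.Sum using (inj₁; inj₂)
open import Data.Empty using (⊥-elim)
open Hilbert using (OddPrime′)
open SymbolCharacters using (odd≢2)
open NormForms using (splits)

theorem3p1 : (d : ℤ) → d ≢ + 0 → d ≢ + 1 → SquareFree d → d %ℕ 8 ≢ 1 →
    (p q : ℕ) → Prime p → Prime q → q ≥ 3 → p ≢ q →
    ((p ≥ 3 → ¬ LegendreIsOne (disc d) p → ¬ LegendreIsOne (disc d) q → QuatSplits d p q)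
    × (p ≡ 2 → ¬ LegendreIsOne (disc d) q → QuatSplits d 2 q))
theorem3p1 d d≢0 _ squareFree d≢1 p q pp pq _ _ =
  (λ _ hp hq → splits d d≢0 squareFree d≢1 p q pp pq (λ { _ (inj₁ refl) → hp ; _ (inj₂ refl) → hq })) ,
  (λ { refl hq → splits d d≢0 squareFree d≢1 2 q pp pq (λ { o (inj₁ e) → ⊥-elim (odd≢2 o e) ; _ (inj₂ refl) → hq }) })
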